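{- For $2\le r\le 9$, every linear intersecting $r$-partite hypergraph (in which every vertex has positive degree) has covering number at most $r-1$.
   Context: A hypergraph $H$ is a set of non-empty subsets (lines) of a finite vertex set $V(H)$; the degree of a vertex is the number of lines containing it. $H$ is $r$-partite if $V(H)$ is partitioned into $r$ sets (sides) such that every line contains exactly one vertex from each side. A cover is a set of vertices meeting every line; the covering number $\tau(H)$ is the minimum size of a cover. $H$ is intersecting if every two lines share at least one vertex, and linear if every two distinct lines share at most one vertex. -}

module Defs where

open import Data.Nat using (ℕ; _≤_; _∸_)
open import Data.Fin using (Fin)
open import Data.Fin.Subset using (Subset; _∈_; ∣_∣)
open import Data.Product using (Σ; ∃; _×_)
open import Relation.Binary.PropositionalEquality using (_≡_; _≢_)
open import Relation.Nullary using (¬_)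
open import Function.Definitions using (Injective)

-- A hypergraph on vertex set Fin n: a finite SET of non-empty lines,
-- represented as an injective family of subsets indexed by Fin m.
record Hypergraph (n : ℕ) : Set where
  field
    m         : ℕ
    line      : Fin m → Subset n
    injective : Injective _≡_ _≡_ line
    nonempty  : ∀ i → ∃ λ x → x ∈ line i

open Hypergraph public

PositiveDegrees : ∀ {n} → Hypergraph n → Set
PositiveDegrees {n} H = ∀ (x : Fin n) → ∃ λ i → x ∈ line H i

IsPartition : ∀ {n} (r : ℕ) → Hypergraph n → (Fin n → Fin r) → Set
IsPartition {n} r H side =
  ∀ i (s : Fin r) → ∃ λ x → (x ∈ line H i × side x ≡ s)
                          × (∀ y → y ∈ line H i → side y ≡ s → y ≡ x)

Partite : ∀ {n} (r : ℕ) → Hypergraph n → Set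
Partite {n} r H = ∃ λ (side : Fin n → Fin r) → IsPartition r H side

Intersecting : ∀ {n} → Hypergraph n → Set
Intersecting H = ∀ i j → ∃ λ x → x ∈ line H i × x ∈ line H j

Linear : ∀ {n} → Hypergraph n → Set
Linear {n} H = ∀ i j → line H i ≢ line H j →
  ∀ (x y : Fin n) → x ∈ line H i → x ∈ line H j → y ∈ line H i → y ∈ line H j → x ≡ y

IsCover : ∀ {n} → Hypergraph n → Subset n → Set
IsCover H C = ∀ i → ∃ λ x → x ∈ C × x ∈ line H i

CoveringNumber≤ : ∀ {n} → Hypergraph n → ℕ → Set
CoveringNumber≤ {n} H k = ∃ λ (C : Subset n) → IsCover H C × ∣ C ∣ ≤ k

{-# OPTIONS --safe #-}
module Submission where

-- Suppose there is no cover of size r - 1.  Then every vertex has degree between 2 and r - 2, every side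
-- has at least r vertices, and for r ≥ 4 a line contains at most one vertex of degree 2: otherwise a line,
-- a side, or the neighbours of a vertex on one side yield a small cover.  Summing (d - 3)(D - d) over all
-- vertices, where D bounds the degrees, gives a quadratic inequality in the number m of lines whose
-- discriminant is negative for D = r - 2 ≤ 6 and also for r = 9, D = 6.
--
-- There remains r = 9 with a vertex of degree 7, where 39 ≤ m ≤ 51.  Every pair of vertices is on a common
-- side, on a common line, or "far" (φ = 1), so a symmetric weight W on pairs of degrees expresses one
-- quadratic form in the degree distribution as a sum of local forms over lines, sides and far pairs.  If the
-- local forms are nonnegative but the global value is negative, the distribution is impossible; such
-- certificates dispose of all but a few distributions.  For those, the vertices of degree 7 on one side are
-- too few to be far from all that they must be: vertices far from two of them are scarce because of the
-- lines without a vertex of degree 2, and the certificates are strengthened by this extra budget.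

-- For r = 9 averaging stops short: with D = 7 its quadratic is -2m² + 169m - 3402, nonnegative for
-- 34 ≤ m ≤ 51. A vertex of degree 7 raises the lower end to 39: at least 16 vertices are far from
-- it, each of degree at least 2, with degree sum m - 7. Moments ignore which degrees occur
-- together; hence the passage to pairs.
--
-- A line has 9 vertices with degree sum m + 8 and a side has degree sum m, so each has finitely
-- many degree types and nonnegativity of a local form is a finite check. Far pairs are controlled
-- at each vertex of degree d instead: its far vertices have degree sum (8 - d)(m - d), and there
-- are at least 72 - 8d of them. A certificate carries multipliers for these facts, like a dual
-- solution of a linear program.
--
-- The extra budget rests on this: if w has degree above 2 and is far from two degree-7 vertices of
-- one side, every degree-2 vertex joined to w lies on that side, which has at most three. So w has
-- degree 3 or lies on some of the m - 2N₂ lines without a vertex of degree 2.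

-- Finite integer sums and 0-1 indicators.

module Sums where
  open import Data.Bool.Base using (Bool; true; false; _∧_; not)
  open import Data.Nat.Base as ℕ using (ℕ; zero; suc)
  open import Data.Integer.Base using (ℤ; +_; -[1+_]; _+_; _*_; _-_; -_; _≤_; 0ℤ; 1ℤ; +≤+)
  import Data.Integer.Properties as ℤₚ
  open import Data.Integer.Tactic.RingSolver using (solve-∀)
  open import Data.Fin.Base using (Fin; zero; suc)
  open import Data.Fin.Properties using (_≟_)
  open import Data.Product.Base using (∃; _×_; _,_)
  open import Data.Sum.Base using (_⊎_; inj₁; inj₂)
  open import Data.Empty using (⊥; ⊥-elim)
  open import Relation.Nullary using (Dec; yes; no; does)
  open import Relation.Nullary.Decidable using (dec-true; dec-false)
  open import Relation.Binary.PropositionalEquality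
  open import Algebra.Properties.Semiring.Sum ℤₚ.+-*-semiring using (sum; sum-cong-≗; ∑-distrib-+; ∑-comm; *-distribˡ-sum; *-distribʳ-sum)

  -- The usual route to an inequality below: the ring solver rewrites the difference as an
  -- expression `e` that is visibly nonnegative.
  ≤-by : ∀ {x y} e → y - x ≡ e → 0ℤ ≤ e → x ≤ y
  ≤-by e eq p = ℤₚ.0≤i-j⇒j≤i (subst (0ℤ ≤_) (sym eq) p)

  diff : ∀ {x y} → x ≤ y → 0ℤ ≤ y - x
  diff = ℤₚ.i≤j⇒0≤j-i

  0≤+ : ∀ {x y} → 0ℤ ≤ x → 0ℤ ≤ y → 0ℤ ≤ x + y
  0≤+ = ℤₚ.+-mono-≤

  0≤* : ∀ {x y} → 0ℤ ≤ x → 0ℤ ≤ y → 0ℤ ≤ x * y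
  0≤* {+ m} {+ n} (+≤+ _) (+≤+ _) = subst (0ℤ ≤_) (ℤₚ.pos-* m n) (+≤+ ℕ.z≤n)

  *-mono-left : ∀ {k x y} → 0ℤ ≤ k → x ≤ y → k * x ≤ k * y
  *-mono-left {k} {x} {y} p q = ≤-by (k * (y - x)) (eq k x y) (0≤* p (diff q))
    where
    eq : ∀ k x y → k * y - k * x ≡ k * (y - x)
    eq = solve-∀

  𝟙 : Bool → ℤ
  𝟙 true = 1ℤ
  𝟙 false = 0ℤ

  𝟙-nonneg : ∀ b → 0ℤ ≤ 𝟙 b
  𝟙-nonneg true = +≤+ ℕ.z≤n
  𝟙-nonneg false = +≤+ ℕ.z≤n

  𝟙≤1 : ∀ b → 𝟙 b ≤ 1ℤ
  𝟙≤1 true = ℤₚ.≤-refl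
  𝟙≤1 false = +≤+ ℕ.z≤n

  𝟙-∧ : ∀ b c → 𝟙 (b ∧ c) ≡ 𝟙 b * 𝟙 c
  𝟙-∧ true c = sym (ℤₚ.*-identityˡ _)
  𝟙-∧ false c = refl

  𝟙-idem : ∀ b → 𝟙 b * 𝟙 b ≡ 𝟙 b
  𝟙-idem true = refl
  𝟙-idem false = refl

  𝟙-not : ∀ b → 𝟙 (not b) ≡ 1ℤ - 𝟙 b
  𝟙-not true = refl
  𝟙-not false = refl

  Σ-mono : ∀ {n} {f g : Fin n → ℤ} → (∀ i → f i ≤ g i) → sum f ≤ sum g
  Σ-mono {zero} p = ℤₚ.≤-refl
  Σ-mono {suc n} p = ℤₚ.+-mono-≤ (p zero) (Σ-mono (λ i → p (suc i)))

  Σ-0 : ∀ {n} {f : Fin n → ℤ} → (∀ i → f i ≡ 0ℤ) → sum f ≡ 0ℤ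
  Σ-0 {zero} p = refl
  Σ-0 {suc n} p = cong₂ _+_ (p zero) (Σ-0 (λ i → p (suc i)))

  Σ-nonneg : ∀ {n} {f : Fin n → ℤ} → (∀ i → 0ℤ ≤ f i) → 0ℤ ≤ sum f
  Σ-nonneg {zero} p = ℤₚ.≤-refl
  Σ-nonneg {suc n} p = 0≤+ (p zero) (Σ-nonneg (λ i → p (suc i)))

  Σ-const : ∀ n c → sum {n} (λ _ → c) ≡ + n * c
  Σ-const zero c = refl
  Σ-const (suc n) c = trans (cong (_+_ (c)) (Σ-const n c)) (trans (eq c (+ n)) (cong (_* c) (sym (ℤₚ.pos-+ 1 n))))
    where
    eq : ∀ c k → c + k * c ≡ (1ℤ + k) * c
    eq = solve-∀

  Σ-*ˡ : ∀ {n} c (f : Fin n → ℤ) → sum (λ i → c * f i) ≡ c * sum f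
  Σ-*ˡ c f = sym (*-distribˡ-sum c f)

  Σ-*ʳ : ∀ {n} c (f : Fin n → ℤ) → sum (λ i → f i * c) ≡ sum f * c
  Σ-*ʳ c f = sym (*-distribʳ-sum c f)

  Σ-neg : ∀ {n} (f : Fin n → ℤ) → sum (λ i → - f i) ≡ - sum f
  Σ-neg {zero} f = refl
  Σ-neg {suc n} f = trans (cong (_+_ (- f zero)) (Σ-neg (λ i → f (suc i)))) (sym (ℤₚ.neg-distrib-+ (f zero) _))

  Σ-- : ∀ {n} (f g : Fin n → ℤ) → sum (λ i → f i - g i) ≡ sum f - sum g
  Σ-- f g = trans (∑-distrib-+ f (λ i → - g i)) (cong (_+_ (sum f)) (Σ-neg g))

  Σ-+ : ∀ {n} (f g : Fin n → ℤ) → sum (λ i → f i + g i) ≡ sum f + sum g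
  Σ-+ = ∑-distrib-+

  δ : ∀ {n} → Fin n → Fin n → ℤ
  δ x y = 𝟙 (does (x ≟ y))

  δ-refl : ∀ {n} (x : Fin n) → δ x x ≡ 1ℤ
  δ-refl x = cong 𝟙 (dec-true (x ≟ x) refl)

  δ-≢ : ∀ {n} {x y : Fin n} → x ≢ y → δ x y ≡ 0ℤ
  δ-≢ {x = x} {y} p = cong 𝟙 (dec-false (x ≟ y) p)

  δ-suc : ∀ {n} (x y : Fin n) → δ (suc x) (suc y) ≡ δ x y
  δ-suc x y with x ≟ y
  ... | yes p = refl
  ... | no p = refl

  Σ-δ : ∀ {n} (x : Fin n) (g : Fin n → ℤ) → sum (λ y → δ x y * g y) ≡ g x
  Σ-δ {suc n} zero g = trans (cong₂ _+_ (ℤₚ.*-identityˡ (g zero)) (Σ-0 {n} {λ y → δ (zero {n}) (suc y) * g (suc y)} (λ i → refl))) (ℤₚ.+-identityʳ _)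
  Σ-δ (suc x) g = trans (ℤₚ.+-identityˡ _)
    (trans (sum-cong-≗ (λ y → cong (_* g (suc y)) (δ-suc x y))) (Σ-δ x (λ y → g (suc y))))

  δ-elim : ∀ {n} {x y : Fin n} {f : Fin n → ℤ} → δ x y * f y ≡ δ x y * f x
  δ-elim {x = x} {y} with x ≟ y
  ... | yes refl = refl
  ... | no _ = refl

  Σ-unique : ∀ {n} (x : Fin n) (b : Fin n → Bool) → b x ≡ true → (∀ y → b y ≡ true → y ≡ x) →
    sum (λ y → 𝟙 (b y)) ≡ 1ℤ
  Σ-unique x b bx u = trans (sum-cong-≗ pt) (Σ-δ x (λ _ → 1ℤ))
    where
    pt : ∀ y → 𝟙 (b y) ≡ δ x y * 1ℤ
    pt y with x ≟ y
    ... | yes refl = cong 𝟙 bx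
    ... | no x≢y with b y in by
    ...   | true = ⊥-elim (x≢y (sym (u y by)))
    ...   | false = refl

  Σ-atMostOne : ∀ {n} (b : Fin n → Bool) → (∀ x y → b x ≡ true → b y ≡ true → x ≡ y) →
    sum (λ y → 𝟙 (b y)) ≤ 1ℤ
  Σ-atMostOne {zero} b u = +≤+ ℕ.z≤n
  Σ-atMostOne {suc n} b u with b zero in b0
  ... | true = ℤₚ.≤-reflexive (trans (cong (_+_ 1ℤ) (Σ-0 {n} {λ i → 𝟙 (b (suc i))} z)) (ℤₚ.+-identityʳ 1ℤ))
    where
    z : ∀ i → 𝟙 (b (suc i)) ≡ 0ℤ
    z i with b (suc i) in bi
    ... | false = refl
    ... | true with u zero (suc i) b0 bi
    ...   | ()
  ... | false = subst (_≤ 1ℤ) (sym (ℤₚ.+-identityˡ _))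
    (Σ-atMostOne (λ i → b (suc i)) (λ x y p q → suc-inj (u (suc x) (suc y) p q)))
    where
    suc-inj : ∀ {k} {x y : Fin k} → Fin.suc x ≡ suc y → x ≡ y
    suc-inj refl = refl

  Σ-pos⇒∃ : ∀ {n} (b : Fin n → Bool) → 1ℤ ≤ sum (λ y → 𝟙 (b y)) → ∃ λ x → b x ≡ true
  Σ-pos⇒∃ {zero} b (+≤+ ())
  Σ-pos⇒∃ {suc n} b p with b zero in b0
  ... | true = zero , b0
  ... | false with Σ-pos⇒∃ (λ i → b (suc i)) (subst (1ℤ ≤_) (ℤₚ.+-identityˡ _) p)
  ...   | x , q = suc x , q

  term≤Σ : ∀ {n} (f : Fin n → ℤ) → (∀ i → 0ℤ ≤ f i) → ∀ i → f i ≤ sum f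
  term≤Σ {suc n} f p zero = ≤-by (sum (λ i → f (suc i))) (eq (f zero) _) (Σ-nonneg (λ i → p (suc i)))
    where
    eq : ∀ a b → (a + b) - a ≡ b
    eq = solve-∀
  term≤Σ {suc n} f p (suc i) = ℤₚ.≤-trans (term≤Σ (λ j → f (suc j)) (λ j → p (suc j)) i)
    (≤-by (f zero) (eq (f zero) _) (p zero))
    where
    eq : ∀ a b → (a + b) - b ≡ a
    eq = solve-∀

  Σ-pos⇒2 : ∀ {n} (b : Fin n → Bool) → + 2 ≤ sum (λ y → 𝟙 (b y)) →
    ∃ λ x → ∃ λ y → x ≢ y × b x ≡ true × b y ≡ true
  Σ-pos⇒2 {zero} b (+≤+ ())
  Σ-pos⇒2 {suc n} b p with b zero in b0
  ... | true with Σ-pos⇒∃ (λ i → b (suc i)) (≤-by _ (eq (sum (λ y → 𝟙 (b (suc y))))) (diff p))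
    where
    eq : ∀ s → s - 1ℤ ≡ (1ℤ + s) - + 2
    eq = solve-∀
  ...   | y , q = zero , suc y , (λ ()) , b0 , q
  Σ-pos⇒2 {suc n} b p | false with Σ-pos⇒2 (λ i → b (suc i)) (subst (+ 2 ≤_) (ℤₚ.+-identityˡ _) p)
  ...   | x , y , x≢y , q , s = suc x , suc y , (λ { refl → x≢y refl }) , q , s

  ∧-left : ∀ {b c} → b ∧ c ≡ true → b ≡ true
  ∧-left {true} _ = refl

  ∧-right : ∀ {b c} → b ∧ c ≡ true → c ≡ true
  ∧-right {true} e = e

  ∧-intro : ∀ {b c} → b ≡ true → c ≡ true → b ∧ c ≡ true
  ∧-intro refl e = e

  does-≡ : ∀ {k} {x y : Fin k} → does (x ≟ y) ≡ true → x ≡ y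
  does-≡ {x = x} {y} e with x ≟ y
  ... | yes p = p

  does-refl : ∀ {k} {x y : Fin k} → x ≡ y → does (x ≟ y) ≡ true
  does-refl {x = x} {y} p with x ≟ y
  ... | yes _ = refl
  ... | no q = ⊥-elim (q p)

  two-terms : ∀ {n} (f : Fin n → ℤ) → (∀ i → 0ℤ ≤ f i) → ∀ {x y} → x ≢ y → f x + f y ≤ sum f
  two-terms f p {x} {y} xy = subst (_≤ sum f) total (Σ-mono le)
    where
    total : sum (λ i → δ x i * f i + δ y i * f i) ≡ f x + f y
    total = trans (Σ-+ (λ i → δ x i * f i) (λ i → δ y i * f i)) (cong₂ _+_ (Σ-δ x f) (Σ-δ y f))
    le : ∀ i → δ x i * f i + δ y i * f i ≤ f i
    le i = go (x ≟ i) (y ≟ i)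
      where
      eq₁ : ∀ z → 1ℤ * z + 0ℤ * z ≡ z
      eq₁ = solve-∀
      eq₂ : ∀ z → 0ℤ * z + 1ℤ * z ≡ z
      eq₂ = solve-∀
      eq₀ : ∀ z → 0ℤ * z + 0ℤ * z ≡ 0ℤ
      eq₀ = solve-∀
      go : Dec (x ≡ i) → Dec (y ≡ i) → δ x i * f i + δ y i * f i ≤ f i
      go (yes refl) (yes q) = ⊥-elim (xy (sym q))
      go (yes refl) (no q) = ℤₚ.≤-reflexive (trans (cong₂ (λ d e → d * f x + e * f x) (δ-refl x) (δ-≢ q)) (eq₁ (f x)))
      go (no q) (yes refl) = ℤₚ.≤-reflexive (trans (cong₂ (λ d e → d * f y + e * f y) (δ-≢ q) (δ-refl y)) (eq₂ (f y)))
      go (no q) (no r) = subst (_≤ f i) (sym (trans (cong₂ (λ d e → d * f i + e * f i) (δ-≢ q) (δ-≢ r)) (eq₀ (f i)))) (p i)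

  three-terms : ∀ {n} (f : Fin n → ℤ) → (∀ i → 0ℤ ≤ f i) → ∀ {x y z} → x ≢ y → x ≢ z → y ≢ z → f x + f y + f z ≤ sum f
  three-terms f p {x} {y} {z} xy xz yz = ℤₚ.≤-trans (ℤₚ.≤-reflexive (sym total)) (Σ-mono le)
    where
    total : sum (λ i → (δ x i + δ y i + δ z i) * f i) ≡ f x + f y + f z
    total = trans (sum-cong-≗ λ i → eq (δ x i) (δ y i) (δ z i) (f i))
      (trans (Σ-+ (λ i → δ x i * f i + δ y i * f i) (λ i → δ z i * f i))
        (cong₂ _+_ (trans (Σ-+ (λ i → δ x i * f i) (λ i → δ y i * f i)) (cong₂ _+_ (Σ-δ x f) (Σ-δ y f))) (Σ-δ z f)))
      where
      eq : ∀ a b c f → (a + b + c) * f ≡ a * f + b * f + c * f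
      eq = solve-∀
    one : ∀ i → (δ x i + δ y i + δ z i ≡ 0ℤ) ⊎ (δ x i + δ y i + δ z i ≡ 1ℤ)
    one i with x ≟ i | y ≟ i | z ≟ i
    ... | yes refl | yes q | _ = ⊥-elim (xy (sym q))
    ... | yes refl | no _ | yes q = ⊥-elim (xz (sym q))
    ... | yes refl | no _ | no _ = inj₂ refl
    ... | no _ | yes refl | yes q = ⊥-elim (yz (sym q))
    ... | no _ | yes refl | no _ = inj₂ refl
    ... | no _ | no _ | yes _ = inj₂ refl
    ... | no _ | no _ | no _ = inj₁ refl
    le : ∀ i → (δ x i + δ y i + δ z i) * f i ≤ f i
    le i with one i
    ... | inj₁ e = subst (_≤ f i) (sym (cong (_* f i) e)) (p i)
    ... | inj₂ e = ℤₚ.≤-reflexive (trans (cong (_* f i) e) (ℤₚ.*-identityˡ (f i)))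

  not≤ : ∀ {x y} → x ≤ y → y + 1ℤ ≤ x → ⊥
  not≤ {x} {y} p q with ℤₚ.≤-trans (subst (0ℤ ≤_) (eq x y) (0≤+ (diff p) (diff q))) (ℤₚ.≤-refl { -[1+ 0 ]})
    where
    eq : ∀ x y → (y - x) + (x - (y + 1ℤ)) ≡ -[1+ 0 ]
    eq = solve-∀
  ... | ()

  true≢false : ∀ {b} → b ≡ true → b ≡ false → ⊥
  true≢false refl ()

-- Incidence counts in partite linear spaces.

module LinearSpaces where
  open Sums
  open import Data.Bool.Base using (Bool; true; _∧_)
  open import Data.Nat.Base as ℕ using (ℕ; suc)
  open import Data.Integer.Base using (ℤ; +_; _+_; _*_; _-_; -_; _≤_; 0ℤ; 1ℤ; +≤+)
  import Data.Integer.Properties as ℤₚ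
  open import Data.Integer.Tactic.RingSolver using (solve-∀)
  open import Data.Fin.Base using (Fin; suc)
  open import Data.Fin.Properties using (_≟_)
  open import Data.Product.Base using (∃; _×_; _,_)
  open import Data.Sum.Base using (_⊎_; inj₁; inj₂)
  open import Relation.Nullary using (Dec; yes; no)
  open import Relation.Binary.PropositionalEquality
  open import Algebra.Properties.Semiring.Sum ℤₚ.+-*-semiring using (sum; sum-cong-≗; ∑-distrib-+; ∑-comm; *-distribˡ-sum; *-distribʳ-sum)

  δ-sym : ∀ {n} (x y : Fin n) → δ x y ≡ δ y x
  δ-sym x y with x ≟ y
  ... | yes refl = sym (δ-refl x)
  ... | no x≢y = sym (δ-≢ (λ e → x≢y (sym e)))

  -- The hypergraph axioms as identities between integer sums, so that every later count is an
  -- exchange of summations. Intersecting and linear together become `meet-once`.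
  record LinearSpace (r n m : ℕ) : Set where
    field
      inc  : Fin n → Fin m → Bool
      side : Fin n → Fin r

    a : Fin n → Fin m → ℤ
    a v ℓ = 𝟙 (inc v ℓ)

    σ : Fin r → Fin n → ℤ
    σ s v = δ s (side v)

    field
      one-per-side : ∀ ℓ s → sum (λ v → a v ℓ * σ s v) ≡ 1ℤ
      meet-once    : ∀ ℓ ℓ′ → ℓ ≢ ℓ′ → sum (λ v → a v ℓ * a v ℓ′) ≡ 1ℤ
      join-once    : ∀ v w → v ≢ w → sum (λ ℓ → a v ℓ * a w ℓ) ≤ 1ℤ
      apart        : ∀ v w → v ≢ w → side v ≡ side w → sum (λ ℓ → a v ℓ * a w ℓ) ≡ 0ℤ

    deg : Fin n → ℤ
    deg v = sum (λ ℓ → a v ℓ)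

    -- Off the diagonal this is 0 or 1, but `c v v` is `deg v`; the last term of `φ` compensates for
    -- that.
    c : Fin n → Fin n → ℤ
    c v w = sum (λ ℓ → a v ℓ * a w ℓ)

    sideSize : Fin r → ℤ
    sideSize s = sum (λ v → σ s v)

    -- φ v w is 1 when v and w lie on different sides and on no common line, and 0 otherwise.
    φ : Fin n → Fin n → ℤ
    φ v w = ((1ℤ - σ (side v) w) - c v w) + δ v w * deg v

  module Counting {r n m : ℕ} (X : LinearSpace r n m) where
    open LinearSpace X public

    R M : ℤ
    R = + r
    M = + m

    Σσ : ∀ v → sum (λ s → σ s v) ≡ 1ℤ
    Σσ v = trans (sum-cong-≗ (λ s → trans (δ-sym s (side v)) (sym (ℤₚ.*-identityʳ _)))) (Σ-δ (side v) (λ _ → 1ℤ))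

    split-sides : ∀ (f : Fin n → ℤ) → sum f ≡ sum (λ s → sum (λ v → σ s v * f v))
    split-sides f = trans (sum-cong-≗ λ v → sym (trans (cong (_* f v) (Σσ v)) (ℤₚ.*-identityˡ _)))
      (trans (sum-cong-≗ λ v → sym (Σ-*ʳ (f v) (λ s → σ s v))) (∑-comm (λ v s → σ s v * f v)))

    line-size : ∀ ℓ → sum (λ v → a v ℓ) ≡ R
    line-size ℓ = trans (split-sides (λ v → a v ℓ))
      (trans (sum-cong-≗ λ s → trans (sum-cong-≗ λ v → ℤₚ.*-comm (σ s v) (a v ℓ)) (one-per-side ℓ s))
        (trans (Σ-const r 1ℤ) (ℤₚ.*-identityʳ _)))

    double-count : ∀ (f : Fin n → ℤ) → sum (λ v → deg v * f v) ≡ sum (λ ℓ → sum (λ v → a v ℓ * f v))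
    double-count f = trans (sum-cong-≗ λ v → sym (Σ-*ʳ (f v) (λ ℓ → a v ℓ))) (∑-comm (λ v ℓ → a v ℓ * f v))

    c-sum : ∀ v (f : Fin n → ℤ) → sum (λ w → c v w * f w) ≡ sum (λ ℓ → a v ℓ * sum (λ w → a w ℓ * f w))
    c-sum v f = trans (sum-cong-≗ λ w → sym (Σ-*ʳ (f w) (λ ℓ → a v ℓ * a w ℓ)))
      (trans (∑-comm (λ w ℓ → a v ℓ * a w ℓ * f w))
        (sum-cong-≗ λ ℓ → trans (sum-cong-≗ λ w → ℤₚ.*-assoc (a v ℓ) (a w ℓ) (f w))
          (Σ-*ˡ (a v ℓ) (λ w → a w ℓ * f w))))

    c-diag : ∀ v → c v v ≡ deg v
    c-diag v = sum-cong-≗ λ ℓ → 𝟙-idem (inc v ℓ)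

    c-sym : ∀ v w → c v w ≡ c w v
    c-sym v w = sum-cong-≗ λ ℓ → ℤₚ.*-comm (a v ℓ) (a w ℓ)

    c-nonneg : ∀ v w → 0ℤ ≤ c v w
    c-nonneg v w = Σ-nonneg λ ℓ → 0≤* (𝟙-nonneg (inc v ℓ)) (𝟙-nonneg (inc w ℓ))

    meet : ∀ ℓ ℓ′ → sum (λ v → a v ℓ * a v ℓ′) ≡ 1ℤ + δ ℓ ℓ′ * (R - 1ℤ)
    meet ℓ ℓ′ with ℓ ≟ ℓ′
    ... | no p = meet-once ℓ ℓ′ p
    ... | yes refl = trans (sum-cong-≗ λ v → 𝟙-idem (inc v ℓ)) (trans (line-size ℓ) (eq R))
      where
      eq : ∀ x → x ≡ 1ℤ + 1ℤ * (x - 1ℤ)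
      eq = solve-∀

    -- Each line through v meets ℓ in one vertex, except that ℓ itself, if it contains v,
    -- contributes all its r vertices.
    line-c : ∀ v ℓ → sum (λ w → a w ℓ * c v w) ≡ deg v + a v ℓ * (R - 1ℤ)
    line-c v ℓ = begin
      sum (λ w → a w ℓ * c v w) ≡⟨ sum-cong-≗ (λ w → ℤₚ.*-comm (a w ℓ) (c v w)) ⟩
      sum (λ w → c v w * a w ℓ) ≡⟨ c-sum v (λ w → a w ℓ) ⟩
      sum (λ ℓ′ → a v ℓ′ * sum (λ w → a w ℓ′ * a w ℓ))
        ≡⟨ sum-cong-≗ (λ ℓ′ → cong (a v ℓ′ *_) (trans (sum-cong-≗ λ w → ℤₚ.*-comm (a w ℓ′) (a w ℓ)) (meet ℓ ℓ′))) ⟩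
      sum (λ ℓ′ → a v ℓ′ * (1ℤ + δ ℓ ℓ′ * (R - 1ℤ))) ≡⟨ sum-cong-≗ (λ ℓ′ → eq (a v ℓ′) (δ ℓ ℓ′) (R - 1ℤ)) ⟩
      sum (λ ℓ′ → a v ℓ′ + δ ℓ ℓ′ * (a v ℓ′ * (R - 1ℤ))) ≡⟨ Σ-+ (λ ℓ′ → a v ℓ′) (λ ℓ′ → δ ℓ ℓ′ * (a v ℓ′ * (R - 1ℤ))) ⟩
      deg v + sum (λ ℓ′ → δ ℓ ℓ′ * (a v ℓ′ * (R - 1ℤ))) ≡⟨ cong (_+_ (deg v)) (Σ-δ ℓ (λ ℓ′ → a v ℓ′ * (R - 1ℤ))) ⟩
      deg v + a v ℓ * (R - 1ℤ) ∎
      where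
      open ≡-Reasoning
      eq : ∀ x d q → x * (1ℤ + d * q) ≡ x + d * (x * q)
      eq = solve-∀

    -- Counts pairs of a vertex of ℓ and a line through it: every other line contributes one pair
    -- and ℓ contributes r.
    line-deg : ∀ ℓ → sum (λ v → a v ℓ * deg v) ≡ (M + R) - 1ℤ
    line-deg ℓ = begin
      sum (λ v → a v ℓ * deg v) ≡⟨ sum-cong-≗ (λ v → sym (Σ-*ˡ (a v ℓ) (a v))) ⟩
      sum (λ v → sum (λ ℓ′ → a v ℓ * a v ℓ′)) ≡⟨ ∑-comm (λ v ℓ′ → a v ℓ * a v ℓ′) ⟩
      sum (λ ℓ′ → sum (λ v → a v ℓ * a v ℓ′)) ≡⟨ sum-cong-≗ (meet ℓ) ⟩
      sum (λ ℓ′ → 1ℤ + δ ℓ ℓ′ * (R - 1ℤ)) ≡⟨ Σ-+ (λ _ → 1ℤ) (λ ℓ′ → δ ℓ ℓ′ * (R - 1ℤ)) ⟩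
      sum {m} (λ _ → 1ℤ) + sum (λ ℓ′ → δ ℓ ℓ′ * (R - 1ℤ)) ≡⟨ cong₂ _+_ (Σ-const m 1ℤ) (Σ-δ ℓ (λ _ → R - 1ℤ)) ⟩
      M * 1ℤ + (R - 1ℤ) ≡⟨ eq M R ⟩
      (M + R) - 1ℤ ∎
      where
      open ≡-Reasoning
      eq : ∀ x y → x * 1ℤ + (y - 1ℤ) ≡ (x + y) - 1ℤ
      eq = solve-∀

    side-deg : ∀ s → sum (λ v → σ s v * deg v) ≡ M
    side-deg s = trans (sum-cong-≗ λ v → ℤₚ.*-comm (σ s v) (deg v)) (trans (double-count (σ s))
      (trans (sum-cong-≗ λ ℓ → one-per-side ℓ s) (trans (Σ-const m 1ℤ) (ℤₚ.*-identityʳ _))))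

    Σdeg : sum deg ≡ R * M
    Σdeg = trans (split-sides deg) (trans (sum-cong-≗ side-deg) (Σ-const r M))

    Σdeg² : sum (λ v → deg v * deg v) ≡ M * ((M + R) - 1ℤ)
    Σdeg² = trans (double-count deg) (trans (sum-cong-≗ line-deg) (Σ-const m _))

    c-side : ∀ v s → sum (λ w → c v w * σ s w) ≡ deg v
    c-side v s = trans (c-sum v (σ s)) (sum-cong-≗ λ ℓ → trans (cong (a v ℓ *_) (one-per-side ℓ s)) (ℤₚ.*-identityʳ _))

    c-size : ∀ v → sum (c v) ≡ deg v * R
    c-size v = trans (sum-cong-≗ λ w → sym (ℤₚ.*-identityʳ (c v w))) (trans (c-sum v (λ _ → 1ℤ))
      (trans (sum-cong-≗ λ ℓ → cong (a v ℓ *_) (trans (sum-cong-≗ λ w → ℤₚ.*-identityʳ (a w ℓ)) (line-size ℓ)))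
        (Σ-*ʳ R (a v))))

    c-deg : ∀ v → sum (λ w → c v w * deg w) ≡ deg v * ((M + R) - 1ℤ)
    c-deg v = trans (c-sum v deg) (trans (sum-cong-≗ λ ℓ → cong (a v ℓ *_) (line-deg ℓ)) (Σ-*ʳ _ (a v)))

    φ-sum : ∀ v (f : Fin n → ℤ) → sum (λ w → φ v w * f w) ≡
      ((sum f - sum (λ w → σ (side v) w * f w)) - sum (λ w → c v w * f w)) + deg v * f v
    φ-sum v f = begin
      sum (λ w → φ v w * f w) ≡⟨ sum-cong-≗ (λ w → eq (σ (side v) w) (c v w) (δ v w) (deg v) (f w)) ⟩
      sum (λ w → ((f w - σ (side v) w * f w) - c v w * f w) + δ v w * (deg v * f w))
        ≡⟨ Σ-+ (λ w → (f w - σ (side v) w * f w) - c v w * f w) (λ w → δ v w * (deg v * f w)) ⟩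
      sum (λ w → (f w - σ (side v) w * f w) - c v w * f w) + sum (λ w → δ v w * (deg v * f w))
        ≡⟨ cong₂ _+_ (trans (Σ-- (λ w → f w - σ (side v) w * f w) (λ w → c v w * f w))
                            (cong (_- sum (λ w → c v w * f w)) (Σ-- f (λ w → σ (side v) w * f w))))
                     (Σ-δ v (λ w → deg v * f w)) ⟩
      ((sum f - sum (λ w → σ (side v) w * f w)) - sum (λ w → c v w * f w)) + deg v * f v ∎
      where
      open ≡-Reasoning
      eq : ∀ s k d g f → (((1ℤ - s) - k) + d * g) * f ≡ ((f - s * f) - k * f) + d * (g * f)
      eq = solve-∀

    -- Counts incidences of far vertices with lines: a line through v has no far vertex, and each of
    -- the m - deg v others has r - 1 - deg v of them by `φ-line`.
    φ-deg : ∀ v → sum (λ w → φ v w * deg w) ≡ ((R - 1ℤ) - deg v) * (M - deg v)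
    φ-deg v = trans (φ-sum v deg) (trans (cong₂ (λ x y → x + y) (cong₂ _-_ (cong₂ _-_ Σdeg (side-deg (side v))) (c-deg v)) refl)
      (eq R M (deg v)))
      where
      eq : ∀ r m d → ((r * m - m) - d * ((m + r) - 1ℤ)) + d * d ≡ ((r - 1ℤ) - d) * (m - d)
      eq = solve-∀

    -- By linearity the lines through v reach (r - 1) deg v distinct vertices, all on the other
    -- sides; the rest of those sides is far.
    φ-count : ∀ v → sum (φ v) ≡ (+ n - sideSize (side v)) - (R - 1ℤ) * deg v
    φ-count v = trans (sum-cong-≗ λ w → sym (ℤₚ.*-identityʳ (φ v w))) (trans (φ-sum v (λ _ → 1ℤ))
      (trans (cong₂ _+_ (cong₂ _-_ (cong₂ _-_ (Σ-const n 1ℤ) (sum-cong-≗ λ w → ℤₚ.*-identityʳ (σ (side v) w)))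
         (trans (sum-cong-≗ λ w → ℤₚ.*-identityʳ (c v w)) (c-size v))) refl)
        (eq (+ n) (sideSize (side v)) R (deg v))))
      where
      eq : ∀ n s r d → ((n * 1ℤ - s) - d * r) + d * 1ℤ ≡ (n - s) - (r - 1ℤ) * d
      eq = solve-∀

    -- If ℓ avoids v, the deg v lines through v meet ℓ in distinct vertices, and one more vertex of
    -- ℓ is on the side of v; the remaining r - 1 - deg v are far.
    φ-line : ∀ v ℓ → sum (λ w → a w ℓ * φ v w) ≡ (1ℤ - a v ℓ) * ((R - 1ℤ) - deg v)
    φ-line v ℓ = trans (sum-cong-≗ λ w → ℤₚ.*-comm (a w ℓ) (φ v w)) (trans (φ-sum v (λ w → a w ℓ))
      (trans (cong₂ _+_ (cong₂ _-_ (cong₂ _-_ (line-size ℓ)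
          (trans (sum-cong-≗ λ w → ℤₚ.*-comm (σ (side v) w) (a w ℓ)) (one-per-side ℓ (side v))))
          (trans (sum-cong-≗ λ w → ℤₚ.*-comm (c v w) (a w ℓ)) (line-c v ℓ))) refl)
        (eq R (deg v) (a v ℓ))))
      where
      eq : ∀ r d x → ((r - 1ℤ) - (d + x * (r - 1ℤ))) + d * x ≡ (1ℤ - x) * ((r - 1ℤ) - d)
      eq = solve-∀

    01-cases : ∀ {z} → 0ℤ ≤ z → z ≤ 1ℤ → z ≡ 0ℤ ⊎ z ≡ 1ℤ
    01-cases {+ 0} p q = inj₁ refl
    01-cases {+ 1} p q = inj₂ refl
    01-cases {+ suc (suc k)} p (+≤+ (ℕ.s≤s ()))

    φ-self : ∀ v → φ v v ≡ 0ℤ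
    φ-self v = trans (cong₂ _+_ (cong₂ (λ x y → (1ℤ - x) - y) (δ-refl (side v)) (c-diag v)) (cong (_* deg v) (δ-refl v))) (eq (deg v))
      where
      eq : ∀ d → ((1ℤ - 1ℤ) - d) + 1ℤ * d ≡ 0ℤ
      eq = solve-∀

    φ-same : ∀ v w → side v ≡ side w → φ v w ≡ 0ℤ
    φ-same v w e = go (v ≟ w)
      where
      eq : ∀ d → ((1ℤ - 1ℤ) - 0ℤ) + 0ℤ * d ≡ 0ℤ
      eq = solve-∀
      go : Dec (v ≡ w) → φ v w ≡ 0ℤ
      go (yes refl) = φ-self v
      go (no v≢w) = trans (cong₂ _+_ (cong₂ (λ x y → (1ℤ - x) - y)
          (trans (cong (δ (side v)) (sym e)) (δ-refl (side v))) (apart v w v≢w e)) (cong (_* deg v) (δ-≢ v≢w))) (eq (deg v))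

    φ-other : ∀ v w → side v ≢ side w → φ v w ≡ 1ℤ - c v w
    φ-other v w ne = trans (cong₂ _+_ (cong (λ x → (1ℤ - x) - c v w) (δ-≢ {x = side v} {y = side w} ne)) (cong (_* deg v) (δ-≢ {x = v} {y = w} (λ { refl → ne refl })))) (eq (c v w) (deg v))
      where
      eq : ∀ k d → ((1ℤ - 0ℤ) - k) + 0ℤ * d ≡ 1ℤ - k
      eq = solve-∀

    φ-01 : ∀ v w → φ v w ≡ 0ℤ ⊎ φ v w ≡ 1ℤ
    φ-01 v w = go (side v ≟ side w)
      where
      go′ : side v ≢ side w → c v w ≡ 0ℤ ⊎ c v w ≡ 1ℤ → φ v w ≡ 0ℤ ⊎ φ v w ≡ 1ℤ
      go′ ne (inj₁ e) = inj₂ (trans (φ-other v w ne) (cong (_-_ 1ℤ) e))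
      go′ ne (inj₂ e) = inj₁ (trans (φ-other v w ne) (cong (_-_ 1ℤ) e))
      go : Dec (side v ≡ side w) → φ v w ≡ 0ℤ ⊎ φ v w ≡ 1ℤ
      go (yes e) = inj₁ (φ-same v w e)
      go (no ne) = go′ ne (01-cases (c-nonneg v w) (join-once v w (λ { refl → ne refl })))

    φ-nonneg : ∀ v w → 0ℤ ≤ φ v w
    φ-nonneg v w = go (φ-01 v w)
      where
      go : φ v w ≡ 0ℤ ⊎ φ v w ≡ 1ℤ → 0ℤ ≤ φ v w
      go (inj₁ e) = ℤₚ.≤-reflexive (sym e)
      go (inj₂ e) = subst (0ℤ ≤_) (sym e) (+≤+ ℕ.z≤n)

    incident : ∀ {x w ℓ} → inc x ℓ ≡ true → inc w ℓ ≡ true → 1ℤ ≤ c x w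
    incident {x} {w} {ℓ} p q = subst (_≤ c x w) (cong₂ (λ b d → 𝟙 b * 𝟙 d) p q)
      (term≤Σ (λ ℓ → a x ℓ * a w ℓ) (λ ℓ → 0≤* (𝟙-nonneg (inc x ℓ)) (𝟙-nonneg (inc w ℓ))) ℓ)

    joining : ∀ {x w} → 1ℤ ≤ c x w → ∃ λ ℓ → inc x ℓ ≡ true × inc w ℓ ≡ true
    joining {x} {w} p with Σ-pos⇒∃ (λ ℓ → inc x ℓ ∧ inc w ℓ) (subst (1ℤ ≤_) (sum-cong-≗ λ ℓ → sym (𝟙-∧ (inc x ℓ) (inc w ℓ))) p)
    ... | ℓ , q = ℓ , ∧-left q , ∧-right {inc x ℓ} q

-- Degree classes for nine sides.

module NineSides where
  open Sums
  open LinearSpaces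
  open import Data.Nat.Base as ℕ using (ℕ; zero)
  open import Data.Integer.Base using (ℤ; +_; _+_; _*_; _≤_; 1ℤ)
  import Data.Integer.Properties as ℤₚ
  open import Data.Fin.Base using (Fin; zero; toℕ)
  open import Relation.Binary.PropositionalEquality
  open import Algebra.Properties.Semiring.Sum ℤₚ.+-*-semiring using (sum; sum-cong-≗; ∑-distrib-+; ∑-comm; *-distribˡ-sum; *-distribʳ-sum)

  D : Fin 6 → ℤ
  D i = + (2 ℕ.+ toℕ i)

  Q : (Fin 6 → Fin 6 → ℤ) → (Fin 6 → ℤ) → ℤ
  Q W x = sum (λ i → x i * sum (λ j → x j * W i j))

  L : (Fin 6 → ℤ) → (Fin 6 → ℤ) → ℤ
  L x h = sum (λ i → x i * h i)

  -- The consequences of having no cover of size 8 on which the analysis of nine sides rests; covers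
  -- themselves do not reappear there.
  record Critical {n m : ℕ} (X : LinearSpace 9 n m) : Set where
    open LinearSpace X
    field
      κ       : Fin n → Fin 6
      deg≡    : ∀ v → deg v ≡ D (κ v)
      one-two : ∀ ℓ → sum (λ v → a v ℓ * δ zero (κ v)) ≤ 1ℤ
      size≥9  : ∀ s → + 9 ≤ sideSize s

-- Executable checks: certificates, line and side types, degree distributions.

module Checkers where
  open Sums
  open LinearSpaces
  open NineSides
  open import Data.Bool.Base using (Bool; true; false; _∧_; _∨_; if_then_else_; T)
  open import Data.Nat.Base as ℕ using (ℕ; zero; suc; _∸_; _≤ᵇ_; _≡ᵇ_; _/_)
  import Data.Nat.Properties as ℕₚ
  import Data.Nat.DivMod as DivMod
  open import Data.Integer.Base as ℤ using (ℤ; +_; -[1+_]; _+_; _*_; _-_; -_; _≤_; 0ℤ)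
  import Data.Integer.Properties as ℤₚ
  open import Data.Fin.Base using (Fin; zero; suc)
  open import Data.List.Base using (List; []; _∷_)
  open import Data.Vec.Base as Vec using (Vec; []; _∷_; lookup; tabulate)
  open import Data.Vec.Properties using (lookup-map)
  open import Data.Product.Base using (_×_; _,_; proj₁; proj₂)
  open import Data.Sum.Base using (inj₁; inj₂)
  open import Relation.Binary.PropositionalEquality
  open import Algebra.Properties.Semiring.Sum ℤₚ.+-*-semiring using (sum; sum-cong-≗)

  ≤ᵇ-true : ∀ {x y} → x ℕ.≤ y → (x ≤ᵇ y) ≡ true
  ≤ᵇ-true {x} {y} p with x ≤ᵇ y | ℕₚ.≤⇒≤ᵇ p
  ... | true | _ = refl

  ≡ᵇ-true : ∀ x → (x ≡ᵇ x) ≡ true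
  ≡ᵇ-true x with x ≡ᵇ x | ℕₚ.≡⇒≡ᵇ x x refl
  ... | true | _ = refl

  ≤ᵇℤ-sound : ∀ {x y} → (x ℤ.≤ᵇ y) ≡ true → x ≤ y
  ≤ᵇℤ-sound {x} {y} e = ℤₚ.≤ᵇ⇒≤ (subst T (sym e) _)

  upTo : ℕ → (ℕ → Bool) → Bool
  upTo zero P = P 0
  upTo (suc k) P = P (suc k) ∧ upTo k P

  upTo-sound : ∀ k P → upTo k P ≡ true → ∀ {x} → x ℕ.≤ k → P x ≡ true
  upTo-sound zero P e ℕ.z≤n = e
  upTo-sound (suc k) P e {x} x≤ with ℕₚ.m≤n⇒m<n∨m≡n x≤
  ... | inj₂ refl = ∧-left e
  ... | inj₁ (ℕ.s≤s q) = upTo-sound k P (∧-right {P (suc k)} e) q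

  every : {A : Set} → (A → Bool) → List A → Bool
  every P [] = true
  every P (x ∷ xs) = P x ∧ every P xs

  some : {A : Set} → (A → Bool) → List A → Bool
  some P [] = false
  some P (x ∷ xs) = P x ∨ some P xs

  weight : ∀ {k} → ℕ → Vec ℕ k → ℕ
  weight d [] = 0
  weight d (x ∷ xs) = d ℕ.* x ℕ.+ weight (suc d) xs

  -- Quantifies over all (x_d , … , x_{d+k-1}) with Σ i·x_i = w and Σ x_i = c.
  opaque
    compositions : ∀ k → ℕ → ℕ → ℕ → (Vec ℕ k → Bool) → Bool
    compositions zero d zero zero P = P []
    compositions zero d _ _ P = true
    compositions (suc k) d w c P = upTo c λ x →
      if d ℕ.* x ≤ᵇ w then compositions k (suc d) (w ∸ d ℕ.* x) (c ∸ x) (λ xs → P (x ∷ xs)) else true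

    compositions-sound : ∀ k d w c P → compositions k d w c P ≡ true →
      ∀ (xs : Vec ℕ k) → weight d xs ≡ w → Vec.sum xs ≡ c → P xs ≡ true
    compositions-sound zero d .0 .0 P e [] refl refl = e
    compositions-sound (suc k) d w c P e (x ∷ xs) refl refl = compositions-sound k (suc d) _ _ (λ xs → P (x ∷ xs)) step xs
        (sym (ℕₚ.m+n∸m≡n (d ℕ.* x) (weight (suc d) xs))) (sym (ℕₚ.m+n∸m≡n x (Vec.sum xs)))
      where
      at-x : (if d ℕ.* x ≤ᵇ w then compositions k (suc d) (w ∸ d ℕ.* x) (c ∸ x) (λ xs → P (x ∷ xs)) else true) ≡ true
      at-x = upTo-sound c _ e (ℕₚ.m≤m+n x _)
      step : compositions k (suc d) (w ∸ d ℕ.* x) (c ∸ x) (λ xs → P (x ∷ xs)) ≡ true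
      step = subst (λ b → (if b then compositions k (suc d) (w ∸ d ℕ.* x) (c ∸ x) (λ xs → P (x ∷ xs)) else true) ≡ true)
        (≤ᵇ-true (ℕₚ.m≤m+n (d ℕ.* x) _)) at-x

  dot : ∀ {k} → Vec ℤ k → Vec ℤ k → ℤ
  dot [] [] = 0ℤ
  dot (x ∷ xs) (y ∷ ys) = x * y + dot xs ys

  dot-sum : ∀ {k} (xs ys : Vec ℤ k) → dot xs ys ≡ sum (λ i → lookup xs i * lookup ys i)
  dot-sum [] [] = refl
  dot-sum (x ∷ xs) (y ∷ ys) = cong (_+_ (x * y)) (dot-sum xs ys)

  quad : Vec (Vec ℤ 6) 6 → Vec ℤ 6 → ℤ
  quad W x = dot x (Vec.map (dot x) W)

  toℤ : ∀ {k} → Vec ℕ k → Vec ℤ k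
  toℤ = Vec.map (λ x → + x)

  -- `pairs` is the weight W. `α` multiplies the degree sum of the vertices far from a vertex, `ω`
  -- multiplies their number. `h` and `hc` are the linear and constant terms of the form on lines,
  -- `g` and `gc` those of the form on sides. `size` is the largest side on which the side form has
  -- to be nonnegative.
  record Certificate : Set where
    constructor mk
    field
      size    : ℕ
      pairs   : Vec (Vec ℤ 6) 6
      α ω h   : Vec ℤ 6
      hc      : ℤ
      g       : Vec ℤ 6
      gc      : ℤ

    W : Fin 6 → Fin 6 → ℤ
    W i j = lookup (lookup pairs i) j

    A K H G : Fin 6 → ℤ
    A = lookup α
    K = lookup ω
    H = lookup h
    G = lookup g

  open Certificate

  quad-Q : ∀ C x → quad (pairs C) x ≡ Q (W C) (lookup x)
  quad-Q C x = trans (dot-sum x _) (sum-cong-≗ λ i → cong (lookup x i *_)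
    (trans (lookup-map i (dot x) (pairs C)) (dot-sum x (lookup (pairs C) i))))

  dot-L : ∀ x y → dot x y ≡ L (lookup x) (lookup y)
  dot-L = dot-sum

  onLine onSide : Certificate → Vec ℕ 6 → ℤ
  onLine C x = (quad (pairs C) (toℤ x) + dot (toℤ x) (h C)) + hc C
  onSide C x = (quad (pairs C) (toℤ x) + dot (toℤ x) (g C)) + gc C

  six : (Fin 6 → Bool) → Bool
  six P = P zero ∧ P (suc zero) ∧ P (suc (suc zero)) ∧ P (suc (suc (suc zero)))
    ∧ P (suc (suc (suc (suc zero)))) ∧ P (suc (suc (suc (suc (suc zero)))))

  six-sound : ∀ P → six P ≡ true → ∀ i → P i ≡ true
  six-sound P e zero = ∧-left e
  six-sound P e (suc zero) = ∧-left (∧-right {P zero} e)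
  six-sound P e (suc (suc zero)) = ∧-left (∧-right {P (suc zero)} (∧-right {P zero} e))
  six-sound P e (suc (suc (suc zero))) = ∧-left (∧-right {P (suc (suc zero))} (∧-right {P (suc zero)} (∧-right {P zero} e)))
  six-sound P e (suc (suc (suc (suc zero)))) =
    ∧-left (∧-right {P (suc (suc (suc zero)))} (∧-right {P (suc (suc zero))} (∧-right {P (suc zero)} (∧-right {P zero} e))))
  six-sound P e (suc (suc (suc (suc (suc zero))))) =
    ∧-right {P (suc (suc (suc (suc zero))))} (∧-right {P (suc (suc (suc zero)))} (∧-right {P (suc (suc zero))} (∧-right {P (suc zero)} (∧-right {P zero} e))))

  farEntry : Certificate → Fin 6 → Fin 6 → Bool
  farEntry C i j = 0ℤ ℤ.≤ᵇ (W C i j + (A C i * D j + A C j * D i)) + (K C i + K C j)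

  -- The sign of K is forced because the number of far vertices is only bounded from below.
  farRow : Certificate → Fin 6 → Bool
  farRow C i = (K C i ℤ.≤ᵇ 0ℤ) ∧ six (farEntry C i)

  farCheck : Certificate → Bool
  farCheck C = six (farRow C)

  -- V corrects for multiplicities: a vertex of degree d has its diagonal weight counted d times too
  -- often and its line term d times in all. The multipliers A and K occur at both ends of a far
  -- pair, hence the factors 2; 72 counts eight sides of at least nine vertices.
  value : Certificate → ℕ → Vec ℕ 6 → ℤ
  value C m x = (quad (pairs C) (toℤ x) + dot (toℤ x) (tabulate V)) + (+ m * hc C + + 9 * gc C)
    where
    V : Fin 6 → ℤ
    V i = ((D i * W C i i + D i * H C i) + G C i) + (+ 2 * (A C i * ((+ 8 - D i) * (+ m - D i))) + + 2 * (K C i * (+ 72 - + 8 * D i)))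

  lineOK : List Certificate → Vec ℕ 6 → Bool
  lineOK Cs x = if lookup x zero ≤ᵇ 1 then every (λ C → 0ℤ ℤ.≤ᵇ onLine C x) Cs else true

  -- By `line-deg` the nine degrees on a line sum to m + 8.
  lineCheck : ℕ → List Certificate → Bool
  lineCheck m Cs = compositions 6 2 (m ℕ.+ 8) 9 (lineOK Cs)

  sideOK : ℕ → Vec ℕ 6 → Certificate → Bool
  sideOK k x C = if k ≤ᵇ size C then 0ℤ ℤ.≤ᵇ onSide C x else true

  sidesOf : ℕ → List Certificate → ℕ → Bool
  sidesOf m Cs k = compositions 6 2 m (9 ℕ.+ k) (λ x → every (sideOK (9 ℕ.+ k) x) Cs)

  -- The moment identities allow n up to 85, attained at m = 42. Since the other eight sides have at
  -- least 72 vertices, a side then has at most 13 = 9 + 4.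
  sideCheck : ℕ → List Certificate → Bool
  sideCheck m Cs = upTo 4 (sidesOf m Cs)

  kills : ℕ → ℕ → Vec ℕ 6 → Certificate → Bool
  kills m n x C = ((n ≤ᵇ 72 ℕ.+ size C) ∧ (n ≤ᵇ 85)) ∧ (value C m x ℤ.≤ᵇ -[1+ 0 ])

  ≤ᵇ-sound : ∀ {x y} → (x ≤ᵇ y) ≡ true → x ℕ.≤ y
  ≤ᵇ-sound {x} e = ℕₚ.≤ᵇ⇒≤ x _ (subst T (sym e) _)

  kills-split : ∀ m n x C → kills m n x C ≡ true → n ℕ.≤ 72 ℕ.+ size C × n ℕ.≤ 85 × value C m x ≤ -[1+ 0 ]
  kills-split m n x C = go (n ≤ᵇ 72 ℕ.+ size C) (n ≤ᵇ 85) (value C m x ℤ.≤ᵇ -[1+ 0 ]) refl refl refl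
    where
    go : ∀ p q r → (n ≤ᵇ 72 ℕ.+ size C) ≡ p → (n ≤ᵇ 85) ≡ q → (value C m x ℤ.≤ᵇ -[1+ 0 ]) ≡ r → (p ∧ q) ∧ r ≡ true →
      n ℕ.≤ 72 ℕ.+ size C × n ℕ.≤ 85 × value C m x ≤ -[1+ 0 ]
    go true true true e₁ e₂ e₃ _ = ≤ᵇ-sound e₁ , ≤ᵇ-sound e₂ , ≤ᵇℤ-sound {value C m x} { -[1+ 0 ]} e₃

  sameVec : ∀ {k} → Vec ℕ k → Vec ℕ k → Bool
  sameVec [] [] = true
  sameVec (x ∷ xs) (y ∷ ys) = (x ≡ᵇ y) ∧ sameVec xs ys

  dead : ℕ → List Certificate → List (Vec ℕ 6) → ℕ → Vec ℕ 6 → Bool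
  dead m Cs exceptions n x = some (kills m n x) Cs ∨ some (sameVec x) exceptions

  -- Enumerates the degree distributions allowed by the two moment identities
  -- 5 N₂ = m² − 82 m + 1701 + 21 (n − 81) + 3 N₄ + 4 N₅ + 3 N₆  and
  -- 4 (N₇ + N₂) = m² − 73 m + 1458 + 18 (n − 81) + 2 N₄ + 2 N₅.
  module Distributions (m : ℕ) (P : ℕ → Vec ℕ 6 → Bool) where

    guard : Bool → Bool → Bool
    guard b x = if b then x else true

    -- The two identities sum (d - 3)(d - 7) and (d - 3)(d - 6) over all vertices; the roots make N₃
    -- drop out of both, N₇ out of the first and N₆ out of the second. Both quadratics in m have
    -- negative discriminant, so the truncated subtraction loses nothing.
    base₁ base₂ : ℕ
    base₁ = m ℕ.* m ℕ.+ 1701 ∸ 82 ℕ.* m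
    base₂ = m ℕ.* m ℕ.+ 1458 ∸ 73 ℕ.* m

    -- Here k should be 4 N₇, by the second identity. N₃ is whatever is missing from n, and the
    -- guards discard non-integral or negative solutions as well as N₇ = 0.
    from₄ : ℕ → ℕ → ℕ → ℕ → ℕ → ℕ → Bool
    from₄ N₂ ν N₄ N₅ N₆ k = guard ((k / 4) ℕ.* 4 ≡ᵇ k) (guard (1 ≤ᵇ k / 4)
      (guard (N₂ ℕ.+ (N₄ ℕ.+ (N₅ ℕ.+ (N₆ ℕ.+ k / 4))) ≤ᵇ 81 ℕ.+ ν) (P (81 ℕ.+ ν) (N₂ ∷ (81 ℕ.+ ν ∸ (N₂ ℕ.+ (N₄ ℕ.+ (N₅ ℕ.+ (N₆ ℕ.+ k / 4))))) ∷ N₄ ∷ N₅ ∷ N₆ ∷ k / 4 ∷ []))))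

    from₃ : ℕ → ℕ → ℕ → ℕ → ℕ → Bool
    from₃ N₂ ν N₄ N₅ k = guard ((k / 3) ℕ.* 3 ≡ᵇ k)
      (from₄ N₂ ν N₄ N₅ (k / 3) (base₂ ℕ.+ (18 ℕ.* ν ℕ.+ (2 ℕ.* N₄ ℕ.+ 2 ℕ.* N₅)) ∸ 4 ℕ.* N₂))

    from₂ : ℕ → ℕ → ℕ → ℕ → Bool
    from₂ N₂ ν N₄ k = upTo (k / 4) λ N₅ → from₃ N₂ ν N₄ N₅ (k ∸ 4 ℕ.* N₅)

    from₁ : ℕ → ℕ → ℕ → Bool
    from₁ N₂ ν k = upTo (k / 3) λ N₄ → from₂ N₂ ν N₄ (k ∸ 3 ℕ.* N₄)

    from₀ : ℕ → Bool
    from₀ N₂ = guard (base₁ ≤ᵇ 5 ℕ.* N₂) (upTo ((5 ℕ.* N₂ ∸ base₁) / 21) λ ν → from₁ N₂ ν (5 ℕ.* N₂ ∸ base₁ ∸ 21 ℕ.* ν))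

    -- N₂ is at most m / 2, since a degree-2 vertex is on two lines and no line has two such
    -- vertices. After N₂, ν, N₄ and N₅ are chosen, everything else is forced.
    distributions : Bool
    distributions = upTo (m / 2) from₀

    private
      unguard : ∀ {x y : Bool} → x ≡ true → (if x then y else true) ≡ true → y ≡ true
      unguard refl e = e

      quotient : ∀ d .{{_ : ℕ.NonZero d}} x → (x ℕ.* d) / d ≡ x
      quotient d x = DivMod.m*n/n≡m x d

      bounded : ∀ d .{{_ : ℕ.NonZero d}} {x k} → d ℕ.* x ℕ.≤ k → x ℕ.≤ k / d
      bounded d {x} {k} p = subst (ℕ._≤ k / d) (trans (cong (_/ d) (ℕₚ.*-comm d x)) (quotient d x)) (DivMod./-monoˡ-≤ d p)

      exact : ∀ d .{{_ : ℕ.NonZero d}} {x k} → d ℕ.* x ≡ k → k / d ≡ x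
      exact d {x} refl = trans (cong (_/ d) (ℕₚ.*-comm d x)) (quotient d x)

      multiple : ∀ d .{{_ : ℕ.NonZero d}} {x k} → d ℕ.* x ≡ k → ((k / d) ℕ.* d ≡ᵇ k) ≡ true
      multiple d {x} {k} e = subst (λ z → (z ≡ᵇ k) ≡ true)
        (sym (trans (cong (ℕ._* d) (exact d e)) (trans (ℕₚ.*-comm x d) e))) (≡ᵇ-true k)

    distributions-sound : distributions ≡ true → ∀ N₂ N₃ N₄ N₅ N₆ N₇ ν → 2 ℕ.* N₂ ℕ.≤ m → 1 ℕ.≤ N₇ →
      5 ℕ.* N₂ ≡ base₁ ℕ.+ (21 ℕ.* ν ℕ.+ (3 ℕ.* N₄ ℕ.+ (4 ℕ.* N₅ ℕ.+ 3 ℕ.* N₆))) →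
      4 ℕ.* N₂ ℕ.+ 4 ℕ.* N₇ ≡ base₂ ℕ.+ (18 ℕ.* ν ℕ.+ (2 ℕ.* N₄ ℕ.+ 2 ℕ.* N₅)) →
      81 ℕ.+ ν ≡ (N₂ ℕ.+ (N₄ ℕ.+ (N₅ ℕ.+ (N₆ ℕ.+ N₇)))) ℕ.+ N₃ →
      P (81 ℕ.+ ν) (N₂ ∷ N₃ ∷ N₄ ∷ N₅ ∷ N₆ ∷ N₇ ∷ []) ≡ true
    distributions-sound ok N₂ N₃ N₄ N₅ N₆ N₇ ν half pos e₁ e₂ e₃ = subst₂ (λ x y → P (81 ℕ.+ ν) (N₂ ∷ x ∷ N₄ ∷ N₅ ∷ proj₁ y ∷ proj₂ y ∷ []) ≡ true)
        (trans (cong₂ (λ x y → 81 ℕ.+ ν ∸ (N₂ ℕ.+ (N₄ ℕ.+ (N₅ ℕ.+ (x ℕ.+ y))))) q₆ q₇)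
          (trans (cong (_∸ (N₂ ℕ.+ (N₄ ℕ.+ (N₅ ℕ.+ (N₆ ℕ.+ N₇))))) e₃) (ℕₚ.m+n∸m≡n (N₂ ℕ.+ (N₄ ℕ.+ (N₅ ℕ.+ (N₆ ℕ.+ N₇)))) N₃)))
        (cong₂ _,_ q₆ q₇)
        (unguard (subst₂ (λ x y → (N₂ ℕ.+ (N₄ ℕ.+ (N₅ ℕ.+ (x ℕ.+ y))) ≤ᵇ 81 ℕ.+ ν) ≡ true) (sym q₆) (sym q₇)
            (≤ᵇ-true (subst (N₂ ℕ.+ (N₄ ℕ.+ (N₅ ℕ.+ (N₆ ℕ.+ N₇))) ℕ.≤_) (sym e₃) (ℕₚ.m≤m+n _ N₃))))
          (unguard (subst (λ z → (1 ≤ᵇ z) ≡ true) (sym q₇) (≤ᵇ-true pos)) (unguard (multiple 4 {N₇} k₄-eq)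
          (subst (λ z → from₄ N₂ ν N₄ N₅ z k₄ ≡ true) refl (unguard (multiple 3 {N₆} k₃-eq) s₃)))))
      where
      k₁ k₂ k₃ : ℕ
      k₁ = 5 ℕ.* N₂ ∸ base₁ ∸ 21 ℕ.* ν
      k₂ = k₁ ∸ 3 ℕ.* N₄
      k₃ = k₂ ∸ 4 ℕ.* N₅
      c≤ : base₁ ℕ.≤ 5 ℕ.* N₂
      c≤ = subst (base₁ ℕ.≤_) (sym e₁) (ℕₚ.m≤m+n base₁ _)
      k₀-eq : 5 ℕ.* N₂ ∸ base₁ ≡ 21 ℕ.* ν ℕ.+ (3 ℕ.* N₄ ℕ.+ (4 ℕ.* N₅ ℕ.+ 3 ℕ.* N₆))
      k₀-eq = trans (cong (_∸ base₁) e₁) (ℕₚ.m+n∸m≡n base₁ _)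
      ν≤ : 21 ℕ.* ν ℕ.≤ 5 ℕ.* N₂ ∸ base₁
      ν≤ = subst (21 ℕ.* ν ℕ.≤_) (sym k₀-eq) (ℕₚ.m≤m+n _ _)
      k₁-eq : k₁ ≡ 3 ℕ.* N₄ ℕ.+ (4 ℕ.* N₅ ℕ.+ 3 ℕ.* N₆)
      k₁-eq = trans (cong (_∸ 21 ℕ.* ν) k₀-eq) (ℕₚ.m+n∸m≡n (21 ℕ.* ν) _)
      N₄≤ : 3 ℕ.* N₄ ℕ.≤ k₁
      N₄≤ = subst (3 ℕ.* N₄ ℕ.≤_) (sym k₁-eq) (ℕₚ.m≤m+n _ _)
      k₂-eq : k₂ ≡ 4 ℕ.* N₅ ℕ.+ 3 ℕ.* N₆
      k₂-eq = trans (cong (_∸ 3 ℕ.* N₄) k₁-eq) (ℕₚ.m+n∸m≡n (3 ℕ.* N₄) _)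
      N₅≤ : 4 ℕ.* N₅ ℕ.≤ k₂
      N₅≤ = subst (4 ℕ.* N₅ ℕ.≤_) (sym k₂-eq) (ℕₚ.m≤m+n _ _)
      k₃-eq : 3 ℕ.* N₆ ≡ k₃
      k₃-eq = sym (trans (cong (_∸ 4 ℕ.* N₅) k₂-eq) (ℕₚ.m+n∸m≡n (4 ℕ.* N₅) _))
      k₄ : ℕ
      k₄ = base₂ ℕ.+ (18 ℕ.* ν ℕ.+ (2 ℕ.* N₄ ℕ.+ 2 ℕ.* N₅)) ∸ 4 ℕ.* N₂
      k₄-eq : 4 ℕ.* N₇ ≡ k₄
      k₄-eq = sym (trans (cong (_∸ 4 ℕ.* N₂) (sym e₂)) (ℕₚ.m+n∸m≡n (4 ℕ.* N₂) _))
      q₆ : k₃ / 3 ≡ N₆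
      q₆ = exact 3 {N₆} k₃-eq
      q₇ : k₄ / 4 ≡ N₇
      q₇ = exact 4 {N₇} k₄-eq
      s₀ : from₀ N₂ ≡ true
      s₀ = upTo-sound (m / 2) from₀ ok {N₂} (bounded 2 half)
      s₁ : from₁ N₂ ν k₁ ≡ true
      s₁ = upTo-sound ((5 ℕ.* N₂ ∸ base₁) / 21) (λ ν → from₁ N₂ ν (5 ℕ.* N₂ ∸ base₁ ∸ 21 ℕ.* ν)) (unguard (≤ᵇ-true c≤) s₀) {ν} (bounded 21 ν≤)
      s₂ : from₂ N₂ ν N₄ k₂ ≡ true
      s₂ = upTo-sound (k₁ / 3) (λ N₄ → from₂ N₂ ν N₄ (k₁ ∸ 3 ℕ.* N₄)) s₁ {N₄} (bounded 3 N₄≤)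
      s₃ : from₃ N₂ ν N₄ N₅ k₃ ≡ true
      s₃ = upTo-sound (k₂ / 4) (λ N₅ → from₃ N₂ ν N₄ N₅ (k₂ ∸ 4 ℕ.* N₅)) s₂ {N₅} (bounded 4 N₅≤)

  open Distributions public

  check : ℕ → List Certificate → List (Vec ℕ 6) → Bool
  check m Cs exceptions = every farCheck Cs ∧ (lineCheck m Cs ∧ (sideCheck m Cs ∧ distributions m (dead m Cs exceptions)))

-- Soundness of the certificates and of the strengthened filter.

module DegreeDistributions where
  open Sums
  open LinearSpaces
  open NineSides
  open Checkers
  open import Data.Bool.Base using (Bool; true; false; _∧_; _∨_; not; if_then_else_; T)
  open import Data.Nat.Base as ℕ using (ℕ; zero; suc; _∸_; _≤ᵇ_; _≡ᵇ_)
  import Data.Nat.Properties as ℕₚ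
  open import Data.Integer.Base as ℤ using (ℤ; +_; -[1+_]; _+_; _*_; _-_; -_; _≤_; 0ℤ; 1ℤ; +≤+; ∣_∣)
  import Data.Integer.Properties as ℤₚ
  open import Data.Integer.Tactic.RingSolver using (solve-∀)
  open import Data.Fin.Base using (Fin; zero; suc; toℕ)
  open import Data.List.Base as List using (List; []; _∷_)
  open import Data.List.Relation.Unary.Any using (here; there)
  open import Data.List.Membership.Propositional using (_∈_)
  open import Data.Vec.Base as Vec using (Vec; []; _∷_; lookup; tabulate)
  open import Data.Vec.Properties using (lookup-map; lookup∘tabulate)
  open import Data.Product.Base using (∃; _×_; _,_; proj₁; proj₂)
  open import Data.Sum.Base using (_⊎_; inj₁; inj₂)
  open import Data.Empty using (⊥; ⊥-elim)
  open import Relation.Binary.PropositionalEquality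
  open import Algebra.Properties.Semiring.Sum ℤₚ.+-*-semiring using (sum; sum-cong-≗; ∑-comm)
  open import Data.Fin.Properties using (_≟_)
  open import Relation.Nullary using (Dec; yes; no; does)
  open import Data.List.Membership.Propositional.Properties using (∈-map⁻)
  open import Data.Unit.Base using (tt)

  some-∈ : {A : Set} (P : A → Bool) (xs : List A) → some P xs ≡ true → ∃ λ x → x ∈ xs × P x ≡ true
  some-∈ P (x ∷ xs) e with P x in px
  ... | true = x , here refl , px
  ... | false with some-∈ P xs e
  ...   | y , y∈ , py = y , there y∈ , py

  every-∈ : {A : Set} (P : A → Bool) (xs : List A) → every P xs ≡ true → ∀ {x} → x ∈ xs → P x ≡ true
  every-∈ P (x ∷ xs) e (here refl) = ∧-left e
  every-∈ P (x ∷ xs) e (there q) = every-∈ P xs (∧-right {P x} e) q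

  ∨-split : ∀ b {c} → b ∨ c ≡ true → b ≡ true ⊎ c ≡ true
  ∨-split true e = inj₁ refl
  ∨-split false e = inj₂ e

  weight-sum : ∀ {k} d (xs : Vec ℕ k) → + weight d xs ≡ sum (λ i → lookup (toℤ xs) i * + (d ℕ.+ toℕ i))
  weight-sum d [] = refl
  weight-sum d (x ∷ xs) = trans (ℤₚ.pos-+ (d ℕ.* x) (weight (suc d) xs)) (cong₂ _+_
    (trans (ℤₚ.pos-* d x) (trans (ℤₚ.*-comm (+ d) (+ x)) (cong (λ z → + x * + z) (sym (ℕₚ.+-identityʳ d)))))
    (trans (weight-sum (suc d) xs) (sum-cong-≗ λ i → cong (λ z → lookup (toℤ xs) i * + z) (sym (ℕₚ.+-suc d (toℕ i))))))

  count-sum : ∀ {k} (xs : Vec ℕ k) → + Vec.sum xs ≡ sum (λ i → lookup (toℤ xs) i)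
  count-sum [] = refl
  count-sum (x ∷ xs) = trans (ℤₚ.pos-+ x (Vec.sum xs)) (cong (_+_ (+ x)) (count-sum xs))

  Q-cong : ∀ W {x y : Fin 6 → ℤ} → (∀ i → x i ≡ y i) → Q W x ≡ Q W y
  Q-cong W e = sum-cong-≗ λ i → cong₂ _*_ (e i) (sum-cong-≗ λ j → cong (_* W i j) (e j))

  L-cong : ∀ h {x y : Fin 6 → ℤ} → (∀ i → x i ≡ y i) → L x h ≡ L y h
  L-cong h e = sum-cong-≗ λ i → cong (_* h i) (e i)

  five : Fin 6
  five = suc (suc (suc (suc (suc zero))))

  Σ-swap : ∀ {n k} (f : Fin n → Fin k → ℤ) (g : Fin n → ℤ) (h : Fin k → ℤ) →
    sum (λ x → g x * sum (λ w → h w * f x w)) ≡ sum (λ w → h w * sum (λ x → g x * f x w))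
  Σ-swap f g h = trans (sum-cong-≗ λ x → sym (Σ-*ˡ (g x) (λ w → h w * f x w)))
    (trans (∑-comm (λ x w → g x * (h w * f x w))) (sum-cong-≗ λ w → trans (sum-cong-≗ λ x → eq (g x) (h w) (f x w)) (Σ-*ˡ (h w) (λ x → g x * f x w))))
    where
    eq : ∀ a b c → a * (b * c) ≡ b * (a * c)
    eq = solve-∀

  0≤pronic : ∀ {d} → 0ℤ ≤ d → 0ℤ ≤ d * d - d
  0≤pronic {+ zero} _ = ℤₚ.≤-refl
  0≤pronic {+ suc k} _ = subst (0ℤ ≤_) (eq (+ k)) (0≤* {+ k} {1ℤ + + k} (+≤+ ℕ.z≤n) (+≤+ ℕ.z≤n))
    where
    eq : ∀ k → k * (1ℤ + k) ≡ (1ℤ + k) * (1ℤ + k) - (1ℤ + k)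
    eq = solve-∀

  pronic-mono : ∀ {j k} → 0ℤ ≤ j → j ≤ k → j * j - j ≤ k * k - k
  pronic-mono {j} {k} p q = ≤-by _ (eq j k) (0≤+ (0≤pronic (diff q)) (0≤* {+ 2} {(k - j) * j} (+≤+ ℕ.z≤n) (0≤* (diff q) p)))
    where
    eq : ∀ j k → (k * k - k) - (j * j - j) ≡ ((k - j) * (k - j) - (k - j)) + + 2 * ((k - j) * j)
    eq = solve-∀

  ∨-left : ∀ {b c} → b ≡ true → b ∨ c ≡ true
  ∨-left refl = refl

  ∨-right : ∀ b {c} → c ≡ true → b ∨ c ≡ true
  ∨-right true e = refl
  ∨-right false e = e

  ≤ᵇℤ-true : ∀ {x y} → x ≤ y → (x ℤ.≤ᵇ y) ≡ true
  ≤ᵇℤ-true {x} {y} p with x ℤ.≤ᵇ y | ℤₚ.≤⇒≤ᵇ p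
  ... | true | _ = refl

  δ≤1 : ∀ {k} (x y : Fin k) → δ x y ≤ 1ℤ
  δ≤1 x y = 𝟙≤1 (does (x ≟ y))

  δ≥0 : ∀ {k} (x y : Fin k) → 0ℤ ≤ δ x y
  δ≥0 x y = 𝟙-nonneg (does (x ≟ y))

  δ≡1 : ∀ {k} {x y : Fin k} → x ≡ y → δ x y ≡ 1ℤ
  δ≡1 {x = x} refl = δ-refl x

  _$ᵛ_ : Vec ℕ 6 → Fin 6 → ℤ
  x $ᵛ k = lookup (toℤ x) k

  -- The factor `1ℤ - (x $ᵛ zero)` is 1 exactly on a free line, one without a vertex of degree 2.
  -- Such a line is charged θ₁ per vertex of degree 7 and θ₂ per vertex of degree 4, and the side
  -- forms receive the proceeds.
  lineFilter : Certificate → ℤ → ℤ → Vec ℕ 6 → Bool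
  lineFilter C θ₁ θ₂ x = if lookup x zero ≤ᵇ 1 then
    (0ℤ ℤ.≤ᵇ onLine C x - (1ℤ - (x $ᵛ zero)) * (θ₁ * (x $ᵛ five) + θ₂ * (x $ᵛ (suc (suc zero))))) else true

  -- In the special case one vertex of degree 3 is exempt from the budget. At most t - z of the t
  -- degree-7 vertices on a side are far from it, so this bounds the ordered pairs of them that it
  -- is far from.
  starSlack : Bool → ℤ → ℤ → ℤ
  starSlack true t z = (t - z) * (t - z) - (t - z)
  starSlack false t z = 0ℤ

  -- Necessary conditions on z = `ζ i`, the number of free lines meeting the side in a vertex of
  -- degree 7; they are `b-low`, `b-high` and, in the special case, z ≤ t.
  feasible : Bool → ℤ → ℤ → ℤ → ℤ → ℤ → Bool
  feasible special M N s t z = (0ℤ ℤ.≤ᵇ t * ((+ 23 + s) - N) - z) ∧ ((t * ((+ 23 + s) - N) - z ℤ.≤ᵇ t * (M - + 39)) ∧ (not special ∨ (z ℤ.≤ᵇ t)))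

  -- The inequality `c-bound`, with b in the role of `β i`.
  payable : Bool → ℤ → ℤ → ℤ → ℤ → ℤ → Bool
  payable special N s t z b =
    (t * (t - 1ℤ)) * ((+ 23 + s) - N) - + 2 * ((t - 1ℤ) * z) + z - + 7 * t ℤ.≤ᵇ (t * t - t) * b + starSlack special t z

  -- z stops at E because there are only E free lines. The value b = 9 is tested whether or not it
  -- is payable and stands for every larger b too, since the form does not decrease in b when θ₂ ≥
  -- 0.
  sideCases : Bool → ℤ → ℤ → ℕ → ℤ → ℤ → ℤ → ℤ → ℤ → Bool
  sideCases special M N E θ₁ θ₂ o s t = upTo E λ z → if feasible special M N s t (+ z)
    then upTo 9 (λ b → if payable special N s t (+ z) (+ b) ∨ (9 ≤ᵇ b) then 0ℤ ℤ.≤ᵇ o + (θ₁ * + z + θ₂ * + b) else true) else true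

  sideFilter : Bool → ℤ → ℤ → ℕ → Certificate → ℤ → ℤ → Vec ℕ 6 → Bool
  sideFilter special M N E C θ₁ θ₂ x = sideCases special M N E θ₁ θ₂ (onSide C x) (x $ᵛ zero) (x $ᵛ five)

  -- What the budget Σρ contains beyond twice `Z₄`: in the generic case 2 N₃ + e(e - 1), where E is
  -- the number e of free lines.
  allowance : Bool → ℕ → Vec ℕ 6 → ℤ
  allowance true E x = 0ℤ
  allowance false E x = + 2 * (x $ᵛ (suc zero)) + (+ E * + E - + E)

  filterCheck : Bool → ℕ → ℕ → Vec ℕ 6 → Certificate → ℤ → ℤ → Bool
  filterCheck special m E x C θ₁ θ₂ = farCheck C ∧ (compositions 6 2 (m ℕ.+ 8) 9 (lineFilter C θ₁ θ₂)
    ∧ (compositions 6 2 m 9 (sideFilter special (+ m) (x $ᵛ zero) E C θ₁ θ₂)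
    ∧ ((0ℤ ℤ.≤ᵇ θ₂) ∧ (+ 2 * value C m x + θ₂ * allowance special E x ℤ.≤ᵇ -[1+ 0 ]))))

  -- Properties of line types (the first two) and of side types (the last) at m = 47. `pencil`
  -- bounds the degree-7 vertices on a line with a vertex of degree 3 from above, and on a line with
  -- two of them also from below.
  noTwoThree pencil fewSevens : Vec ℕ 6 → Bool
  noTwoThree x = if lookup x zero ≤ᵇ 1 then (lookup x zero ≤ᵇ 0) ∨ (lookup x (suc zero) ≤ᵇ 0) else true
  pencil x = if lookup x zero ≤ᵇ 1 then
    ((lookup x (suc zero) ≤ᵇ 0) ∨ (lookup x five ≤ᵇ 5 ℕ.+ lookup x (suc zero))) ∧ ((lookup x (suc zero) ≤ᵇ 1) ∨ (7 ≤ᵇ lookup x five)) else true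
  fewSevens x = lookup x five ≤ᵇ 5

  unguard : ∀ {x y : Bool} → x ≡ true → (if x then y else true) ≡ true → y ≡ true
  unguard refl q = q

  -- θ₁ multiplies an identity and may have either sign; θ₂ multiplies an inequality and has to be
  -- nonnegative.
  record Entry : Set where
    constructor entry
    field
      distribution : Vec ℕ 6
      free         : ℕ
      certificate  : Certificate
      θ₁ θ₂        : ℤ

  open Entry

  -- "free" counts the lines without a vertex of degree 2.
  entryCheck : ℕ → Entry → Bool
  entryCheck m E = (45 ≤ᵇ m) ∧ ((Vec.sum (distribution E) ≡ᵇ 81) ∧ ((m ≡ᵇ free E ℕ.+ 2 ℕ.* lookup (distribution E) zero)
    ∧ (((free E ≤ᵇ 2) ∨ ((free E ≤ᵇ 3) ∧ (lookup (distribution E) (suc zero) ≤ᵇ 0)))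
    ∧ filterCheck false m (free E) (distribution E) (certificate E) (θ₁ E) (θ₂ E))))

  ≡ᵇ-sound : ∀ x y → (x ≡ᵇ y) ≡ true → x ≡ y
  ≡ᵇ-sound x y e = ℕₚ.≡ᵇ⇒≡ x y (subst T (sym e) tt)

  sameVec-sound : ∀ {k} (xs ys : Vec ℕ k) → sameVec xs ys ≡ true → xs ≡ ys
  sameVec-sound [] [] _ = refl
  sameVec-sound (x ∷ xs) (y ∷ ys) e = cong₂ _∷_ (≡ᵇ-sound x y (∧-left e)) (sameVec-sound xs ys (∧-right {x ≡ᵇ y} e))

  module Analysis {n m : ℕ} {X : LinearSpace 9 n m} (Z : Critical X) where
    open Counting X public
    open Critical Z public

    comp : (Fin n → ℤ) → Fin 6 → ℤ
    comp u i = sum (λ v → u v * δ i (κ v))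

    linear : ∀ (u : Fin n → ℤ) (h : Fin 6 → ℤ) → sum (λ v → u v * h (κ v)) ≡ L (comp u) h
    linear u h = sym (begin
      sum (λ i → comp u i * h i) ≡⟨ sum-cong-≗ (λ i → sym (Σ-*ʳ (h i) (λ v → u v * δ i (κ v)))) ⟩
      sum (λ i → sum (λ v → u v * δ i (κ v) * h i)) ≡⟨ ∑-comm (λ i v → u v * δ i (κ v) * h i) ⟩
      sum (λ v → sum (λ i → u v * δ i (κ v) * h i)) ≡⟨ sum-cong-≗ inner ⟩
      sum (λ v → u v * h (κ v)) ∎)
      where
      open ≡-Reasoning
      inner : ∀ v → sum (λ i → u v * δ i (κ v) * h i) ≡ u v * h (κ v)
      inner v = trans (sum-cong-≗ λ i → trans (ℤₚ.*-assoc (u v) (δ i (κ v)) (h i)) (cong (λ z → u v * (z * h i)) (δ-sym i (κ v))))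
        (trans (Σ-*ˡ (u v) (λ i → δ (κ v) i * h i)) (cong (u v *_) (Σ-δ (κ v) h)))

    bilinear : ∀ (u : Fin n → ℤ) (W : Fin 6 → Fin 6 → ℤ) →
      sum (λ v → u v * sum (λ w → u w * W (κ v) (κ w))) ≡ Q W (comp u)
    bilinear u W = trans (linear u (λ i → sum (λ w → u w * W i (κ w))))
      (sum-cong-≗ λ i → cong (comp u i *_) (linear u (W i)))

    N : Fin 6 → ℤ
    N = comp (λ _ → 1ℤ)

    linear-N : ∀ (h : Fin 6 → ℤ) → sum (λ v → h (κ v)) ≡ L N h
    linear-N h = trans (sum-cong-≗ λ v → sym (ℤₚ.*-identityˡ (h (κ v)))) (linear (λ _ → 1ℤ) h)

    bilinear-N : ∀ W → sum (λ v → sum (λ w → W (κ v) (κ w))) ≡ Q W N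
    bilinear-N W = trans (sum-cong-≗ λ v → trans (sum-cong-≗ λ w → sym (ℤₚ.*-identityˡ (W (κ v) (κ w)))) (sym (ℤₚ.*-identityˡ _)))
      (bilinear (λ _ → 1ℤ) W)

    lineType : Fin m → Fin 6 → ℤ
    lineType ℓ = comp (λ v → a v ℓ)

    sideType : Fin 9 → Fin 6 → ℤ
    sideType s = comp (σ s)

    -- By the definition of φ, the side, line and far terms give every ordered pair of distinct
    -- vertices weight 1. The pair (v, v) is counted once by its side and deg v times by lines,
    -- hence the subtracted term.
    pair-split : ∀ (G : Fin n → Fin n → ℤ) → sum (λ v → sum (λ w → G v w)) ≡
      ((sum (λ s → sum (λ v → σ s v * sum (λ w → σ s w * G v w)))
       + sum (λ ℓ → sum (λ v → a v ℓ * sum (λ w → a w ℓ * G v w))))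
       - sum (λ v → deg v * G v v)) + sum (λ v → sum (λ w → φ v w * G v w))
    pair-split G = sym (begin
      ((S + C) - E) + F
        ≡⟨ cong (_+ F) (cong (_- E) (cong₂ _+_ s-eq c-eq)) ⟩
      ((sum S′ + sum C′) - E) + F
        ≡⟨ sym (trans (Σ-+ (λ v → (S′ v + C′ v) - deg v * G v v) F′)
             (cong (_+ F) (trans (Σ-- (λ v → S′ v + C′ v) (λ v → deg v * G v v)) (cong (_- E) (Σ-+ S′ C′))))) ⟩
      sum (λ v → ((S′ v + C′ v) - deg v * G v v) + F′ v) ≡⟨ sum-cong-≗ pointwise ⟩
      sum (λ v → sum (λ w → G v w)) ∎)
      where
      open ≡-Reasoning
      S C E F : ℤ
      S = sum (λ s → sum (λ v → σ s v * sum (λ w → σ s w * G v w)))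
      C = sum (λ ℓ → sum (λ v → a v ℓ * sum (λ w → a w ℓ * G v w)))
      E = sum (λ v → deg v * G v v)
      S′ C′ F′ : Fin n → ℤ
      S′ v = sum (λ w → σ (side v) w * G v w)
      C′ v = sum (λ w → c v w * G v w)
      F′ v = sum (λ w → φ v w * G v w)
      F = sum F′
      s-eq : S ≡ sum S′
      s-eq = trans (∑-comm (λ s v → σ s v * sum (λ w → σ s w * G v w)))
        (sum-cong-≗ λ v → trans (sum-cong-≗ λ s → cong (_* sum (λ w → σ s w * G v w)) (δ-sym s (side v)))
          (Σ-δ (side v) (λ s → sum (λ w → σ s w * G v w))))
      c-eq : C ≡ sum C′
      c-eq = trans (∑-comm (λ ℓ v → a v ℓ * sum (λ w → a w ℓ * G v w))) (sum-cong-≗ λ v → sym (c-sum v (G v)))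
      eq : ∀ g s k d → ((s + k) - d) + (((g - s) - k) + d) ≡ g
      eq = solve-∀
      pointwise : ∀ v → ((S′ v + C′ v) - deg v * G v v) + F′ v ≡ sum (λ w → G v w)
      pointwise v = trans (cong (_+_ ((S′ v + C′ v) - deg v * G v v)) (φ-sum v (G v)))
        (eq (sum (G v)) (S′ v) (C′ v) (deg v * G v v))

    φ-sym : ∀ v w → φ v w ≡ φ w v
    φ-sym v w = cong₂ _+_ (cong₂ (λ x y → (1ℤ - x) - y) (δ-sym (side v) (side w)) (c-sym v w))
      (trans (cong (_* deg v) (δ-sym v w)) (δ-elim {x = w} {y = v} {f = deg}))

    Σsize : sum sideSize ≡ + n
    Σsize = trans (sum-cong-≗ λ s → sum-cong-≗ λ v → sym (ℤₚ.*-identityʳ (σ s v)))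
      (trans (sym (split-sides (λ _ → 1ℤ))) (trans (Σ-const n 1ℤ) (ℤₚ.*-identityʳ _)))

    n≥81 : + 81 ≤ + n
    n≥81 = subst (+ 81 ≤_) Σsize (Σ-mono {f = λ _ → + 9} size≥9)

    others≥72 : ∀ s → + 72 ≤ + n - sideSize s
    others≥72 s = subst₂ _≤_ low high (Σ-mono {f = λ t → (1ℤ - δ s t) * + 9} {g = λ t → (1ℤ - δ s t) * sideSize t}
        (λ t → *-mono-left (diff (𝟙≤1 (does (s ≟ t)))) (size≥9 t)))
      where
      open ≡-Reasoning
      ex : ∀ (f : Fin 9 → ℤ) → sum (λ t → (1ℤ - δ s t) * f t) ≡ sum f - f s
      ex f = trans (sum-cong-≗ λ t → eq (δ s t) (f t)) (trans (Σ-- f (λ t → δ s t * f t)) (cong (_-_ (sum f)) (Σ-δ s f)))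
        where
        eq : ∀ d x → (1ℤ - d) * x ≡ x - d * x
        eq = solve-∀
      low : sum (λ t → (1ℤ - δ s t) * + 9) ≡ + 72
      low = ex (λ _ → + 9)
      high : sum (λ t → (1ℤ - δ s t) * sideSize t) ≡ + n - sideSize s
      high = trans (ex sideSize) (cong (_- sideSize s) Σsize)

    φ-count≥ : ∀ v → + 72 - + 8 * deg v ≤ sum (φ v)
    φ-count≥ v = subst (+ 72 - + 8 * deg v ≤_) (sym (φ-count v))
      (ℤₚ.+-monoˡ-≤ (- (+ 8 * deg v)) (others≥72 (side v)))

    -- `zl` is taken away from the line forms and `zs` is added to the side forms, at net cost at
    -- most `E`. Plain certificates set both to zero; the strengthened ones transfer budget this
    -- way.
    module Apply
      (W : Fin 6 → Fin 6 → ℤ) (A K H G : Fin 6 → ℤ) (CL CS E : ℤ) (zl : Fin m → ℤ) (zs : Fin 9 → ℤ)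
      (far : ∀ i j → 0ℤ ≤ (W i j + (A i * D j + A j * D i)) + (K i + K j))
      (K≤0 : ∀ i → K i ≤ 0ℤ)
      (line : ∀ ℓ → 0ℤ ≤ ((Q W (lineType ℓ) + L (lineType ℓ) H) + CL) - zl ℓ)
      (side′ : ∀ s → 0ℤ ≤ ((Q W (sideType s) + L (sideType s) G) + CS) + zs s)
      (bound : sum zs - sum zl ≤ E)
      where

      V : Fin 6 → ℤ
      V i = ((D i * W i i + D i * H i) + G i) + (+ 2 * (A i * ((+ 8 - D i) * (M - D i))) + + 2 * (K i * (+ 72 - + 8 * D i)))

      -- The multiplier terms at the two ends of a far pair have equal sums because φ is symmetric;
      -- the inner sum of the degree terms is evaluated by `φ-deg`.
      far-part : sum (λ v → sum (λ w → φ v w * W (κ v) (κ w))) +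
        sum (λ v → + 2 * (A (κ v) * ((+ 8 - D (κ v)) * (M - D (κ v)))) + + 2 * (K (κ v) * sum (φ v)))
        ≡ sum (λ v → sum (λ w → φ v w * ((W (κ v) (κ w) + (A (κ v) * D (κ w) + A (κ w) * D (κ v))) + (K (κ v) + K (κ w)))))
      far-part = sym (begin
        sum (λ v → sum (λ w → φ v w * ((W (κ v) (κ w) + (A (κ v) * D (κ w) + A (κ w) * D (κ v))) + (K (κ v) + K (κ w)))))
          ≡⟨ sum-cong-≗ (λ v → trans (sum-cong-≗ (pt v))
               (trans (Σ-+ (λ w → φ v w * W (κ v) (κ w)) (λ w → P v w + P′ v w)) (cong (_+_ (FW v)) (Σ-+ (P v) (P′ v))))) ⟩
        sum (λ v → FW v + (sum (P v) + sum (P′ v)))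
          ≡⟨ trans (Σ-+ FW (λ v → sum (P v) + sum (P′ v))) (cong (_+_ (sum FW)) (Σ-+ (λ v → sum (P v)) (λ v → sum (P′ v)))) ⟩
        sum FW + (sum (λ v → sum (P v)) + sum (λ v → sum (P′ v)))
          ≡⟨ cong (λ z → sum FW + (sum (λ v → sum (P v)) + z)) flip ⟩
        sum FW + (sum (λ v → sum (P v)) + sum (λ v → sum (P v)))
          ≡⟨ cong (_+_ (sum FW)) (trans (sym (Σ-+ (λ v → sum (P v)) (λ v → sum (P v)))) (sum-cong-≗ λ v → trans (cong₂ _+_ (pv v) (pv v)) (eq₂ (A (κ v)) _ (K (κ v)) _))) ⟩
        sum FW + sum (λ v → + 2 * (A (κ v) * ((+ 8 - D (κ v)) * (M - D (κ v)))) + + 2 * (K (κ v) * sum (φ v))) ∎)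
        where
        open ≡-Reasoning
        P P′ : Fin n → Fin n → ℤ
        P v w = A (κ v) * (φ v w * deg w) + K (κ v) * φ v w
        P′ v w = P w v
        FW : Fin n → ℤ
        FW v = sum (λ w → φ v w * W (κ v) (κ w))
        eq₂ : ∀ x y k z → (x * y + k * z) + (x * y + k * z) ≡ + 2 * (x * y) + + 2 * (k * z)
        eq₂ = solve-∀
        eq₀ : ∀ f x a d a′ d′ k k′ → f * ((x + (a * d + a′ * d′)) + (k + k′)) ≡ f * x + ((a * (f * d) + k * f) + (a′ * (f * d′) + k′ * f))
        eq₀ = solve-∀
        pt : ∀ v w → φ v w * ((W (κ v) (κ w) + (A (κ v) * D (κ w) + A (κ w) * D (κ v))) + (K (κ v) + K (κ w)))
          ≡ φ v w * W (κ v) (κ w) + (P v w + P′ v w)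
        pt v w = trans (eq₀ (φ v w) (W (κ v) (κ w)) (A (κ v)) (D (κ w)) (A (κ w)) (D (κ v)) (K (κ v)) (K (κ w)))
          (cong (_+_ (φ v w * W (κ v) (κ w))) (cong₂ _+_
            (cong (λ z → A (κ v) * (φ v w * z) + K (κ v) * φ v w) (sym (deg≡ w)))
            (cong₂ (λ f z → A (κ w) * (f * z) + K (κ w) * f) (φ-sym v w) (sym (deg≡ v)))))
        flip : sum (λ v → sum (P′ v)) ≡ sum (λ v → sum (P v))
        flip = ∑-comm P′
        pv : ∀ v → sum (P v) ≡ A (κ v) * ((+ 8 - D (κ v)) * (M - D (κ v))) + K (κ v) * sum (φ v)
        pv v = trans (Σ-+ (λ w → A (κ v) * (φ v w * deg w)) (λ w → K (κ v) * φ v w))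
          (cong₂ _+_ (trans (Σ-*ˡ (A (κ v)) (λ w → φ v w * deg w)) (cong (A (κ v) *_) (trans (φ-deg v)
              (cong₂ _*_ (cong (_-_ (+ 8)) (deg≡ v)) (cong (_-_ M) (deg≡ v))))))
            (Σ-*ˡ (K (κ v)) (φ v)))

      φF-nonneg : 0ℤ ≤ sum (λ v → sum (λ w → φ v w * ((W (κ v) (κ w) + (A (κ v) * D (κ w) + A (κ w) * D (κ v))) + (K (κ v) + K (κ w)))))
      φF-nonneg = Σ-nonneg λ v → Σ-nonneg λ w → 0≤* (φ-nonneg v w) (far (κ v) (κ w))

      -- All local forms together equal the global value plus the transferred budget minus `slack`,
      -- the loss from replacing the number of far vertices by its lower bound under a nonpositive
      -- multiplier.
      conclusion : 0ℤ ≤ ((Q W N + L N V) + (M * CL + + 9 * CS)) + E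
      conclusion = ℤₚ.≤-trans total (≤-by ((E - (sum zs - sum zl)) + slack)
          (eq₃ ((Q W N + L N V) + (M * CL + + 9 * CS)) E (sum zs) (sum zl) slack) (0≤+ (diff bound) slack-nonneg))
        where
        open ≡-Reasoning
        QL QS FW TL TS TG TH TA TK TKφ WD : ℤ
        QL = sum (λ ℓ → Q W (lineType ℓ))
        QS = sum (λ s → Q W (sideType s))
        FW = sum (λ v → sum (λ w → φ v w * W (κ v) (κ w)))
        TL = sum (λ ℓ → L (lineType ℓ) H)
        TS = sum (λ s → L (sideType s) G)
        TH = sum (λ v → D (κ v) * H (κ v))
        TG = sum (λ v → G (κ v))
        WD = sum (λ v → D (κ v) * W (κ v) (κ v))
        TA = sum (λ v → + 2 * (A (κ v) * ((+ 8 - D (κ v)) * (M - D (κ v)))))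
        TKφ = sum (λ v → + 2 * (K (κ v) * sum (φ v)))
        TK = sum (λ v → + 2 * (K (κ v) * (+ 72 - + 8 * D (κ v))))
        slack : ℤ
        slack = TK - TKφ
        slack-nonneg : 0ℤ ≤ slack
        slack-nonneg = diff (Σ-mono λ v → *-mono-left {+ 2} (+≤+ ℕ.z≤n)
          (ℤₚ.*-monoˡ-≤-nonPos (K (κ v)) {{ℤ.nonPositive (K≤0 (κ v))}}
            (subst (λ z → + 72 - + 8 * z ≤ sum (φ v)) (deg≡ v) (φ-count≥ v))))
        eqW : Q W N ≡ ((QS + QL) - WD) + FW
        eqW = trans (sym (bilinear-N W)) (trans (pair-split (λ v w → W (κ v) (κ w)))
          (cong (_+ FW) (cong₂ _-_
            (cong₂ _+_ (sum-cong-≗ λ s → bilinear (σ s) W) (sum-cong-≗ λ ℓ → bilinear (λ v → a v ℓ) W))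
            (sum-cong-≗ λ v → cong (_* W (κ v) (κ v)) (deg≡ v)))))
        eqTL : TL ≡ TH
        eqTL = trans (sum-cong-≗ λ ℓ → sym (linear (λ v → a v ℓ) H)) (trans (sym (double-count (λ v → H (κ v))))
          (sum-cong-≗ λ v → cong (_* H (κ v)) (deg≡ v)))
        eqTS : TS ≡ TG
        eqTS = trans (sum-cong-≗ λ s → sym (linear (σ s) G)) (sym (split-sides (λ v → G (κ v))))
        eqV : L N V ≡ ((WD + TH) + TG) + (TA + TK)
        eqV = trans (sym (linear-N V)) (trans (Σ-+ (λ v → (D (κ v) * W (κ v) (κ v) + D (κ v) * H (κ v)) + G (κ v)) _)
          (cong₂ _+_ (trans (Σ-+ (λ v → D (κ v) * W (κ v) (κ v) + D (κ v) * H (κ v)) (λ v → G (κ v)))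
            (cong (_+ TG) (Σ-+ (λ v → D (κ v) * W (κ v) (κ v)) (λ v → D (κ v) * H (κ v)))))
            (Σ-+ (λ v → + 2 * (A (κ v) * ((+ 8 - D (κ v)) * (M - D (κ v))))) (λ v → + 2 * (K (κ v) * (+ 72 - + 8 * D (κ v)))))))
        lines sides : ℤ
        lines = sum (λ ℓ → ((Q W (lineType ℓ) + L (lineType ℓ) H) + CL) - zl ℓ)
        sides = sum (λ s → ((Q W (sideType s) + L (sideType s) G) + CS) + zs s)
        lines-eq : lines ≡ ((QL + TL) + M * CL) - sum zl
        lines-eq = trans (Σ-- (λ ℓ → (Q W (lineType ℓ) + L (lineType ℓ) H) + CL) zl) (cong (_- sum zl)
          (trans (Σ-+ (λ ℓ → Q W (lineType ℓ) + L (lineType ℓ) H) (λ _ → CL))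
            (cong₂ _+_ (Σ-+ (λ ℓ → Q W (lineType ℓ)) (λ ℓ → L (lineType ℓ) H)) (Σ-const m CL))))
        sides-eq : sides ≡ ((QS + TS) + + 9 * CS) + sum zs
        sides-eq = trans (Σ-+ (λ s → (Q W (sideType s) + L (sideType s) G) + CS) zs) (cong (_+ sum zs)
          (trans (Σ-+ (λ s → Q W (sideType s) + L (sideType s) G) (λ _ → CS))
            (cong₂ _+_ (Σ-+ (λ s → Q W (sideType s)) (λ s → L (sideType s) G)) (Σ-const 9 CS))))
        total : 0ℤ ≤ (((Q W N + L N V) + (M * CL + + 9 * CS)) + (sum zs - sum zl)) - slack
        total = subst (0ℤ ≤_) (begin
          (lines + sides) + sum (λ v → sum (λ w → φ v w * ((W (κ v) (κ w) + (A (κ v) * D (κ w) + A (κ w) * D (κ v))) + (K (κ v) + K (κ w)))))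
            ≡⟨ cong₂ _+_ (cong₂ _+_ lines-eq sides-eq) (trans (sym far-part) (cong (_+_ FW)
                 (Σ-+ (λ v → + 2 * (A (κ v) * ((+ 8 - D (κ v)) * (M - D (κ v))))) (λ v → + 2 * (K (κ v) * sum (φ v)))))) ⟩
          ((((QL + TL) + M * CL) - sum zl) + (((QS + TS) + + 9 * CS) + sum zs)) + (FW + (TA + TKφ))
            ≡⟨ cong₂ (λ x y → ((((QL + x) + M * CL) - sum zl) + (((QS + y) + + 9 * CS) + sum zs)) + (FW + (TA + TKφ))) eqTL eqTS ⟩
          ((((QL + TH) + M * CL) - sum zl) + (((QS + TG) + + 9 * CS) + sum zs)) + (FW + (TA + TKφ))
            ≡⟨ eq₄ QL QS FW TH TG WD TA TK TKφ (M * CL) (+ 9 * CS) (sum zl) (sum zs) ⟩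
          ((((((QS + QL) - WD) + FW) + (((WD + TH) + TG) + (TA + TK))) + (M * CL + + 9 * CS)) + (sum zs - sum zl)) - (TK - TKφ)
            ≡⟨ cong₂ (λ x y → (((x + y) + (M * CL + + 9 * CS)) + (sum zs - sum zl)) - slack) (sym eqW) (sym eqV) ⟩
          (((Q W N + L N V) + (M * CL + + 9 * CS)) + (sum zs - sum zl)) - slack ∎)
          (0≤+ (0≤+ (Σ-nonneg line) (Σ-nonneg side′)) φF-nonneg)
          where
          eq₄ : ∀ ql qs fw th tg wd ta tk tkp mc nc zl zs →
            ((((ql + th) + mc) - zl) + (((qs + tg) + nc) + zs)) + (fw + (ta + tkp)) ≡
            ((((((qs + ql) - wd) + fw) + (((wd + th) + tg) + (ta + tk))) + (mc + nc)) + (zs - zl)) - (tk - tkp)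
          eq₄ = solve-∀
        eq₃ : ∀ x e s l k → (x + e) - ((x + (s - l)) - k) ≡ (e - (s - l)) + k
        eq₃ = solve-∀

    natType : (Fin n → ℤ) → Vec ℕ 6
    natType u = tabulate λ i → ∣ comp u i ∣

    comp-nonneg : ∀ {u} → (∀ v → 0ℤ ≤ u v) → ∀ i → 0ℤ ≤ comp u i
    comp-nonneg p i = Σ-nonneg λ v → 0≤* (p v) (𝟙-nonneg _)

    look : ∀ {u} → (∀ v → 0ℤ ≤ u v) → ∀ i → lookup (toℤ (natType u)) i ≡ comp u i
    look {u} p i = trans (lookup-map i (λ x → + x) (natType u))
      (trans (cong (λ x → + x) (lookup∘tabulate (λ i → ∣ comp u i ∣) i)) (ℤₚ.0≤i⇒+∣i∣≡i (comp-nonneg p i)))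

    type-weight : ∀ {u} → (∀ v → 0ℤ ≤ u v) → ∀ {w} → sum (λ v → u v * deg v) ≡ + w → weight 2 (natType u) ≡ w
    type-weight {u} p {w} e = ℤₚ.+-injective (trans (weight-sum 2 (natType u)) (trans (L-cong D (look p))
      (trans (sym (linear u D)) (trans (sum-cong-≗ λ v → cong (u v *_) (sym (deg≡ v))) e))))

    Σcomp : ∀ u → sum (comp u) ≡ sum u
    Σcomp u = trans (sum-cong-≗ λ i → sym (ℤₚ.*-identityʳ (comp u i))) (trans (sym (linear u (λ _ → 1ℤ)))
      (sum-cong-≗ λ v → ℤₚ.*-identityʳ (u v)))

    type-count : ∀ {u} → (∀ v → 0ℤ ≤ u v) → ∀ {k} → sum u ≡ + k → Vec.sum (natType u) ≡ k
    type-count {u} p e = ℤₚ.+-injective (trans (count-sum (natType u)) (trans (sum-cong-≗ (look p)) (trans (Σcomp u) e)))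

    a≥0 : ∀ ℓ v → 0ℤ ≤ a v ℓ
    a≥0 ℓ v = 𝟙-nonneg (inc v ℓ)

    σ≥0 : ∀ s v → 0ℤ ≤ σ s v
    σ≥0 s v = 𝟙-nonneg _

    1≥0 : (v : Fin n) → 0ℤ ≤ 1ℤ
    1≥0 v = +≤+ ℕ.z≤n

    lineVec : Fin m → Vec ℕ 6
    lineVec ℓ = natType (λ v → a v ℓ)

    sideVec : Fin 9 → Vec ℕ 6
    sideVec s = natType (σ s)

    allVec : Vec ℕ 6
    allVec = natType (λ _ → 1ℤ)

    lineVec-weight : ∀ ℓ → weight 2 (lineVec ℓ) ≡ m ℕ.+ 8
    lineVec-weight ℓ = type-weight (a≥0 ℓ) (trans (line-deg ℓ) (trans (eq M) (sym (ℤₚ.pos-+ m 8))))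
      where
      eq : ∀ x → (x + + 9) - 1ℤ ≡ x + + 8
      eq = solve-∀

    lineVec-count : ∀ ℓ → Vec.sum (lineVec ℓ) ≡ 9
    lineVec-count ℓ = type-count (a≥0 ℓ) (line-size ℓ)

    lineVec-twos : ∀ ℓ → lookup (lineVec ℓ) zero ℕ.≤ 1
    lineVec-twos ℓ = ℤₚ.drop‿+≤+ (subst (_≤ 1ℤ) (sym (trans (sym (lookup-map zero (λ x → + x) (lineVec ℓ))) (look (a≥0 ℓ) zero))) (one-two ℓ))

    natSize : Fin 9 → ℕ
    natSize s = ∣ sideSize s ∣

    natSize≡ : ∀ s → + natSize s ≡ sideSize s
    natSize≡ s = ℤₚ.0≤i⇒+∣i∣≡i (Σ-nonneg (σ≥0 s))

    sideVec-count : ∀ s → Vec.sum (sideVec s) ≡ natSize s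
    sideVec-count s = type-count (σ≥0 s) (sym (natSize≡ s))

    sideVec-weight : ∀ s → weight 2 (sideVec s) ≡ m
    sideVec-weight s = type-weight (σ≥0 s) (side-deg s)

    natSize≥9 : ∀ s → 9 ℕ.≤ natSize s
    natSize≥9 s = ℤₚ.drop‿+≤+ (subst (+ 9 ≤_) (sym (natSize≡ s)) (size≥9 s))

    natSize≤ : ∀ s → natSize s ℕ.+ 72 ℕ.≤ n
    natSize≤ s = ℤₚ.drop‿+≤+ (≤-by _ (trans (cong (λ z → + n - z) (trans (ℤₚ.pos-+ (natSize s) 72) (cong (_+ + 72) (natSize≡ s)))) (eq (+ n) (sideSize s)))
        (diff (others≥72 s)))
      where
      eq : ∀ x y → x - (y + + 72) ≡ (x - y) - + 72
      eq = solve-∀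

    module _ (C : Certificate) where
      open Certificate C renaming (W to W′; A to A′; K to K′; H to H′; G to G′; hc to hc′; gc to gc′)

      far-sound : farCheck C ≡ true → (∀ i j → 0ℤ ≤ (W′ i j + (A′ i * D j + A′ j * D i)) + (K′ i + K′ j)) × (∀ i → K′ i ≤ 0ℤ)
      far-sound e = (λ i j → ≤ᵇℤ-sound (six-sound (farEntry C i) (∧-right {K′ i ℤ.≤ᵇ 0ℤ} (six-sound (farRow C) e i)) j)) ,
        (λ i → ≤ᵇℤ-sound (∧-left {K′ i ℤ.≤ᵇ 0ℤ} (six-sound (farRow C) e i)))

      onLine≡ : ∀ {u} → (∀ v → 0ℤ ≤ u v) → onLine C (natType u) ≡ (Q W′ (comp u) + L (comp u) H′) + hc′
      onLine≡ {u} p = cong (_+ hc′) (cong₂ _+_ (trans (quad-Q C (toℤ (natType u))) (Q-cong W′ (look p)))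
        (trans (dot-L (toℤ (natType u)) (Certificate.h C)) (L-cong H′ (look p))))

      onSide≡ : ∀ {u} → (∀ v → 0ℤ ≤ u v) → onSide C (natType u) ≡ (Q W′ (comp u) + L (comp u) G′) + gc′
      onSide≡ {u} p = cong (_+ gc′) (cong₂ _+_ (trans (quad-Q C (toℤ (natType u))) (Q-cong W′ (look p)))
        (trans (dot-L (toℤ (natType u)) (Certificate.g C)) (L-cong G′ (look p))))

      V′ : Fin 6 → ℤ
      V′ i = ((D i * W′ i i + D i * H′ i) + G′ i) + (+ 2 * (A′ i * ((+ 8 - D i) * (M - D i))) + + 2 * (K′ i * (+ 72 - + 8 * D i)))

      value≡ : value C m allVec ≡ (Q W′ N + L N V′) + (M * hc′ + + 9 * gc′)
      value≡ = cong (_+ (M * hc′ + + 9 * gc′)) (cong₂ _+_ (trans (quad-Q C (toℤ allVec)) (Q-cong W′ (look 1≥0)))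
        (trans (dot-L (toℤ allVec) (tabulate V′)) (trans (L-cong (lookup (tabulate V′)) (look 1≥0))
          (sum-cong-≗ λ i → cong (N i *_) (lookup∘tabulate V′ i)))))

      value-bound : farCheck C ≡ true → ∀ zl zs E →
        (∀ ℓ → 0ℤ ≤ onLine C (lineVec ℓ) - zl ℓ) → (∀ s → 0ℤ ≤ onSide C (sideVec s) + zs s) →
        sum zs - sum zl ≤ E → 0ℤ ≤ value C m allVec + E
      value-bound e zl zs E pl ps b = subst (λ z → 0ℤ ≤ z + E) (sym value≡)
        (Apply.conclusion W′ A′ K′ H′ G′ hc′ gc′ E zl zs (proj₁ (far-sound e)) (proj₂ (far-sound e))
          (λ ℓ → subst (λ z → 0ℤ ≤ z - zl ℓ) (onLine≡ (a≥0 ℓ)) (pl ℓ))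
          (λ s → subst (λ z → 0ℤ ≤ z + zs s) (onSide≡ (σ≥0 s)) (ps s)) b)

    kill-sound : ∀ Cs → every farCheck Cs ≡ true → lineCheck m Cs ≡ true → sideCheck m Cs ≡ true →
      some (kills m n allVec) Cs ≡ true → ⊥
    kill-sound Cs far line side″ k = go (some-∈ (kills m n allVec) Cs k)
      where
      unif : ∀ {x y} → x ≡ true → (if x then y else true) ≡ true → y ≡ true
      unif refl q = q
      on-line : ∀ {C} → C ∈ Cs → ∀ ℓ → 0ℤ ≤ onLine C (lineVec ℓ)
      on-line {C} C∈ ℓ = ≤ᵇℤ-sound {0ℤ} {onLine C (lineVec ℓ)} (every-∈ (λ C → 0ℤ ℤ.≤ᵇ onLine C (lineVec ℓ)) Cs
        (unif (≤ᵇ-true (lineVec-twos ℓ)) (compositions-sound 6 2 (m ℕ.+ 8) 9 (lineOK Cs)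
          line (lineVec ℓ) (lineVec-weight ℓ) (lineVec-count ℓ))) C∈)
      on-side : ∀ {C} → C ∈ Cs → n ℕ.≤ 72 ℕ.+ Certificate.size C → n ℕ.≤ 85 → ∀ s → 0ℤ ≤ onSide C (sideVec s)
      on-side {C} C∈ n≤ n≤85 s = ≤ᵇℤ-sound {0ℤ} {onSide C (sideVec s)} (unif (≤ᵇ-true (subst (ℕ._≤ Certificate.size C) (sym k≡)
          (ℕₚ.+-cancelʳ-≤ 72 _ _ (ℕₚ.≤-trans (natSize≤ s) (subst (n ℕ.≤_) (ℕₚ.+-comm 72 _) n≤)))))
        (every-∈ (sideOK (9 ℕ.+ k₀) (sideVec s)) Cs
          (compositions-sound 6 2 m (9 ℕ.+ k₀) (λ x → every (sideOK (9 ℕ.+ k₀) x) Cs)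
            (upTo-sound 4 (sidesOf m Cs) side″ {k₀} k₀≤4) (sideVec s) (sideVec-weight s) (trans (sideVec-count s) (sym k≡))) C∈))
        where
        k₀ : ℕ
        k₀ = natSize s ∸ 9
        k≡ : 9 ℕ.+ k₀ ≡ natSize s
        k≡ = ℕₚ.m+[n∸m]≡n (natSize≥9 s)
        k₀≤4 : k₀ ℕ.≤ 4
        k₀≤4 = ℕₚ.∸-monoˡ-≤ 9 (ℕₚ.+-cancelʳ-≤ 72 _ 13 (ℕₚ.≤-trans (natSize≤ s) n≤85))
      zero-diff : sum {9} (λ _ → 0ℤ) - sum {m} (λ _ → 0ℤ) ≤ 0ℤ
      zero-diff = ℤₚ.≤-reflexive (cong (_-_ 0ℤ) (Σ-0 {m} {λ _ → 0ℤ} (λ _ → refl)))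
      clash : ∀ {z} → 0ℤ ≤ z + 0ℤ → z ≤ -[1+ 0 ] → ⊥
      clash {z} p q with ℤₚ.≤-trans (subst (0ℤ ≤_) (ℤₚ.+-identityʳ z) p) q
      ... | ()
      go : (∃ λ C → C ∈ Cs × kills m n allVec C ≡ true) → ⊥
      go (C , C∈ , kC) = finish (kills-split m n allVec C kC)
        where
        finish : n ℕ.≤ 72 ℕ.+ Certificate.size C × n ℕ.≤ 85 × value C m allVec ≤ -[1+ 0 ] → ⊥
        finish (n≤ , n≤85 , neg) = clash {value C m allVec} (value-bound C (every-∈ farCheck Cs far C∈) (λ _ → 0ℤ) (λ _ → 0ℤ) 0ℤ
          (λ ℓ → subst (0ℤ ≤_) (sym (ℤₚ.+-identityʳ (onLine C (lineVec ℓ)))) (on-line C∈ ℓ))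
          (λ s → subst (0ℤ ≤_) (sym (ℤₚ.+-identityʳ (onSide C (sideVec s)))) (on-side C∈ n≤ n≤85 s)) zero-diff) neg

    ΣN : sum N ≡ + n
    ΣN = trans (Σcomp (λ _ → 1ℤ)) (trans (Σ-const n 1ℤ) (ℤₚ.*-identityʳ _))

    ΣND : L N D ≡ + 9 * M
    ΣND = trans (sym (linear-N D)) (trans (sum-cong-≗ λ v → sym (deg≡ v)) Σdeg)

    ΣND² : L N (λ i → D i * D i) ≡ M * ((M + + 9) - 1ℤ)
    ΣND² = trans (sym (linear-N (λ i → D i * D i))) (trans (sum-cong-≗ λ v → sym (cong₂ _*_ (deg≡ v) (deg≡ v))) Σdeg²)

    #deg : Fin 6 → ℕ
    #deg i = ∣ N i ∣

    #deg≡ : ∀ i → + #deg i ≡ N i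
    #deg≡ i = ℤₚ.0≤i⇒+∣i∣≡i (comp-nonneg 1≥0 i)

    -- Counts incidences of degree-2 vertices with lines: two per vertex, at most one per line.
    twos≤ : 2 ℕ.* #deg zero ℕ.≤ m
    twos≤ = ℤₚ.drop‿+≤+ (subst₂ _≤_ (sym (trans (ℤₚ.pos-* 2 (#deg zero)) (trans (cong (+ 2 *_) (#deg≡ zero)) low)))
        (trans (Σ-const m 1ℤ) (ℤₚ.*-identityʳ _)) (Σ-mono one-two))
      where
      at : ∀ v → + 2 * (1ℤ * δ zero (κ v)) ≡ deg v * δ zero (κ v)
      at v = trans (cong (+ 2 *_) (ℤₚ.*-identityˡ (δ zero (κ v)))) (trans (go (κ v)) (cong (_* δ zero (κ v)) (sym (deg≡ v))))
        where
        go : ∀ i → + 2 * δ zero i ≡ D i * δ zero i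
        go zero = refl
        go (suc i) = sym (ℤₚ.*-zeroʳ (D (suc i)))
      low : + 2 * N zero ≡ sum (λ ℓ → sum (λ v → a v ℓ * δ zero (κ v)))
      low = trans (sym (Σ-*ˡ (+ 2) (λ v → 1ℤ * δ zero (κ v)))) (trans (sum-cong-≗ at) (double-count (λ v → δ zero (κ v))))

    -- The actual distribution occurs in the enumeration and is not killed, so it has to be one of
    -- the listed exceptions. The last two hypotheses say that the truncated subtractions are exact;
    -- for a numeral m they hold by `refl`.
    search-sound : ∀ Cs exceptions → check m Cs exceptions ≡ true → 1 ℕ.≤ #deg (suc (suc (suc (suc (suc zero))))) →
      base₁ m (dead m Cs exceptions) ℕ.+ 82 ℕ.* m ≡ m ℕ.* m ℕ.+ 1701 →
      base₂ m (dead m Cs exceptions) ℕ.+ 73 ℕ.* m ≡ m ℕ.* m ℕ.+ 1458 →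
      ∃ λ x → x ∈ exceptions × sameVec allVec x ≡ true
    search-sound Cs exceptions ok seven c-eq b-eq = conclude (∨-split (some (kills m n allVec) Cs) deadAll)
      where
      P : ℕ → Vec ℕ 6 → Bool
      P = dead m Cs exceptions
      x₀ x₁ x₂ x₃ x₄ x₅ ν : ℕ
      x₀ = #deg zero
      x₁ = #deg (suc zero)
      x₂ = #deg (suc (suc zero))
      x₃ = #deg (suc (suc (suc zero)))
      x₄ = #deg (suc (suc (suc (suc zero))))
      x₅ = #deg (suc (suc (suc (suc (suc zero)))))
      ν = n ∸ 81
      ν≡ : 81 ℕ.+ ν ≡ n
      ν≡ = ℕₚ.m+[n∸m]≡n (ℤₚ.drop‿+≤+ n≥81)
      s₀ : + x₀ + (+ x₁ + (+ x₂ + (+ x₃ + (+ x₄ + (+ x₅ + 0ℤ))))) ≡ + 81 + + ν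
      s₀ = trans (trans (sum-cong-≗ #deg≡) ΣN) (cong +_ (sym ν≡))
      s₁ : + x₀ * + 2 + (+ x₁ * + 3 + (+ x₂ * + 4 + (+ x₃ * + 5 + (+ x₄ * + 6 + (+ x₅ * + 7 + 0ℤ))))) ≡ + 9 * M
      s₁ = trans (sum-cong-≗ λ i → cong (_* D i) (#deg≡ i)) ΣND
      s₂ : + x₀ * + 4 + (+ x₁ * + 9 + (+ x₂ * + 16 + (+ x₃ * + 25 + (+ x₄ * + 36 + (+ x₅ * + 49 + 0ℤ))))) ≡ M * ((M + + 9) - 1ℤ)
      s₂ = trans (sum-cong-≗ λ i → cong (_* (D i * D i)) (#deg≡ i)) ΣND²
      cast : ∀ {x y} → + x ≡ + y → x ≡ y
      cast = ℤₚ.+-injective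
      cℤ : + base₁ m P ≡ (M * M + + 1701) - + 82 * M
      cℤ = trans (eq (+ base₁ m P) (+ 82 * M)) (cong (_- + 82 * M) (trans (cong (_+_ (+ base₁ m P)) (sym (ℤₚ.pos-* 82 m)))
          (trans (cong +_ c-eq) (cong (_+ + 1701) (ℤₚ.pos-* m m)))))
        where
        eq : ∀ x y → x ≡ (x + y) - y
        eq = solve-∀
      bℤ : + base₂ m P ≡ (M * M + + 1458) - + 73 * M
      bℤ = trans (eq (+ base₂ m P) (+ 73 * M)) (cong (_- + 73 * M) (trans (cong (_+_ (+ base₂ m P)) (sym (ℤₚ.pos-* 73 m)))
          (trans (cong +_ b-eq) (cong (_+ + 1458) (ℤₚ.pos-* m m)))))
        where
        eq : ∀ x y → x ≡ (x + y) - y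
        eq = solve-∀
      -- The factors 10 and 21 are coefficients of (d - 3)(d - 7); likewise 9 and 18 in `e₂` belong
      -- to (d - 3)(d - 6).
      e₁ : 5 ℕ.* x₀ ≡ base₁ m P ℕ.+ (21 ℕ.* ν ℕ.+ (3 ℕ.* x₂ ℕ.+ (4 ℕ.* x₃ ℕ.+ 3 ℕ.* x₄)))
      e₁ = cast (trans (ℤₚ.pos-* 5 x₀) (trans (ring (+ x₀) (+ x₁) (+ x₂) (+ x₃) (+ x₄) (+ x₅))
          (trans (cong₂ (λ u w → (+ 3 * + x₂ + (+ 4 * + x₃ + + 3 * + x₄)) + (u + w)) (cong₂ (λ u w → u - + 10 * w) s₂ s₁) (cong (+ 21 *_) s₀))
          (trans (ring′ (+ x₂) (+ x₃) (+ x₄) M (+ ν)) (cong₂ _+_ (sym cℤ) (cong₂ _+_ (sym (ℤₚ.pos-* 21 ν))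
            (cong₂ _+_ (sym (ℤₚ.pos-* 3 x₂)) (cong₂ _+_ (sym (ℤₚ.pos-* 4 x₃)) (sym (ℤₚ.pos-* 3 x₄))))))))))
        where
        ring : ∀ x₀ x₁ x₂ x₃ x₄ x₅ → + 5 * x₀ ≡ (+ 3 * x₂ + (+ 4 * x₃ + + 3 * x₄)) +
          (((x₀ * + 4 + (x₁ * + 9 + (x₂ * + 16 + (x₃ * + 25 + (x₄ * + 36 + (x₅ * + 49 + 0ℤ)))))) -
            + 10 * (x₀ * + 2 + (x₁ * + 3 + (x₂ * + 4 + (x₃ * + 5 + (x₄ * + 6 + (x₅ * + 7 + 0ℤ))))))) +
            + 21 * (x₀ + (x₁ + (x₂ + (x₃ + (x₄ + (x₅ + 0ℤ)))))))
        ring = solve-∀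
        ring′ : ∀ x₂ x₃ x₄ M ν → (+ 3 * x₂ + (+ 4 * x₃ + + 3 * x₄)) + ((M * ((M + + 9) - 1ℤ) - + 10 * (+ 9 * M)) + + 21 * (+ 81 + ν)) ≡
          ((M * M + + 1701) - + 82 * M) + (+ 21 * ν + (+ 3 * x₂ + (+ 4 * x₃ + + 3 * x₄)))
        ring′ = solve-∀
      e₂ : 4 ℕ.* x₀ ℕ.+ 4 ℕ.* x₅ ≡ base₂ m P ℕ.+ (18 ℕ.* ν ℕ.+ (2 ℕ.* x₂ ℕ.+ 2 ℕ.* x₃))
      e₂ = cast (trans (cong₂ _+_ (ℤₚ.pos-* 4 x₀) (ℤₚ.pos-* 4 x₅)) (trans (ring (+ x₀) (+ x₁) (+ x₂) (+ x₃) (+ x₄) (+ x₅))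
          (trans (cong₂ (λ u w → (+ 2 * + x₂ + + 2 * + x₃) + (u + w)) (cong₂ (λ u w → u - + 9 * w) s₂ s₁) (cong (+ 18 *_) s₀))
          (trans (ring′ (+ x₂) (+ x₃) M (+ ν)) (cong₂ _+_ (sym bℤ) (cong₂ _+_ (sym (ℤₚ.pos-* 18 ν))
            (cong₂ _+_ (sym (ℤₚ.pos-* 2 x₂)) (sym (ℤₚ.pos-* 2 x₃)))))))))
        where
        ring : ∀ x₀ x₁ x₂ x₃ x₄ x₅ → + 4 * x₀ + + 4 * x₅ ≡ (+ 2 * x₂ + + 2 * x₃) +
          (((x₀ * + 4 + (x₁ * + 9 + (x₂ * + 16 + (x₃ * + 25 + (x₄ * + 36 + (x₅ * + 49 + 0ℤ)))))) -
            + 9 * (x₀ * + 2 + (x₁ * + 3 + (x₂ * + 4 + (x₃ * + 5 + (x₄ * + 6 + (x₅ * + 7 + 0ℤ))))))) +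
            + 18 * (x₀ + (x₁ + (x₂ + (x₃ + (x₄ + (x₅ + 0ℤ)))))))
        ring = solve-∀
        ring′ : ∀ x₂ x₃ M ν → (+ 2 * x₂ + + 2 * x₃) + ((M * ((M + + 9) - 1ℤ) - + 9 * (+ 9 * M)) + + 18 * (+ 81 + ν)) ≡
          ((M * M + + 1458) - + 73 * M) + (+ 18 * ν + (+ 2 * x₂ + + 2 * x₃))
        ring′ = solve-∀
      e₃ : 81 ℕ.+ ν ≡ (x₀ ℕ.+ (x₂ ℕ.+ (x₃ ℕ.+ (x₄ ℕ.+ x₅)))) ℕ.+ x₁
      e₃ = cast (trans (sym s₀) (ring (+ x₀) (+ x₁) (+ x₂) (+ x₃) (+ x₄) (+ x₅)))
        where
        ring : ∀ x₀ x₁ x₂ x₃ x₄ x₅ → x₀ + (x₁ + (x₂ + (x₃ + (x₄ + (x₅ + 0ℤ))))) ≡ (x₀ + (x₂ + (x₃ + (x₄ + x₅)))) + x₁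
        ring = solve-∀
      ok-line : lineCheck m Cs ∧ (sideCheck m Cs ∧ distributions m P) ≡ true
      ok-line = ∧-right {every farCheck Cs} ok
      ok-side : sideCheck m Cs ∧ distributions m P ≡ true
      ok-side = ∧-right {lineCheck m Cs} ok-line
      deadAll : dead m Cs exceptions n allVec ≡ true
      deadAll = subst (λ z → P z allVec ≡ true) ν≡ (distributions-sound m P (∧-right {sideCheck m Cs} ok-side)
        x₀ x₁ x₂ x₃ x₄ x₅ ν twos≤ seven e₁ e₂ e₃)
      conclude : some (kills m n allVec) Cs ≡ true ⊎ some (sameVec allVec) exceptions ≡ true →
        ∃ λ x → x ∈ exceptions × sameVec allVec x ≡ true
      conclude (inj₁ k) = ⊥-elim (kill-sound Cs (∧-left {every farCheck Cs} ok) (∧-left {lineCheck m Cs} ok-line) (∧-left {sideCheck m Cs} ok-side) k)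
      conclude (inj₂ q) = some-∈ (sameVec allVec) exceptions q

    -- Degree-7 vertices on a common side when n = 81.

    module Far (n≡81 : + n ≡ + 81) where

      size≡9 : ∀ s → sideSize s ≡ + 9
      size≡9 s = ℤₚ.≤-antisym (≤-by _ (eq (sideSize s)) (diff (subst (λ z → + 72 ≤ z - sideSize s) n≡81 (others≥72 s)))) (size≥9 s)
        where
        eq : ∀ x → + 9 - x ≡ (+ 81 - x) - + 72
        eq = solve-∀

      two seven nt : Fin n → ℤ
      two v = δ zero (κ v)
      seven v = δ five (κ v)
      nt v = 1ℤ - two v

      -- `tw` counts the degree-2 vertices on a line and is 0 or 1, so `zf` is the indicator of a
      -- free line; `rz` below counts the free lines through a vertex.
      tw zf : Fin m → ℤ
      tw ℓ = sum (λ v → a v ℓ * two v)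
      zf ℓ = 1ℤ - tw ℓ

      rz : Fin n → ℤ
      rz v = sum (λ ℓ → a v ℓ * zf ℓ)

      N₂ : ℤ
      N₂ = N zero

      -- `s#` and `t#` count the vertices of degree 2 and 7 on a side; `ζ` counts the free lines
      -- that meet the side in a vertex of degree 7.
      s# t# ζ : Fin 9 → ℤ
      s# i = sideType i zero
      t# i = sideType i five
      ζ i = sum (λ v → (σ i v * seven v) * rz v)

      tw≥0 : ∀ ℓ → 0ℤ ≤ tw ℓ
      tw≥0 ℓ = Σ-nonneg λ v → 0≤* (a≥0 ℓ v) (𝟙-nonneg _)

      zf≥0 : ∀ ℓ → 0ℤ ≤ zf ℓ
      zf≥0 ℓ = diff (one-two ℓ)

      rz≥0 : ∀ v → 0ℤ ≤ rz v
      rz≥0 v = Σ-nonneg λ ℓ → 0≤* (a≥0 ℓ v) (zf≥0 ℓ)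

      nt≥0 : ∀ v → 0ℤ ≤ nt v
      nt≥0 v = diff (𝟙≤1 (does (zero ≟ κ v)))

      zf-01 : ∀ ℓ → zf ℓ ≡ 0ℤ ⊎ zf ℓ ≡ 1ℤ
      zf-01 ℓ = 01-cases (zf≥0 ℓ) (≤-by _ (eq (tw ℓ)) (tw≥0 ℓ))
        where
        eq : ∀ x → 1ℤ - (1ℤ - x) ≡ x
        eq = solve-∀

      c-two : ∀ v → sum (λ w → c v w * two w) ≡ deg v - rz v
      c-two v = trans (c-sum v two) (trans (sum-cong-≗ λ ℓ → eq (a v ℓ) (tw ℓ)) (Σ-- (a v) (λ ℓ → a v ℓ * zf ℓ)))
        where
        eq : ∀ x t → x * t ≡ x - x * (1ℤ - t)
        eq = solve-∀

      module _ {x : Fin n} (x7 : κ x ≡ five) where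

        deg7 : deg x ≡ + 7
        deg7 = trans (deg≡ x) (cong D x7)

        two-x : two x ≡ 0ℤ
        two-x = cong (δ zero) x7

        φ16 : sum (φ x) ≡ + 16
        φ16 = trans (φ-count x) (cong₂ (λ u d → u - + 8 * d) (cong₂ _-_ n≡81 (size≡9 (side x))) deg7)

        φtwo : sum (λ w → φ x w * two w) ≡ ((N₂ - s# (side x)) - (+ 7 - rz x))
        φtwo = trans (φ-sum x two) (trans (cong₂ _+_ (cong₂ _-_ (cong (_- s# (side x)) (sum-cong-≗ λ v → sym (ℤₚ.*-identityˡ (two v))))
            (trans (c-two x) (cong (_- rz x) deg7))) (trans (cong (deg x *_) two-x) (ℤₚ.*-zeroʳ (deg x)))) (ℤₚ.+-identityʳ _))

        -- Exactly 81 - 9 - 8 · 7 = 16 vertices are far from x. The N₂ vertices of degree 2 are far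
        -- from x except those on its side and the 7 - `rz x` joined to it. What remains of the 16
        -- is `need - rz x`, with 23 = 16 + 7.
        need : ℤ
        need = (+ 23 + s# (side x)) - N₂

        φnt : sum (λ w → φ x w * nt w) ≡ need - rz x
        φnt = trans (sum-cong-≗ λ w → eq (φ x w) (two w)) (trans (Σ-- (φ x) (λ w → φ x w * two w))
          (trans (cong₂ _-_ φ16 φtwo) (eq′ N₂ (s# (side x)) (rz x))))
          where
          eq : ∀ p t → p * (1ℤ - t) ≡ p - p * t
          eq = solve-∀
          eq′ : ∀ N s z → + 16 - ((N - s) - (+ 7 - z)) ≡ ((+ 23 + s) - N) - z
          eq′ = solve-∀

        need≥ : 0ℤ ≤ need - rz x
        need≥ = subst (0ℤ ≤_) φnt (Σ-nonneg λ w → 0≤* (φ-nonneg x w) (nt≥0 w))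

        -- The 16 far vertices have degree sum m - 7, hence total excess m - 39 over degree 2, and
        -- each one of larger degree takes at least 1 of it.
        need≤ : need - rz x ≤ M - + 39
        need≤ = subst₂ _≤_ φnt high (Σ-mono λ w → *-mono-left (φ-nonneg x w) (le w))
          where
          le : ∀ w → nt w ≤ deg w - + 2
          le w = subst (λ d → nt w ≤ d - + 2) (sym (deg≡ w)) (go (κ w))
            where
            go : ∀ i → 1ℤ - δ zero i ≤ D i - + 2
            go zero = ℤₚ.≤-refl
            go (suc zero) = ℤₚ.≤-refl
            go (suc (suc zero)) = +≤+ (ℕ.s≤s ℕ.z≤n)
            go (suc (suc (suc zero))) = +≤+ (ℕ.s≤s ℕ.z≤n)
            go (suc (suc (suc (suc zero)))) = +≤+ (ℕ.s≤s ℕ.z≤n)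
            go (suc (suc (suc (suc (suc zero))))) = +≤+ (ℕ.s≤s ℕ.z≤n)
          high : sum (λ w → φ x w * (deg w - + 2)) ≡ M - + 39
          high = trans (sum-cong-≗ λ w → eq (φ x w) (deg w)) (trans (Σ-- (λ w → φ x w * deg w) (λ w → + 2 * φ x w))
            (trans (cong₂ _-_ (trans (φ-deg x) (cong (λ d → (+ 8 - d) * (M - d)) deg7)) (trans (Σ-*ˡ (+ 2) (φ x)) (cong (+ 2 *_) φ16))) (eq′ M)))
            where
            eq : ∀ p d → p * (d - + 2) ≡ p * d - + 2 * p
            eq = solve-∀
            eq′ : ∀ M → (+ 8 - + 7) * (M - + 7) - + 2 * + 16 ≡ M - + 39
            eq′ = solve-∀

        -- A degree-2 vertex w joined to x has exactly one further line, so the second factor is 1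
        -- wherever the first is nonzero. In `both-sum` that factor counts the other vertices on the
        -- side of x joined to w.
        c-two-sq : ∀ w → (c x w * two w) * (deg w - c x w) ≡ c x w * two w
        c-two-sq w = go (zero ≟ κ w)
          where
          eq0 : ∀ k d → (k * 0ℤ) * d ≡ k * 0ℤ
          eq0 = solve-∀
          go : Dec (zero ≡ κ w) → (c x w * two w) * (deg w - c x w) ≡ c x w * two w
          go (no ne) = subst (λ t → (c x w * t) * (deg w - c x w) ≡ c x w * t) (sym (δ-≢ ne)) (eq0 (c x w) (deg w - c x w))
          go (yes e) = trans (cong (λ d → (c x w * two w) * (d - c x w)) (trans (deg≡ w) (cong D (sym e)))) (go′ (01-cases (c-nonneg x w) (join-once x w x≢w)))
            where
            x≢w : x ≢ w
            x≢w refl with trans (sym x7) (sym e)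
            ... | ()
            go′ : c x w ≡ 0ℤ ⊎ c x w ≡ 1ℤ → (c x w * two w) * (+ 2 - c x w) ≡ c x w * two w
            go′ (inj₁ z) = subst (λ k → (k * two w) * (+ 2 - k) ≡ k * two w) (sym z) refl
            go′ (inj₂ z) = subst (λ k → (k * two w) * (+ 2 - k) ≡ k * two w) (sym z) (ℤₚ.*-identityʳ _)

      -- Counts the degree-2 vertices joined to both; their number is what keeps the common far
      -- vertices from being determined.
      both : Fin n → Fin n → ℤ
      both x x′ = sum (λ w → (c x w * two w) * c x′ w)

      common : Fin n → Fin n → ℤ
      common x x′ = sum (λ w → nt w * (φ x w * φ x′ w))

      module _ {x x′ : Fin n} (x7 : κ x ≡ five) (x7′ : κ x′ ≡ five) (ne : x ≢ x′) (same : side x ≡ side x′) where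

        private
          c0 : c x x′ ≡ 0ℤ
          c0 = apart x x′ ne same

        -- Of the 16 vertices far from x′, none is on the common side. Each of the 7 lines through x
        -- avoids x′ and so carries exactly 8 - 7 = 1 vertex far from x′; the other 16 - 7 = 9 are
        -- far from x too.
        φφ : sum (λ w → φ x w * φ x′ w) ≡ + 9
        φφ = trans (φ-sum x (φ x′)) (trans (cong₂ _+_ (cong₂ _-_ (cong₂ _-_ (φ16 x7′) own) cross) (trans (cong (deg x *_) (φ-same x′ x (sym same))) (ℤₚ.*-zeroʳ (deg x)))) refl)
          where
          own : sum (λ w → σ (side x) w * φ x′ w) ≡ 0ℤ
          own = Σ-0 λ w → go w (side x ≟ side w)
            where
            go : ∀ w → Dec (side x ≡ side w) → σ (side x) w * φ x′ w ≡ 0ℤ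
            go w (yes e) = trans (cong (σ (side x) w *_) (φ-same x′ w (trans (sym same) e))) (ℤₚ.*-zeroʳ (σ (side x) w))
            go w (no q) = cong (_* φ x′ w) (δ-≢ q)
          cross : sum (λ w → c x w * φ x′ w) ≡ + 7
          cross = trans (c-sum x (φ x′)) (trans (sum-cong-≗ λ ℓ → trans (cong (a x ℓ *_) (trans (φ-line x′ ℓ) (cong (λ d → (1ℤ - a x′ ℓ) * (+ 8 - d)) (deg7 x7′)))) (eq (a x ℓ) (a x′ ℓ)))
            (trans (Σ-- (a x) (λ ℓ → a x ℓ * a x′ ℓ)) (cong₂ _-_ (deg7 x7) c0)))
            where
            eq : ∀ p q → p * ((1ℤ - q) * (+ 8 - + 7)) ≡ p - p * q
            eq = solve-∀

        φφtwo : sum (λ w → φ x w * (φ x′ w * two w)) ≡ ((N₂ - s# (side x′)) - (+ 7 - rz x′)) - ((+ 7 - rz x) - both x x′)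
        φφtwo = trans (φ-sum x (λ w → φ x′ w * two w)) (trans (cong₂ _+_ (cong₂ _-_ (cong₂ _-_ (φtwo x7′) own) cross)
            (trans (cong (deg x *_) (trans (cong (φ x′ x *_) (two-x x7)) (ℤₚ.*-zeroʳ (φ x′ x)))) (ℤₚ.*-zeroʳ (deg x)))) (eq ((N₂ - s# (side x′)) - (+ 7 - rz x′)) ((+ 7 - rz x) - both x x′)))
          where
          eq : ∀ p q → ((p - 0ℤ) - q) + 0ℤ ≡ p - q
          eq = solve-∀
          own : sum (λ w → σ (side x) w * (φ x′ w * two w)) ≡ 0ℤ
          own = Σ-0 λ w → go w (side x ≟ side w)
            where
            go : ∀ w → Dec (side x ≡ side w) → σ (side x) w * (φ x′ w * two w) ≡ 0ℤ
            go w (yes e) = trans (cong (λ z → σ (side x) w * (z * two w)) (φ-same x′ w (trans (sym same) e))) (ℤₚ.*-zeroʳ (σ (side x) w))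
            go w (no q) = cong (_* (φ x′ w * two w)) (δ-≢ q)
          pt : ∀ w → c x w * (φ x′ w * two w) ≡ c x w * two w - (c x w * two w) * c x′ w
          pt w = go (side x′ ≟ side w) (x ≟ w)
            where
            eq₀ : ∀ k t d → k * ((1ℤ - d) * t) ≡ k * t - (k * t) * d
            eq₀ = solve-∀
            eq₁ : ∀ p d → d * (p * 0ℤ) ≡ d * 0ℤ - (d * 0ℤ) * p
            eq₁ = solve-∀
            go : Dec (side x′ ≡ side w) → Dec (x ≡ w) → c x w * (φ x′ w * two w) ≡ c x w * two w - (c x w * two w) * c x′ w
            go (no q) _ = trans (cong (λ z → c x w * (z * two w)) (φ-other x′ w q)) (eq₀ (c x w) (two w) (c x′ w))
            go (yes e) (no q) = subst (λ k → k * (φ x′ w * two w) ≡ k * two w - (k * two w) * c x′ w) (sym (apart x w q (trans same e))) refl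
            go (yes e) (yes refl) = trans (cong (λ t → c x x * (φ x′ x * t)) (two-x x7)) (trans (eq₂ (c x x) (φ x′ x) (c x′ x)) (sym (cong (λ t → c x x * t - (c x x * t) * c x′ x) (two-x x7))))
              where
              eq₂ : ∀ k p d → k * (p * 0ℤ) ≡ k * 0ℤ - (k * 0ℤ) * d
              eq₂ = solve-∀
          cross : sum (λ w → c x w * (φ x′ w * two w)) ≡ (+ 7 - rz x) - both x x′
          cross = trans (sum-cong-≗ pt) (trans (Σ-- (λ w → c x w * two w) (λ w → (c x w * two w) * c x′ w))
            (cong (_- both x x′) (trans (c-two x) (cong (_- rz x) (deg7 x7)))))

        -- From the nine vertices far from both, subtract those of degree 2, which `φφtwo` finds by
        -- inclusion-exclusion over the degree-2 vertices joined to x and to x′.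
        common≡ : common x x′ ≡ (need x7 - rz x) - rz x′ - both x x′
        common≡ = trans (sum-cong-≗ λ w → eq (two w) (φ x w) (φ x′ w)) (trans (Σ-- (λ w → φ x w * φ x′ w) (λ w → φ x w * (φ x′ w * two w)))
          (trans (cong₂ _-_ φφ (trans φφtwo (cong (λ i → ((N₂ - s# i) - (+ 7 - rz x′)) - ((+ 7 - rz x) - both x x′)) (sym same)))) (eq′ N₂ (s# (side x)) (rz x) (rz x′) (both x x′))))
          where
          eq : ∀ t p q → (1ℤ - t) * (p * q) ≡ p * q - p * (q * t)
          eq = solve-∀
          eq′ : ∀ N s z z′ b → + 9 - (((N - s) - (+ 7 - z′)) - ((+ 7 - z) - b)) ≡ ((((+ 23 + s) - N) - z) - z′) - b
          eq′ = solve-∀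

      guard-cong : ∀ {k} (b : Fin k → Bool) {f g : Fin k → ℤ} → (∀ v → b v ≡ true → f v ≡ g v) →
        sum (λ v → 𝟙 (b v) * f v) ≡ sum (λ v → 𝟙 (b v) * g v)
      guard-cong b {f} {g} p = sum-cong-≗ λ v → go v (b v) refl
        where
        go : ∀ v c → b v ≡ c → 𝟙 c * f v ≡ 𝟙 c * g v
        go v true e = cong (1ℤ *_) (p v e)
        go v false e = refl

      guard-mono : ∀ {k} (b : Fin k → Bool) {f g : Fin k → ℤ} → (∀ v → b v ≡ true → f v ≤ g v) →
        sum (λ v → 𝟙 (b v) * f v) ≤ sum (λ v → 𝟙 (b v) * g v)
      guard-mono b {f} {g} p = Σ-mono λ v → go v (b v) refl
        where
        go : ∀ v c → b v ≡ c → 𝟙 c * f v ≤ 𝟙 c * g v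
        go v true e = *-mono-left {1ℤ} (+≤+ ℕ.z≤n) (p v e)
        go v false e = ℤₚ.≤-refl

      uB : Fin 9 → Fin n → Bool
      uB i v = does (i ≟ side v) ∧ does (five ≟ κ v)

      u : Fin 9 → Fin n → ℤ
      u i v = 𝟙 (uB i v)

      u≡ : ∀ i v → u i v ≡ σ i v * seven v
      u≡ i v = 𝟙-∧ (does (i ≟ side v)) _

      u-side : ∀ {i v} → uB i v ≡ true → side v ≡ i
      u-side {i} {v} e = sym (does-≡ (∧-left {does (i ≟ side v)} e))

      u-seven : ∀ {i v} → uB i v ≡ true → κ v ≡ five
      u-seven {i} {v} e = sym (does-≡ (∧-right {does (i ≟ side v)} e))

      t≡ : ∀ i → t# i ≡ sum (u i)
      t≡ i = sum-cong-≗ λ v → sym (u≡ i v)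

      ζ≡ : ∀ i → ζ i ≡ sum (λ v → u i v * rz v)
      ζ≡ i = sum-cong-≗ λ v → cong (_* rz v) (sym (u≡ i v))

      need# : Fin 9 → ℤ
      need# i = (+ 23 + s# i) - N₂

      -- How many degree-7 vertices on side i are far from w. Vertices with value at least 2 are the
      -- ones that turn out to be scarce.
      j : Fin 9 → Fin n → ℤ
      j i w = sum (λ x → u i x * φ x w)

      Σ-need : ∀ i → sum (λ x → u i x * (need# i - rz x)) ≡ t# i * need# i - ζ i
      Σ-need i = trans (sum-cong-≗ λ x → eq (u i x) (need# i) (rz x)) (trans (Σ-- (λ x → u i x * need# i) (λ x → u i x * rz x))
        (cong₂ _-_ (trans (Σ-*ʳ (need# i) (u i)) (cong (_* need# i) (sym (t≡ i)))) (sym (ζ≡ i))))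
        where
        eq : ∀ p n z → p * (n - z) ≡ p * n - p * z
        eq = solve-∀

      b-low : ∀ i → 0ℤ ≤ t# i * need# i - ζ i
      b-low i = subst (0ℤ ≤_) (Σ-need i) (ℤₚ.≤-trans (ℤₚ.≤-reflexive (sym (Σ-0 {n} {λ v → u i v * 0ℤ} (λ v → ℤₚ.*-zeroʳ (u i v)))))
        (guard-mono (uB i) λ v e → subst (λ s → 0ℤ ≤ ((+ 23 + s# s) - N₂) - rz v) (u-side {i} {v} e) (need≥ (u-seven {i} {v} e))))

      b-high : ∀ i → t# i * need# i - ζ i ≤ t# i * (M - + 39)
      b-high i = subst₂ _≤_ (Σ-need i) (trans (Σ-*ʳ (M - + 39) (u i)) (cong (_* (M - + 39)) (sym (t≡ i))))
        (guard-mono (uB i) λ v e → subst (λ s → ((+ 23 + s# s) - N₂) - rz v ≤ M - + 39) (u-side {i} {v} e) (need≤ (u-seven {i} {v} e)))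

      module _ (i : Fin 9) where

        private
          v′ : Fin n → Fin n → ℤ
          v′ x x′ = u i x′ * (1ℤ - δ x x′)

        minus-self : ∀ x → uB i x ≡ true → ∀ (f : Fin n → ℤ) → sum (λ x′ → v′ x x′ * f x′) ≡ sum (λ x′ → u i x′ * f x′) - f x
        minus-self x ux f = trans (sum-cong-≗ λ x′ → eq (u i x′) (δ x x′) (f x′)) (trans (Σ-- (λ x′ → u i x′ * f x′) (λ x′ → δ x x′ * (u i x′ * f x′)))
          (cong (_-_ (sum (λ x′ → u i x′ * f x′))) (trans (Σ-δ x (λ x′ → u i x′ * f x′)) (trans (cong (λ b → 𝟙 b * f x) ux) (ℤₚ.*-identityˡ (f x))))))
          where
          eq : ∀ p d f → (p * (1ℤ - d)) * f ≡ p * f - d * (p * f)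
          eq = solve-∀

        -- Each of the 7 - `rz x` degree-2 vertices joined to x has one other line, and that line
        -- meets side i in a single vertex.
        both-sum : ∀ x → uB i x ≡ true → sum (λ x′ → v′ x x′ * both x x′) ≤ + 7 - rz x
        both-sum x ux = ℤₚ.≤-trans (Σ-mono le) (ℤₚ.≤-reflexive (trans
            (Σ-swap (λ x′ w → c x′ w) (λ x′ → σ i x′ * (1ℤ - δ x x′)) (λ w → c x w * two w))
            (trans (sum-cong-≗ inner) (trans (sum-cong-≗ (c-two-sq x7)) (trans (c-two x) (cong (_- rz x) (deg7 x7)))))))
          where
          x7 : κ x ≡ five
          x7 = u-seven {i} {x} ux
          eq : ∀ p d k → (p * (1ℤ - d)) * k ≡ k * p - d * (p * k)
          eq = solve-∀
          le : ∀ x′ → v′ x x′ * both x x′ ≤ (σ i x′ * (1ℤ - δ x x′)) * both x x′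
          le x′ = subst₂ _≤_ (ℤₚ.*-comm (both x x′) (v′ x x′)) (ℤₚ.*-comm (both x x′) _) (*-mono-left
            (Σ-nonneg λ w → 0≤* (0≤* (c-nonneg x w) (𝟙-nonneg _)) (c-nonneg x′ w))
            (subst₂ _≤_ (ℤₚ.*-comm (1ℤ - δ x x′) (u i x′)) (ℤₚ.*-comm (1ℤ - δ x x′) (σ i x′))
              (*-mono-left {1ℤ - δ x x′} (diff (𝟙≤1 (does (x ≟ x′)))) (subst₂ _≤_ (sym (u≡ i x′)) (ℤₚ.*-identityʳ (σ i x′)) (*-mono-left {σ i x′} {seven x′} {1ℤ} (𝟙-nonneg (does (i ≟ side x′))) (𝟙≤1 (does (five ≟ κ x′))))))))
          inner : ∀ w → (c x w * two w) * sum (λ x′ → (σ i x′ * (1ℤ - δ x x′)) * c x′ w) ≡ (c x w * two w) * (deg w - c x w)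
          inner w = cong ((c x w * two w) *_) (trans (sum-cong-≗ λ x′ → eq (σ i x′) (δ x x′) (c x′ w))
            (trans (Σ-- (λ x′ → c x′ w * σ i x′) (λ x′ → δ x x′ * (σ i x′ * c x′ w)))
              (cong₂ _-_ (trans (sum-cong-≗ λ x′ → cong (_* σ i x′) (c-sym x′ w)) (c-side w i))
                (trans (Σ-δ x (λ x′ → σ i x′ * c x′ w)) (trans (cong (_* c x w) (trans (cong (δ i) (u-side {i} {x} ux)) (δ-refl i))) (ℤₚ.*-identityˡ (c x w)))))))

        common-sum : ∀ x → uB i x ≡ true →
          (t# i - 1ℤ) * (need# i - rz x) - (ζ i - rz x) - (+ 7 - rz x) ≤ sum (λ x′ → v′ x x′ * common x x′)
        common-sum x ux = ≤-by _ total (diff (both-sum x ux))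
          where
          open ≡-Reasoning
          C : ℤ
          C = need# i - rz x
          at : ∀ x′ → v′ x x′ * common x x′ ≡ (v′ x x′ * C - v′ x x′ * rz x′) - v′ x x′ * both x x′
          at x′ = go (uB i x′) refl (x ≟ x′)
            where
            eq : ∀ p k r b → p * ((k - r) - b) ≡ (p * k - p * r) - p * b
            eq = solve-∀
            go : ∀ b → uB i x′ ≡ b → Dec (x ≡ x′) → v′ x x′ * common x x′ ≡ (v′ x x′ * C - v′ x x′ * rz x′) - v′ x x′ * both x x′
            go false e _ = subst (λ b → (𝟙 b * (1ℤ - δ x x′)) * common x x′ ≡ ((𝟙 b * (1ℤ - δ x x′)) * C - (𝟙 b * (1ℤ - δ x x′)) * rz x′) - (𝟙 b * (1ℤ - δ x x′)) * both x x′) (sym e) refl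
            go true e (yes refl) = subst (λ z → z * common x x ≡ (z * C - z * rz x) - z * both x x)
              (sym (trans (cong (λ d → u i x * (1ℤ - d)) (δ-refl x)) (ℤₚ.*-zeroʳ (u i x)))) refl
            go true e (no ne) = trans (cong (v′ x x′ *_) (trans (common≡ (u-seven {i} {x} ux) (u-seven {i} {x′} e) ne (trans (u-side {i} {x} ux) (sym (u-side {i} {x′} e))))
                (cong (λ s → ((((+ 23 + s# s) - N₂) - rz x) - rz x′) - both x x′) (u-side {i} {x} ux)))) (eq (v′ x x′) C (rz x′) (both x x′))
          total : sum (λ x′ → v′ x x′ * common x x′) - ((t# i - 1ℤ) * (need# i - rz x) - (ζ i - rz x) - (+ 7 - rz x)) ≡ (+ 7 - rz x) - sum (λ x′ → v′ x x′ * both x x′)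
          total = trans (cong (_- ((t# i - 1ℤ) * (need# i - rz x) - (ζ i - rz x) - (+ 7 - rz x)))
              (trans (sum-cong-≗ at) (trans (Σ-- (λ x′ → v′ x x′ * C - v′ x x′ * rz x′) (λ x′ → v′ x x′ * both x x′))
                (cong (_- sum (λ x′ → v′ x x′ * both x x′)) (trans (Σ-- (λ x′ → v′ x x′ * C) (λ x′ → v′ x x′ * rz x′))
                  (cong₂ _-_ (trans (minus-self x ux (λ _ → C)) (cong (_- C) (trans (Σ-*ʳ C (u i)) (cong (_* C) (sym (t≡ i))))))
                    (trans (minus-self x ux rz) (cong (_- rz x) (sym (ζ≡ i)))))))))) (eq (t# i) C (ζ i) (rz x) (sum (λ x′ → v′ x x′ * both x x′)))
            where
            eq : ∀ t C z r B → (((t * C - C) - (z - r)) - B) - (((t - 1ℤ) * C - (z - r)) - (+ 7 - r)) ≡ (+ 7 - r) - B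
            eq = solve-∀

        -- Double counting of triples: an ordered pair of distinct degree-7 vertices on side i and a
        -- vertex w of larger degree than 2 far from both. A fixed w is in j(j - 1) of them.
        quadruple : sum (λ x → u i x * sum (λ x′ → v′ x x′ * common x x′)) ≡ sum (λ w → nt w * (j i w * j i w - j i w))
        quadruple = trans (guard-cong (uB i) λ x ux → trans (Σ-swap (λ x′ w → φ x w * φ x′ w) (v′ x) nt)
            (sum-cong-≗ λ w → cong (nt w *_) (trans (minus-self x ux (λ x′ → φ x w * φ x′ w))
              (cong (_- φ x w * φ x w) (trans (sum-cong-≗ λ x′ → eq (u i x′) (φ x w) (φ x′ w)) (Σ-*ˡ (φ x w) (λ x′ → u i x′ * φ x′ w)))))))
          (trans (Σ-swap (λ x w → φ x w * j i w - φ x w * φ x w) (u i) nt)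
            (sum-cong-≗ λ w → cong (nt w *_) (trans (sum-cong-≗ λ x → trans (cong (λ z → u i x * (φ x w * j i w - z)) (sq x w)) (eq′ (u i x) (φ x w) (j i w)))
              (trans (Σ-- (λ x → (u i x * φ x w) * j i w) (λ x → u i x * φ x w)) (cong (_- j i w) (Σ-*ʳ (j i w) (λ x → u i x * φ x w)))))))
          where
          eq : ∀ p f g → p * (f * g) ≡ f * (p * g)
          eq = solve-∀
          eq′ : ∀ p f j → p * (f * j - f) ≡ (p * f) * j - p * f
          eq′ = solve-∀
          sq : ∀ x w → φ x w * φ x w ≡ φ x w
          sq x w = go (φ-01 x w)
            where
            go : φ x w ≡ 0ℤ ⊎ φ x w ≡ 1ℤ → φ x w * φ x w ≡ φ x w
            go (inj₁ e) = subst (λ z → z * z ≡ z) (sym e) refl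
            go (inj₂ e) = subst (λ z → z * z ≡ z) (sym e) refl

        -- Sums `common≡` over the t(t - 1) ordered pairs: each vertex's `rz` is subtracted 2(t - 1)
        -- times, and `both-sum` costs at most 7t - `ζ i` in all.
        c-agg : (t# i * (t# i - 1ℤ)) * need# i - + 2 * ((t# i - 1ℤ) * ζ i) + ζ i - + 7 * t# i ≤ sum (λ w → nt w * (j i w * j i w - j i w))
        c-agg = subst₂ _≤_ left quadruple (guard-mono (uB i) common-sum)
          where
          k : ℤ
          k = (t# i - 1ℤ) * need# i - ζ i - + 7
          l : ℤ
          l = + 3 - t# i
          left : sum (λ x → u i x * ((t# i - 1ℤ) * (need# i - rz x) - (ζ i - rz x) - (+ 7 - rz x))) ≡ (t# i * (t# i - 1ℤ)) * need# i - + 2 * ((t# i - 1ℤ) * ζ i) + ζ i - + 7 * t# i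
          left = trans (sum-cong-≗ λ x → eq (u i x) (t# i) (need# i) (rz x) (ζ i)) (trans (Σ-+ (λ x → u i x * k) (λ x → (u i x * rz x) * l))
            (trans (cong₂ _+_ (trans (Σ-*ʳ k (u i)) (cong (_* k) (sym (t≡ i)))) (trans (Σ-*ʳ l (λ x → u i x * rz x)) (cong (_* l) (sym (ζ≡ i))))) (eq′ (t# i) (need# i) (ζ i))))
            where
            eq : ∀ p t d r z → p * (((t - 1ℤ) * (d - r) - (z - r)) - (+ 7 - r)) ≡ p * ((t - 1ℤ) * d - z - + 7) + (p * r) * (+ 3 - t)
            eq = solve-∀
            eq′ : ∀ t d z → t * ((t - 1ℤ) * d - z - + 7) + z * (+ 3 - t) ≡ (t * (t - 1ℤ)) * d - + 2 * ((t - 1ℤ) * z) + z - + 7 * t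
            eq′ = solve-∀

      -- The budget supplied by the free lines.

      module Resources (m≥45 : + 45 ≤ + m) where

        -- The number of free lines: every degree-2 vertex spoils two lines, and no line is spoiled
        -- twice.
        e : ℤ
        e = M - + 2 * N₂

        line-sum : ∀ ℓ → sum (λ v → a v ℓ * 1ℤ) ≡ + 9
        line-sum ℓ = trans (sum-cong-≗ λ v → ℤₚ.*-identityʳ (a v ℓ)) (line-size ℓ)

        Σzf : sum zf ≡ e
        Σzf = trans (Σ-- (λ _ → 1ℤ) tw) (cong₂ _-_ (trans (Σ-const m 1ℤ) (ℤₚ.*-identityʳ M)) Σtw)
          where
          go : ∀ i → D i * δ zero i ≡ + 2 * (1ℤ * δ zero i)
          go zero = refl
          go (suc i) = ℤₚ.*-zeroʳ (D (suc i))
          at : ∀ v → deg v * two v ≡ + 2 * (1ℤ * two v)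
          at v = trans (cong (_* two v) (deg≡ v)) (go (κ v))
          Σtw : sum tw ≡ + 2 * N₂
          Σtw = trans (sym (double-count two)) (trans (sum-cong-≗ at) (Σ-*ˡ (+ 2) (λ v → 1ℤ * two v)))

        Σ-rz : ∀ (f : Fin n → ℤ) → sum (λ v → f v * rz v) ≡ sum (λ ℓ → zf ℓ * sum (λ v → a v ℓ * f v))
        Σ-rz f = trans (sum-cong-≗ λ v → cong (f v *_) (sum-cong-≗ λ ℓ → ℤₚ.*-comm (a v ℓ) (zf ℓ)))
          (trans (Σ-swap a f zf) (sum-cong-≗ λ ℓ → cong (zf ℓ *_) (sum-cong-≗ λ v → ℤₚ.*-comm (f v) (a v ℓ))))

        ζ≥0 : ∀ i → 0ℤ ≤ ζ i
        ζ≥0 i = Σ-nonneg λ v → 0≤* (0≤* (σ≥0 i v) (δ≥0 five (κ v))) (rz≥0 v)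

        ζ≤e : ∀ i → ζ i ≤ e
        ζ≤e i = ℤₚ.≤-trans (Σ-mono le) (ℤₚ.≤-reflexive (trans (Σ-rz (σ i))
            (trans (sum-cong-≗ λ ℓ → trans (cong (zf ℓ *_) (one-per-side ℓ i)) (ℤₚ.*-identityʳ (zf ℓ))) Σzf)))
          where
          eq : ∀ s t r → s * r - (s * t) * r ≡ (s * (1ℤ - t)) * r
          eq = solve-∀
          le : ∀ v → (σ i v * seven v) * rz v ≤ σ i v * rz v
          le v = ≤-by _ (eq (σ i v) (seven v) (rz v)) (0≤* (0≤* (σ≥0 i v) (diff (δ≤1 five (κ v)))) (rz≥0 v))

        Σζ : sum ζ ≡ sum (λ ℓ → zf ℓ * lineType ℓ five)
        Σζ = trans (sum-cong-≗ λ i → sum-cong-≗ λ v → ℤₚ.*-assoc (σ i v) (seven v) (rz v))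
          (trans (sym (split-sides (λ v → seven v * rz v))) (Σ-rz seven))

        Σrz : sum rz ≡ e * + 9
        Σrz = trans (sum-cong-≗ λ v → sym (ℤₚ.*-identityˡ (rz v))) (trans (Σ-rz (λ _ → 1ℤ))
          (trans (sum-cong-≗ λ ℓ → cong (zf ℓ *_) (line-sum ℓ)) (trans (Σ-*ʳ (+ 9) zf) (cong (_* + 9) Σzf))))

        -- Ordered pairs of free lines through a common vertex: e(e - 1) pairs of distinct lines
        -- meet once each, and every line meets itself in nine vertices.
        Σrz² : sum (λ v → rz v * rz v) ≡ e * e + + 8 * e
        Σrz² = trans (Σ-rz rz) (trans (sum-cong-≗ λ ℓ → trans (cong (zf ℓ *_) (inner ℓ)) (idem ℓ (zf-01 ℓ)))
            (trans (Σ-*ʳ (e + + 8) zf) (trans (cong (_* (e + + 8)) Σzf) (eq e))))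
          where
          eq : ∀ e → e * (e + + 8) ≡ e * e + + 8 * e
          eq = solve-∀
          eq₁ : ∀ z d → z * (1ℤ + d * (+ 9 - 1ℤ)) ≡ z + d * (z * + 8)
          eq₁ = solve-∀
          inner : ∀ ℓ → sum (λ v → a v ℓ * rz v) ≡ e + zf ℓ * + 8
          inner ℓ = trans (Σ-rz (λ v → a v ℓ)) (trans (sum-cong-≗ λ ℓ′ → trans (cong (zf ℓ′ *_) (trans (sum-cong-≗ λ v → ℤₚ.*-comm (a v ℓ′) (a v ℓ)) (meet ℓ ℓ′)))
            (eq₁ (zf ℓ′) (δ ℓ ℓ′))) (trans (Σ-+ zf (λ ℓ′ → δ ℓ ℓ′ * (zf ℓ′ * + 8))) (cong₂ _+_ Σzf (Σ-δ ℓ (λ ℓ′ → zf ℓ′ * + 8)))))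
          idem : ∀ ℓ → zf ℓ ≡ 0ℤ ⊎ zf ℓ ≡ 1ℤ → zf ℓ * (e + zf ℓ * + 8) ≡ zf ℓ * (e + + 8)
          idem ℓ (inj₁ z) = subst (λ k → k * (e + k * + 8) ≡ k * (e + + 8)) (sym z) refl
          idem ℓ (inj₂ z) = subst (λ k → k * (e + k * + 8) ≡ k * (e + + 8)) (sym z) refl

        rz≤e : ∀ w → rz w ≤ e
        rz≤e w = ℤₚ.≤-trans (Σ-mono le) (ℤₚ.≤-reflexive Σzf)
          where
          eq : ∀ p q → q - p * q ≡ (1ℤ - p) * q
          eq = solve-∀
          le : ∀ ℓ → a w ℓ * zf ℓ ≤ zf ℓ
          le ℓ = ≤-by _ (eq (a w ℓ) (zf ℓ)) (0≤* (diff (𝟙≤1 (inc w ℓ))) (zf≥0 ℓ))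

        -- Nine degrees of at most 7 sum to m ≥ 45, and a degree 2 falls 5 short of 7, so 5s ≤ 63 -
        -- 45 = 18.
        s≤3 : ∀ i → s# i ≤ + 3
        s≤3 i = small (s# i) (≤-by _ (eq M (s# i)) (0≤+ (diff total) (diff m≥45)))
          where
          eq : ∀ M s → + 18 - + 5 * s ≡ (+ 63 - (M + + 5 * s)) + (M - + 45)
          eq = solve-∀
          eq₁ : ∀ s d t → s * (d + + 5 * t) ≡ s * d + + 5 * (s * t)
          eq₁ = solve-∀
          go : ∀ k → D k + + 5 * δ zero k ≤ + 7
          go zero = ℤₚ.≤-refl
          go (suc zero) = ≤ᵇℤ-sound { + 3} { + 7} refl
          go (suc (suc zero)) = ≤ᵇℤ-sound { + 4} { + 7} refl
          go (suc (suc (suc zero))) = ≤ᵇℤ-sound { + 5} { + 7} refl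
          go (suc (suc (suc (suc zero)))) = ≤ᵇℤ-sound { + 6} { + 7} refl
          go (suc (suc (suc (suc (suc zero))))) = ≤ᵇℤ-sound { + 7} { + 7} refl
          total : M + + 5 * s# i ≤ + 63
          total = subst₂ _≤_ (trans (sum-cong-≗ λ v → eq₁ (σ i v) (deg v) (two v)) (trans (Σ-+ (λ v → σ i v * deg v) (λ v → + 5 * (σ i v * two v)))
              (cong₂ _+_ (side-deg i) (Σ-*ˡ (+ 5) (λ v → σ i v * two v))))) (trans (Σ-*ʳ (+ 7) (σ i)) (cong (_* + 7) (size≡9 i)))
            (Σ-mono λ v → *-mono-left {σ i v} (σ≥0 i v) (subst (λ d → d + + 5 * two v ≤ + 7) (sym (deg≡ v)) (go (κ v))))
          small : ∀ s → + 5 * s ≤ + 18 → s ≤ + 3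
          small -[1+ _ ] _ = ℤ.-≤+
          small (+ 0) _ = +≤+ ℕ.z≤n
          small (+ 1) _ = ≤ᵇℤ-sound { + 1} { + 3} refl
          small (+ 2) _ = ≤ᵇℤ-sound { + 2} { + 3} refl
          small (+ 3) _ = ℤₚ.≤-refl
          small (+ suc (suc (suc (suc k)))) p = ⊥-elim (not≤ p (≤-by _ (eq₂ (+ k)) (0≤+ {+ 5 * + k} {1ℤ} (0≤* {+ 5} {+ k} (+≤+ ℕ.z≤n) (+≤+ ℕ.z≤n)) (+≤+ ℕ.z≤n))))
            where
            eq₂ : ∀ k → + 5 * (+ 4 + k) - (+ 18 + 1ℤ) ≡ + 5 * k + 1ℤ
            eq₂ = solve-∀

        c≤1 : ∀ {x w} → x ≢ w → c x w ≤ 1ℤ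
        c≤1 {x} {w} = join-once x w

        φ-side : ∀ {x w} → φ x w ≡ 1ℤ → side x ≢ side w
        φ-side {x} {w} p s with trans (sym p) (φ-same x w s)
        ... | ()

        φ⇒c : ∀ {x w} → φ x w ≡ 1ℤ → c x w ≡ 0ℤ
        φ⇒c {x} {w} p = trans (eq (c x w)) (cong (_-_ 1ℤ) (trans (sym (φ-other x w (φ-side p))) p))
          where
          eq : ∀ c → c ≡ 1ℤ - (1ℤ - c)
          eq = solve-∀

        record TwoFar (i : Fin 9) (w : Fin n) : Set where
          field
            x x′  : Fin n
            x≢x′  : x ≢ x′
            ux    : uB i x ≡ true
            ux′   : uB i x′ ≡ true
            far   : φ x w ≡ 1ℤ
            far′  : φ x′ w ≡ 1ℤ

        -- Otherwise p is joined to both far vertices and to the side-i vertex of ℓ, so its degree is at least 3.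
        two-on-side : ∀ {i w ℓ p} → TwoFar i w → κ w ≢ zero → inc w ℓ ≡ true → inc p ℓ ≡ true → κ p ≡ zero → side p ≡ i
        two-on-side {i} {w} {ℓ} {p} F w≠2 wℓ pℓ p2 = go (side p ≟ i)
          where
          open TwoFar F
          -- A line carries at most 8 - 7 = 1 vertex far from the degree-7 vertex z. On ℓ that
          -- vertex is w, so p, which is not on the side of z, is joined to z.
          seen : ∀ {z} → uB i z ≡ true → φ z w ≡ 1ℤ → side p ≢ i → 1ℤ ≤ c p z
          seen {z} uz fz ne = subst (1ℤ ≤_) (c-sym z p) (≤-by _ (trans (cong (λ f → c z p - f) refl) (eq (c z p))) (diff bound))
            where
            eq : ∀ k → k - 1ℤ ≡ 1ℤ - (1ℤ * 1ℤ + 1ℤ * (1ℤ - k))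
            eq = solve-∀
            line≤1 : sum (λ v → a v ℓ * φ z v) ≤ 1ℤ
            line≤1 = ℤₚ.≤-trans (ℤₚ.≤-reflexive (trans (φ-line z ℓ) (trans (cong (λ d → (1ℤ - a z ℓ) * (+ 8 - d)) (deg7 (u-seven {i} {z} uz))) (eq₁ (a z ℓ)))))
                (≤-by _ (eq₂ (a z ℓ)) (a≥0 ℓ z))
              where
              eq₁ : ∀ p → (1ℤ - p) * (+ 8 - + 7) ≡ 1ℤ - p
              eq₁ = solve-∀
              eq₂ : ∀ p → 1ℤ - (1ℤ - p) ≡ p
              eq₂ = solve-∀
            w≢p : w ≢ p
            w≢p refl = w≠2 p2
            bound : 1ℤ * 1ℤ + 1ℤ * (1ℤ - c z p) ≤ 1ℤ
            bound = ℤₚ.≤-trans (ℤₚ.≤-reflexive (sym (cong₂ _+_ (cong₂ (λ b f → 𝟙 b * f) wℓ fz) (cong₂ (λ b f → 𝟙 b * f) pℓ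
                (φ-other z p (λ s → ne (trans (sym s) (u-side {i} {z} uz))))))))
              (ℤₚ.≤-trans (two-terms (λ v → a v ℓ * φ z v) (λ v → 0≤* (a≥0 ℓ v) (φ-nonneg z v)) w≢p) line≤1)
          go : Dec (side p ≡ i) → side p ≡ i
          go (yes q) = q
          go (no ne) = contra (Σ-pos⇒∃ (λ v → inc v ℓ ∧ does (i ≟ side v))
              (ℤₚ.≤-reflexive (sym (trans (sum-cong-≗ λ v → 𝟙-∧ (inc v ℓ) (does (i ≟ side v))) (one-per-side ℓ i)))))
            where
            contra : (∃ λ y → inc y ℓ ∧ does (i ≟ side y) ≡ true) → side p ≡ i
            contra (y , q) = ⊥-elim (not≤ {+ 3} {+ 2} (ℤₚ.≤-trans (ℤₚ.+-mono-≤ (ℤₚ.+-mono-≤ (lift ux (seen ux far ne)) (lift ux′ (seen ux′ far′ ne)))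
                  (lift′ (sym (does-≡ (∧-right {inc y ℓ} q))) (incident {p} {y} {ℓ} pℓ (∧-left q))))
                (ℤₚ.≤-trans (three-terms (λ v → c p v * σ i v) (λ v → 0≤* (c-nonneg p v) (σ≥0 i v)) x≢x′ (off far) (off far′))
                  (ℤₚ.≤-reflexive (trans (c-side p i) (trans (deg≡ p) (cong D p2)))))) ℤₚ.≤-refl)
              where
              lift′ : ∀ {z} → side z ≡ i → 1ℤ ≤ c p z → 1ℤ ≤ c p z * σ i z
              lift′ {z} s q = subst (1ℤ ≤_) (sym (trans (cong (c p z *_) (δ≡1 (sym s))) (ℤₚ.*-identityʳ (c p z)))) q
              lift : ∀ {z} → uB i z ≡ true → 1ℤ ≤ c p z → 1ℤ ≤ c p z * σ i z
              lift {z} uz = lift′ (u-side {i} {z} uz)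
              off : ∀ {z} → φ z w ≡ 1ℤ → z ≢ y
              off {z} fz refl with ℤₚ.≤-trans (incident {z} {w} {ℓ} (∧-left q) wℓ) (ℤₚ.≤-reflexive (φ⇒c fz))
              ... | +≤+ ()

        two-term≤ : ∀ {i w} → TwoFar i w → κ w ≢ zero → ∀ p → c w p * two p ≤ σ i p * two p
        two-term≤ {i} {w} F w≠2 p = go (zero ≟ κ p) (01-cases-c (w ≟ p))
          where
          01-cases-c : Dec (w ≡ p) → (c w p ≡ 0ℤ ⊎ c w p ≡ 1ℤ) ⊎ w ≡ p
          01-cases-c (yes q) = inj₂ q
          01-cases-c (no q) = inj₁ (01-cases (c-nonneg w p) (c≤1 q))
          go : Dec (zero ≡ κ p) → (c w p ≡ 0ℤ ⊎ c w p ≡ 1ℤ) ⊎ w ≡ p → c w p * two p ≤ σ i p * two p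
          go (no ne) _ = ℤₚ.≤-reflexive (subst (λ t → c w p * t ≡ σ i p * t) (sym (δ-≢ ne)) (trans (ℤₚ.*-zeroʳ (c w p)) (sym (ℤₚ.*-zeroʳ (σ i p)))))
          go (yes q) (inj₂ refl) = ⊥-elim (w≠2 (sym q))
          go (yes q) (inj₁ (inj₁ z)) = subst (λ k → k * two p ≤ σ i p * two p) (sym z) (0≤* (σ≥0 i p) (δ≥0 zero (κ p)))
          go (yes q) (inj₁ (inj₂ z)) = ℤₚ.≤-reflexive (cong (_* two p) (trans z (sym (δ≡1 (sym s)))))
            where
            s : side p ≡ i
            s = let ℓ , wℓ , pℓ = joining {w} {p} (ℤₚ.≤-reflexive (sym z)) in two-on-side {i} {w} {ℓ} {p} F w≠2 wℓ pℓ (sym q)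

        -- The non-free lines through w lead to distinct degree-2 vertices, all on side i by
        -- `two-on-side`, and a side has at most three.
        far⇒rz : ∀ {i w} → TwoFar i w → κ w ≢ zero → deg w - rz w ≤ + 3
        far⇒rz {i} {w} F w≠2 = ℤₚ.≤-trans (ℤₚ.≤-reflexive (sym (c-two w))) (ℤₚ.≤-trans (Σ-mono (two-term≤ F w≠2)) (s≤3 i))

        -- A degree-2 vertex joined to w would have to lie on both sides i and i′, so every line
        -- through w is free.
        far-twice⇒full : ∀ {i i′ w} → i ≢ i′ → TwoFar i w → TwoFar i′ w → κ w ≢ zero → rz w ≡ deg w
        far-twice⇒full {i} {i′} {w} ne F F′ w≠2 = sym (trans (eq (deg w) (rz w)) (trans (cong (_+ rz w) (trans (sym (c-two w)) (Σ-0 null))) (ℤₚ.+-identityˡ (rz w))))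
          where
          eq : ∀ d r → d ≡ (d - r) + r
          eq = solve-∀
          null : ∀ p → c w p * two p ≡ 0ℤ
          null p = go (i ≟ side p)
            where
            by : ∀ k → k ≢ side p → TwoFar k w → c w p * two p ≡ 0ℤ
            by k q G = ℤₚ.≤-antisym (subst (λ s → c w p * two p ≤ s * two p) (δ-≢ q) (two-term≤ G w≠2 p)) (0≤* (c-nonneg w p) (δ≥0 zero (κ p)))
            go : Dec (i ≡ side p) → c w p * two p ≡ 0ℤ
            go (yes q) = by i′ (λ q′ → ne (trans q (sym q′))) F′
            go (no q) = by i q F

        φB : Fin n → Fin n → Bool
        φB x w = 1ℤ ℤ.≤ᵇ φ x w

        φ≡𝟙 : ∀ x w → φ x w ≡ 𝟙 (φB x w)
        φ≡𝟙 x w = go (φ-01 x w)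
          where
          go : φ x w ≡ 0ℤ ⊎ φ x w ≡ 1ℤ → φ x w ≡ 𝟙 (φB x w)
          go (inj₁ q) = subst (λ z → z ≡ 𝟙 (1ℤ ℤ.≤ᵇ z)) (sym q) refl
          go (inj₂ q) = subst (λ z → z ≡ 𝟙 (1ℤ ℤ.≤ᵇ z)) (sym q) refl

        twoFar : ∀ {i w} → + 2 ≤ j i w → TwoFar i w
        twoFar {i} {w} p with Σ-pos⇒2 (λ x → uB i x ∧ φB x w) (subst (+ 2 ≤_)
          (sum-cong-≗ λ x → trans (cong (u i x *_) (φ≡𝟙 x w)) (sym (𝟙-∧ (uB i x) (φB x w)))) p)
        ... | x , x′ , ne , q , q′ = record { x = x ; x′ = x′ ; x≢x′ = ne ; ux = ∧-left q ; ux′ = ∧-left q′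
          ; far = trans (φ≡𝟙 x w) (cong 𝟙 (∧-right {uB i x} q)) ; far′ = trans (φ≡𝟙 x′ w) (cong 𝟙 (∧-right {uB i x′} q′)) }

        j≥0 : ∀ i w → 0ℤ ≤ j i w
        j≥0 i w = Σ-nonneg λ x → 0≤* (𝟙-nonneg (uB i x)) (φ-nonneg x w)

        j≤t : ∀ i w → j i w ≤ t# i
        j≤t i w = subst (j i w ≤_) (sym (t≡ i)) (Σ-mono λ x → ≤-by _ (eq (u i x) (φ x w)) (0≤* (𝟙-nonneg (uB i x)) (φ≤1 x)))
          where
          eq : ∀ p f → p - p * f ≡ p * (1ℤ - f)
          eq = solve-∀
          φ≤1 : ∀ x → 0ℤ ≤ 1ℤ - φ x w
          φ≤1 x = subst (λ z → 0ℤ ≤ 1ℤ - z) (sym (φ≡𝟙 x w)) (diff (𝟙≤1 (φB x w)))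

        -- Incidences of free lines with degree-4 vertices. This stays a variable of the budget, so
        -- the line forms are charged for it locally.
        Z₄ : ℤ
        Z₄ = sum (λ ℓ → zf ℓ * lineType ℓ (suc (suc zero)))

        N-at : ∀ {x} → allVec ≡ x → ∀ k → x $ᵛ k ≡ N k
        N-at refl = look 1≥0

        side9 : ∀ i → Vec.sum (sideVec i) ≡ 9
        side9 i = trans (sideVec-count i) (ℤₚ.+-injective (trans (natSize≡ i) (size≡9 i)))

        -- Away from `star`, a vertex of degree above 2 that is far from two degree-7 vertices of
        -- one side consumes 2 units of ρ. `partial` keeps any such vertex from being charged on two
        -- sides, by `far-twice⇒full`. Starred vertices are accounted for separately by γ.
        module Budget
          (star : Fin n → Bool) (ρ : Fin n → ℤ) (ρ≥0 : ∀ w → 0ℤ ≤ ρ w)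
          (paid : ∀ w → star w ≡ false → κ w ≢ zero → deg w - rz w ≤ + 3 → + 2 ≤ ρ w)
          (partial : ∀ w → star w ≡ false → κ w ≢ zero → rz w ≢ deg w)
          where

          bad : Fin 9 → Fin n → Bool
          bad i w = not (star w) ∧ (not (does (zero ≟ κ w)) ∧ (+ 2 ℤ.≤ᵇ j i w))

          β γ : Fin 9 → ℤ
          β i = sum (λ w → 𝟙 (bad i w))
          γ i = sum (λ w → 𝟙 (star w) * (nt w * (j i w * j i w - j i w)))

          private
            not-true : ∀ {b} → not b ≡ true → b ≡ false
            not-true {false} _ = refl
            ≢-of : ∀ {k} {x y : Fin k} → does (x ≟ y) ≡ false → y ≢ x
            ≢-of q r = true≢false (does-refl (sym r)) q

          bad⇒ : ∀ {i w} → bad i w ≡ true → star w ≡ false × κ w ≢ zero × TwoFar i w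
          bad⇒ {i} {w} p = not-true (∧-left p) , ≢-of (not-true (∧-left (∧-right {not (star w)} p))) ,
            twoFar (≤ᵇℤ-sound {+ 2} {j i w} (∧-right {not (does (zero ≟ κ w))} (∧-right {not (star w)} p)))

          β≥0 : ∀ i → 0ℤ ≤ β i
          β≥0 i = Σ-nonneg λ w → 𝟙-nonneg (bad i w)

          -- A vertex is bad for at most one side, and if it is bad then `far⇒rz` makes `paid`
          -- applicable.
          resource : + 2 * sum β ≤ sum ρ
          resource = ℤₚ.≤-trans (ℤₚ.≤-reflexive (trans (cong (+ 2 *_) (∑-comm (λ i w → 𝟙 (bad i w)))) (sym (Σ-*ˡ (+ 2) (λ w → sum (λ i → 𝟙 (bad i w)))))))
              (Σ-mono λ w → at w (01-cases (Σ-nonneg λ i → 𝟙-nonneg (bad i w)) (Σ-atMostOne (λ i → bad i w) (uniq w))))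
            where
            uniq : ∀ w i i′ → bad i w ≡ true → bad i′ w ≡ true → i ≡ i′
            uniq w i i′ p q = go (i ≟ i′) (bad⇒ {i} {w} p) (bad⇒ {i′} {w} q)
              where
              go : Dec (i ≡ i′) → star w ≡ false × κ w ≢ zero × TwoFar i w → star w ≡ false × κ w ≢ zero × TwoFar i′ w → i ≡ i′
              go (yes r) _ _ = r
              go (no r) (s , k , F) (_ , _ , F′) = ⊥-elim (partial w s k (far-twice⇒full r F F′ k))
            at : ∀ w → sum (λ i → 𝟙 (bad i w)) ≡ 0ℤ ⊎ sum (λ i → 𝟙 (bad i w)) ≡ 1ℤ → + 2 * sum (λ i → 𝟙 (bad i w)) ≤ ρ w
            at w (inj₁ z) = subst (λ k → + 2 * k ≤ ρ w) (sym z) (ρ≥0 w)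
            at w (inj₂ z) = subst (λ k → + 2 * k ≤ ρ w) (sym z) (go (Σ-pos⇒∃ (λ i → bad i w) (ℤₚ.≤-reflexive (sym z))))
              where
              go : (∃ λ i → bad i w ≡ true) → + 2 ≤ ρ w
              go (i , p) = let s , k , F = bad⇒ {i} {w} p in paid w s k (far⇒rz F k)

          -- In `c-agg` a vertex w matters only if j ≥ 2. Then it is bad and contributes at most t²
          -- - t because j ≤ t, or it is starred and belongs to γ.
          c-bound : ∀ i → (t# i * (t# i - 1ℤ)) * need# i - + 2 * ((t# i - 1ℤ) * ζ i) + ζ i - + 7 * t# i ≤ (t# i * t# i - t# i) * β i + γ i
          c-bound i = ℤₚ.≤-trans (c-agg i) (ℤₚ.≤-trans (Σ-mono λ w → at w (star w) refl (does (zero ≟ κ w)) refl (+ 2 ℤ.≤ᵇ j i w) refl)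
              (ℤₚ.≤-reflexive (trans (Σ-+ (λ w → P * 𝟙 (bad i w)) (λ w → 𝟙 (star w) * (nt w * Pr w))) (cong (_+ γ i) (Σ-*ˡ P (λ w → 𝟙 (bad i w)))))))
            where
            P : ℤ
            P = t# i * t# i - t# i
            Pr : Fin n → ℤ
            Pr w = j i w * j i w - j i w
            form : Bool → Bool → Bool → ℤ → Set
            form s k b q = (1ℤ - 𝟙 k) * q ≤ P * 𝟙 (not s ∧ (not k ∧ b)) + 𝟙 s * ((1ℤ - 𝟙 k) * q)
            eq₁ : ∀ P x → x ≡ P * 0ℤ + 1ℤ * x
            eq₁ = solve-∀
            eq₂ : ∀ P x → 0ℤ * x ≡ P * 0ℤ + 0ℤ * (0ℤ * x)
            eq₂ = solve-∀
            eq₃ : ∀ P x → (P * 1ℤ + 0ℤ * (1ℤ * x)) - 1ℤ * x ≡ P - x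
            eq₃ = solve-∀
            at′ : ∀ s k b w → (b ≡ true ⊎ Pr w ≡ 0ℤ) → form s k b (Pr w)
            at′ true k b w _ = ℤₚ.≤-reflexive (eq₁ P ((1ℤ - 𝟙 k) * Pr w))
            at′ false true b w _ = ℤₚ.≤-reflexive (eq₂ P (Pr w))
            at′ false false true w _ = ≤-by _ (eq₃ P (Pr w)) (diff (pronic-mono (j≥0 i w) (j≤t i w)))
            at′ false false false w (inj₂ z) = subst (form false false false) (sym z) (ℤₚ.≤-reflexive (eq₀ P))
              where
              eq₀ : ∀ P → 0ℤ ≡ P * 0ℤ + 0ℤ
              eq₀ = solve-∀
            low : ∀ z → 0ℤ ≤ z → (+ 2 ℤ.≤ᵇ z) ≡ false → z * z - z ≡ 0ℤ
            low (+ 0) _ _ = refl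
            low (+ 1) _ _ = refl
            low (+ suc (suc k)) _ ()
            at : ∀ w s → star w ≡ s → ∀ k → does (zero ≟ κ w) ≡ k → ∀ b → (+ 2 ℤ.≤ᵇ j i w) ≡ b →
              nt w * Pr w ≤ P * 𝟙 (bad i w) + 𝟙 (star w) * (nt w * Pr w)
            at w s es k ek b eb = transport es ek eb (at′ s k b w (which b eb))
              where
              which : ∀ b → (+ 2 ℤ.≤ᵇ j i w) ≡ b → b ≡ true ⊎ Pr w ≡ 0ℤ
              which true _ = inj₁ refl
              which false q = inj₂ (low (j i w) (j≥0 i w) q)
              transport : ∀ {s k b} → star w ≡ s → does (zero ≟ κ w) ≡ k → (+ 2 ℤ.≤ᵇ j i w) ≡ b → form s k b (Pr w) →
                form (star w) (does (zero ≟ κ w)) (+ 2 ℤ.≤ᵇ j i w) (Pr w)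
              transport refl refl refl f = f

          -- The θ₁ terms cancel in total, since Σζ counts the incidences of free lines with
          -- degree-7 vertices either way. The θ₂ terms cost θ₂ (Σβ - `Z₄`), which `resource` bounds
          -- by half of θ₂ times the allowance; therefore the value is doubled.
          filter-sound : ∀ special E x C θ₁ θ₂ → allVec ≡ x → e ≡ + E →
            (∀ i → γ i ≤ starSlack special (t# i) (ζ i)) → (special ≡ true → ∀ i → ζ i ≤ t# i) →
            sum ρ ≤ + 2 * Z₄ + allowance special E x → filterCheck special m E x C θ₁ θ₂ ≡ true → ⊥
          filter-sound special E x C θ₁ θ₂ all≡ e≡ slack≥ ζ≤t ρ≤ ok = contra (ℤₚ.≤-trans positive negative)
            where
            contra : 0ℤ ≤ -[1+ 0 ] → ⊥
            contra ()
            F : Bool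
            F = farCheck C
            far : F ≡ true
            far = ∧-left ok
            P₁ P₂ P₃ : Bool
            P₁ = compositions 6 2 (m ℕ.+ 8) 9 (lineFilter C θ₁ θ₂)
            P₂ = compositions 6 2 m 9 (sideFilter special (+ m) (x $ᵛ zero) E C θ₁ θ₂)
            P₃ = 0ℤ ℤ.≤ᵇ θ₂
            ok₁ : P₁ ≡ true
            ok₁ = ∧-left (∧-right {F} ok)
            ok₂ : P₂ ≡ true
            ok₂ = ∧-left (∧-right {P₁} (∧-right {F} ok))
            θ₂≥0 : 0ℤ ≤ θ₂
            θ₂≥0 = ≤ᵇℤ-sound {0ℤ} {θ₂} (∧-left (∧-right {P₂} (∧-right {P₁} (∧-right {F} ok))))
            negative : + 2 * value C m allVec + θ₂ * allowance special E x ≤ -[1+ 0 ]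
            negative = subst (λ y → + 2 * value C m y + θ₂ * allowance special E x ≤ -[1+ 0 ]) (sym all≡)
              (≤ᵇℤ-sound {+ 2 * value C m x + θ₂ * allowance special E x} (∧-right {P₃} (∧-right {P₂} (∧-right {P₁} (∧-right {F} ok)))))
            zl : Fin m → ℤ
            zl ℓ = zf ℓ * (θ₁ * lineType ℓ five + θ₂ * lineType ℓ (suc (suc zero)))
            zs : Fin 9 → ℤ
            zs i = θ₁ * ζ i + θ₂ * β i
            lines : ∀ ℓ → 0ℤ ≤ onLine C (lineVec ℓ) - zl ℓ
            lines ℓ = subst (λ z → 0ℤ ≤ onLine C (lineVec ℓ) - z) (cong₂ (λ p q → (1ℤ - p) * q) (look (a≥0 ℓ) zero)
                (cong₂ (λ p q → θ₁ * p + θ₂ * q) (look (a≥0 ℓ) five) (look (a≥0 ℓ) (suc (suc zero)))))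
              (≤ᵇℤ-sound {0ℤ} {onLine C (lineVec ℓ) - (1ℤ - (lineVec ℓ $ᵛ zero)) * (θ₁ * (lineVec ℓ $ᵛ five) + θ₂ * (lineVec ℓ $ᵛ (suc (suc zero))))}
                (unguard (≤ᵇ-true (lineVec-twos ℓ)) (compositions-sound 6 2 (m ℕ.+ 8) 9 (lineFilter C θ₁ θ₂) ok₁ (lineVec ℓ) (lineVec-weight ℓ) (lineVec-count ℓ))))
            sides : ∀ i → 0ℤ ≤ onSide C (sideVec i) + zs i
            sides i = go (ℕₚ.≤-total ∣ β i ∣ 9)
              where
              o : ℤ
              o = onSide C (sideVec i)
              cases : sideCases special M N₂ E θ₁ θ₂ o (s# i) (t# i) ≡ true
              cases = subst₂ (λ s t → sideCases special M N₂ E θ₁ θ₂ o s t ≡ true) (look (σ≥0 i) zero) (look (σ≥0 i) five)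
                (subst (λ N → sideCases special M N E θ₁ θ₂ o (sideVec i $ᵛ zero) (sideVec i $ᵛ five) ≡ true) (N-at all≡ zero)
                  (compositions-sound 6 2 m 9 (sideFilter special (+ m) (x $ᵛ zero) E C θ₁ θ₂) ok₂ (sideVec i) (sideVec-weight i) (side9 i)))
              body : ℤ → ℕ → ℤ → Bool
              body z b w = if payable special N₂ (s# i) (t# i) z w ∨ (9 ≤ᵇ b) then 0ℤ ℤ.≤ᵇ o + (θ₁ * z + θ₂ * w) else true
              at-z : ℤ → Bool
              at-z z = if feasible special M N₂ (s# i) (t# i) z then upTo 9 (λ b → body z b (+ b)) else true
              z≡ : + ∣ ζ i ∣ ≡ ζ i
              z≡ = ℤₚ.0≤i⇒+∣i∣≡i (ζ≥0 i)
              b≡ : + ∣ β i ∣ ≡ β i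
              b≡ = ℤₚ.0≤i⇒+∣i∣≡i (β≥0 i)
              at-ζ : at-z (ζ i) ≡ true
              at-ζ = subst (λ z → at-z z ≡ true) z≡ (upTo-sound E (λ z → at-z (+ z)) cases (ℤₚ.drop‿+≤+ (subst₂ _≤_ (sym z≡) e≡ (ζ≤e i))))
              extra : ∀ s → (s ≡ true → ∀ i → ζ i ≤ t# i) → not s ∨ (ζ i ℤ.≤ᵇ t# i) ≡ true
              extra true p = ≤ᵇℤ-true (p refl i)
              extra false p = refl
              inner : upTo 9 (λ b → body (ζ i) b (+ b)) ≡ true
              inner = unguard (∧-intro (≤ᵇℤ-true (b-low i)) (∧-intro (≤ᵇℤ-true (b-high i)) (extra special ζ≤t))) at-ζ
              pay : payable special N₂ (s# i) (t# i) (ζ i) (β i) ≡ true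
              pay = ≤ᵇℤ-true (ℤₚ.≤-trans (c-bound i) (ℤₚ.+-monoʳ-≤ ((t# i * t# i - t# i) * β i) (slack≥ i)))
              go : ∣ β i ∣ ℕ.≤ 9 ⊎ 9 ℕ.≤ ∣ β i ∣ → 0ℤ ≤ o + zs i
              go (inj₁ le) = ≤ᵇℤ-sound {0ℤ} {o + zs i} (unguard (∨-left pay)
                (subst (λ w → body (ζ i) ∣ β i ∣ w ≡ true) b≡ (upTo-sound 9 (λ b → body (ζ i) b (+ b)) inner le)))
              -- For β above 9 the tested case b = 9 suffices, by monotonicity in β.
              go (inj₂ ge) = ℤₚ.≤-trans (≤ᵇℤ-sound {0ℤ} {o + (θ₁ * ζ i + θ₂ * + 9)} (unguard (∨-right (payable special N₂ (s# i) (t# i) (ζ i) (+ 9)) refl)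
                  (upTo-sound 9 (λ b → body (ζ i) b (+ b)) inner {9} ℕₚ.≤-refl)))
                (ℤₚ.+-monoʳ-≤ o (ℤₚ.+-monoʳ-≤ (θ₁ * ζ i) (*-mono-left θ₂≥0 (subst (+ 9 ≤_) b≡ (+≤+ ge)))))
            Σzs : sum zs ≡ θ₁ * sum ζ + θ₂ * sum β
            Σzs = trans (Σ-+ (λ i → θ₁ * ζ i) (λ i → θ₂ * β i)) (cong₂ _+_ (Σ-*ˡ θ₁ ζ) (Σ-*ˡ θ₂ β))
            eq : ∀ z p q θ₁ θ₂ → z * (θ₁ * p + θ₂ * q) ≡ θ₁ * (z * p) + θ₂ * (z * q)
            eq = solve-∀
            Σzl : sum zl ≡ θ₁ * sum ζ + θ₂ * Z₄
            Σzl = trans (sum-cong-≗ λ ℓ → eq (zf ℓ) (lineType ℓ five) (lineType ℓ (suc (suc zero))) θ₁ θ₂)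
              (trans (Σ-+ (λ ℓ → θ₁ * (zf ℓ * lineType ℓ five)) (λ ℓ → θ₂ * (zf ℓ * lineType ℓ (suc (suc zero)))))
                (cong₂ _+_ (trans (Σ-*ˡ θ₁ (λ ℓ → zf ℓ * lineType ℓ five)) (cong (θ₁ *_) (sym Σζ))) (Σ-*ˡ θ₂ (λ ℓ → zf ℓ * lineType ℓ (suc (suc zero))))))
            V A′ : ℤ
            V = value C m allVec
            A′ = allowance special E x
            bound : 0ℤ ≤ V + ((θ₁ * sum ζ + θ₂ * sum β) - (θ₁ * sum ζ + θ₂ * Z₄))
            bound = value-bound C far zl zs ((θ₁ * sum ζ + θ₂ * sum β) - (θ₁ * sum ζ + θ₂ * Z₄)) lines sides (ℤₚ.≤-reflexive (cong₂ _-_ Σzs Σzl))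
            positive : 0ℤ ≤ + 2 * V + θ₂ * A′
            positive = ℤₚ.≤-trans (0≤+ (0≤* {+ 2} (+≤+ ℕ.z≤n) bound) (0≤* θ₂≥0 (diff (ℤₚ.≤-trans resource ρ≤))))
              (ℤₚ.≤-reflexive (eq₁ V (θ₁ * sum ζ) θ₂ (sum β) Z₄ A′))
              where
              eq₁ : ∀ V z θ b q a → + 2 * (V + ((z + θ * b) - (z + θ * q))) + θ * ((+ 2 * q + a) - + 2 * b) ≡ + 2 * V + θ * a
              eq₁ = solve-∀

        three four : Fin n → ℤ
        three v = δ (suc zero) (κ v)
        four v = δ (suc (suc zero)) (κ v)

        D≥2 : ∀ k → + 2 ≤ D k
        D≥2 k = +≤+ (ℕ.s≤s (ℕ.s≤s ℕ.z≤n))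

        -- With fewer free lines than the degree of any vertex of degree above 2, no such vertex has
        -- only free lines, so nothing needs to be starred.
        generic-filter : ∀ E x C θ₁ θ₂ → allVec ≡ x → e ≡ + E → (∀ w → κ w ≢ zero → e + 1ℤ ≤ deg w) →
          filterCheck false m E x C θ₁ θ₂ ≡ true → ⊥
        generic-filter E x C θ₁ θ₂ all≡ e≡ e<deg = Budget.filter-sound (λ _ → false) ρ ρ≥0 paid partial false E x C θ₁ θ₂ all≡ e≡
            (λ i → ℤₚ.≤-reflexive (Σ-0 {n} {λ w → 0ℤ * (nt w * (j i w * j i w - j i w))} (λ w → refl))) (λ ()) (ℤₚ.≤-reflexive Σρ)
          where
          -- Chosen to be at least 2 whenever d - r ≤ 3: the first term pays for d = 3; for d = 4
          -- there is a free line and the second term pays; for d = 5, 6, 7 there are at least 2, 3,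
          -- 4 free lines and r² - r is at least 2, 6, 12.
          ρ′ : ℤ → ℤ → ℤ → ℤ
          ρ′ p q r = (+ 2 * p + + 2 * (q * r)) + (r * r - r)
          ρ : Fin n → ℤ
          ρ w = ρ′ (three w) (four w) (rz w)
          ρ≥0 : ∀ w → 0ℤ ≤ ρ w
          ρ≥0 w = 0≤+ (0≤+ (0≤* {+ 2} (+≤+ ℕ.z≤n) (δ≥0 (suc zero) (κ w))) (0≤* {+ 2} (+≤+ ℕ.z≤n) (0≤* (δ≥0 (suc (suc zero)) (κ w)) (rz≥0 w)))) (0≤pronic (rz≥0 w))
          pay : ∀ k r → k ≢ zero → 0ℤ ≤ r → D k - r ≤ + 3 → + 2 ≤ ρ′ (δ (suc zero) k) (δ (suc (suc zero)) k) r
          pay zero r ne p q = ⊥-elim (ne refl)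
          pay (suc zero) r ne p q = ≤-by _ (eq r) (0≤pronic p)
            where
            eq : ∀ r → ((+ 2 * 1ℤ + + 2 * (0ℤ * r)) + (r * r - r)) - + 2 ≡ r * r - r
            eq = solve-∀
          pay (suc (suc zero)) r ne p q = ≤-by _ (eq r) (0≤+ (0≤* {+ 2} (+≤+ ℕ.z≤n) (diff q)) (0≤pronic p))
            where
            eq : ∀ r → ((+ 2 * 0ℤ + + 2 * (1ℤ * r)) + (r * r - r)) - + 2 ≡ + 2 * (+ 3 - (+ 4 - r)) + (r * r - r)
            eq = solve-∀
          pay (suc (suc (suc zero))) r ne p q = ≤-by _ (eq r) (0≤+ (0≤* (diff q) (diff q)) (0≤* {+ 3} (+≤+ ℕ.z≤n) (diff q)))
            where
            eq : ∀ r → ((+ 2 * 0ℤ + + 2 * (0ℤ * r)) + (r * r - r)) - + 2 ≡ (+ 3 - (+ 5 - r)) * (+ 3 - (+ 5 - r)) + + 3 * (+ 3 - (+ 5 - r))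
            eq = solve-∀
          pay (suc (suc (suc (suc zero)))) r ne p q = ≤-by _ (eq r) (0≤+ (0≤+ (0≤* (diff q) (diff q)) (0≤* {+ 5} (+≤+ ℕ.z≤n) (diff q))) (+≤+ {0} {4} ℕ.z≤n))
            where
            eq : ∀ r → ((+ 2 * 0ℤ + + 2 * (0ℤ * r)) + (r * r - r)) - + 2 ≡ ((+ 3 - (+ 6 - r)) * (+ 3 - (+ 6 - r)) + + 5 * (+ 3 - (+ 6 - r))) + + 4
            eq = solve-∀
          pay (suc (suc (suc (suc (suc zero))))) r ne p q = ≤-by _ (eq r) (0≤+ (0≤+ (0≤* (diff q) (diff q)) (0≤* {+ 7} (+≤+ ℕ.z≤n) (diff q))) (+≤+ {0} {10} ℕ.z≤n))
            where
            eq : ∀ r → ((+ 2 * 0ℤ + + 2 * (0ℤ * r)) + (r * r - r)) - + 2 ≡ ((+ 3 - (+ 7 - r)) * (+ 3 - (+ 7 - r)) + + 7 * (+ 3 - (+ 7 - r))) + + 10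
            eq = solve-∀
          paid : ∀ w → false ≡ false → κ w ≢ zero → deg w - rz w ≤ + 3 → + 2 ≤ ρ w
          paid w _ ne q = pay (κ w) (rz w) ne (rz≥0 w) (subst (λ d → d - rz w ≤ + 3) (deg≡ w) q)
          partial : ∀ w → false ≡ false → κ w ≢ zero → rz w ≢ deg w
          partial w _ ne q = not≤ (rz≤e w) (subst (e + 1ℤ ≤_) (sym q) (e<deg w ne))
          Σρ : sum ρ ≡ + 2 * Z₄ + allowance false E x
          Σρ = trans (Σ-+ (λ w → + 2 * three w + + 2 * (four w * rz w)) (λ w → rz w * rz w - rz w))
            (trans (cong₂ _+_ (trans (Σ-+ (λ w → + 2 * three w) (λ w → + 2 * (four w * rz w)))
                (cong₂ _+_ (trans (Σ-*ˡ (+ 2) three) (cong (+ 2 *_) (trans (sum-cong-≗ λ w → sym (ℤₚ.*-identityˡ (three w))) (sym (N-at all≡ (suc zero))))))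
                  (trans (Σ-*ˡ (+ 2) (λ w → four w * rz w)) (cong (+ 2 *_) (Σ-rz four)))))
              (trans (Σ-- (λ w → rz w * rz w) rz) (trans (cong₂ _-_ Σrz² Σrz) (trans (eq₁ e) (cong (λ z → z * z - z) e≡)))))
              (eq₂ (x $ᵛ (suc zero)) Z₄ (+ E * + E - + E)))
            where
            eq₁ : ∀ e → (e * e + + 8 * e) - e * + 9 ≡ e * e - e
            eq₁ = solve-∀
            eq₂ : ∀ p q r → (+ 2 * p + + 2 * q) + r ≡ + 2 * q + (+ 2 * p + r)
            eq₂ = solve-∀

        line-at : ∀ ℓ k → + lookup (lineVec ℓ) k ≡ lineType ℓ k
        line-at ℓ k = trans (sym (lookup-map k (λ x → + x) (lineVec ℓ))) (look (a≥0 ℓ) k)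

        on-line : ∀ P → compositions 6 2 (m ℕ.+ 8) 9 P ≡ true → ∀ ℓ → P (lineVec ℓ) ≡ true
        on-line P ok ℓ = compositions-sound 6 2 (m ℕ.+ 8) 9 P ok (lineVec ℓ) (lineVec-weight ℓ) (lineVec-count ℓ)

        line-has : ∀ {w ℓ} k → inc w ℓ ≡ true → κ w ≡ k → 1ℤ ≤ lineType ℓ k
        line-has {w} {ℓ} k wℓ e = subst (_≤ lineType ℓ k) (cong₂ (λ b d → 𝟙 b * d) wℓ (δ≡1 (sym e)))
          (term≤Σ (λ v → a v ℓ * δ k (κ v)) (λ v → 0≤* (a≥0 ℓ v) (δ≥0 k (κ v))) w)

        φ≤1-c : ∀ {x w} → x ≢ w → φ x w ≤ 1ℤ - c x w
        φ≤1-c {x} {w} ne = go (side x ≟ side w)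
          where
          go : Dec (side x ≡ side w) → φ x w ≤ 1ℤ - c x w
          go (yes q) = subst₂ (λ f k → f ≤ 1ℤ - k) (sym (φ-same x w q)) (sym (apart x w ne q)) (+≤+ ℕ.z≤n)
          go (no q) = ℤₚ.≤-reflexive (φ-other x w q)

        -- If no line carries both a degree 2 and a degree 3, all three lines through a degree-3
        -- vertex are free. This is what makes such vertices exceptional.
        module Threes (no23 : compositions 6 2 (m ℕ.+ 8) 9 noTwoThree ≡ true) where

          three-zf : ∀ {w ℓ} → κ w ≡ suc zero → inc w ℓ ≡ true → zf ℓ ≡ 1ℤ
          three-zf {w} {ℓ} e wℓ = go (∨-split (lookup (lineVec ℓ) zero ≤ᵇ 0) (unguard (≤ᵇ-true (lineVec-twos ℓ)) (on-line noTwoThree no23 ℓ)))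
            where
            null : ∀ k → (lookup (lineVec ℓ) k ≤ᵇ 0) ≡ true → lineType ℓ k ≡ 0ℤ
            null k q = trans (sym (line-at ℓ k)) (cong +_ (ℕₚ.n≤0⇒n≡0 (≤ᵇ-sound q)))
            go : (lookup (lineVec ℓ) zero ≤ᵇ 0) ≡ true ⊎ (lookup (lineVec ℓ) (suc zero) ≤ᵇ 0) ≡ true → zf ℓ ≡ 1ℤ
            go (inj₁ q) = cong (_-_ 1ℤ) (null zero q)
            go (inj₂ q) with ℤₚ.≤-trans (line-has {w} {ℓ} (suc zero) wℓ e) (ℤₚ.≤-reflexive (null (suc zero) q))
            ... | +≤+ ()

          three-full : ∀ {w} → κ w ≡ suc zero → rz w ≡ + 3
          three-full {w} e = trans (sum-cong-≗ λ ℓ → at ℓ (inc w ℓ) refl) (trans (deg≡ w) (cong D e))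
            where
            at : ∀ ℓ b → inc w ℓ ≡ b → 𝟙 b * zf ℓ ≡ 𝟙 (inc w ℓ)
            at ℓ true q = trans (ℤₚ.*-identityˡ (zf ℓ)) (trans (three-zf {w} {ℓ} e q) (cong 𝟙 (sym q)))
            at ℓ false q = cong 𝟙 (sym q)

        module Exceptional (no23 : compositions 6 2 (m ℕ.+ 8) 9 noTwoThree ≡ true) where

          open Threes no23

          private
            three-only : ∀ {w z} → κ w ≡ suc zero → κ z ≡ suc zero → N (suc zero) ≡ 1ℤ → w ≡ z
            three-only {w} {z} p q N≡1 = go (w ≟ z)
              where
              go : Dec (w ≡ z) → w ≡ z
              go (yes r) = r
              go (no r) = ⊥-elim (not≤ {+ 2} {1ℤ} (ℤₚ.≤-trans (ℤₚ.≤-reflexive (sym (cong₂ (λ b d → 1ℤ * b + 1ℤ * d) (δ≡1 (sym p)) (δ≡1 (sym q)))))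
                (ℤₚ.≤-trans (two-terms (λ v → 1ℤ * three v) (λ v → 0≤* {1ℤ} (+≤+ ℕ.z≤n) (δ≥0 (suc zero) (κ v))) r) (ℤₚ.≤-reflexive N≡1))) ℤₚ.≤-refl)

          -- With e = 3 the unique vertex of degree 3 lies on every line without a vertex of degree 2.
          starred-filter : ∀ x C θ₁ θ₂ → allVec ≡ x → e ≡ + 3 → N (suc zero) ≡ 1ℤ → ∀ w* → κ w* ≡ suc zero →
            filterCheck true m 3 x C θ₁ θ₂ ≡ true → ⊥
          starred-filter x C θ₁ θ₂ all≡ e≡ N≡1 w* k* = Budget.filter-sound star ρ ρ≥0 paid partial true 3 x C θ₁ θ₂ all≡ e≡ γ≤ (λ _ → ζ≤t) (ℤₚ.≤-reflexive Σρ)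
            where
            zf≤1 : ∀ ℓ → 0ℤ ≤ 1ℤ - zf ℓ
            zf≤1 ℓ = go (zf-01 ℓ)
              where
              go : zf ℓ ≡ 0ℤ ⊎ zf ℓ ≡ 1ℤ → 0ℤ ≤ 1ℤ - zf ℓ
              go (inj₁ q) = subst (λ z → 0ℤ ≤ 1ℤ - z) (sym q) (+≤+ ℕ.z≤n)
              go (inj₂ q) = subst (λ z → 0ℤ ≤ 1ℤ - z) (sym q) (+≤+ ℕ.z≤n)
            zf≤ : ∀ ℓ → zf ℓ ≤ a w* ℓ
            zf≤ ℓ = ≤-by _ (eq (zf ℓ) (a w* ℓ)) (0≤+ (diff (ℤₚ.≤-trans (term≤Σ f f≥0 ℓ) (ℤₚ.≤-reflexive none))) (0≤* (𝟙-nonneg (inc w* ℓ)) (zf≤1 ℓ)))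
              where
              f : Fin m → ℤ
              f ℓ = zf ℓ - a w* ℓ * zf ℓ
              eq : ∀ z p → p - z ≡ (0ℤ - (z - p * z)) + p * (1ℤ - z)
              eq = solve-∀
              eq₁ : ∀ z p → z - p * z ≡ (1ℤ - p) * z
              eq₁ = solve-∀
              f≥0 : ∀ ℓ → 0ℤ ≤ f ℓ
              f≥0 ℓ = subst (0ℤ ≤_) (sym (eq₁ (zf ℓ) (a w* ℓ))) (0≤* (diff (𝟙≤1 (inc w* ℓ))) (zf≥0 ℓ))
              none : sum f ≡ 0ℤ
              none = trans (Σ-- zf (λ ℓ → a w* ℓ * zf ℓ)) (cong₂ _-_ (trans Σzf e≡) (three-full k*))
            rz≤c : ∀ w → rz w ≤ c w w*
            rz≤c w = Σ-mono λ ℓ → *-mono-left {a w ℓ} (a≥0 ℓ w) (zf≤ ℓ)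
            rz≤1 : ∀ {w} → w ≢ w* → rz w ≤ 1ℤ
            rz≤1 {w} ne = ℤₚ.≤-trans (rz≤c w) (c≤1 ne)
            star : Fin n → Bool
            star w = does (w* ≟ w)
            unstarred : ∀ {w} → star w ≡ false → w ≢ w*
            unstarred q refl = true≢false (does-refl {x = w*} refl) q
            -- Any other vertex shares at most one line with `w*`, hence has at most one free line.
            -- So a bad vertex has degree 4 and exactly one free line, and the other terms of the
            -- generic budget are unnecessary.
            ρ : Fin n → ℤ
            ρ w = + 2 * (four w * rz w)
            ρ≥0 : ∀ w → 0ℤ ≤ ρ w
            ρ≥0 w = 0≤* {+ 2} (+≤+ ℕ.z≤n) (0≤* (δ≥0 (suc (suc zero)) (κ w)) (rz≥0 w))
            big : ∀ r d → r ≤ 1ℤ → + 5 ≤ d → d - r ≤ + 3 → ⊥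
            big r d p q s = not≤ {d} {r + + 3} (≤-by _ (eq d r) (diff s)) (ℤₚ.≤-trans (≤-by _ (eq₁ r) (diff p)) q)
              where
              eq : ∀ d r → (r + + 3) - d ≡ + 3 - (d - r)
              eq = solve-∀
              eq₁ : ∀ r → + 5 - ((r + + 3) + 1ℤ) ≡ 1ℤ - r
              eq₁ = solve-∀
            pay : ∀ k r → k ≢ zero → k ≢ suc zero → r ≤ 1ℤ → D k - r ≤ + 3 → + 2 ≤ + 2 * (δ (suc (suc zero)) k * r)
            pay zero r ne _ _ _ = ⊥-elim (ne refl)
            pay (suc zero) r _ ne _ _ = ⊥-elim (ne refl)
            pay (suc (suc zero)) r _ _ _ q = ≤-by _ (eq r) (0≤* {+ 2} (+≤+ ℕ.z≤n) (diff q))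
              where
              eq : ∀ r → + 2 * (1ℤ * r) - + 2 ≡ + 2 * (+ 3 - (+ 4 - r))
              eq = solve-∀
            pay (suc (suc (suc k))) r _ _ p q = ⊥-elim (big r (D (suc (suc (suc k)))) p (+≤+ (ℕ.s≤s (ℕ.s≤s (ℕ.s≤s (ℕ.s≤s (ℕ.s≤s ℕ.z≤n)))))) q)
            paid : ∀ w → star w ≡ false → κ w ≢ zero → deg w - rz w ≤ + 3 → + 2 ≤ ρ w
            paid w s ne q = pay (κ w) (rz w) ne (λ k → unstarred s (three-only k k* N≡1)) (rz≤1 (unstarred s)) (subst (λ d → d - rz w ≤ + 3) (deg≡ w) q)
            partial : ∀ w → star w ≡ false → κ w ≢ zero → rz w ≢ deg w
            partial w s _ q = not≤ {+ 2} {1ℤ} (ℤₚ.≤-trans (subst (+ 2 ≤_) (sym (deg≡ w)) (D≥2 (κ w))) (subst (_≤ 1ℤ) q (rz≤1 (unstarred s)))) ℤₚ.≤-refl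
            off : ∀ {i x} → uB i x ≡ true → x ≢ w*
            off {i} {x} ux refl with trans (sym (u-seven {i} {x} ux)) k*
            ... | ()
            Σu-rz : ∀ i → sum (λ x → u i x * (1ℤ - rz x)) ≡ t# i - ζ i
            Σu-rz i = trans (sum-cong-≗ λ x → eq (u i x) (rz x)) (trans (Σ-- (u i) (λ x → u i x * rz x)) (cong₂ _-_ (sym (t≡ i)) (sym (ζ≡ i))))
              where
              eq : ∀ p r → p * (1ℤ - r) ≡ p - p * r
              eq = solve-∀
            -- A degree-7 vertex on a free line is joined to `w*` and so not far from it; on side i
            -- that removes `ζ i` candidates.
            j≤ : ∀ i → j i w* ≤ t# i - ζ i
            j≤ i = subst (j i w* ≤_) (Σu-rz i) (guard-mono (uB i) {f = λ x → φ x w*} {g = λ x → 1ℤ - rz x} λ x ux →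
              ℤₚ.≤-trans (φ≤1-c (off {i} ux)) (≤-by _ (eq (rz x) (c x w*)) (diff (rz≤c x))))
              where
              eq : ∀ r c → (1ℤ - r) - (1ℤ - c) ≡ c - r
              eq = solve-∀
            ζ≤t : ∀ i → ζ i ≤ t# i
            ζ≤t i = ℤₚ.0≤i-j⇒j≤i (ℤₚ.≤-trans (j≥0 i w*) (j≤ i))
            γ≤ : ∀ i → Budget.γ star ρ ρ≥0 paid partial i ≤ starSlack true (t# i) (ζ i)
            γ≤ i = ℤₚ.≤-trans (ℤₚ.≤-reflexive (trans (Σ-δ w* (λ w → nt w * (j i w * j i w - j i w)))
              (trans (cong (λ k → (1ℤ - δ zero k) * (j i w* * j i w* - j i w*)) k*) (ℤₚ.*-identityˡ (j i w* * j i w* - j i w*)))))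
              (pronic-mono (j≥0 i w*) (j≤ i))
            Σρ : sum ρ ≡ + 2 * Z₄ + 0ℤ
            Σρ = trans (Σ-*ˡ (+ 2) (λ w → four w * rz w)) (trans (cong (+ 2 *_) (Σ-rz four)) (sym (ℤₚ.+-identityʳ (+ 2 * Z₄))))

          -- With e = 5 the two vertices of degree 3 are joined by a line, which carries at least 7 vertices of degree 7.
          -- Each vertex of degree 7 off that line is far from at most one of them, but both are far from many.
          two-threes : N (suc zero) ≡ + 2 → N five ≡ + 43 → e ≡ + 5 → compositions 6 2 (m ℕ.+ 8) 9 pencil ≡ true →
            compositions 6 2 m 9 fewSevens ≡ true → ∀ {w w′} → w ≢ w′ → κ w ≡ suc zero → κ w′ ≡ suc zero → ⊥
          two-threes N₃≡2 N₇≡43 e≡5 pencil-ok few-ok {w} {w′} ne k k′ = go (joining {w} {w′} joined)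
            where
            pointwise : ∀ ℓ b b′ → inc w ℓ ≡ b → inc w′ ℓ ≡ b′ → (𝟙 b + 𝟙 b′) - 𝟙 b * 𝟙 b′ ≤ zf ℓ
            pointwise ℓ true true p q = ℤₚ.≤-reflexive (sym (three-zf {w} {ℓ} k p))
            pointwise ℓ true false p q = ℤₚ.≤-reflexive (sym (three-zf {w} {ℓ} k p))
            pointwise ℓ false true p q = ℤₚ.≤-reflexive (sym (three-zf {w′} {ℓ} k′ q))
            pointwise ℓ false false p q = zf≥0 ℓ
            three-deg : ∀ {v} → κ v ≡ suc zero → deg v ≡ + 3
            three-deg {v} e = trans (deg≡ v) (cong D e)
            -- The lines through w and w′ are all free, and 3 + 3 of them fit among five only if one
            -- is shared.
            joined : 1ℤ ≤ c w w′
            joined = ≤-by _ (eq (c w w′)) (diff (subst₂ _≤_ left (trans Σzf e≡5) (Σ-mono λ ℓ → pointwise ℓ (inc w ℓ) (inc w′ ℓ) refl refl)))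
              where
              eq : ∀ c → c - 1ℤ ≡ + 5 - ((+ 3 + + 3) - c)
              eq = solve-∀
              left : sum (λ ℓ → (a w ℓ + a w′ ℓ) - a w ℓ * a w′ ℓ) ≡ (+ 3 + + 3) - c w w′
              left = trans (Σ-- (λ ℓ → a w ℓ + a w′ ℓ) (λ ℓ → a w ℓ * a w′ ℓ)) (cong (_- c w w′) (trans (Σ-+ (a w) (a w′)) (cong₂ _+_ (three-deg k) (three-deg k′))))
            at-line : ∀ ℓ → ((lookup (lineVec ℓ) (suc zero) ≤ᵇ 0) ∨ (lookup (lineVec ℓ) five ≤ᵇ 5 ℕ.+ lookup (lineVec ℓ) (suc zero))) ∧
              ((lookup (lineVec ℓ) (suc zero) ≤ᵇ 1) ∨ (7 ≤ᵇ lookup (lineVec ℓ) five)) ≡ true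
            at-line ℓ = unguard (≤ᵇ-true (lineVec-twos ℓ)) (on-line pencil pencil-ok ℓ)
            at-most : ∀ ℓ b → (lookup (lineVec ℓ) (suc zero) ≤ᵇ b) ≡ true → lineType ℓ (suc zero) ≤ + b
            at-most ℓ b q = subst (_≤ + b) (line-at ℓ (suc zero)) (+≤+ (≤ᵇ-sound q))
            sevens≤ : ∀ {v ℓ} → κ v ≡ suc zero → inc v ℓ ≡ true → lineType ℓ five ≤ + 5 + lineType ℓ (suc zero)
            sevens≤ {v} {ℓ} kv vℓ = go (∨-split (lookup (lineVec ℓ) (suc zero) ≤ᵇ 0) (∧-left (at-line ℓ)))
              where
              go : (lookup (lineVec ℓ) (suc zero) ≤ᵇ 0) ≡ true ⊎ (lookup (lineVec ℓ) five ≤ᵇ 5 ℕ.+ lookup (lineVec ℓ) (suc zero)) ≡ true →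
                lineType ℓ five ≤ + 5 + lineType ℓ (suc zero)
              go (inj₁ q) = ⊥-elim (not≤ {1ℤ} {0ℤ} (ℤₚ.≤-trans (line-has {v} {ℓ} (suc zero) vℓ kv) (at-most ℓ 0 q)) ℤₚ.≤-refl)
              go (inj₂ q) = subst₂ _≤_ (line-at ℓ five) (trans (ℤₚ.pos-+ 5 (lookup (lineVec ℓ) (suc zero))) (cong (_+_ (+ 5)) (line-at ℓ (suc zero)))) (+≤+ (≤ᵇ-sound q))
            few : ∀ i → t# i ≤ + 5
            few i = subst (_≤ + 5) (trans (sym (lookup-map five (λ x → + x) (sideVec i))) (look (σ≥0 i) five))
              (+≤+ (≤ᵇ-sound (compositions-sound 6 2 m 9 fewSevens few-ok (sideVec i) (sideVec-weight i) (side9 i))))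
            -- 19 = 3 · 5 + 4: each of the three lines has at most 5 degree-7 vertices plus its
            -- number of degree-3 vertices, and v is counted three times among those, the other one
            -- at most once.
            collinear : ∀ {v} → κ v ≡ suc zero → sum (λ x → c v x * seven x) ≤ + 19
            collinear {v} kv = ℤₚ.≤-trans (ℤₚ.≤-reflexive (c-sum v seven)) (ℤₚ.≤-trans (Σ-mono λ ℓ → at ℓ (inc v ℓ) refl)
                (ℤₚ.≤-trans (ℤₚ.≤-reflexive (trans (sum-cong-≗ λ ℓ → eq (a v ℓ) (lineType ℓ (suc zero))) (trans (Σ-+ (λ ℓ → a v ℓ * + 5) (λ ℓ → a v ℓ * lineType ℓ (suc zero)))
                  (cong₂ _+_ (trans (Σ-*ʳ (+ 5) (a v)) (cong (_* + 5) (three-deg kv))) (sym (c-sum v three)))))) (ℤₚ.+-monoʳ-≤ (+ 15) threes)))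
              where
              eq : ∀ p q → p * (+ 5 + q) ≡ p * + 5 + p * q
              eq = solve-∀
              at : ∀ ℓ b → inc v ℓ ≡ b → 𝟙 b * lineType ℓ five ≤ 𝟙 b * (+ 5 + lineType ℓ (suc zero))
              at ℓ true q = *-mono-left {1ℤ} (+≤+ ℕ.z≤n) (sevens≤ {v} {ℓ} kv q)
              at ℓ false q = ℤₚ.≤-refl
              threes : sum (λ x → c v x * three x) ≤ + 4
              threes = ℤₚ.≤-trans (Σ-mono λ x → subst₂ _≤_ (ℤₚ.*-comm (three x) (c v x)) (eq₁ (three x) (δ v x)) (*-mono-left {three x} (δ≥0 (suc zero) (κ x)) (bound x (v ≟ x))))
                  (ℤₚ.≤-reflexive (trans (Σ-+ (λ x → 1ℤ * three x) (λ x → δ v x * (+ 2 * three x))) (cong₂ _+_ N₃≡2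
                    (trans (Σ-δ v (λ x → + 2 * three x)) (cong (λ z → + 2 * z) (δ≡1 (sym kv)))))))
                where
                eq₁ : ∀ t d → t * (1ℤ + d * + 2) ≡ 1ℤ * t + d * (+ 2 * t)
                eq₁ = solve-∀
                bound : ∀ x → Dec (v ≡ x) → c v x ≤ 1ℤ + δ v x * + 2
                bound x (yes refl) = ℤₚ.≤-reflexive (trans (c-diag v) (trans (three-deg kv) (cong (λ d → 1ℤ + d * + 2) (sym (δ-refl v)))))
                bound x (no q) = subst (λ d → c v x ≤ 1ℤ + d * + 2) (sym (δ-≢ q)) (c≤1 q)
            -- Of the 43 vertices of degree 7, at most 5 are on the side of v and at most 19 are
            -- joined to it.
            far≥ : ∀ {v} → κ v ≡ suc zero → + 19 ≤ sum (λ x → seven x * φ x v)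
            far≥ {v} kv = subst (+ 19 ≤_) (sym (trans (sum-cong-≗ λ x → trans (ℤₚ.*-comm (seven x) (φ x v)) (cong (_* seven x) (φ-sym x v))) (φ-sum v seven)))
                (≤-by _ (trans (cong₂ (λ p q → (((p - sum (λ x → σ (side v) x * seven x)) - sum (λ x → c v x * seven x)) + deg v * q) - + 19)
                    (trans (sum-cong-≗ λ x → sym (ℤₚ.*-identityˡ (seven x))) N₇≡43) (cong (δ five) kv)) (eq (t# (side v)) (sum (λ x → c v x * seven x)) (deg v)))
                  (0≤+ (diff (few (side v))) (diff (collinear kv))))
              where
              eq : ∀ t k d → (((+ 43 - t) - k) + d * 0ℤ) - + 19 ≡ (+ 5 - t) + (+ 19 - k)
              eq = solve-∀
            go : (∃ λ ℓ → inc w ℓ ≡ true × inc w′ ℓ ≡ true) → ⊥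
            -- 19 + 19 = 38 far pairs are required, but the at most 43 - 7 = 36 degree-7 vertices
            -- off ℓ supply one each, because ℓ has a single vertex far from such a vertex.
            go (ℓ , wℓ , w′ℓ) = not≤ {+ 38} {+ 36} (ℤₚ.≤-trans lower (ℤₚ.≤-trans upper upper≤)) (+≤+ (ℕₚ.m≤m+n 37 1))
              where
              two≤ : + 2 ≤ lineType ℓ (suc zero)
              two≤ = ℤₚ.≤-trans (ℤₚ.≤-reflexive (sym (cong₂ _+_ (cong₂ (λ b d → 𝟙 b * d) wℓ (δ≡1 (sym k))) (cong₂ (λ b d → 𝟙 b * d) w′ℓ (δ≡1 (sym k′))))))
                (two-terms (λ v → a v ℓ * three v) (λ v → 0≤* (a≥0 ℓ v) (δ≥0 (suc zero) (κ v))) ne)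
              seven≤ : + 7 ≤ lineType ℓ five
              seven≤ = from (∨-split (lookup (lineVec ℓ) (suc zero) ≤ᵇ 1) (∧-right {(lookup (lineVec ℓ) (suc zero) ≤ᵇ 0) ∨ (lookup (lineVec ℓ) five ≤ᵇ 5 ℕ.+ lookup (lineVec ℓ) (suc zero))} (at-line ℓ)))
                where
                from : (lookup (lineVec ℓ) (suc zero) ≤ᵇ 1) ≡ true ⊎ (7 ≤ᵇ lookup (lineVec ℓ) five) ≡ true → + 7 ≤ lineType ℓ five
                from (inj₁ q) = ⊥-elim (not≤ {+ 2} {1ℤ} (ℤₚ.≤-trans two≤ (at-most ℓ 1 q)) ℤₚ.≤-refl)
                from (inj₂ q) = subst (+ 7 ≤_) (line-at ℓ five) (+≤+ (≤ᵇ-sound q))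
              isSeven : Fin n → Bool
              isSeven x = does (five ≟ κ x)
              lower : + 38 ≤ sum (λ x → seven x * (φ x w + φ x w′))
              lower = ℤₚ.≤-trans (ℤₚ.+-mono-≤ (far≥ k) (far≥ k′)) (ℤₚ.≤-reflexive (sym (trans (sum-cong-≗ λ x → ℤₚ.*-distribˡ-+ (seven x) (φ x w) (φ x w′))
                (Σ-+ (λ x → seven x * φ x w) (λ x → seven x * φ x w′)))))
              upper : sum (λ x → seven x * (φ x w + φ x w′)) ≤ sum (λ x → seven x * (1ℤ - a x ℓ))
              upper = guard-mono isSeven {f = λ x → φ x w + φ x w′} {g = λ x → 1ℤ - a x ℓ} λ x e →
                ℤₚ.≤-trans (ℤₚ.≤-reflexive (sym (trans (cong₂ (λ b d → 𝟙 b * φ x w + 𝟙 d * φ x w′) wℓ w′ℓ) (cong₂ _+_ (ℤₚ.*-identityˡ (φ x w)) (ℤₚ.*-identityˡ (φ x w′))))))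
                  (ℤₚ.≤-trans (two-terms (λ v → a v ℓ * φ x v) (λ v → 0≤* (a≥0 ℓ v) (φ-nonneg x v)) ne)
                    (ℤₚ.≤-reflexive (trans (φ-line x ℓ) (trans (cong (λ d → (1ℤ - a x ℓ) * (+ 8 - d)) (deg7 {x} (sym (does-≡ e)))) (ℤₚ.*-identityʳ (1ℤ - a x ℓ))))))
              upper≤ : sum (λ x → seven x * (1ℤ - a x ℓ)) ≤ + 36
              upper≤ = ℤₚ.≤-trans (ℤₚ.≤-reflexive (trans (sum-cong-≗ λ x → eq (seven x) (a x ℓ)) (trans (Σ-- (λ x → 1ℤ * seven x) (λ x → a x ℓ * seven x)) (cong (_- lineType ℓ five) N₇≡43))))
                (≤-by _ (eq₁ (lineType ℓ five)) (diff seven≤))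
                where
                eq : ∀ s p → s * (1ℤ - p) ≡ 1ℤ * s - p * s
                eq = solve-∀
                eq₁ : ∀ x → + 36 - (+ 43 - x) ≡ x - + 7
                eq₁ = solve-∀

    order : ∀ {x} → allVec ≡ x → Vec.sum x ≡ 81 → + n ≡ + 81
    order refl s = cong +_ (trans (sym (type-count {λ _ → 1ℤ} 1≥0 (trans (Σ-const n 1ℤ) (ℤₚ.*-identityʳ (+ n))))) s)

    N-lookup : ∀ {x} → allVec ≡ x → ∀ k → N k ≡ + lookup x k
    N-lookup {x} refl k = trans (sym (look 1≥0 k)) (lookup-map k (λ x → + x) x)

    free≡ : ∀ {x E} → allVec ≡ x → m ≡ E ℕ.+ 2 ℕ.* lookup x zero → M - + 2 * N zero ≡ + E
    free≡ {x} {E} all≡ m≡ = trans (cong₂ (λ p q → p - + 2 * q) (trans (cong +_ m≡) (trans (ℤₚ.pos-+ E (2 ℕ.* lookup x zero)) (cong (_+_ (+ E)) (ℤₚ.pos-* 2 (lookup x zero)))))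
        (N-lookup all≡ zero)) (eq (+ E) (+ lookup x zero))
      where
      eq : ∀ E t → (E + + 2 * t) - + 2 * t ≡ E
      eq = solve-∀

    entry-sound : ∀ E → allVec ≡ distribution E → entryCheck m E ≡ true → ⊥
    entry-sound E all≡ ok = Far.Resources.generic-filter n≡81 (+≤+ (≤ᵇ-sound (∧-left ok))) (free E) (distribution E) (certificate E) (θ₁ E) (θ₂ E) all≡ e≡ (λ w ne → spread w ne (∨-split (free E ≤ᵇ 2) (∧-left ok₄)))
        (∧-right {(free E ≤ᵇ 2) ∨ ((free E ≤ᵇ 3) ∧ (lookup (distribution E) (suc zero) ≤ᵇ 0))} ok₄)
      where
      ok₂ = ∧-right {45 ≤ᵇ m} ok
      ok₃ = ∧-right {Vec.sum (distribution E) ≡ᵇ 81} ok₂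
      ok₄ = ∧-right {m ≡ᵇ free E ℕ.+ 2 ℕ.* lookup (distribution E) zero} ok₃
      n≡81 : + n ≡ + 81
      n≡81 = order all≡ (≡ᵇ-sound (Vec.sum (distribution E)) 81 (∧-left ok₂))
      e : ℤ
      e = M - + 2 * N zero
      e≡ : e ≡ + free E
      e≡ = free≡ all≡ (≡ᵇ-sound m (free E ℕ.+ 2 ℕ.* lookup (distribution E) zero) (∧-left ok₃))
      spread : ∀ w → κ w ≢ zero → (free E ≤ᵇ 2) ≡ true ⊎ ((free E ≤ᵇ 3) ∧ (lookup (distribution E) (suc zero) ≤ᵇ 0)) ≡ true → e + 1ℤ ≤ deg w
      spread w ne = subst₂ (λ f d → (free E ≤ᵇ 2) ≡ true ⊎ ((free E ≤ᵇ 3) ∧ (lookup (distribution E) (suc zero) ≤ᵇ 0)) ≡ true → f + 1ℤ ≤ d) (sym e≡) (sym (deg≡ w)) (go (κ w) refl)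
        where
        up : ∀ f b c → f ℕ.≤ b → suc b ℕ.≤ c → + f + 1ℤ ≤ + c
        up f b c p q = +≤+ (subst (ℕ._≤ c) (ℕₚ.+-comm 1 f) (ℕₚ.≤-trans (ℕ.s≤s p) q))
        go : ∀ k → κ w ≡ k → (free E ≤ᵇ 2) ≡ true ⊎ ((free E ≤ᵇ 3) ∧ (lookup (distribution E) (suc zero) ≤ᵇ 0)) ≡ true → + free E + 1ℤ ≤ D k
        go zero q _ = ⊥-elim (ne q)
        go (suc k) q (inj₁ p) = up (free E) 2 (2 ℕ.+ suc (toℕ k)) (≤ᵇ-sound p) (ℕ.s≤s (ℕ.s≤s (ℕ.s≤s ℕ.z≤n)))
        go (suc zero) q (inj₂ p) = ⊥-elim (not≤ {1ℤ} {0ℤ} (ℤₚ.≤-trans (ℤₚ.≤-reflexive (sym (trans (ℤₚ.*-identityˡ (δ (suc zero) (κ w))) (δ≡1 (sym q)))))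
          (ℤₚ.≤-trans (term≤Σ (λ v → 1ℤ * δ (suc zero) (κ v)) (λ v → 0≤* {1ℤ} (+≤+ ℕ.z≤n) (δ≥0 (suc zero) (κ v))) w)
            (ℤₚ.≤-trans (ℤₚ.≤-reflexive (N-lookup all≡ (suc zero))) (+≤+ (≤ᵇ-sound (∧-right {free E ≤ᵇ 3} p)))))) ℤₚ.≤-refl)
        go (suc (suc k)) q (inj₂ p) = up (free E) 3 (2 ℕ.+ suc (suc (toℕ k))) (≤ᵇ-sound (∧-left p)) (ℕ.s≤s (ℕ.s≤s (ℕ.s≤s (ℕ.s≤s ℕ.z≤n))))

    Sevens : Set
    Sevens = 1 ℕ.≤ #deg five

    entries-sound : ∀ Es → every (entryCheck m) Es ≡ true → ∀ {x} → x ∈ List.map distribution Es → allVec ≡ x → ⊥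
    entries-sound Es ok x∈ all≡ = let E , E∈ , x≡ = ∈-map⁻ distribution x∈ in entry-sound E (trans all≡ x≡) (every-∈ (entryCheck m) Es ok E∈)

    plan-sound : ∀ Cs Es → check m Cs (List.map distribution Es) ≡ true → every (entryCheck m) Es ≡ true → Sevens →
      base₁ m (dead m Cs (List.map distribution Es)) ℕ.+ 82 ℕ.* m ≡ m ℕ.* m ℕ.+ 1701 →
      base₂ m (dead m Cs (List.map distribution Es)) ℕ.+ 73 ℕ.* m ≡ m ℕ.* m ℕ.+ 1458 → ⊥
    plan-sound Cs Es ok oks seven b₁ b₂ = let x , x∈ , same = search-sound Cs (List.map distribution Es) ok seven b₁ b₂ in
      entries-sound Es oks x∈ (sameVec-sound allVec x same)

    private
      sum-N : ∀ k → sum (λ v → 𝟙 (does (k ≟ κ v))) ≡ N k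
      sum-N k = sum-cong-≗ λ v → sym (ℤₚ.*-identityˡ (δ k (κ v)))

    starred-sound : ∀ E → allVec ≡ distribution E → + n ≡ + 81 → + 45 ≤ M → m ≡ 3 ℕ.+ 2 ℕ.* lookup (distribution E) zero → lookup (distribution E) (suc zero) ≡ 1 →
      compositions 6 2 (m ℕ.+ 8) 9 noTwoThree ≡ true → filterCheck true m 3 (distribution E) (certificate E) (θ₁ E) (θ₂ E) ≡ true → ⊥
    starred-sound E all≡ n≡ m≥ m≡ one ok₁ ok₂ = go (Σ-pos⇒∃ (λ v → does (suc zero ≟ κ v)) (ℤₚ.≤-reflexive (sym (trans (sum-N (suc zero)) N≡))))
      where
      N≡ : N (suc zero) ≡ 1ℤ
      N≡ = trans (N-lookup all≡ (suc zero)) (cong +_ one)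
      go : (∃ λ w → does (suc zero ≟ κ w) ≡ true) → ⊥
      go (w , q) = Far.Resources.Exceptional.starred-filter n≡ m≥ ok₁ (distribution E) (certificate E) (θ₁ E) (θ₂ E) all≡ (free≡ all≡ m≡) N≡ w (sym (does-≡ q)) ok₂

    two-threes-sound : ∀ x → allVec ≡ x → + n ≡ + 81 → + 45 ≤ M → m ≡ 5 ℕ.+ 2 ℕ.* lookup x zero → lookup x (suc zero) ≡ 2 → lookup x five ≡ 43 →
      compositions 6 2 (m ℕ.+ 8) 9 noTwoThree ≡ true → compositions 6 2 (m ℕ.+ 8) 9 pencil ≡ true → compositions 6 2 m 9 fewSevens ≡ true → ⊥
    two-threes-sound x all≡ n≡ m≥ m≡ two seven ok₁ ok₂ ok₃ = go (Σ-pos⇒2 (λ v → does (suc zero ≟ κ v)) (ℤₚ.≤-reflexive (sym (trans (sum-N (suc zero)) N≡))))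
      where
      N≡ : N (suc zero) ≡ + 2
      N≡ = trans (N-lookup all≡ (suc zero)) (cong +_ two)
      go : (∃ λ w → ∃ λ w′ → w ≢ w′ × does (suc zero ≟ κ w) ≡ true × does (suc zero ≟ κ w′) ≡ true) → ⊥
      go (w , w′ , ne , q , q′) = Far.Resources.Exceptional.two-threes n≡ m≥ ok₁ N≡ (trans (N-lookup all≡ five) (cong +_ seven)) (free≡ all≡ m≡) ok₂ ok₃ ne (sym (does-≡ q)) (sym (does-≡ q′))

    -- At least 16 vertices are far from a vertex of degree 7, and each has degree at least 2, while
    -- their degrees sum to m - 7.
    39≤m : Sevens → 39 ℕ.≤ m
    39≤m p = go (Σ-pos⇒∃ (λ v → does (five ≟ κ v)) (subst (1ℤ ≤_) (trans (#deg≡ five) (sym (sum-N five))) (+≤+ p)))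
      where
      eq : ∀ m → m - + 39 ≡ ((+ 8 - + 7) * (m - + 7) - + 2 * + 16)
      eq = solve-∀
      go : (∃ λ x → does (five ≟ κ x) ≡ true) → 39 ℕ.≤ m
      go (x , q) = ℤₚ.drop‿+≤+ (≤-by _ (eq M) (diff (ℤₚ.≤-trans low (ℤₚ.≤-trans mid (ℤₚ.≤-reflexive (trans (φ-deg x) (cong (λ d → (+ 8 - d) * (M - d)) d7)))))))
        where
        d7 : deg x ≡ + 7
        d7 = trans (deg≡ x) (cong D (sym (does-≡ q)))
        low : + 2 * + 16 ≤ + 2 * sum (φ x)
        low = *-mono-left {+ 2} (+≤+ ℕ.z≤n) (subst (λ d → + 72 - + 8 * d ≤ sum (φ x)) d7 (φ-count≥ x))
        mid : + 2 * sum (φ x) ≤ sum (λ w → φ x w * deg w)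
        mid = subst (_≤ sum (λ w → φ x w * deg w)) (Σ-*ˡ (+ 2) (φ x)) (Σ-mono λ w → subst (_≤ φ x w * deg w) (ℤₚ.*-comm (φ x w) (+ 2))
          (*-mono-left (φ-nonneg x w) (subst (+ 2 ≤_) (sym (deg≡ w)) (+≤+ (ℕ.s≤s (ℕ.s≤s ℕ.z≤n))))))

    -- Sums (d - 3)(d - 7) ≤ 5 [d = 2] over all vertices.
    m<52 : ∀ k → m ≡ 52 ℕ.+ k → ⊥
    m<52 k m≡ = contra (ℤₚ.≤-trans bound (ℤₚ.≤-trans (ℤₚ.≤-reflexive (trans (cong F (trans (cong +_ m≡) (ℤₚ.pos-+ 52 k))) (eq (+ k)))) neg))
      where
      F : ℤ → ℤ
      F m = + 5 * m - + 2 * ((m * ((m + + 9) - 1ℤ) - + 10 * (+ 9 * m)) + + 21 * + 81)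
      eq : ∀ k → + 5 * (+ 52 + k) - + 2 * (((+ 52 + k) * (((+ 52 + k) + + 9) - 1ℤ) - + 10 * (+ 9 * (+ 52 + k))) + + 21 * + 81) ≡ -[1+ 0 ] - ((+ 2 * (k * k) + + 39 * k) + + 21)
      eq = solve-∀
      neg : -[1+ 0 ] - ((+ 2 * (+ k * + k) + + 39 * + k) + + 21) ≤ -[1+ 0 ]
      neg = ≤-by _ (eq′ ((+ 2 * (+ k * + k) + + 39 * + k) + + 21)) (0≤+ (0≤+ (0≤* {+ 2} (+≤+ ℕ.z≤n) (0≤* {+ k} {+ k} (+≤+ ℕ.z≤n) (+≤+ ℕ.z≤n))) (0≤* {+ 39} {+ k} (+≤+ ℕ.z≤n) (+≤+ ℕ.z≤n))) (+≤+ {0} {21} ℕ.z≤n))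
        where
        eq′ : ∀ x → -[1+ 0 ] - (-[1+ 0 ] - x) ≡ x
        eq′ = solve-∀
      contra : 0ℤ ≤ -[1+ 0 ] → ⊥
      contra ()
      h : Fin 6 → ℤ
      h i = + 5 * δ zero i - ((D i * D i - + 10 * D i) + + 21)
      h≥0 : ∀ i → 0ℤ ≤ h i
      h≥0 zero = ≤ᵇℤ-sound {0ℤ} {0ℤ} refl
      h≥0 (suc zero) = ≤ᵇℤ-sound {0ℤ} {0ℤ} refl
      h≥0 (suc (suc zero)) = ≤ᵇℤ-sound {0ℤ} {+ 3} refl
      h≥0 (suc (suc (suc zero))) = ≤ᵇℤ-sound {0ℤ} {+ 4} refl
      h≥0 (suc (suc (suc (suc zero)))) = ≤ᵇℤ-sound {0ℤ} {+ 3} refl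
      h≥0 (suc (suc (suc (suc (suc zero))))) = ≤ᵇℤ-sound {0ℤ} {0ℤ} refl
      total : sum (λ v → h (κ v)) ≡ + 5 * N zero - ((M * ((M + + 9) - 1ℤ) - + 10 * (+ 9 * M)) + + 21 * + n)
      total = trans (sum-cong-≗ λ v → cong (λ d → + 5 * δ zero (κ v) - ((d * d - + 10 * d) + + 21)) (sym (deg≡ v)))
        (trans (Σ-- (λ v → + 5 * δ zero (κ v)) (λ v → (deg v * deg v - + 10 * deg v) + + 21))
          (cong₂ _-_ (trans (Σ-*ˡ (+ 5) (λ v → δ zero (κ v))) (cong (+ 5 *_) (sum-N zero)))
            (trans (Σ-+ (λ v → deg v * deg v - + 10 * deg v) (λ _ → + 21)) (cong₂ _+_
              (trans (Σ-- (λ v → deg v * deg v) (λ v → + 10 * deg v)) (cong₂ _-_ Σdeg² (trans (Σ-*ˡ (+ 10) deg) (cong (+ 10 *_) Σdeg))))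
              (trans (Σ-const n (+ 21)) (ℤₚ.*-comm (+ n) (+ 21)))))))
      twos : + 2 * N zero ≤ M
      twos = subst (_≤ M) (trans (ℤₚ.pos-* 2 (#deg zero)) (cong (+ 2 *_) (#deg≡ zero))) (+≤+ twos≤)
      bound : 0ℤ ≤ F M
      bound = subst (0ℤ ≤_) (eq″ (N zero) M (+ n) (M * ((M + + 9) - 1ℤ) - + 10 * (+ 9 * M))) (0≤+ (0≤+ (0≤* {+ 2} (+≤+ ℕ.z≤n) (subst (0ℤ ≤_) total (Σ-nonneg λ v → h≥0 (κ v))))
        (0≤* {+ 42} (+≤+ ℕ.z≤n) (diff n≥81))) (0≤* {+ 5} (+≤+ ℕ.z≤n) (diff twos)))
        where
        eq″ : ∀ N m n q → (+ 2 * (+ 5 * N - (q + + 21 * n)) + + 42 * (n - + 81)) + + 5 * (m - + 2 * N) ≡ + 5 * m - + 2 * (q + + 21 * + 81)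
        eq″ = solve-∀

-- Certificate data and its verification for each m from 39 to 51.

module Tables where
  open LinearSpaces
  open NineSides
  open Checkers
  open DegreeDistributions
  open import Data.Bool.Base using (true)
  open import Data.Nat.Base as ℕ using (ℕ; suc)
  open import Data.Integer.Base using (ℤ; +_; _+_; _-_; -_; _≤_; +≤+)
  import Data.Integer.Properties as ℤₚ
  open import Data.Fin.Base using (suc)
  open import Data.List.Base as List using (List; []; _∷_)
  open import Data.List.Membership.Propositional using (_∈_)
  open import Data.List.Relation.Unary.Any using (here; there)
  open import Data.Vec.Base using (Vec; []; _∷_)
  open import Data.Product.Base using (∃; _×_; _,_)
  open import Data.Empty using (⊥)
  open import Relation.Binary.PropositionalEquality
  open import Algebra.Properties.Semiring.Sum ℤₚ.+-*-semiring using (sum; sum-cong-≗; ∑-comm)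

  infix 9 ⁻_

  ⁻_ : ℕ → ℤ
  ⁻ n = - (+ n)

  -- No property of the integers in these tables is assumed: the proofs named `check` and `filter`
  -- evaluate everything that is required of them.
  certs39 : List Certificate
  certs39 =
    mk 12 ((+ 4 ∷ + 7 ∷ + 8 ∷ + 1 ∷ ⁻ 1 ∷ + 1 ∷ []) ∷ (+ 7 ∷ + 12 ∷ + 14 ∷ ⁻ 1 ∷ + 0 ∷ ⁻ 1 ∷ []) ∷ (+ 8 ∷ + 14 ∷ + 16 ∷ ⁻ 1 ∷ ⁻ 1 ∷ ⁻ 1 ∷ []) ∷ (+ 1 ∷ ⁻ 1 ∷ ⁻ 1 ∷ + 0 ∷ + 0 ∷ + 2 ∷ []) ∷ (⁻ 1 ∷ + 0 ∷ ⁻ 1 ∷ + 0 ∷ ⁻ 1 ∷ + 6 ∷ []) ∷ (+ 1 ∷ ⁻ 1 ∷ ⁻ 1 ∷ + 2 ∷ + 6 ∷ ⁻ 1 ∷ []) ∷ [])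
      (⁻ 1 ∷ ⁻ 2 ∷ ⁻ 2 ∷ + 9 ∷ + 4 ∷ + 10 ∷ []) (+ 0 ∷ + 0 ∷ + 0 ∷ ⁻ 14 ∷ + 0 ∷ ⁻ 14 ∷ [])
      (⁻ 32 ∷ ⁻ 19 ∷ + 21 ∷ + 3 ∷ + 15 ∷ ⁻ 5 ∷ []) (⁻ 17) (+ 1 ∷ ⁻ 15 ∷ ⁻ 19 ∷ + 7 ∷ + 2 ∷ ⁻ 6 ∷ []) (⁻ 33) ∷
    mk 10 ((+ 4 ∷ + 7 ∷ + 13 ∷ + 1 ∷ + 1 ∷ + 1 ∷ []) ∷ (+ 7 ∷ + 12 ∷ + 19 ∷ ⁻ 1 ∷ + 1 ∷ ⁻ 1 ∷ []) ∷ (+ 13 ∷ + 19 ∷ + 26 ∷ ⁻ 1 ∷ + 0 ∷ ⁻ 1 ∷ []) ∷ (+ 1 ∷ ⁻ 1 ∷ ⁻ 1 ∷ + 0 ∷ + 2 ∷ + 11 ∷ []) ∷ (+ 1 ∷ + 1 ∷ + 0 ∷ + 2 ∷ + 15 ∷ ⁻ 2 ∷ []) ∷ (+ 1 ∷ ⁻ 1 ∷ ⁻ 1 ∷ + 11 ∷ ⁻ 2 ∷ ⁻ 1 ∷ []) ∷ [])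
      (⁻ 1 ∷ ⁻ 2 ∷ ⁻ 2 ∷ + 9 ∷ + 6 ∷ + 10 ∷ []) (+ 0 ∷ + 0 ∷ ⁻ 5 ∷ ⁻ 14 ∷ ⁻ 7 ∷ ⁻ 14 ∷ [])
      (⁻ 32 ∷ ⁻ 19 ∷ ⁻ 32 ∷ ⁻ 4 ∷ ⁻ 19 ∷ ⁻ 5 ∷ []) (⁻ 26) (⁻ 9 ∷ ⁻ 16 ∷ ⁻ 29 ∷ + 10 ∷ ⁻ 21 ∷ ⁻ 6 ∷ []) (⁻ 64) ∷
    mk 10 ((+ 4 ∷ + 7 ∷ + 8 ∷ + 3 ∷ + 2 ∷ + 3 ∷ []) ∷ (+ 7 ∷ + 12 ∷ + 14 ∷ + 7 ∷ + 4 ∷ + 1 ∷ []) ∷ (+ 8 ∷ + 14 ∷ + 16 ∷ + 6 ∷ + 0 ∷ ⁻ 1 ∷ []) ∷ (+ 3 ∷ + 7 ∷ + 6 ∷ + 3 ∷ ⁻ 1 ∷ ⁻ 1 ∷ []) ∷ (+ 2 ∷ + 4 ∷ + 0 ∷ ⁻ 1 ∷ + 13 ∷ ⁻ 2 ∷ []) ∷ (+ 3 ∷ + 1 ∷ ⁻ 1 ∷ ⁻ 1 ∷ ⁻ 2 ∷ ⁻ 1 ∷ []) ∷ [])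
      (⁻ 1 ∷ ⁻ 2 ∷ ⁻ 2 ∷ + 1 ∷ + 4 ∷ + 9 ∷ []) (+ 0 ∷ + 0 ∷ + 0 ∷ + 0 ∷ ⁻ 4 ∷ ⁻ 14 ∷ [])
      (⁻ 32 ∷ ⁻ 19 ∷ + 27 ∷ ⁻ 7 ∷ + 58 ∷ ⁻ 5 ∷ []) (⁻ 77) (+ 5 ∷ ⁻ 16 ∷ ⁻ 19 ∷ + 4 ∷ ⁻ 19 ∷ ⁻ 6 ∷ []) (⁻ 169) ∷
    mk 10 ((+ 4 ∷ + 7 ∷ + 8 ∷ + 7 ∷ + 2 ∷ + 1 ∷ []) ∷ (+ 7 ∷ + 12 ∷ + 14 ∷ + 13 ∷ + 6 ∷ ⁻ 1 ∷ []) ∷ (+ 8 ∷ + 14 ∷ + 16 ∷ + 14 ∷ + 4 ∷ ⁻ 1 ∷ []) ∷ (+ 7 ∷ + 13 ∷ + 14 ∷ + 10 ∷ ⁻ 1 ∷ ⁻ 1 ∷ []) ∷ (+ 2 ∷ + 6 ∷ + 4 ∷ ⁻ 1 ∷ + 3 ∷ ⁻ 1 ∷ []) ∷ (+ 1 ∷ ⁻ 1 ∷ ⁻ 1 ∷ ⁻ 1 ∷ ⁻ 1 ∷ + 1 ∷ []) ∷ [])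
      (⁻ 1 ∷ ⁻ 2 ∷ ⁻ 2 ∷ ⁻ 1 ∷ + 2 ∷ + 10 ∷ []) (+ 0 ∷ + 0 ∷ + 0 ∷ + 0 ∷ + 0 ∷ ⁻ 14 ∷ [])
      (⁻ 32 ∷ ⁻ 19 ∷ ⁻ 15 ∷ ⁻ 14 ∷ ⁻ 7 ∷ ⁻ 7 ∷ []) (⁻ 53) (⁻ 9 ∷ ⁻ 16 ∷ ⁻ 19 ∷ ⁻ 14 ∷ + 3 ∷ ⁻ 8 ∷ []) (⁻ 88) ∷
    mk 9 ((+ 150 ∷ + 64 ∷ + 33 ∷ + 36 ∷ ⁻ 12 ∷ ⁻ 12 ∷ []) ∷ (+ 64 ∷ + 37 ∷ + 33 ∷ + 26 ∷ + 42 ∷ ⁻ 10 ∷ []) ∷ (+ 33 ∷ + 33 ∷ + 24 ∷ + 14 ∷ + 21 ∷ ⁻ 12 ∷ []) ∷ (+ 36 ∷ + 26 ∷ + 14 ∷ ⁻ 7 ∷ + 32 ∷ + 80 ∷ []) ∷ (⁻ 12 ∷ + 42 ∷ + 21 ∷ + 32 ∷ ⁻ 6 ∷ + 0 ∷ []) ∷ (⁻ 12 ∷ ⁻ 10 ∷ ⁻ 12 ∷ + 80 ∷ + 0 ∷ + 58 ∷ []) ∷ [])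
      (+ 24 ∷ ⁻ 6 ∷ ⁻ 3 ∷ + 2 ∷ + 3 ∷ + 84 ∷ []) (⁻ 123 ∷ + 0 ∷ + 0 ∷ + 0 ∷ ⁻ 15 ∷ ⁻ 200 ∷ [])
      (⁻ 452 ∷ ⁻ 137 ∷ + 44 ∷ ⁻ 43 ∷ + 99 ∷ ⁻ 138 ∷ []) (⁻ 404) (⁻ 250 ∷ ⁻ 104 ∷ ⁻ 74 ∷ ⁻ 50 ∷ ⁻ 74 ∷ ⁻ 158 ∷ []) (⁻ 396) ∷
    []

  certs40 : List Certificate
  certs40 =
    mk 12 ((+ 4 ∷ + 7 ∷ + 0 ∷ + 9 ∷ + 2 ∷ + 1 ∷ []) ∷ (+ 7 ∷ + 12 ∷ + 0 ∷ + 16 ∷ + 0 ∷ ⁻ 1 ∷ []) ∷ (+ 0 ∷ + 0 ∷ + 0 ∷ ⁻ 1 ∷ ⁻ 1 ∷ + 7 ∷ []) ∷ (+ 9 ∷ + 16 ∷ ⁻ 1 ∷ + 20 ∷ ⁻ 1 ∷ ⁻ 1 ∷ []) ∷ (+ 2 ∷ + 0 ∷ ⁻ 1 ∷ ⁻ 1 ∷ + 63 ∷ ⁻ 2 ∷ []) ∷ (+ 1 ∷ ⁻ 1 ∷ + 7 ∷ ⁻ 1 ∷ ⁻ 2 ∷ ⁻ 1 ∷ []) ∷ [])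
      (⁻ 1 ∷ ⁻ 2 ∷ + 3 ∷ ⁻ 2 ∷ + 8 ∷ + 10 ∷ []) (+ 0 ∷ + 0 ∷ + 0 ∷ + 0 ∷ ⁻ 12 ∷ ⁻ 14 ∷ [])
      (⁻ 32 ∷ ⁻ 21 ∷ ⁻ 6 ∷ + 17 ∷ ⁻ 67 ∷ ⁻ 5 ∷ []) (⁻ 29) (⁻ 1 ∷ ⁻ 15 ∷ + 8 ∷ ⁻ 24 ∷ ⁻ 69 ∷ ⁻ 6 ∷ []) (⁻ 34) ∷
    mk 11 ((+ 4 ∷ + 9 ∷ + 10 ∷ + 5 ∷ ⁻ 1 ∷ ⁻ 1 ∷ []) ∷ (+ 9 ∷ + 18 ∷ + 21 ∷ + 15 ∷ + 0 ∷ ⁻ 1 ∷ []) ∷ (+ 10 ∷ + 21 ∷ + 24 ∷ + 15 ∷ ⁻ 1 ∷ ⁻ 1 ∷ []) ∷ (+ 5 ∷ + 15 ∷ + 15 ∷ + 0 ∷ ⁻ 1 ∷ ⁻ 1 ∷ []) ∷ (⁻ 1 ∷ + 0 ∷ ⁻ 1 ∷ ⁻ 1 ∷ ⁻ 1 ∷ + 6 ∷ []) ∷ (⁻ 1 ∷ ⁻ 1 ∷ ⁻ 1 ∷ ⁻ 1 ∷ + 6 ∷ ⁻ 2 ∷ []) ∷ [])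
      (⁻ 1 ∷ ⁻ 3 ∷ ⁻ 3 ∷ + 0 ∷ + 6 ∷ + 14 ∷ []) (+ 0 ∷ + 0 ∷ + 0 ∷ + 0 ∷ + 0 ∷ ⁻ 20 ∷ [])
      (⁻ 44 ∷ ⁻ 31 ∷ ⁻ 8 ∷ + 100 ∷ + 17 ∷ ⁻ 6 ∷ []) (⁻ 38) (+ 1 ∷ ⁻ 22 ∷ ⁻ 28 ∷ ⁻ 6 ∷ + 3 ∷ ⁻ 8 ∷ []) (⁻ 38) ∷
    mk 10 ((+ 4 ∷ + 13 ∷ ⁻ 3 ∷ + 9 ∷ ⁻ 2 ∷ ⁻ 2 ∷ []) ∷ (+ 13 ∷ + 30 ∷ ⁻ 1 ∷ + 31 ∷ + 18 ∷ ⁻ 1 ∷ []) ∷ (⁻ 3 ∷ ⁻ 1 ∷ ⁻ 1 ∷ + 0 ∷ ⁻ 2 ∷ + 34 ∷ []) ∷ (+ 9 ∷ + 31 ∷ + 0 ∷ + 20 ∷ ⁻ 2 ∷ ⁻ 3 ∷ []) ∷ (⁻ 2 ∷ + 18 ∷ ⁻ 2 ∷ ⁻ 2 ∷ + 62 ∷ ⁻ 5 ∷ []) ∷ (⁻ 2 ∷ ⁻ 1 ∷ + 34 ∷ ⁻ 3 ∷ ⁻ 5 ∷ + 10 ∷ []) ∷ [])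
      (⁻ 1 ∷ ⁻ 5 ∷ + 7 ∷ ⁻ 2 ∷ + 4 ∷ + 27 ∷ []) (+ 0 ∷ + 0 ∷ + 0 ∷ + 0 ∷ + 0 ∷ ⁻ 45 ∷ [])
      (⁻ 94 ∷ ⁻ 60 ∷ ⁻ 17 ∷ ⁻ 33 ∷ ⁻ 75 ∷ ⁻ 28 ∷ []) (⁻ 102) (+ 25 ∷ ⁻ 43 ∷ + 29 ∷ ⁻ 33 ∷ ⁻ 80 ∷ ⁻ 32 ∷ []) (⁻ 83) ∷
    mk 10 ((+ 8 ∷ + 26 ∷ ⁻ 7 ∷ + 14 ∷ + 12 ∷ ⁻ 4 ∷ []) ∷ (+ 26 ∷ + 60 ∷ ⁻ 5 ∷ + 57 ∷ + 60 ∷ ⁻ 7 ∷ []) ∷ (⁻ 7 ∷ ⁻ 5 ∷ ⁻ 2 ∷ + 39 ∷ + 43 ∷ + 17 ∷ []) ∷ (+ 14 ∷ + 57 ∷ + 39 ∷ + 44 ∷ + 14 ∷ ⁻ 7 ∷ []) ∷ (+ 12 ∷ + 60 ∷ + 43 ∷ + 14 ∷ + 1 ∷ ⁻ 11 ∷ []) ∷ (⁻ 4 ∷ ⁻ 7 ∷ + 17 ∷ ⁻ 7 ∷ ⁻ 11 ∷ + 26 ∷ []) ∷ [])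
      (⁻ 2 ∷ ⁻ 10 ∷ + 15 ∷ ⁻ 2 ∷ + 0 ∷ + 59 ∷ []) (+ 0 ∷ + 0 ∷ + 0 ∷ + 0 ∷ + 0 ∷ ⁻ 100 ∷ [])
      (⁻ 208 ∷ ⁻ 127 ∷ ⁻ 38 ∷ ⁻ 73 ∷ ⁻ 30 ∷ ⁻ 66 ∷ []) (⁻ 187) (+ 21 ∷ ⁻ 89 ∷ + 42 ∷ ⁻ 73 ∷ ⁻ 17 ∷ ⁻ 76 ∷ []) (⁻ 205) ∷
    mk 10 ((+ 4 ∷ + 7 ∷ + 8 ∷ + 7 ∷ + 2 ∷ + 1 ∷ []) ∷ (+ 7 ∷ + 12 ∷ + 14 ∷ + 13 ∷ + 6 ∷ ⁻ 1 ∷ []) ∷ (+ 8 ∷ + 14 ∷ + 16 ∷ + 14 ∷ + 4 ∷ ⁻ 1 ∷ []) ∷ (+ 7 ∷ + 13 ∷ + 14 ∷ + 10 ∷ ⁻ 1 ∷ ⁻ 1 ∷ []) ∷ (+ 2 ∷ + 6 ∷ + 4 ∷ ⁻ 1 ∷ + 9 ∷ ⁻ 2 ∷ []) ∷ (+ 1 ∷ ⁻ 1 ∷ ⁻ 1 ∷ ⁻ 1 ∷ ⁻ 2 ∷ + 0 ∷ []) ∷ [])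
      (⁻ 1 ∷ ⁻ 2 ∷ ⁻ 2 ∷ ⁻ 1 ∷ + 2 ∷ + 10 ∷ []) (+ 0 ∷ + 0 ∷ + 0 ∷ + 0 ∷ + 0 ∷ ⁻ 14 ∷ [])
      (⁻ 32 ∷ ⁻ 2 ∷ ⁻ 22 ∷ ⁻ 14 ∷ ⁻ 13 ∷ ⁻ 6 ∷ []) (⁻ 46) (+ 1 ∷ ⁻ 16 ∷ ⁻ 19 ∷ ⁻ 14 ∷ ⁻ 15 ∷ ⁻ 7 ∷ []) (⁻ 113) ∷
    mk 9 ((+ 18 ∷ + 8 ∷ + 5 ∷ ⁻ 2 ∷ + 0 ∷ ⁻ 2 ∷ []) ∷ (+ 8 ∷ + 6 ∷ + 7 ∷ ⁻ 1 ∷ + 8 ∷ ⁻ 2 ∷ []) ∷ (+ 5 ∷ + 7 ∷ + 8 ∷ ⁻ 2 ∷ + 7 ∷ ⁻ 2 ∷ []) ∷ (⁻ 2 ∷ ⁻ 1 ∷ ⁻ 2 ∷ ⁻ 1 ∷ + 4 ∷ + 9 ∷ []) ∷ (+ 0 ∷ + 8 ∷ + 7 ∷ + 4 ∷ ⁻ 1 ∷ ⁻ 1 ∷ []) ∷ (⁻ 2 ∷ ⁻ 2 ∷ ⁻ 2 ∷ + 9 ∷ ⁻ 1 ∷ + 9 ∷ []) ∷ [])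
      (+ 3 ∷ ⁻ 1 ∷ ⁻ 1 ∷ + 2 ∷ + 1 ∷ + 13 ∷ []) (⁻ 15 ∷ + 0 ∷ + 0 ∷ + 0 ∷ ⁻ 5 ∷ ⁻ 30 ∷ [])
      (⁻ 52 ∷ ⁻ 25 ∷ ⁻ 20 ∷ ⁻ 8 ∷ + 14 ∷ ⁻ 21 ∷ []) (⁻ 43) (⁻ 33 ∷ ⁻ 18 ∷ ⁻ 17 ∷ + 29 ∷ ⁻ 11 ∷ ⁻ 24 ∷ []) (⁻ 58) ∷
    mk 9 ((+ 0 ∷ + 2 ∷ + 2 ∷ + 0 ∷ + 1 ∷ + 2 ∷ []) ∷ (+ 2 ∷ + 6 ∷ + 7 ∷ + 5 ∷ + 6 ∷ + 0 ∷ []) ∷ (+ 2 ∷ + 7 ∷ + 8 ∷ + 5 ∷ + 5 ∷ ⁻ 1 ∷ []) ∷ (+ 0 ∷ + 5 ∷ + 5 ∷ + 4 ∷ + 2 ∷ ⁻ 1 ∷ []) ∷ (+ 1 ∷ + 6 ∷ + 5 ∷ + 2 ∷ ⁻ 1 ∷ ⁻ 1 ∷ []) ∷ (+ 2 ∷ + 0 ∷ ⁻ 1 ∷ ⁻ 1 ∷ ⁻ 1 ∷ + 6 ∷ []) ∷ [])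
      (+ 0 ∷ ⁻ 1 ∷ ⁻ 1 ∷ + 0 ∷ + 1 ∷ + 9 ∷ []) (+ 0 ∷ + 0 ∷ + 0 ∷ + 0 ∷ ⁻ 3 ∷ ⁻ 20 ∷ [])
      (+ 3 ∷ ⁻ 19 ∷ ⁻ 16 ∷ + 0 ∷ + 9 ∷ ⁻ 14 ∷ []) (⁻ 80) (+ 35 ∷ ⁻ 14 ∷ ⁻ 14 ∷ ⁻ 10 ∷ ⁻ 7 ∷ ⁻ 16 ∷ []) (⁻ 113) ∷
    []

  certs41 : List Certificate
  certs41 =
    mk 12 ((+ 4 ∷ + 7 ∷ + 8 ∷ + 0 ∷ + 2 ∷ + 1 ∷ []) ∷ (+ 7 ∷ + 12 ∷ + 14 ∷ + 0 ∷ + 6 ∷ ⁻ 1 ∷ []) ∷ (+ 8 ∷ + 14 ∷ + 21 ∷ ⁻ 1 ∷ + 4 ∷ ⁻ 1 ∷ []) ∷ (+ 0 ∷ + 0 ∷ ⁻ 1 ∷ ⁻ 1 ∷ + 6 ∷ + 10 ∷ []) ∷ (+ 2 ∷ + 6 ∷ + 4 ∷ + 6 ∷ ⁻ 1 ∷ + 5 ∷ []) ∷ (+ 1 ∷ ⁻ 1 ∷ ⁻ 1 ∷ + 10 ∷ + 5 ∷ ⁻ 1 ∷ []) ∷ [])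
      (⁻ 1 ∷ ⁻ 2 ∷ ⁻ 2 ∷ + 4 ∷ + 2 ∷ + 10 ∷ []) (+ 0 ∷ + 0 ∷ + 0 ∷ + 0 ∷ + 0 ∷ ⁻ 14 ∷ [])
      (⁻ 32 ∷ ⁻ 21 ∷ ⁻ 28 ∷ ⁻ 3 ∷ + 30 ∷ ⁻ 5 ∷ []) (⁻ 48) (⁻ 5 ∷ ⁻ 15 ∷ ⁻ 24 ∷ + 10 ∷ ⁻ 5 ∷ ⁻ 6 ∷ []) (⁻ 19) ∷
    mk 11 ((+ 4 ∷ + 9 ∷ + 24 ∷ + 5 ∷ + 2 ∷ ⁻ 1 ∷ []) ∷ (+ 9 ∷ + 18 ∷ + 35 ∷ + 15 ∷ + 12 ∷ ⁻ 1 ∷ []) ∷ (+ 24 ∷ + 35 ∷ + 52 ∷ + 29 ∷ + 24 ∷ ⁻ 1 ∷ []) ∷ (+ 5 ∷ + 15 ∷ + 29 ∷ + 3 ∷ ⁻ 1 ∷ ⁻ 1 ∷ []) ∷ (+ 2 ∷ + 12 ∷ + 24 ∷ ⁻ 1 ∷ + 8 ∷ ⁻ 2 ∷ []) ∷ (⁻ 1 ∷ ⁻ 1 ∷ ⁻ 1 ∷ ⁻ 1 ∷ ⁻ 2 ∷ ⁻ 2 ∷ []) ∷ [])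
      (⁻ 1 ∷ ⁻ 3 ∷ ⁻ 3 ∷ + 0 ∷ + 2 ∷ + 14 ∷ []) (+ 0 ∷ + 0 ∷ ⁻ 14 ∷ + 0 ∷ + 0 ∷ ⁻ 20 ∷ [])
      (⁻ 44 ∷ ⁻ 25 ∷ ⁻ 62 ∷ ⁻ 9 ∷ + 105 ∷ ⁻ 6 ∷ []) (⁻ 36) (+ 12 ∷ ⁻ 22 ∷ ⁻ 56 ∷ ⁻ 9 ∷ ⁻ 16 ∷ ⁻ 8 ∷ []) (⁻ 42) ∷
    mk 10 ((+ 28 ∷ + 71 ∷ + 86 ∷ + 47 ∷ ⁻ 8 ∷ ⁻ 9 ∷ []) ∷ (+ 71 ∷ + 150 ∷ + 187 ∷ + 145 ∷ + 75 ∷ ⁻ 11 ∷ []) ∷ (+ 86 ∷ + 187 ∷ + 232 ∷ + 169 ∷ + 74 ∷ ⁻ 12 ∷ []) ∷ (+ 47 ∷ + 145 ∷ + 169 ∷ + 209 ∷ + 19 ∷ ⁻ 13 ∷ []) ∷ (⁻ 8 ∷ + 75 ∷ + 74 ∷ + 19 ∷ + 25 ∷ ⁻ 3 ∷ []) ∷ (⁻ 9 ∷ ⁻ 11 ∷ ⁻ 12 ∷ ⁻ 13 ∷ ⁻ 3 ∷ + 5 ∷ []) ∷ [])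
      (⁻ 7 ∷ ⁻ 25 ∷ ⁻ 29 ∷ ⁻ 6 ∷ + 25 ∷ + 129 ∷ []) (+ 0 ∷ + 0 ∷ + 0 ∷ + 0 ∷ + 0 ∷ ⁻ 200 ∷ [])
      (⁻ 428 ∷ + 176 ∷ ⁻ 332 ∷ ⁻ 266 ∷ ⁻ 82 ∷ ⁻ 85 ∷ []) (⁻ 423) (+ 102 ∷ ⁻ 207 ∷ ⁻ 276 ∷ ⁻ 266 ∷ + 79 ∷ ⁻ 105 ∷ []) (⁻ 443) ∷
    mk 9 ((+ 194 ∷ + 105 ∷ + 116 ∷ + 30 ∷ ⁻ 1 ∷ ⁻ 25 ∷ []) ∷ (+ 105 ∷ + 114 ∷ + 16 ∷ + 128 ∷ + 123 ∷ ⁻ 25 ∷ []) ∷ (+ 116 ∷ + 16 ∷ ⁻ 19 ∷ ⁻ 20 ∷ ⁻ 27 ∷ ⁻ 25 ∷ []) ∷ (+ 30 ∷ + 128 ∷ ⁻ 20 ∷ + 112 ∷ + 50 ∷ ⁻ 27 ∷ []) ∷ (⁻ 1 ∷ + 123 ∷ ⁻ 27 ∷ + 50 ∷ + 24 ∷ + 13 ∷ []) ∷ (⁻ 25 ∷ ⁻ 25 ∷ ⁻ 25 ∷ ⁻ 27 ∷ + 13 ∷ + 99 ∷ []) ∷ [])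
      (+ 30 ∷ ⁻ 19 ∷ + 20 ∷ ⁻ 11 ∷ + 13 ∷ + 186 ∷ []) (⁻ 157 ∷ + 0 ∷ + 0 ∷ + 0 ∷ ⁻ 47 ∷ ⁻ 400 ∷ [])
      (⁻ 411 ∷ ⁻ 381 ∷ + 1186 ∷ ⁻ 76 ∷ ⁻ 138 ∷ ⁻ 259 ∷ []) (⁻ 775) (⁻ 394 ∷ ⁻ 274 ∷ + 430 ∷ ⁻ 226 ∷ ⁻ 184 ∷ ⁻ 299 ∷ []) (⁻ 780) ∷
    mk 9 ((+ 125 ∷ + 54 ∷ + 30 ∷ + 24 ∷ ⁻ 12 ∷ ⁻ 12 ∷ []) ∷ (+ 54 ∷ + 36 ∷ + 39 ∷ + 66 ∷ + 51 ∷ ⁻ 13 ∷ []) ∷ (+ 30 ∷ + 39 ∷ + 40 ∷ + 73 ∷ + 50 ∷ ⁻ 12 ∷ []) ∷ (+ 24 ∷ + 66 ∷ + 73 ∷ + 120 ∷ + 97 ∷ ⁻ 13 ∷ []) ∷ (⁻ 12 ∷ + 51 ∷ + 50 ∷ + 97 ∷ + 60 ∷ ⁻ 20 ∷ []) ∷ (⁻ 12 ∷ ⁻ 13 ∷ ⁻ 12 ∷ ⁻ 13 ∷ ⁻ 20 ∷ + 78 ∷ []) ∷ [])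
      (+ 21 ∷ ⁻ 6 ∷ ⁻ 5 ∷ ⁻ 12 ∷ ⁻ 5 ∷ + 85 ∷ []) (⁻ 104 ∷ + 0 ∷ + 0 ∷ + 0 ∷ + 0 ∷ ⁻ 200 ∷ [])
      (⁻ 434 ∷ ⁻ 169 ∷ + 220 ∷ ⁻ 177 ∷ ⁻ 117 ∷ ⁻ 158 ∷ []) (⁻ 416) (⁻ 225 ∷ ⁻ 116 ∷ ⁻ 97 ∷ ⁻ 177 ∷ ⁻ 140 ∷ ⁻ 178 ∷ []) (⁻ 412) ∷
    mk 9 ((⁻ 2 ∷ ⁻ 1 ∷ ⁻ 1 ∷ ⁻ 2 ∷ + 2 ∷ ⁻ 1 ∷ []) ∷ (⁻ 1 ∷ + 3 ∷ + 4 ∷ + 5 ∷ + 6 ∷ ⁻ 1 ∷ []) ∷ (⁻ 1 ∷ + 4 ∷ + 8 ∷ + 9 ∷ + 7 ∷ ⁻ 1 ∷ []) ∷ (⁻ 2 ∷ + 5 ∷ + 9 ∷ + 11 ∷ + 5 ∷ ⁻ 1 ∷ []) ∷ (+ 2 ∷ + 6 ∷ + 7 ∷ + 5 ∷ ⁻ 1 ∷ ⁻ 1 ∷ []) ∷ (⁻ 1 ∷ ⁻ 1 ∷ ⁻ 1 ∷ ⁻ 1 ∷ ⁻ 1 ∷ + 9 ∷ []) ∷ [])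
      (+ 1 ∷ + 0 ∷ ⁻ 1 ∷ ⁻ 1 ∷ + 3 ∷ + 8 ∷ []) (⁻ 1 ∷ ⁻ 1 ∷ + 0 ∷ + 0 ∷ ⁻ 13 ∷ ⁻ 20 ∷ [])
      (⁻ 38 ∷ ⁻ 16 ∷ ⁻ 18 ∷ ⁻ 17 ∷ + 15 ∷ ⁻ 17 ∷ []) (⁻ 49) (+ 25 ∷ ⁻ 10 ∷ ⁻ 14 ∷ ⁻ 17 ∷ ⁻ 7 ∷ ⁻ 19 ∷ []) (⁻ 48) ∷
    []

  certs42 : List Certificate
  certs42 =
    mk 13 ((+ 36 ∷ + 104 ∷ ⁻ 2 ∷ ⁻ 2 ∷ ⁻ 2 ∷ ⁻ 1 ∷ []) ∷ (+ 104 ∷ + 175 ∷ ⁻ 1 ∷ ⁻ 3 ∷ ⁻ 3 ∷ ⁻ 3 ∷ []) ∷ (⁻ 2 ∷ ⁻ 1 ∷ ⁻ 2 ∷ ⁻ 2 ∷ + 2 ∷ + 20 ∷ []) ∷ (⁻ 2 ∷ ⁻ 3 ∷ ⁻ 2 ∷ ⁻ 2 ∷ ⁻ 1 ∷ + 4 ∷ []) ∷ (⁻ 2 ∷ ⁻ 3 ∷ + 2 ∷ ⁻ 1 ∷ ⁻ 2 ∷ + 18 ∷ []) ∷ (⁻ 1 ∷ ⁻ 3 ∷ + 20 ∷ + 4 ∷ + 18 ∷ ⁻ 5 ∷ []) ∷ [])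
      (⁻ 9 ∷ ⁻ 10 ∷ + 56 ∷ + 60 ∷ + 40 ∷ + 67 ∷ []) (+ 0 ∷ ⁻ 57 ∷ ⁻ 70 ∷ ⁻ 70 ∷ + 0 ∷ ⁻ 70 ∷ [])
      (⁻ 176 ∷ ⁻ 222 ∷ ⁻ 33 ∷ + 163 ∷ + 58 ∷ ⁻ 18 ∷ []) (⁻ 142) (⁻ 52 ∷ ⁻ 187 ∷ + 35 ∷ + 44 ∷ + 22 ∷ ⁻ 30 ∷ []) (⁻ 94) ∷
    mk 12 ((+ 4 ∷ + 7 ∷ + 8 ∷ + 0 ∷ + 2 ∷ + 1 ∷ []) ∷ (+ 7 ∷ + 12 ∷ + 14 ∷ ⁻ 1 ∷ ⁻ 1 ∷ ⁻ 1 ∷ []) ∷ (+ 8 ∷ + 14 ∷ + 16 ∷ ⁻ 1 ∷ ⁻ 1 ∷ ⁻ 1 ∷ []) ∷ (+ 0 ∷ ⁻ 1 ∷ ⁻ 1 ∷ + 0 ∷ + 0 ∷ + 8 ∷ []) ∷ (+ 2 ∷ ⁻ 1 ∷ ⁻ 1 ∷ + 0 ∷ + 0 ∷ + 7 ∷ []) ∷ (+ 1 ∷ ⁻ 1 ∷ ⁻ 1 ∷ + 8 ∷ + 7 ∷ ⁻ 1 ∷ []) ∷ [])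
      (⁻ 1 ∷ ⁻ 2 ∷ ⁻ 2 ∷ + 4 ∷ + 9 ∷ + 10 ∷ []) (+ 0 ∷ + 0 ∷ + 0 ∷ + 0 ∷ ⁻ 14 ∷ ⁻ 14 ∷ [])
      (⁻ 32 ∷ + 31 ∷ ⁻ 23 ∷ ⁻ 5 ∷ + 11 ∷ ⁻ 4 ∷ []) (⁻ 33) (⁻ 6 ∷ ⁻ 15 ∷ ⁻ 19 ∷ + 8 ∷ + 8 ∷ ⁻ 6 ∷ []) (⁻ 46) ∷
    mk 11 ((+ 4 ∷ + 7 ∷ + 8 ∷ + 7 ∷ + 2 ∷ + 1 ∷ []) ∷ (+ 7 ∷ + 12 ∷ + 14 ∷ + 13 ∷ + 6 ∷ ⁻ 1 ∷ []) ∷ (+ 8 ∷ + 14 ∷ + 29 ∷ + 14 ∷ + 21 ∷ ⁻ 1 ∷ []) ∷ (+ 7 ∷ + 13 ∷ + 14 ∷ + 10 ∷ ⁻ 1 ∷ ⁻ 1 ∷ []) ∷ (+ 2 ∷ + 6 ∷ + 21 ∷ ⁻ 1 ∷ + 31 ∷ ⁻ 1 ∷ []) ∷ (+ 1 ∷ ⁻ 1 ∷ ⁻ 1 ∷ ⁻ 1 ∷ ⁻ 1 ∷ ⁻ 1 ∷ []) ∷ [])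
      (⁻ 1 ∷ ⁻ 2 ∷ ⁻ 2 ∷ ⁻ 1 ∷ + 2 ∷ + 10 ∷ []) (+ 0 ∷ + 0 ∷ + 0 ∷ + 0 ∷ + 0 ∷ ⁻ 14 ∷ [])
      (⁻ 32 ∷ + 31 ∷ ⁻ 36 ∷ ⁻ 15 ∷ ⁻ 35 ∷ ⁻ 4 ∷ []) (⁻ 38) (⁻ 6 ∷ ⁻ 16 ∷ ⁻ 32 ∷ ⁻ 14 ∷ + 42 ∷ ⁻ 6 ∷ []) (⁻ 88) ∷
    mk 11 ((+ 4 ∷ + 9 ∷ ⁻ 1 ∷ ⁻ 1 ∷ + 0 ∷ ⁻ 1 ∷ []) ∷ (+ 9 ∷ + 18 ∷ + 0 ∷ ⁻ 1 ∷ + 9 ∷ ⁻ 1 ∷ []) ∷ (⁻ 1 ∷ + 0 ∷ + 0 ∷ ⁻ 1 ∷ + 25 ∷ + 2 ∷ []) ∷ (⁻ 1 ∷ ⁻ 1 ∷ ⁻ 1 ∷ ⁻ 1 ∷ + 12 ∷ + 4 ∷ []) ∷ (+ 0 ∷ + 9 ∷ + 25 ∷ + 12 ∷ + 7 ∷ ⁻ 2 ∷ []) ∷ (⁻ 1 ∷ ⁻ 1 ∷ + 2 ∷ + 4 ∷ ⁻ 2 ∷ + 4 ∷ []) ∷ [])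
      (⁻ 1 ∷ ⁻ 3 ∷ + 4 ∷ + 13 ∷ + 3 ∷ + 14 ∷ []) (+ 0 ∷ + 0 ∷ + 0 ∷ ⁻ 20 ∷ + 0 ∷ ⁻ 20 ∷ [])
      (⁻ 44 ∷ ⁻ 31 ∷ ⁻ 10 ∷ ⁻ 6 ∷ ⁻ 12 ∷ ⁻ 11 ∷ []) (⁻ 38) (+ 6 ∷ ⁻ 23 ∷ + 12 ∷ + 14 ∷ ⁻ 14 ∷ ⁻ 14 ∷ []) (⁻ 28) ∷
    mk 11 ((+ 76 ∷ + 171 ∷ + 241 ∷ ⁻ 15 ∷ ⁻ 12 ∷ ⁻ 13 ∷ []) ∷ (+ 171 ∷ + 343 ∷ + 451 ∷ ⁻ 16 ∷ + 153 ∷ ⁻ 19 ∷ []) ∷ (+ 241 ∷ + 451 ∷ + 559 ∷ ⁻ 20 ∷ + 141 ∷ ⁻ 25 ∷ []) ∷ (⁻ 15 ∷ ⁻ 16 ∷ ⁻ 20 ∷ ⁻ 14 ∷ + 230 ∷ + 75 ∷ []) ∷ (⁻ 12 ∷ + 153 ∷ + 141 ∷ + 230 ∷ + 147 ∷ ⁻ 33 ∷ []) ∷ (⁻ 13 ∷ ⁻ 19 ∷ ⁻ 25 ∷ + 75 ∷ ⁻ 33 ∷ + 73 ∷ []) ∷ [])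
      (⁻ 19 ∷ ⁻ 57 ∷ ⁻ 57 ∷ + 255 ∷ + 63 ∷ + 273 ∷ []) (+ 0 ∷ + 0 ∷ ⁻ 51 ∷ ⁻ 400 ∷ + 0 ∷ ⁻ 400 ∷ [])
      (⁻ 876 ∷ ⁻ 610 ∷ ⁻ 759 ∷ ⁻ 119 ∷ ⁻ 247 ∷ ⁻ 206 ∷ []) (⁻ 794) (+ 120 ∷ ⁻ 443 ∷ ⁻ 639 ∷ + 222 ∷ ⁻ 280 ∷ ⁻ 273 ∷ []) (⁻ 836) ∷
    mk 10 ((⁻ 15 ∷ + 2 ∷ ⁻ 17 ∷ + 18 ∷ ⁻ 10 ∷ + 3 ∷ []) ∷ (+ 2 ∷ + 42 ∷ ⁻ 12 ∷ + 89 ∷ + 60 ∷ ⁻ 6 ∷ []) ∷ (⁻ 17 ∷ ⁻ 12 ∷ ⁻ 6 ∷ + 5 ∷ + 30 ∷ + 50 ∷ []) ∷ (+ 18 ∷ + 89 ∷ + 5 ∷ + 184 ∷ + 142 ∷ ⁻ 12 ∷ []) ∷ (⁻ 10 ∷ + 60 ∷ + 30 ∷ + 142 ∷ + 89 ∷ ⁻ 17 ∷ []) ∷ (+ 3 ∷ ⁻ 6 ∷ + 50 ∷ ⁻ 12 ∷ ⁻ 17 ∷ + 52 ∷ []) ∷ [])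
      (+ 4 ∷ ⁻ 7 ∷ + 14 ∷ ⁻ 18 ∷ ⁻ 6 ∷ + 85 ∷ []) (+ 0 ∷ + 0 ∷ + 0 ∷ + 0 ∷ + 0 ∷ ⁻ 200 ∷ [])
      (⁻ 385 ∷ ⁻ 175 ∷ ⁻ 94 ∷ ⁻ 251 ∷ ⁻ 139 ∷ ⁻ 119 ∷ []) (⁻ 424) (+ 203 ∷ ⁻ 99 ∷ + 42 ∷ ⁻ 234 ∷ ⁻ 156 ∷ ⁻ 152 ∷ []) (⁻ 365) ∷
    mk 10 ((⁻ 12 ∷ + 11 ∷ + 34 ∷ + 15 ∷ ⁻ 8 ∷ ⁻ 7 ∷ []) ∷ (+ 11 ∷ + 60 ∷ + 109 ∷ + 95 ∷ + 75 ∷ ⁻ 9 ∷ []) ∷ (+ 34 ∷ + 109 ∷ + 184 ∷ + 175 ∷ + 158 ∷ ⁻ 11 ∷ []) ∷ (+ 15 ∷ + 95 ∷ + 175 ∷ + 150 ∷ + 115 ∷ ⁻ 12 ∷ []) ∷ (⁻ 8 ∷ + 75 ∷ + 158 ∷ + 115 ∷ + 89 ∷ ⁻ 17 ∷ []) ∷ (⁻ 7 ∷ ⁻ 9 ∷ ⁻ 11 ∷ ⁻ 12 ∷ ⁻ 17 ∷ + 55 ∷ []) ∷ [])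
      (+ 3 ∷ ⁻ 10 ∷ ⁻ 23 ∷ ⁻ 15 ∷ ⁻ 5 ∷ + 93 ∷ []) (+ 0 ∷ + 0 ∷ + 0 ∷ + 0 ∷ + 0 ∷ ⁻ 200 ∷ [])
      (⁻ 388 ∷ ⁻ 193 ∷ ⁻ 284 ∷ ⁻ 217 ∷ ⁻ 88 ∷ ⁻ 122 ∷ []) (⁻ 446) (+ 237 ∷ ⁻ 117 ∷ ⁻ 228 ∷ ⁻ 200 ∷ ⁻ 156 ∷ ⁻ 155 ∷ []) (⁻ 506) ∷
    mk 9 ((⁻ 166 ∷ ⁻ 70 ∷ ⁻ 75 ∷ ⁻ 94 ∷ + 54 ∷ ⁻ 60 ∷ []) ∷ (⁻ 70 ∷ + 134 ∷ + 235 ∷ + 286 ∷ + 217 ∷ ⁻ 4 ∷ []) ∷ (⁻ 75 ∷ + 235 ∷ + 440 ∷ + 559 ∷ + 271 ∷ ⁻ 59 ∷ []) ∷ (⁻ 94 ∷ + 286 ∷ + 559 ∷ + 714 ∷ + 169 ∷ ⁻ 62 ∷ []) ∷ (+ 54 ∷ + 217 ∷ + 271 ∷ + 169 ∷ ⁻ 36 ∷ ⁻ 39 ∷ []) ∷ (⁻ 60 ∷ ⁻ 4 ∷ ⁻ 59 ∷ ⁻ 62 ∷ ⁻ 39 ∷ + 320 ∷ []) ∷ [])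
      (+ 51 ∷ ⁻ 3 ∷ ⁻ 55 ∷ ⁻ 71 ∷ + 200 ∷ + 361 ∷ []) (⁻ 19 ∷ ⁻ 58 ∷ + 0 ∷ + 0 ∷ ⁻ 741 ∷ ⁻ 1000 ∷ [])
      (⁻ 1834 ∷ ⁻ 801 ∷ ⁻ 940 ∷ ⁻ 567 ∷ + 913 ∷ ⁻ 653 ∷ []) (⁻ 2038) (+ 1591 ∷ ⁻ 534 ∷ ⁻ 726 ∷ ⁻ 964 ∷ ⁻ 297 ∷ ⁻ 820 ∷ []) (⁻ 2053) ∷
    mk 9 ((⁻ 36 ∷ + 97 ∷ + 150 ∷ + 1 ∷ ⁻ 33 ∷ ⁻ 59 ∷ []) ∷ (+ 97 ∷ + 372 ∷ + 89 ∷ + 379 ∷ + 391 ∷ ⁻ 60 ∷ []) ∷ (+ 150 ∷ + 89 ∷ ⁻ 48 ∷ + 6 ∷ ⁻ 37 ∷ ⁻ 62 ∷ []) ∷ (+ 1 ∷ + 379 ∷ + 6 ∷ + 230 ∷ + 153 ∷ ⁻ 62 ∷ []) ∷ (⁻ 33 ∷ + 391 ∷ ⁻ 37 ∷ + 153 ∷ + 26 ∷ ⁻ 73 ∷ []) ∷ (⁻ 59 ∷ ⁻ 60 ∷ ⁻ 62 ∷ ⁻ 62 ∷ ⁻ 73 ∷ + 109 ∷ []) ∷ [])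
      (+ 9 ∷ ⁻ 62 ∷ + 53 ∷ ⁻ 23 ∷ + 2 ∷ + 498 ∷ []) (+ 0 ∷ + 0 ∷ + 0 ∷ + 0 ∷ ⁻ 25 ∷ ⁻ 1000 ∷ [])
      (⁻ 1964 ∷ ⁻ 1027 ∷ + 2449 ∷ ⁻ 563 ∷ ⁻ 276 ∷ ⁻ 442 ∷ []) (+ 3121) (+ 1622 ∷ ⁻ 772 ∷ + 981 ∷ ⁻ 480 ∷ ⁻ 359 ∷ ⁻ 609 ∷ []) (⁻ 1983) ∷
    mk 9 ((+ 0 ∷ + 14 ∷ + 16 ∷ ⁻ 20 ∷ + 4 ∷ + 28 ∷ []) ∷ (+ 14 ∷ + 42 ∷ + 52 ∷ ⁻ 16 ∷ + 48 ∷ ⁻ 9 ∷ []) ∷ (+ 16 ∷ + 52 ∷ + 64 ∷ ⁻ 11 ∷ + 56 ∷ ⁻ 12 ∷ []) ∷ (⁻ 20 ∷ ⁻ 16 ∷ ⁻ 11 ∷ ⁻ 7 ∷ + 35 ∷ + 35 ∷ []) ∷ (+ 4 ∷ + 48 ∷ + 56 ∷ + 35 ∷ + 24 ∷ ⁻ 17 ∷ []) ∷ (+ 28 ∷ ⁻ 9 ∷ ⁻ 12 ∷ + 35 ∷ ⁻ 17 ∷ + 53 ∷ []) ∷ [])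
      (+ 0 ∷ ⁻ 7 ∷ ⁻ 8 ∷ + 17 ∷ ⁻ 2 ∷ + 86 ∷ []) (+ 0 ∷ + 0 ∷ + 0 ∷ + 0 ∷ + 0 ∷ ⁻ 200 ∷ [])
      (⁻ 400 ∷ ⁻ 175 ∷ ⁻ 164 ∷ ⁻ 60 ∷ + 85 ∷ ⁻ 120 ∷ []) (⁻ 410) (⁻ 3 ∷ ⁻ 122 ∷ ⁻ 74 ∷ + 161 ∷ ⁻ 91 ∷ ⁻ 126 ∷ []) (⁻ 420) ∷
    mk 9 ((+ 28 ∷ + 71 ∷ + 62 ∷ + 53 ∷ + 50 ∷ + 51 ∷ []) ∷ (+ 71 ∷ + 150 ∷ + 151 ∷ + 152 ∷ + 157 ∷ ⁻ 22 ∷ []) ∷ (+ 62 ∷ + 151 ∷ + 136 ∷ + 121 ∷ + 108 ∷ ⁻ 25 ∷ []) ∷ (+ 53 ∷ + 152 ∷ + 121 ∷ + 90 ∷ + 60 ∷ ⁻ 25 ∷ []) ∷ (+ 50 ∷ + 157 ∷ + 108 ∷ + 60 ∷ + 10 ∷ ⁻ 29 ∷ []) ∷ (+ 51 ∷ ⁻ 22 ∷ ⁻ 25 ∷ ⁻ 25 ∷ ⁻ 29 ∷ + 44 ∷ []) ∷ [])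
      (⁻ 7 ∷ ⁻ 25 ∷ ⁻ 17 ∷ ⁻ 9 ∷ + 1 ∷ + 199 ∷ []) (+ 0 ∷ + 0 ∷ + 0 ∷ + 0 ∷ ⁻ 10 ∷ ⁻ 400 ∷ [])
      (⁻ 459 ∷ ⁻ 412 ∷ ⁻ 318 ∷ ⁻ 223 ∷ ⁻ 110 ∷ ⁻ 177 ∷ []) (⁻ 129) (⁻ 228 ∷ ⁻ 310 ∷ ⁻ 250 ∷ ⁻ 190 ∷ ⁻ 143 ∷ ⁻ 244 ∷ []) (⁻ 870) ∷
    []

  certs43 : List Certificate
  certs43 =
    mk 12 ((+ 4 ∷ + 10 ∷ + 22 ∷ + 0 ∷ + 0 ∷ ⁻ 1 ∷ []) ∷ (+ 10 ∷ + 19 ∷ + 31 ∷ + 0 ∷ ⁻ 1 ∷ ⁻ 1 ∷ []) ∷ (+ 22 ∷ + 31 ∷ + 44 ∷ + 0 ∷ + 0 ∷ ⁻ 1 ∷ []) ∷ (+ 0 ∷ + 0 ∷ + 0 ∷ + 0 ∷ ⁻ 1 ∷ + 12 ∷ []) ∷ (+ 0 ∷ ⁻ 1 ∷ + 0 ∷ ⁻ 1 ∷ + 20 ∷ ⁻ 1 ∷ []) ∷ (⁻ 1 ∷ ⁻ 1 ∷ ⁻ 1 ∷ + 12 ∷ ⁻ 1 ∷ ⁻ 1 ∷ []) ∷ [])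
      (⁻ 1 ∷ ⁻ 2 ∷ ⁻ 2 ∷ + 6 ∷ + 10 ∷ + 11 ∷ []) (+ 0 ∷ ⁻ 3 ∷ ⁻ 14 ∷ + 0 ∷ ⁻ 13 ∷ ⁻ 14 ∷ [])
      (⁻ 32 ∷ ⁻ 20 ∷ ⁻ 34 ∷ ⁻ 5 ∷ ⁻ 24 ∷ ⁻ 4 ∷ []) (⁻ 11) (+ 9 ∷ ⁻ 22 ∷ ⁻ 47 ∷ + 8 ∷ ⁻ 25 ∷ ⁻ 5 ∷ []) (⁻ 10) ∷
    mk 11 ((+ 4 ∷ + 9 ∷ ⁻ 1 ∷ + 11 ∷ + 0 ∷ ⁻ 1 ∷ []) ∷ (+ 9 ∷ + 18 ∷ + 0 ∷ + 24 ∷ + 9 ∷ ⁻ 1 ∷ []) ∷ (⁻ 1 ∷ + 0 ∷ + 0 ∷ ⁻ 1 ∷ ⁻ 1 ∷ + 13 ∷ []) ∷ (+ 11 ∷ + 24 ∷ ⁻ 1 ∷ + 30 ∷ + 3 ∷ ⁻ 1 ∷ []) ∷ (+ 0 ∷ + 9 ∷ ⁻ 1 ∷ + 3 ∷ + 19 ∷ ⁻ 2 ∷ []) ∷ (⁻ 1 ∷ ⁻ 1 ∷ + 13 ∷ ⁻ 1 ∷ ⁻ 2 ∷ ⁻ 1 ∷ []) ∷ [])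
      (⁻ 1 ∷ ⁻ 3 ∷ + 4 ∷ ⁻ 3 ∷ + 3 ∷ + 14 ∷ []) (+ 0 ∷ + 0 ∷ + 0 ∷ + 0 ∷ + 0 ∷ ⁻ 20 ∷ [])
      (⁻ 44 ∷ + 0 ∷ ⁻ 10 ∷ + 44 ∷ ⁻ 24 ∷ ⁻ 6 ∷ []) (⁻ 44) (+ 20 ∷ ⁻ 23 ∷ + 14 ∷ ⁻ 35 ∷ ⁻ 26 ∷ ⁻ 7 ∷ []) (⁻ 44) ∷
    mk 11 ((+ 4 ∷ + 9 ∷ + 24 ∷ + 6 ∷ + 0 ∷ ⁻ 1 ∷ []) ∷ (+ 9 ∷ + 18 ∷ + 35 ∷ + 16 ∷ + 9 ∷ ⁻ 1 ∷ []) ∷ (+ 24 ∷ + 35 ∷ + 52 ∷ + 30 ∷ + 20 ∷ ⁻ 1 ∷ []) ∷ (+ 6 ∷ + 16 ∷ + 30 ∷ + 5 ∷ + 53 ∷ ⁻ 1 ∷ []) ∷ (+ 0 ∷ + 9 ∷ + 20 ∷ + 53 ∷ + 19 ∷ ⁻ 2 ∷ []) ∷ (⁻ 1 ∷ ⁻ 1 ∷ ⁻ 1 ∷ ⁻ 1 ∷ ⁻ 2 ∷ ⁻ 1 ∷ []) ∷ [])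
      (⁻ 1 ∷ ⁻ 3 ∷ ⁻ 3 ∷ + 0 ∷ + 3 ∷ + 14 ∷ []) (+ 0 ∷ + 0 ∷ ⁻ 14 ∷ + 0 ∷ + 0 ∷ ⁻ 20 ∷ [])
      (⁻ 44 ∷ + 0 ∷ ⁻ 6 ∷ ⁻ 12 ∷ ⁻ 24 ∷ ⁻ 6 ∷ []) (⁻ 45) (+ 20 ∷ ⁻ 23 ∷ ⁻ 56 ∷ ⁻ 10 ∷ ⁻ 26 ∷ ⁻ 7 ∷ []) (⁻ 44) ∷
    mk 10 ((+ 0 ∷ + 2 ∷ + 4 ∷ + 2 ∷ + 1 ∷ + 2 ∷ []) ∷ (+ 2 ∷ + 6 ∷ + 10 ∷ + 8 ∷ + 7 ∷ + 0 ∷ []) ∷ (+ 4 ∷ + 10 ∷ + 16 ∷ + 14 ∷ + 15 ∷ ⁻ 1 ∷ []) ∷ (+ 2 ∷ + 8 ∷ + 14 ∷ + 10 ∷ + 7 ∷ ⁻ 1 ∷ []) ∷ (+ 1 ∷ + 7 ∷ + 15 ∷ + 7 ∷ + 7 ∷ ⁻ 1 ∷ []) ∷ (+ 2 ∷ + 0 ∷ ⁻ 1 ∷ ⁻ 1 ∷ ⁻ 1 ∷ ⁻ 1 ∷ []) ∷ [])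
      (+ 0 ∷ ⁻ 1 ∷ ⁻ 2 ∷ ⁻ 1 ∷ + 0 ∷ + 9 ∷ []) (+ 0 ∷ + 0 ∷ + 0 ∷ + 0 ∷ ⁻ 1 ∷ ⁻ 20 ∷ [])
      (⁻ 40 ∷ + 37 ∷ + 115 ∷ ⁻ 17 ∷ + 102 ∷ ⁻ 6 ∷ []) (⁻ 93) (+ 23 ∷ ⁻ 13 ∷ ⁻ 20 ∷ ⁻ 15 ∷ ⁻ 14 ∷ + 12 ∷ []) (⁻ 117) ∷
    mk 10 ((+ 4 ∷ + 11 ∷ + 14 ∷ + 7 ∷ + 8 ∷ + 4 ∷ []) ∷ (+ 11 ∷ + 24 ∷ + 31 ∷ + 23 ∷ + 27 ∷ + 1 ∷ []) ∷ (+ 14 ∷ + 31 ∷ + 40 ∷ + 29 ∷ + 34 ∷ ⁻ 2 ∷ []) ∷ (+ 7 ∷ + 23 ∷ + 29 ∷ + 13 ∷ + 13 ∷ ⁻ 2 ∷ []) ∷ (+ 8 ∷ + 27 ∷ + 34 ∷ + 13 ∷ + 12 ∷ ⁻ 4 ∷ []) ∷ (+ 4 ∷ + 1 ∷ ⁻ 2 ∷ ⁻ 2 ∷ ⁻ 4 ∷ + 7 ∷ []) ∷ [])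
      (⁻ 1 ∷ ⁻ 4 ∷ ⁻ 5 ∷ ⁻ 1 ∷ ⁻ 1 ∷ + 24 ∷ []) (+ 0 ∷ + 0 ∷ + 0 ∷ + 0 ∷ + 0 ∷ ⁻ 45 ∷ [])
      (⁻ 58 ∷ ⁻ 54 ∷ ⁻ 62 ∷ + 4 ∷ ⁻ 23 ∷ ⁻ 22 ∷ []) (⁻ 155) (⁻ 22 ∷ ⁻ 39 ∷ ⁻ 50 ∷ ⁻ 24 ∷ ⁻ 27 ∷ ⁻ 25 ∷ []) (⁻ 155) ∷
    mk 9 ((+ 8 ∷ + 68 ∷ + 56 ∷ + 32 ∷ + 18 ∷ + 64 ∷ []) ∷ (+ 68 ∷ + 142 ∷ + 150 ∷ + 119 ∷ + 105 ∷ ⁻ 20 ∷ []) ∷ (+ 56 ∷ + 150 ∷ + 265 ∷ + 198 ∷ + 156 ∷ ⁻ 20 ∷ []) ∷ (+ 32 ∷ + 119 ∷ + 198 ∷ + 181 ∷ + 81 ∷ ⁻ 22 ∷ []) ∷ (+ 18 ∷ + 105 ∷ + 156 ∷ + 81 ∷ + 36 ∷ ⁻ 23 ∷ []) ∷ (+ 64 ∷ ⁻ 20 ∷ ⁻ 20 ∷ ⁻ 22 ∷ ⁻ 23 ∷ + 17 ∷ []) ∷ [])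
      (⁻ 2 ∷ ⁻ 8 ∷ ⁻ 24 ∷ ⁻ 11 ∷ ⁻ 3 ∷ + 175 ∷ []) (+ 0 ∷ ⁻ 46 ∷ + 0 ∷ + 0 ∷ + 0 ∷ ⁻ 400 ∷ [])
      (+ 199 ∷ + 178 ∷ ⁻ 465 ∷ ⁻ 314 ∷ ⁻ 136 ∷ ⁻ 150 ∷ []) (⁻ 789) (⁻ 208 ∷ ⁻ 302 ∷ ⁻ 398 ∷ ⁻ 203 ∷ ⁻ 17 ∷ ⁻ 177 ∷ []) (⁻ 789) ∷
    mk 9 ((+ 39 ∷ + 8 ∷ ⁻ 1 ∷ ⁻ 7 ∷ ⁻ 5 ∷ ⁻ 4 ∷ []) ∷ (+ 8 ∷ ⁻ 6 ∷ ⁻ 9 ∷ + 0 ∷ + 5 ∷ ⁻ 2 ∷ []) ∷ (⁻ 1 ∷ ⁻ 9 ∷ ⁻ 5 ∷ ⁻ 3 ∷ + 8 ∷ + 23 ∷ []) ∷ (⁻ 7 ∷ + 0 ∷ ⁻ 3 ∷ + 32 ∷ + 29 ∷ ⁻ 4 ∷ []) ∷ (⁻ 5 ∷ + 5 ∷ + 8 ∷ + 29 ∷ + 16 ∷ + 3 ∷ []) ∷ (⁻ 4 ∷ ⁻ 2 ∷ + 23 ∷ ⁻ 4 ∷ + 3 ∷ + 20 ∷ []) ∷ [])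
      (+ 11 ∷ + 3 ∷ + 3 ∷ ⁻ 3 ∷ + 3 ∷ + 19 ∷ []) (⁻ 41 ∷ ⁻ 6 ∷ + 0 ∷ + 0 ∷ ⁻ 26 ∷ ⁻ 70 ∷ [])
      (⁻ 179 ∷ + 62 ∷ ⁻ 30 ∷ ⁻ 55 ∷ ⁻ 29 ∷ ⁻ 43 ∷ []) (⁻ 136) (⁻ 74 ∷ + 65 ∷ ⁻ 18 ∷ ⁻ 20 ∷ ⁻ 39 ∷ ⁻ 48 ∷ []) (⁻ 130) ∷
    mk 9 ((⁻ 2 ∷ + 2 ∷ ⁻ 3 ∷ ⁻ 4 ∷ ⁻ 2 ∷ ⁻ 1 ∷ []) ∷ (+ 2 ∷ + 10 ∷ + 10 ∷ + 12 ∷ + 8 ∷ + 1 ∷ []) ∷ (⁻ 3 ∷ + 10 ∷ + 17 ∷ + 22 ∷ + 13 ∷ ⁻ 1 ∷ []) ∷ (⁻ 4 ∷ + 12 ∷ + 22 ∷ + 30 ∷ + 14 ∷ ⁻ 2 ∷ []) ∷ (⁻ 2 ∷ + 8 ∷ + 13 ∷ + 14 ∷ + 8 ∷ + 3 ∷ []) ∷ (⁻ 1 ∷ + 1 ∷ ⁻ 1 ∷ ⁻ 2 ∷ + 3 ∷ + 14 ∷ []) ∷ [])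
      (+ 3 ∷ + 1 ∷ ⁻ 2 ∷ ⁻ 3 ∷ + 5 ∷ + 15 ∷ []) (⁻ 5 ∷ ⁻ 8 ∷ + 0 ∷ + 0 ∷ ⁻ 21 ∷ ⁻ 45 ∷ [])
      (⁻ 88 ∷ ⁻ 17 ∷ ⁻ 39 ∷ ⁻ 45 ∷ ⁻ 16 ∷ ⁻ 29 ∷ []) (⁻ 127) (+ 45 ∷ ⁻ 28 ∷ ⁻ 32 ∷ ⁻ 41 ∷ ⁻ 23 ∷ ⁻ 32 ∷ []) (⁻ 140) ∷
    mk 9 ((⁻ 64 ∷ ⁻ 10 ∷ + 48 ∷ + 333 ∷ ⁻ 64 ∷ + 168 ∷ []) ∷ (⁻ 10 ∷ + 114 ∷ + 244 ∷ + 400 ∷ + 154 ∷ + 53 ∷ []) ∷ (+ 48 ∷ + 244 ∷ + 448 ∷ + 180 ∷ + 384 ∷ ⁻ 48 ∷ []) ∷ (+ 333 ∷ + 400 ∷ + 180 ∷ ⁻ 36 ∷ + 69 ∷ ⁻ 56 ∷ []) ∷ (⁻ 64 ∷ + 154 ∷ + 384 ∷ + 69 ∷ + 128 ∷ ⁻ 37 ∷ []) ∷ (+ 168 ∷ + 53 ∷ ⁻ 48 ∷ ⁻ 56 ∷ ⁻ 37 ∷ + 115 ∷ []) ∷ [])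
      (+ 16 ∷ ⁻ 19 ∷ ⁻ 56 ∷ + 25 ∷ ⁻ 8 ∷ + 360 ∷ []) (+ 0 ∷ + 0 ∷ + 0 ∷ + 0 ∷ ⁻ 16 ∷ ⁻ 1000 ∷ [])
      (⁻ 77 ∷ + 653 ∷ ⁻ 948 ∷ + 933 ∷ ⁻ 378 ∷ ⁻ 448 ∷ []) (⁻ 1977) (⁻ 436 ∷ ⁻ 514 ∷ ⁻ 781 ∷ ⁻ 214 ∷ + 498 ∷ ⁻ 515 ∷ []) (⁻ 1984) ∷
    mk 9 ((+ 3666 ∷ + 1040 ∷ + 1114 ∷ ⁻ 400 ∷ ⁻ 267 ∷ ⁻ 200 ∷ []) ∷ (+ 1040 ∷ ⁻ 400 ∷ + 254 ∷ ⁻ 333 ∷ + 43 ∷ ⁻ 35 ∷ []) ∷ (+ 1114 ∷ + 254 ∷ + 883 ∷ + 1194 ∷ + 628 ∷ ⁻ 200 ∷ []) ∷ (⁻ 400 ∷ ⁻ 333 ∷ + 1194 ∷ + 2173 ∷ + 1010 ∷ ⁻ 222 ∷ []) ∷ (⁻ 267 ∷ + 43 ∷ + 628 ∷ + 1010 ∷ + 304 ∷ ⁻ 279 ∷ []) ∷ (⁻ 200 ∷ ⁻ 35 ∷ ⁻ 200 ∷ ⁻ 222 ∷ ⁻ 279 ∷ ⁻ 21 ∷ []) ∷ [])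
      (+ 812 ∷ + 219 ∷ + 232 ∷ ⁻ 101 ∷ + 249 ∷ + 987 ∷ []) (⁻ 3457 ∷ ⁻ 457 ∷ ⁻ 1368 ∷ + 0 ∷ ⁻ 1646 ∷ ⁻ 4000 ∷ [])
      (+ 7916 ∷ + 11407 ∷ + 3977 ∷ ⁻ 3506 ∷ ⁻ 1304 ∷ ⁻ 1312 ∷ []) (⁻ 7973) (⁻ 5666 ∷ + 5210 ∷ ⁻ 2216 ∷ + 475 ∷ ⁻ 404 ∷ ⁻ 1579 ∷ []) (⁻ 7976) ∷
    mk 9 ((+ 266 ∷ + 152 ∷ + 62 ∷ ⁻ 2 ∷ ⁻ 27 ∷ ⁻ 20 ∷ []) ∷ (+ 152 ∷ + 118 ∷ + 101 ∷ + 74 ∷ + 65 ∷ ⁻ 18 ∷ []) ∷ (+ 62 ∷ + 101 ∷ + 155 ∷ + 158 ∷ + 160 ∷ ⁻ 20 ∷ []) ∷ (⁻ 2 ∷ + 74 ∷ + 158 ∷ + 180 ∷ + 125 ∷ ⁻ 22 ∷ []) ∷ (⁻ 27 ∷ + 65 ∷ + 160 ∷ + 125 ∷ + 51 ∷ ⁻ 25 ∷ []) ∷ (⁻ 20 ∷ ⁻ 18 ∷ ⁻ 20 ∷ ⁻ 22 ∷ ⁻ 25 ∷ + 60 ∷ []) ∷ [])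
      (+ 55 ∷ + 15 ∷ ⁻ 19 ∷ ⁻ 15 ∷ + 9 ∷ + 139 ∷ []) (⁻ 243 ∷ ⁻ 104 ∷ + 0 ∷ + 0 ∷ ⁻ 78 ∷ ⁻ 400 ∷ [])
      (+ 201 ∷ + 403 ∷ ⁻ 355 ∷ ⁻ 313 ∷ ⁻ 151 ∷ ⁻ 193 ∷ []) (⁻ 788) (⁻ 466 ∷ ⁻ 278 ∷ ⁻ 288 ∷ ⁻ 181 ∷ ⁻ 30 ∷ ⁻ 220 ∷ []) (⁻ 781) ∷
    []

  certs44 : List Certificate
  certs44 =
    mk 12 ((+ 32 ∷ + 58 ∷ + 94 ∷ ⁻ 2 ∷ ⁻ 2 ∷ ⁻ 2 ∷ []) ∷ (+ 58 ∷ + 88 ∷ + 126 ∷ ⁻ 2 ∷ ⁻ 1 ∷ ⁻ 3 ∷ []) ∷ (+ 94 ∷ + 126 ∷ + 164 ∷ ⁻ 3 ∷ + 2 ∷ ⁻ 4 ∷ []) ∷ (⁻ 2 ∷ ⁻ 2 ∷ ⁻ 3 ∷ ⁻ 2 ∷ ⁻ 5 ∷ + 51 ∷ []) ∷ (⁻ 2 ∷ ⁻ 1 ∷ + 2 ∷ ⁻ 5 ∷ + 332 ∷ ⁻ 6 ∷ []) ∷ (⁻ 2 ∷ ⁻ 3 ∷ ⁻ 4 ∷ + 51 ∷ ⁻ 6 ∷ ⁻ 5 ∷ []) ∷ [])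
      (⁻ 8 ∷ ⁻ 10 ∷ ⁻ 10 ∷ + 24 ∷ + 25 ∷ + 29 ∷ []) (+ 0 ∷ ⁻ 14 ∷ ⁻ 42 ∷ + 0 ∷ + 0 ∷ + 0 ∷ [])
      (⁻ 172 ∷ ⁻ 158 ∷ ⁻ 145 ∷ ⁻ 26 ∷ ⁻ 350 ∷ ⁻ 18 ∷ []) (⁻ 134) (⁻ 50 ∷ ⁻ 102 ∷ ⁻ 177 ∷ + 56 ∷ ⁻ 355 ∷ ⁻ 23 ∷ []) (⁻ 142) ∷
    mk 11 ((+ 8 ∷ + 12 ∷ + 0 ∷ + 16 ∷ + 0 ∷ + 0 ∷ []) ∷ (+ 12 ∷ + 18 ∷ + 0 ∷ + 24 ∷ + 0 ∷ + 0 ∷ []) ∷ (+ 0 ∷ + 0 ∷ + 0 ∷ ⁻ 1 ∷ ⁻ 1 ∷ + 14 ∷ []) ∷ (+ 16 ∷ + 24 ∷ ⁻ 1 ∷ + 30 ∷ ⁻ 1 ∷ ⁻ 1 ∷ []) ∷ (+ 0 ∷ + 0 ∷ ⁻ 1 ∷ ⁻ 1 ∷ + 102 ∷ ⁻ 2 ∷ []) ∷ (+ 0 ∷ + 0 ∷ + 14 ∷ ⁻ 1 ∷ ⁻ 2 ∷ ⁻ 1 ∷ []) ∷ [])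
      (⁻ 2 ∷ ⁻ 3 ∷ + 4 ∷ ⁻ 3 ∷ + 6 ∷ + 7 ∷ []) (+ 0 ∷ + 0 ∷ + 0 ∷ + 0 ∷ + 0 ∷ + 0 ∷ [])
      (⁻ 48 ∷ ⁻ 38 ∷ ⁻ 13 ∷ + 88 ∷ ⁻ 107 ∷ ⁻ 6 ∷ []) (⁻ 63) (+ 3 ∷ ⁻ 23 ∷ + 12 ∷ ⁻ 35 ∷ ⁻ 109 ∷ ⁻ 7 ∷ []) (⁻ 81) ∷
    mk 11 ((+ 376 ∷ + 568 ∷ + 662 ∷ + 756 ∷ + 194 ∷ ⁻ 40 ∷ []) ∷ (+ 568 ∷ + 858 ∷ + 1001 ∷ + 1144 ∷ + 303 ∷ ⁻ 46 ∷ []) ∷ (+ 662 ∷ + 1001 ∷ + 4395 ∷ + 1287 ∷ + 118 ∷ ⁻ 67 ∷ []) ∷ (+ 756 ∷ + 1144 ∷ + 1287 ∷ + 1430 ∷ ⁻ 67 ∷ ⁻ 62 ∷ []) ∷ (+ 194 ∷ + 303 ∷ + 118 ∷ ⁻ 67 ∷ ⁻ 36 ∷ ⁻ 83 ∷ []) ∷ (⁻ 40 ∷ ⁻ 46 ∷ ⁻ 67 ∷ ⁻ 62 ∷ ⁻ 83 ∷ ⁻ 67 ∷ []) ∷ [])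
      (⁻ 94 ∷ ⁻ 143 ∷ ⁻ 143 ∷ ⁻ 143 ∷ + 185 ∷ + 349 ∷ []) (+ 0 ∷ + 0 ∷ + 0 ∷ + 0 ∷ + 0 ∷ + 0 ∷ [])
      (⁻ 2376 ∷ + 590 ∷ ⁻ 5062 ∷ + 2014 ∷ + 2568 ∷ ⁻ 266 ∷ []) (⁻ 2008) (⁻ 709 ∷ ⁻ 1108 ∷ ⁻ 4577 ∷ ⁻ 1680 ∷ ⁻ 297 ∷ + 198 ∷ []) (⁻ 2070) ∷
    mk 10 ((+ 20 ∷ + 77 ∷ + 164 ∷ + 139 ∷ ⁻ 14 ∷ + 7 ∷ []) ∷ (+ 77 ∷ + 189 ∷ + 327 ∷ + 329 ∷ + 36 ∷ ⁻ 22 ∷ []) ∷ (+ 164 ∷ + 327 ∷ + 516 ∷ + 544 ∷ + 112 ∷ ⁻ 27 ∷ []) ∷ (+ 139 ∷ + 329 ∷ + 544 ∷ + 571 ∷ ⁻ 26 ∷ ⁻ 25 ∷ []) ∷ (⁻ 14 ∷ + 36 ∷ + 112 ∷ ⁻ 26 ∷ + 1128 ∷ ⁻ 33 ∷ []) ∷ (+ 7 ∷ ⁻ 22 ∷ ⁻ 27 ∷ ⁻ 25 ∷ ⁻ 33 ∷ + 61 ∷ []) ∷ [])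
      (⁻ 5 ∷ ⁻ 31 ∷ ⁻ 57 ∷ ⁻ 57 ∷ + 108 ∷ + 214 ∷ []) (+ 0 ∷ + 0 ∷ ⁻ 30 ∷ + 0 ∷ ⁻ 172 ∷ ⁻ 400 ∷ [])
      (⁻ 820 ∷ ⁻ 589 ∷ ⁻ 783 ∷ ⁻ 181 ∷ ⁻ 1228 ∷ ⁻ 194 ∷ []) (⁻ 799) (⁻ 13 ∷ ⁻ 322 ∷ ⁻ 616 ∷ ⁻ 671 ∷ ⁻ 581 ∷ ⁻ 221 ∷ []) (⁻ 880) ∷
    mk 10 ((+ 28 ∷ + 43 ∷ ⁻ 20 ∷ + 53 ∷ + 32 ∷ ⁻ 9 ∷ []) ∷ (+ 43 ∷ + 66 ∷ ⁻ 17 ∷ + 82 ∷ + 51 ∷ ⁻ 10 ∷ []) ∷ (⁻ 20 ∷ ⁻ 17 ∷ ⁻ 7 ∷ + 21 ∷ + 25 ∷ + 79 ∷ []) ∷ (+ 53 ∷ + 82 ∷ + 21 ∷ + 90 ∷ + 29 ∷ ⁻ 12 ∷ []) ∷ (+ 32 ∷ + 51 ∷ + 25 ∷ + 29 ∷ + 268 ∷ ⁻ 17 ∷ []) ∷ (⁻ 9 ∷ ⁻ 10 ∷ + 79 ∷ ⁻ 12 ∷ ⁻ 17 ∷ + 50 ∷ []) ∷ [])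
      (⁻ 7 ∷ ⁻ 11 ∷ + 24 ∷ ⁻ 9 ∷ + 5 ∷ + 29 ∷ []) (+ 0 ∷ + 0 ∷ + 0 ∷ + 0 ∷ + 0 ∷ + 0 ∷ [])
      (⁻ 428 ∷ ⁻ 232 ∷ ⁻ 126 ∷ ⁻ 170 ∷ ⁻ 318 ∷ ⁻ 117 ∷ []) (⁻ 423) (⁻ 56 ∷ ⁻ 133 ∷ ⁻ 43 ∷ ⁻ 140 ∷ ⁻ 335 ∷ ⁻ 130 ∷ []) (⁻ 408) ∷
    mk 10 ((+ 248 ∷ + 456 ∷ + 500 ∷ + 690 ∷ + 428 ∷ ⁻ 198 ∷ []) ∷ (+ 456 ∷ + 810 ∷ + 97 ∷ + 1245 ∷ + 894 ∷ ⁻ 3 ∷ []) ∷ (+ 500 ∷ + 97 ∷ ⁻ 143 ∷ ⁻ 165 ∷ ⁻ 200 ∷ ⁻ 267 ∷ []) ∷ (+ 690 ∷ + 1245 ∷ ⁻ 165 ∷ + 2935 ∷ + 1280 ∷ ⁻ 250 ∷ []) ∷ (+ 428 ∷ + 894 ∷ ⁻ 200 ∷ + 1280 ∷ + 338 ∷ ⁻ 143 ∷ []) ∷ (⁻ 198 ∷ ⁻ 3 ∷ ⁻ 267 ∷ ⁻ 250 ∷ ⁻ 143 ∷ + 761 ∷ []) ∷ [])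
      (⁻ 62 ∷ ⁻ 135 ∷ + 185 ∷ ⁻ 190 ∷ ⁻ 28 ∷ + 316 ∷ []) (+ 0 ∷ + 0 ∷ + 0 ∷ + 0 ∷ + 0 ∷ + 0 ∷ [])
      (⁻ 8248 ∷ + 2611 ∷ + 12061 ∷ ⁻ 4535 ∷ + 681 ∷ ⁻ 2094 ∷ []) (⁻ 8019) (+ 1061 ∷ ⁻ 2143 ∷ + 4254 ∷ ⁻ 3935 ∷ ⁻ 1671 ∷ ⁻ 2361 ∷ []) (⁻ 7985) ∷
    mk 10 ((+ 28 ∷ + 73 ∷ + 136 ∷ + 63 ∷ + 52 ∷ + 47 ∷ []) ∷ (+ 73 ∷ + 156 ∷ + 266 ∷ + 172 ∷ + 171 ∷ ⁻ 21 ∷ []) ∷ (+ 136 ∷ + 266 ∷ + 432 ∷ + 327 ∷ + 344 ∷ ⁻ 26 ∷ []) ∷ (+ 63 ∷ + 172 ∷ + 327 ∷ + 262 ∷ + 111 ∷ ⁻ 25 ∷ []) ∷ (+ 52 ∷ + 171 ∷ + 344 ∷ + 111 ∷ + 60 ∷ ⁻ 33 ∷ []) ∷ (+ 47 ∷ ⁻ 21 ∷ ⁻ 26 ∷ ⁻ 25 ∷ ⁻ 33 ∷ + 23 ∷ []) ∷ [])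
      (⁻ 7 ∷ ⁻ 26 ∷ ⁻ 54 ∷ ⁻ 14 ∷ ⁻ 5 ∷ + 201 ∷ []) (+ 0 ∷ + 0 ∷ + 0 ∷ + 0 ∷ + 0 ∷ ⁻ 400 ∷ [])
      (+ 114 ∷ + 183 ∷ ⁻ 699 ∷ ⁻ 422 ∷ ⁻ 147 ∷ ⁻ 156 ∷ []) (⁻ 832) (⁻ 188 ∷ ⁻ 289 ∷ ⁻ 532 ∷ ⁻ 362 ∷ ⁻ 193 ∷ ⁻ 183 ∷ []) (⁻ 846) ∷
    mk 10 ((+ 489 ∷ + 756 ∷ + 1016 ∷ ⁻ 17 ∷ + 770 ∷ ⁻ 200 ∷ []) ∷ (+ 756 ∷ + 1167 ∷ + 1568 ∷ ⁻ 65 ∷ + 1222 ∷ ⁻ 222 ∷ []) ∷ (+ 1016 ∷ + 1568 ∷ + 2108 ∷ ⁻ 167 ∷ + 1655 ∷ ⁻ 267 ∷ []) ∷ (⁻ 17 ∷ ⁻ 65 ∷ ⁻ 167 ∷ + 351 ∷ + 845 ∷ + 669 ∷ []) ∷ (+ 770 ∷ + 1222 ∷ + 1655 ∷ + 845 ∷ + 228 ∷ ⁻ 333 ∷ []) ∷ (⁻ 200 ∷ ⁻ 222 ∷ ⁻ 267 ∷ + 669 ∷ ⁻ 333 ∷ + 995 ∷ []) ∷ [])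
      (⁻ 122 ∷ ⁻ 194 ∷ ⁻ 263 ∷ + 2314 ∷ ⁻ 19 ∷ + 528 ∷ []) (+ 0 ∷ + 0 ∷ + 0 ∷ ⁻ 4000 ∷ + 0 ∷ + 0 ∷ [])
      (⁻ 8489 ∷ ⁻ 1356 ∷ ⁻ 4775 ∷ ⁻ 1951 ∷ + 1730 ∷ ⁻ 2328 ∷ []) (⁻ 7990) (⁻ 1094 ∷ ⁻ 2500 ∷ ⁻ 3108 ∷ ⁻ 1351 ∷ ⁻ 1561 ∷ ⁻ 2595 ∷ []) (⁻ 7984) ∷
    mk 10 ((+ 56 ∷ + 86 ∷ + 116 ∷ + 110 ∷ + 68 ∷ ⁻ 20 ∷ []) ∷ (+ 86 ∷ + 133 ∷ + 178 ∷ + 170 ∷ + 108 ∷ ⁻ 22 ∷ []) ∷ (+ 116 ∷ + 178 ∷ + 240 ∷ + 230 ∷ + 148 ∷ ⁻ 26 ∷ []) ∷ (+ 110 ∷ + 170 ∷ + 230 ∷ + 200 ∷ + 80 ∷ ⁻ 25 ∷ []) ∷ (+ 68 ∷ + 108 ∷ + 148 ∷ + 80 ∷ + 37 ∷ ⁻ 33 ∷ []) ∷ (⁻ 20 ∷ ⁻ 22 ∷ ⁻ 26 ∷ ⁻ 25 ∷ ⁻ 33 ∷ + 94 ∷ []) ∷ [])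
      (⁻ 14 ∷ ⁻ 22 ∷ ⁻ 30 ∷ ⁻ 20 ∷ + 8 ∷ + 59 ∷ []) (+ 0 ∷ + 0 ∷ + 0 ∷ + 0 ∷ + 0 ∷ + 0 ∷ [])
      (⁻ 856 ∷ ⁻ 302 ∷ ⁻ 474 ∷ ⁻ 360 ∷ + 314 ∷ ⁻ 227 ∷ []) (⁻ 818) (⁻ 112 ∷ ⁻ 266 ∷ ⁻ 340 ∷ ⁻ 300 ∷ ⁻ 170 ∷ ⁻ 254 ∷ []) (⁻ 811) ∷
    mk 10 ((+ 556 ∷ + 799 ∷ + 980 ∷ + 958 ∷ + 858 ∷ ⁻ 66 ∷ []) ∷ (+ 799 ∷ + 1146 ∷ + 1400 ∷ + 1349 ∷ + 1182 ∷ ⁻ 222 ∷ []) ∷ (+ 980 ∷ + 1400 ∷ + 1696 ∷ + 1584 ∷ + 1320 ∷ ⁻ 267 ∷ []) ∷ (+ 958 ∷ + 1349 ∷ + 1584 ∷ + 1314 ∷ + 848 ∷ ⁻ 250 ∷ []) ∷ (+ 858 ∷ + 1182 ∷ + 1320 ∷ + 848 ∷ + 144 ∷ ⁻ 333 ∷ []) ∷ (⁻ 66 ∷ ⁻ 222 ∷ ⁻ 267 ∷ ⁻ 250 ∷ ⁻ 333 ∷ + 911 ∷ []) ∷ [])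
      (⁻ 139 ∷ ⁻ 191 ∷ ⁻ 212 ∷ ⁻ 131 ∷ ⁻ 12 ∷ + 520 ∷ []) (+ 0 ∷ + 0 ∷ + 0 ∷ + 0 ∷ + 0 ∷ + 0 ∷ [])
      (⁻ 3353 ∷ ⁻ 4161 ∷ ⁻ 4363 ∷ ⁻ 2914 ∷ + 744 ∷ ⁻ 2244 ∷ []) (⁻ 8025) (⁻ 2156 ∷ ⁻ 2479 ∷ ⁻ 2696 ∷ ⁻ 2314 ∷ ⁻ 1477 ∷ ⁻ 2511 ∷ []) (⁻ 8017) ∷
    mk 9 ((+ 44 ∷ ⁻ 7 ∷ ⁻ 12 ∷ ⁻ 25 ∷ ⁻ 16 ∷ ⁻ 13 ∷ []) ∷ (⁻ 7 ∷ ⁻ 33 ∷ ⁻ 26 ∷ ⁻ 20 ∷ ⁻ 4 ∷ ⁻ 12 ∷ []) ∷ (⁻ 12 ∷ ⁻ 26 ∷ ⁻ 12 ∷ ⁻ 13 ∷ + 18 ∷ ⁻ 13 ∷ []) ∷ (⁻ 25 ∷ ⁻ 20 ∷ ⁻ 13 ∷ ⁻ 7 ∷ + 93 ∷ ⁻ 1 ∷ []) ∷ (⁻ 16 ∷ ⁻ 4 ∷ + 18 ∷ + 93 ∷ + 60 ∷ ⁻ 16 ∷ []) ∷ (⁻ 13 ∷ ⁻ 12 ∷ ⁻ 13 ∷ ⁻ 1 ∷ ⁻ 16 ∷ + 87 ∷ []) ∷ [])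
      (+ 17 ∷ + 6 ∷ + 3 ∷ + 1 ∷ + 0 ∷ + 24 ∷ []) (⁻ 56 ∷ + 0 ∷ ⁻ 6 ∷ + 0 ∷ ⁻ 30 ∷ ⁻ 98 ∷ [])
      (⁻ 444 ∷ + 107 ∷ + 488 ∷ ⁻ 73 ∷ ⁻ 110 ∷ ⁻ 154 ∷ []) (⁻ 413) (⁻ 177 ∷ + 254 ∷ + 371 ∷ + 244 ∷ + 107 ∷ ⁻ 167 ∷ []) (⁻ 421) ∷
    mk 9 ((+ 50 ∷ ⁻ 35 ∷ ⁻ 16 ∷ ⁻ 49 ∷ + 51 ∷ ⁻ 27 ∷ []) ∷ (⁻ 35 ∷ ⁻ 54 ∷ + 10 ∷ + 33 ∷ + 58 ∷ ⁻ 25 ∷ []) ∷ (⁻ 16 ∷ + 10 ∷ + 98 ∷ + 156 ∷ + 85 ∷ ⁻ 26 ∷ []) ∷ (⁻ 49 ∷ + 33 ∷ + 156 ∷ + 260 ∷ + 104 ∷ ⁻ 23 ∷ []) ∷ (+ 51 ∷ + 58 ∷ + 85 ∷ + 104 ∷ + 238 ∷ ⁻ 33 ∷ []) ∷ (⁻ 27 ∷ ⁻ 25 ∷ ⁻ 26 ∷ ⁻ 23 ∷ ⁻ 33 ∷ + 126 ∷ []) ∷ [])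
      (+ 42 ∷ + 9 ∷ ⁻ 3 ∷ ⁻ 26 ∷ + 82 ∷ + 121 ∷ []) (⁻ 109 ∷ + 0 ∷ ⁻ 37 ∷ + 0 ∷ ⁻ 358 ∷ ⁻ 400 ∷ [])
      (⁻ 850 ∷ ⁻ 154 ∷ + 130 ∷ ⁻ 420 ∷ ⁻ 93 ∷ ⁻ 259 ∷ []) (⁻ 799) (⁻ 317 ∷ + 103 ∷ ⁻ 231 ∷ ⁻ 204 ∷ ⁻ 371 ∷ + 74 ∷ []) (⁻ 795) ∷
    mk 9 ((⁻ 32 ∷ ⁻ 35 ∷ ⁻ 16 ∷ ⁻ 49 ∷ ⁻ 32 ∷ ⁻ 25 ∷ []) ∷ (⁻ 35 ∷ + 13 ∷ + 78 ∷ + 66 ∷ + 78 ∷ ⁻ 25 ∷ []) ∷ (⁻ 16 ∷ + 78 ∷ + 184 ∷ + 188 ∷ + 190 ∷ ⁻ 27 ∷ []) ∷ (⁻ 49 ∷ + 66 ∷ + 188 ∷ + 182 ∷ + 150 ∷ ⁻ 25 ∷ []) ∷ (⁻ 32 ∷ + 78 ∷ + 190 ∷ + 150 ∷ + 57 ∷ ⁻ 25 ∷ []) ∷ (⁻ 25 ∷ ⁻ 25 ∷ ⁻ 27 ∷ ⁻ 25 ∷ ⁻ 25 ∷ + 62 ∷ []) ∷ [])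
      (+ 23 ∷ ⁻ 2 ∷ ⁻ 23 ∷ ⁻ 18 ∷ + 12 ∷ + 147 ∷ []) (⁻ 30 ∷ + 0 ∷ + 0 ∷ + 0 ∷ ⁻ 100 ∷ ⁻ 400 ∷ [])
      (+ 956 ∷ + 276 ∷ ⁻ 451 ∷ ⁻ 342 ∷ ⁻ 157 ∷ ⁻ 195 ∷ []) (⁻ 786) (+ 696 ∷ + 250 ∷ ⁻ 317 ∷ ⁻ 94 ∷ ⁻ 49 ∷ ⁻ 222 ∷ []) (⁻ 787) ∷
    mk 9 ((+ 308 ∷ ⁻ 17 ∷ + 110 ∷ ⁻ 125 ∷ ⁻ 83 ∷ ⁻ 67 ∷ []) ∷ (⁻ 17 ∷ ⁻ 125 ∷ + 105 ∷ + 58 ∷ + 119 ∷ ⁻ 10 ∷ []) ∷ (+ 110 ∷ + 105 ∷ + 325 ∷ + 352 ∷ + 321 ∷ ⁻ 67 ∷ []) ∷ (⁻ 125 ∷ + 58 ∷ + 352 ∷ + 540 ∷ + 500 ∷ ⁻ 62 ∷ []) ∷ (⁻ 83 ∷ + 119 ∷ + 321 ∷ + 500 ∷ + 285 ∷ ⁻ 83 ∷ []) ∷ (⁻ 67 ∷ ⁻ 10 ∷ ⁻ 67 ∷ ⁻ 62 ∷ ⁻ 83 ∷ + 446 ∷ []) ∷ [])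
      (+ 129 ∷ + 21 ∷ + 26 ∷ ⁻ 54 ∷ + 34 ∷ + 288 ∷ []) (⁻ 412 ∷ + 0 ∷ ⁻ 265 ∷ + 0 ∷ ⁻ 346 ∷ ⁻ 1000 ∷ [])
      (⁻ 2308 ∷ ⁻ 875 ∷ + 118 ∷ ⁻ 940 ∷ ⁻ 535 ∷ ⁻ 779 ∷ []) (⁻ 2005) (⁻ 957 ∷ + 315 ∷ ⁻ 658 ∷ + 478 ∷ + 396 ∷ ⁻ 846 ∷ []) (⁻ 1993) ∷
    mk 9 ((+ 158 ∷ ⁻ 242 ∷ ⁻ 473 ∷ ⁻ 498 ∷ ⁻ 331 ∷ ⁻ 264 ∷ []) ∷ (⁻ 242 ∷ ⁻ 132 ∷ + 111 ∷ + 516 ∷ + 567 ∷ ⁻ 248 ∷ []) ∷ (⁻ 473 ∷ + 111 ∷ + 794 ∷ + 1593 ∷ + 1492 ∷ ⁻ 240 ∷ []) ∷ (⁻ 498 ∷ + 516 ∷ + 1593 ∷ + 4004 ∷ + 2444 ∷ ⁻ 250 ∷ []) ∷ (⁻ 331 ∷ + 567 ∷ + 1492 ∷ + 2444 ∷ + 1405 ∷ ⁻ 271 ∷ []) ∷ (⁻ 264 ∷ ⁻ 248 ∷ ⁻ 240 ∷ ⁻ 250 ∷ ⁻ 271 ∷ + 831 ∷ []) ∷ [])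
      (+ 375 ∷ + 120 ∷ ⁻ 99 ∷ ⁻ 274 ∷ + 97 ∷ + 1234 ∷ []) (⁻ 829 ∷ ⁻ 294 ∷ + 0 ∷ + 0 ∷ ⁻ 1284 ∷ ⁻ 4000 ∷ [])
      (⁻ 8158 ∷ + 15527 ∷ + 9700 ∷ ⁻ 5604 ∷ ⁻ 2405 ∷ ⁻ 2164 ∷ []) (⁻ 8046) (⁻ 2825 ∷ ⁻ 1868 ∷ ⁻ 2127 ∷ ⁻ 5004 ∷ ⁻ 638 ∷ + 3672 ∷ []) (⁻ 8071) ∷
    mk 9 ((+ 634 ∷ + 413 ∷ + 74 ∷ ⁻ 124 ∷ ⁻ 82 ∷ ⁻ 64 ∷ []) ∷ (+ 413 ∷ + 318 ∷ + 151 ∷ + 52 ∷ + 70 ∷ ⁻ 62 ∷ []) ∷ (+ 74 ∷ + 151 ∷ + 202 ∷ + 246 ∷ + 286 ∷ + 52 ∷ []) ∷ (⁻ 124 ∷ + 52 ∷ + 246 ∷ + 634 ∷ + 351 ∷ ⁻ 62 ∷ []) ∷ (⁻ 82 ∷ + 70 ∷ + 286 ∷ + 351 ∷ + 166 ∷ ⁻ 5 ∷ []) ∷ (⁻ 64 ∷ ⁻ 62 ∷ + 52 ∷ ⁻ 62 ∷ ⁻ 5 ∷ + 211 ∷ []) ∷ [])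
      (+ 171 ∷ + 108 ∷ ⁻ 1 ∷ ⁻ 36 ∷ + 51 ∷ + 263 ∷ []) (⁻ 659 ∷ ⁻ 483 ∷ ⁻ 97 ∷ + 0 ∷ ⁻ 387 ∷ ⁻ 1000 ∷ [])
      (⁻ 489 ∷ ⁻ 217 ∷ ⁻ 869 ∷ ⁻ 1034 ∷ ⁻ 416 ∷ ⁻ 544 ∷ []) (⁻ 2012) (⁻ 1301 ∷ ⁻ 818 ∷ ⁻ 535 ∷ + 692 ∷ + 202 ∷ ⁻ 611 ∷ []) (⁻ 2045) ∷
    mk 9 ((⁻ 768 ∷ ⁻ 44 ∷ ⁻ 318 ∷ ⁻ 500 ∷ ⁻ 331 ∷ ⁻ 264 ∷ []) ∷ (⁻ 44 ∷ + 904 ∷ + 1046 ∷ ⁻ 400 ∷ + 929 ∷ ⁻ 250 ∷ []) ∷ (⁻ 318 ∷ + 1046 ∷ + 1800 ∷ ⁻ 267 ∷ + 1967 ∷ ⁻ 265 ∷ []) ∷ (⁻ 500 ∷ ⁻ 400 ∷ ⁻ 267 ∷ ⁻ 143 ∷ ⁻ 267 ∷ + 2209 ∷ []) ∷ (⁻ 331 ∷ + 929 ∷ + 1967 ∷ ⁻ 267 ∷ + 826 ∷ + 105 ∷ []) ∷ (⁻ 264 ∷ ⁻ 250 ∷ ⁻ 265 ∷ + 2209 ∷ + 105 ∷ + 1221 ∷ []) ∷ [])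
      (+ 192 ∷ + 81 ∷ ⁻ 225 ∷ + 348 ∷ + 102 ∷ + 1460 ∷ []) (+ 0 ∷ ⁻ 694 ∷ + 0 ∷ + 0 ∷ ⁻ 1025 ∷ ⁻ 4000 ∷ [])
      (⁻ 7232 ∷ ⁻ 1524 ∷ ⁻ 4467 ∷ ⁻ 1457 ∷ ⁻ 1826 ∷ ⁻ 2554 ∷ []) (⁻ 8045) (+ 5276 ∷ ⁻ 2904 ∷ ⁻ 3133 ∷ + 3516 ∷ ⁻ 960 ∷ ⁻ 2821 ∷ []) (⁻ 7991) ∷
    []

  certs45 : List Certificate
  certs45 =
    mk 12 ((+ 8 ∷ + 12 ∷ + 0 ∷ + 0 ∷ + 18 ∷ + 0 ∷ []) ∷ (+ 12 ∷ + 18 ∷ + 0 ∷ + 0 ∷ + 27 ∷ + 0 ∷ []) ∷ (+ 0 ∷ + 0 ∷ + 1 ∷ + 1 ∷ ⁻ 1 ∷ + 9 ∷ []) ∷ (+ 0 ∷ + 0 ∷ + 1 ∷ ⁻ 1 ∷ ⁻ 1 ∷ + 13 ∷ []) ∷ (+ 18 ∷ + 27 ∷ ⁻ 1 ∷ ⁻ 1 ∷ + 36 ∷ ⁻ 1 ∷ []) ∷ (+ 0 ∷ + 0 ∷ + 9 ∷ + 13 ∷ ⁻ 1 ∷ ⁻ 1 ∷ []) ∷ [])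
      (⁻ 2 ∷ ⁻ 3 ∷ + 4 ∷ + 5 ∷ ⁻ 3 ∷ + 7 ∷ []) (+ 0 ∷ + 0 ∷ + 0 ∷ + 0 ∷ + 0 ∷ + 0 ∷ [])
      (⁻ 48 ∷ ⁻ 38 ∷ ⁻ 14 ∷ ⁻ 7 ∷ + 70 ∷ ⁻ 6 ∷ []) (⁻ 72) (⁻ 13 ∷ ⁻ 22 ∷ ⁻ 5 ∷ + 13 ∷ ⁻ 43 ∷ ⁻ 4 ∷ []) (⁻ 29) ∷
    mk 11 ((+ 8 ∷ + 13 ∷ + 22 ∷ ⁻ 1 ∷ + 12 ∷ + 0 ∷ []) ∷ (+ 13 ∷ + 20 ∷ + 30 ∷ ⁻ 1 ∷ + 19 ∷ + 1 ∷ []) ∷ (+ 22 ∷ + 30 ∷ + 44 ∷ ⁻ 1 ∷ + 26 ∷ + 1 ∷ []) ∷ (⁻ 1 ∷ ⁻ 1 ∷ ⁻ 1 ∷ ⁻ 1 ∷ ⁻ 1 ∷ + 14 ∷ []) ∷ (+ 12 ∷ + 19 ∷ + 26 ∷ ⁻ 1 ∷ + 0 ∷ ⁻ 1 ∷ []) ∷ (+ 0 ∷ + 1 ∷ + 1 ∷ + 14 ∷ ⁻ 1 ∷ ⁻ 1 ∷ []) ∷ [])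
      (⁻ 2 ∷ ⁻ 3 ∷ ⁻ 3 ∷ + 6 ∷ + 0 ∷ + 7 ∷ []) (+ 0 ∷ ⁻ 1 ∷ ⁻ 8 ∷ + 0 ∷ + 0 ∷ + 0 ∷ [])
      (⁻ 48 ∷ ⁻ 40 ∷ ⁻ 57 ∷ ⁻ 7 ∷ + 132 ∷ ⁻ 6 ∷ []) (⁻ 87) (⁻ 10 ∷ ⁻ 25 ∷ ⁻ 48 ∷ + 11 ∷ ⁻ 7 ∷ ⁻ 7 ∷ []) (⁻ 11) ∷
    mk 11 ((+ 8 ∷ + 12 ∷ + 21 ∷ + 16 ∷ + 12 ∷ + 0 ∷ []) ∷ (+ 12 ∷ + 18 ∷ + 28 ∷ + 24 ∷ + 18 ∷ + 0 ∷ []) ∷ (+ 21 ∷ + 28 ∷ + 38 ∷ + 73 ∷ + 25 ∷ + 0 ∷ []) ∷ (+ 16 ∷ + 24 ∷ + 73 ∷ + 30 ∷ + 18 ∷ ⁻ 1 ∷ []) ∷ (+ 12 ∷ + 18 ∷ + 25 ∷ + 18 ∷ + 0 ∷ ⁻ 1 ∷ []) ∷ (+ 0 ∷ + 0 ∷ + 0 ∷ ⁻ 1 ∷ ⁻ 1 ∷ ⁻ 1 ∷ []) ∷ [])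
      (⁻ 2 ∷ ⁻ 3 ∷ ⁻ 3 ∷ ⁻ 3 ∷ + 0 ∷ + 7 ∷ []) (+ 0 ∷ + 0 ∷ ⁻ 7 ∷ + 0 ∷ + 0 ∷ + 0 ∷ [])
      (⁻ 48 ∷ ⁻ 1 ∷ ⁻ 51 ∷ ⁻ 38 ∷ + 100 ∷ ⁻ 6 ∷ []) (⁻ 74) (⁻ 12 ∷ ⁻ 23 ∷ ⁻ 42 ∷ ⁻ 34 ∷ ⁻ 7 ∷ ⁻ 3 ∷ []) (⁻ 90) ∷
    mk 10 ((+ 20 ∷ + 29 ∷ + 30 ∷ + 47 ∷ + 38 ∷ ⁻ 5 ∷ []) ∷ (+ 29 ∷ + 43 ∷ + 10 ∷ + 68 ∷ + 55 ∷ ⁻ 10 ∷ []) ∷ (+ 30 ∷ + 10 ∷ ⁻ 7 ∷ ⁻ 8 ∷ ⁻ 11 ∷ ⁻ 11 ∷ []) ∷ (+ 47 ∷ + 68 ∷ ⁻ 8 ∷ + 110 ∷ + 86 ∷ ⁻ 10 ∷ []) ∷ (+ 38 ∷ + 55 ∷ ⁻ 11 ∷ + 86 ∷ + 48 ∷ ⁻ 13 ∷ []) ∷ (⁻ 5 ∷ ⁻ 10 ∷ ⁻ 11 ∷ ⁻ 10 ∷ ⁻ 13 ∷ + 51 ∷ []) ∷ [])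
      (⁻ 5 ∷ ⁻ 7 ∷ + 95 ∷ ⁻ 11 ∷ ⁻ 4 ∷ + 20 ∷ []) (+ 0 ∷ + 0 ∷ ⁻ 200 ∷ + 0 ∷ + 0 ∷ + 0 ∷ [])
      (⁻ 395 ∷ ⁻ 225 ∷ + 379 ∷ ⁻ 190 ∷ ⁻ 86 ∷ ⁻ 118 ∷ []) (⁻ 407) (⁻ 58 ∷ ⁻ 110 ∷ + 219 ∷ ⁻ 154 ∷ ⁻ 115 ∷ ⁻ 131 ∷ []) (⁻ 405) ∷
    mk 10 ((+ 44 ∷ + 65 ∷ + 86 ∷ + 109 ∷ + 70 ∷ ⁻ 1 ∷ []) ∷ (+ 65 ∷ + 96 ∷ + 127 ∷ + 161 ∷ + 102 ∷ ⁻ 5 ∷ []) ∷ (+ 86 ∷ + 127 ∷ + 168 ∷ + 213 ∷ + 134 ∷ ⁻ 9 ∷ []) ∷ (+ 109 ∷ + 161 ∷ + 213 ∷ + 270 ∷ + 172 ∷ ⁻ 6 ∷ []) ∷ (+ 70 ∷ + 102 ∷ + 134 ∷ + 172 ∷ + 24 ∷ ⁻ 13 ∷ []) ∷ (⁻ 1 ∷ ⁻ 5 ∷ ⁻ 9 ∷ ⁻ 6 ∷ ⁻ 13 ∷ + 14 ∷ []) ∷ [])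
      (⁻ 11 ∷ ⁻ 16 ∷ ⁻ 21 ∷ ⁻ 27 ∷ ⁻ 2 ∷ + 39 ∷ []) (+ 0 ∷ + 0 ∷ + 0 ∷ + 0 ∷ + 0 ∷ + 0 ∷ [])
      (+ 65 ∷ + 96 ∷ ⁻ 301 ∷ ⁻ 350 ∷ ⁻ 74 ∷ ⁻ 81 ∷ []) (⁻ 497) (⁻ 124 ∷ ⁻ 163 ∷ ⁻ 218 ∷ ⁻ 314 ∷ ⁻ 91 ∷ ⁻ 33 ∷ []) (⁻ 555) ∷
    mk 10 ((+ 32 ∷ + 48 ∷ + 66 ∷ + 84 ∷ + 66 ∷ ⁻ 14 ∷ []) ∷ (+ 48 ∷ + 72 ∷ + 99 ∷ + 126 ∷ + 99 ∷ ⁻ 20 ∷ []) ∷ (+ 66 ∷ + 99 ∷ + 136 ∷ + 173 ∷ + 138 ∷ ⁻ 20 ∷ []) ∷ (+ 84 ∷ + 126 ∷ + 173 ∷ + 220 ∷ + 177 ∷ ⁻ 20 ∷ []) ∷ (+ 66 ∷ + 99 ∷ + 138 ∷ + 177 ∷ + 108 ∷ ⁻ 27 ∷ []) ∷ (⁻ 14 ∷ ⁻ 20 ∷ ⁻ 20 ∷ ⁻ 20 ∷ ⁻ 27 ∷ + 93 ∷ []) ∷ [])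
      (⁻ 8 ∷ ⁻ 12 ∷ ⁻ 17 ∷ ⁻ 22 ∷ ⁻ 9 ∷ + 35 ∷ []) (+ 0 ∷ + 0 ∷ + 0 ∷ + 0 ∷ + 0 ∷ + 0 ∷ [])
      (⁻ 832 ∷ ⁻ 83 ∷ + 110 ∷ ⁻ 380 ∷ ⁻ 139 ∷ ⁻ 226 ∷ []) (⁻ 844) (⁻ 45 ∷ ⁻ 116 ∷ ⁻ 236 ∷ ⁻ 309 ∷ ⁻ 241 ∷ ⁻ 253 ∷ []) (⁻ 836) ∷
    mk 9 ((⁻ 16 ∷ ⁻ 18 ∷ ⁻ 10 ∷ ⁻ 18 ∷ ⁻ 16 ∷ ⁻ 12 ∷ []) ∷ (⁻ 18 ∷ + 6 ∷ + 37 ∷ + 44 ∷ + 42 ∷ ⁻ 9 ∷ []) ∷ (⁻ 10 ∷ + 37 ∷ + 90 ∷ + 107 ∷ + 99 ∷ ⁻ 11 ∷ []) ∷ (⁻ 18 ∷ + 44 ∷ + 107 ∷ + 130 ∷ + 106 ∷ ⁻ 10 ∷ []) ∷ (⁻ 16 ∷ + 42 ∷ + 99 ∷ + 106 ∷ + 48 ∷ ⁻ 13 ∷ []) ∷ (⁻ 12 ∷ ⁻ 9 ∷ ⁻ 11 ∷ ⁻ 10 ∷ ⁻ 13 ∷ + 19 ∷ []) ∷ [])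
      (+ 12 ∷ ⁻ 1 ∷ ⁻ 11 ∷ ⁻ 13 ∷ + 4 ∷ + 72 ∷ []) (⁻ 16 ∷ + 0 ∷ + 0 ∷ + 0 ∷ ⁻ 48 ∷ ⁻ 200 ∷ [])
      (+ 478 ∷ + 268 ∷ + 8 ∷ ⁻ 210 ∷ ⁻ 98 ∷ ⁻ 86 ∷ []) (⁻ 410) (+ 400 ∷ + 164 ∷ ⁻ 157 ∷ ⁻ 174 ∷ ⁻ 56 ∷ ⁻ 99 ∷ []) (⁻ 439) ∷
    mk 9 ((+ 712 ∷ + 131 ∷ ⁻ 62 ∷ ⁻ 114 ∷ ⁻ 83 ∷ ⁻ 65 ∷ []) ∷ (+ 131 ∷ ⁻ 164 ∷ ⁻ 160 ∷ ⁻ 97 ∷ + 67 ∷ + 69 ∷ []) ∷ (⁻ 62 ∷ ⁻ 160 ∷ ⁻ 48 ∷ + 41 ∷ + 249 ∷ + 146 ∷ []) ∷ (⁻ 114 ∷ ⁻ 97 ∷ + 41 ∷ + 74 ∷ + 244 ∷ ⁻ 46 ∷ []) ∷ (⁻ 83 ∷ + 67 ∷ + 249 ∷ + 244 ∷ + 396 ∷ ⁻ 65 ∷ []) ∷ (⁻ 65 ∷ + 69 ∷ + 146 ∷ ⁻ 46 ∷ ⁻ 65 ∷ + 262 ∷ []) ∷ [])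
      (+ 203 ∷ + 60 ∷ + 6 ∷ + 34 ∷ + 44 ∷ + 203 ∷ []) (⁻ 762 ∷ ⁻ 98 ∷ + 0 ∷ ⁻ 207 ∷ ⁻ 461 ∷ ⁻ 1000 ∷ [])
      (⁻ 2712 ∷ ⁻ 836 ∷ + 229 ∷ + 2298 ∷ ⁻ 646 ∷ ⁻ 595 ∷ []) (⁻ 2073) (⁻ 1379 ∷ + 281 ∷ ⁻ 285 ∷ + 1056 ∷ ⁻ 101 ∷ ⁻ 662 ∷ []) (⁻ 2070) ∷
    mk 9 ((+ 4 ∷ + 1 ∷ ⁻ 1 ∷ ⁻ 3 ∷ ⁻ 2 ∷ ⁻ 1 ∷ []) ∷ (+ 1 ∷ + 2 ∷ + 4 ∷ + 5 ∷ + 8 ∷ + 0 ∷ []) ∷ (⁻ 1 ∷ + 4 ∷ + 10 ∷ + 14 ∷ + 19 ∷ + 2 ∷ []) ∷ (⁻ 3 ∷ + 5 ∷ + 14 ∷ + 20 ∷ + 26 ∷ ⁻ 1 ∷ []) ∷ (⁻ 2 ∷ + 8 ∷ + 19 ∷ + 26 ∷ + 33 ∷ ⁻ 1 ∷ []) ∷ (⁻ 1 ∷ + 0 ∷ + 2 ∷ ⁻ 1 ∷ ⁻ 1 ∷ ⁻ 2 ∷ []) ∷ [])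
      (+ 3 ∷ + 1 ∷ ⁻ 1 ∷ ⁻ 2 ∷ ⁻ 2 ∷ + 9 ∷ []) (⁻ 8 ∷ ⁻ 4 ∷ ⁻ 1 ∷ + 0 ∷ ⁻ 4 ∷ ⁻ 30 ∷ [])
      (⁻ 64 ∷ + 118 ∷ + 294 ∷ ⁻ 32 ∷ + 138 ∷ ⁻ 8 ∷ []) (⁻ 85) (⁻ 24 ∷ ⁻ 17 ∷ ⁻ 20 ∷ ⁻ 27 ∷ ⁻ 43 ∷ + 51 ∷ []) (⁻ 101) ∷
    mk 9 ((+ 262 ∷ + 50 ∷ + 21 ∷ ⁻ 6 ∷ ⁻ 31 ∷ ⁻ 24 ∷ []) ∷ (+ 50 ∷ ⁻ 54 ∷ ⁻ 12 ∷ + 33 ∷ + 35 ∷ ⁻ 23 ∷ []) ∷ (+ 21 ∷ ⁻ 12 ∷ + 66 ∷ + 144 ∷ + 137 ∷ ⁻ 22 ∷ []) ∷ (⁻ 6 ∷ + 33 ∷ + 144 ∷ + 260 ∷ + 243 ∷ ⁻ 18 ∷ []) ∷ (⁻ 31 ∷ + 35 ∷ + 137 ∷ + 243 ∷ + 172 ∷ ⁻ 27 ∷ []) ∷ (⁻ 24 ∷ ⁻ 23 ∷ ⁻ 22 ∷ ⁻ 18 ∷ ⁻ 27 ∷ + 112 ∷ []) ∷ [])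
      (+ 63 ∷ + 9 ∷ ⁻ 8 ∷ ⁻ 26 ∷ + 1 ∷ + 120 ∷ []) (⁻ 257 ∷ + 0 ∷ + 0 ∷ + 0 ∷ ⁻ 92 ∷ ⁻ 400 ∷ [])
      (⁻ 1062 ∷ + 34 ∷ + 380 ∷ ⁻ 420 ∷ ⁻ 272 ∷ ⁻ 245 ∷ []) (⁻ 831) (⁻ 489 ∷ + 446 ∷ + 47 ∷ ⁻ 349 ∷ ⁻ 87 ∷ ⁻ 272 ∷ []) (⁻ 854) ∷
    mk 9 ((⁻ 824 ∷ ⁻ 622 ∷ ⁻ 416 ∷ ⁻ 500 ∷ + 3 ∷ ⁻ 266 ∷ []) ∷ (⁻ 622 ∷ ⁻ 12 ∷ + 604 ∷ ⁻ 400 ∷ + 1018 ∷ ⁻ 250 ∷ []) ∷ (⁻ 416 ∷ + 604 ∷ + 1632 ∷ ⁻ 104 ∷ + 2045 ∷ ⁻ 220 ∷ []) ∷ (⁻ 500 ∷ ⁻ 400 ∷ ⁻ 104 ∷ ⁻ 111 ∷ + 22 ∷ + 1004 ∷ []) ∷ (+ 3 ∷ + 1018 ∷ + 2045 ∷ + 22 ∷ + 807 ∷ ⁻ 65 ∷ []) ∷ (⁻ 266 ∷ ⁻ 250 ∷ ⁻ 220 ∷ + 1004 ∷ ⁻ 65 ∷ + 869 ∷ []) ∷ [])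
      (+ 206 ∷ + 2 ∷ ⁻ 204 ∷ + 281 ∷ + 209 ∷ + 1412 ∷ []) (+ 0 ∷ + 0 ∷ + 0 ∷ + 0 ∷ ⁻ 1657 ∷ ⁻ 4000 ∷ [])
      (+ 10 ∷ ⁻ 2059 ∷ ⁻ 4299 ∷ ⁻ 1489 ∷ ⁻ 1807 ∷ ⁻ 2202 ∷ []) (⁻ 8007) (+ 6700 ∷ + 1940 ∷ ⁻ 2965 ∷ + 1889 ∷ ⁻ 2140 ∷ ⁻ 2469 ∷ []) (⁻ 8010) ∷
    mk 9 ((+ 119 ∷ ⁻ 411 ∷ ⁻ 513 ∷ ⁻ 500 ∷ ⁻ 333 ∷ + 377 ∷ []) ∷ (⁻ 411 ∷ ⁻ 667 ∷ ⁻ 450 ∷ ⁻ 141 ∷ + 254 ∷ ⁻ 250 ∷ []) ∷ (⁻ 513 ∷ ⁻ 450 ∷ + 132 ∷ + 780 ∷ + 1451 ∷ ⁻ 222 ∷ []) ∷ (⁻ 500 ∷ ⁻ 141 ∷ + 780 ∷ + 1750 ∷ + 2670 ∷ ⁻ 195 ∷ []) ∷ (⁻ 333 ∷ + 254 ∷ + 1451 ∷ + 2670 ∷ + 3774 ∷ ⁻ 267 ∷ []) ∷ (+ 377 ∷ ⁻ 250 ∷ ⁻ 222 ∷ ⁻ 195 ∷ ⁻ 267 ∷ + 914 ∷ []) ∷ [])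
      (+ 303 ∷ + 166 ∷ ⁻ 16 ∷ ⁻ 175 ∷ ⁻ 267 ∷ + 1084 ∷ []) (⁻ 665 ∷ ⁻ 164 ∷ + 0 ∷ + 0 ∷ ⁻ 285 ∷ ⁻ 4000 ∷ [])
      (⁻ 8119 ∷ + 906 ∷ ⁻ 940 ∷ ⁻ 3350 ∷ ⁻ 4774 ∷ ⁻ 2247 ∷ []) (⁻ 7999) (⁻ 2786 ∷ + 10950 ∷ + 1850 ∷ + 4664 ∷ ⁻ 5107 ∷ ⁻ 2514 ∷ []) (⁻ 8006) ∷
    mk 9 ((+ 3079 ∷ + 718 ∷ + 1023 ∷ + 238 ∷ ⁻ 333 ∷ ⁻ 267 ∷ []) ∷ (+ 718 ∷ ⁻ 666 ∷ + 83 ∷ ⁻ 42 ∷ ⁻ 12 ∷ ⁻ 250 ∷ []) ∷ (+ 1023 ∷ + 83 ∷ + 746 ∷ + 751 ∷ + 851 ∷ ⁻ 222 ∷ []) ∷ (+ 238 ∷ ⁻ 42 ∷ + 751 ∷ + 1105 ∷ + 1491 ∷ ⁻ 200 ∷ []) ∷ (⁻ 333 ∷ ⁻ 12 ∷ + 851 ∷ + 1491 ∷ + 2103 ∷ ⁻ 267 ∷ []) ∷ (⁻ 267 ∷ ⁻ 250 ∷ ⁻ 222 ∷ ⁻ 200 ∷ ⁻ 267 ∷ + 1077 ∷ []) ∷ [])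
      (+ 599 ∷ + 111 ∷ + 154 ∷ ⁻ 19 ∷ ⁻ 132 ∷ + 660 ∷ []) (⁻ 2737 ∷ + 0 ∷ ⁻ 989 ∷ ⁻ 456 ∷ ⁻ 257 ∷ ⁻ 2506 ∷ [])
      (⁻ 11079 ∷ + 2008 ∷ + 4280 ∷ + 394 ∷ ⁻ 3103 ∷ ⁻ 2410 ∷ []) (⁻ 7989) (⁻ 5746 ∷ + 5740 ∷ ⁻ 2079 ∷ ⁻ 1994 ∷ ⁻ 2488 ∷ ⁻ 2677 ∷ []) (⁻ 7990) ∷
    mk 9 ((+ 4544 ∷ + 2866 ∷ + 872 ∷ + 293 ∷ ⁻ 215 ∷ ⁻ 263 ∷ []) ∷ (+ 2866 ∷ + 2012 ∷ + 976 ∷ + 934 ∷ + 494 ∷ ⁻ 247 ∷ []) ∷ (+ 872 ∷ + 976 ∷ + 1032 ∷ + 1661 ∷ + 1423 ∷ + 123 ∷ []) ∷ (+ 293 ∷ + 934 ∷ + 1661 ∷ + 3802 ∷ + 2083 ∷ ⁻ 197 ∷ []) ∷ (⁻ 215 ∷ + 494 ∷ + 1423 ∷ + 2083 ∷ + 938 ∷ ⁻ 267 ∷ []) ∷ (⁻ 263 ∷ ⁻ 247 ∷ + 123 ∷ ⁻ 197 ∷ ⁻ 267 ∷ + 109 ∷ []) ∷ [])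
      (+ 829 ∷ + 417 ∷ ⁻ 129 ∷ ⁻ 254 ∷ + 90 ∷ + 1195 ∷ []) (⁻ 3930 ∷ ⁻ 2257 ∷ + 0 ∷ + 0 ∷ ⁻ 1009 ∷ ⁻ 4000 ∷ [])
      (+ 4822 ∷ + 5483 ∷ + 2446 ∷ ⁻ 5402 ∷ ⁻ 1938 ∷ ⁻ 1442 ∷ []) (⁻ 8043) (⁻ 7211 ∷ ⁻ 4012 ∷ ⁻ 2365 ∷ ⁻ 4691 ∷ ⁻ 678 ∷ ⁻ 1709 ∷ []) (⁻ 8115) ∷
    mk 9 ((⁻ 196 ∷ + 431 ∷ + 90 ∷ ⁻ 125 ∷ ⁻ 83 ∷ + 203 ∷ []) ∷ (+ 431 ∷ + 772 ∷ + 394 ∷ + 115 ∷ + 38 ∷ ⁻ 62 ∷ []) ∷ (+ 90 ∷ + 394 ∷ + 226 ∷ + 132 ∷ + 184 ∷ ⁻ 56 ∷ []) ∷ (⁻ 125 ∷ + 115 ∷ + 132 ∷ + 1451 ∷ + 355 ∷ ⁻ 50 ∷ []) ∷ (⁻ 83 ∷ + 38 ∷ + 184 ∷ + 355 ∷ + 558 ∷ ⁻ 67 ∷ []) ∷ (+ 203 ∷ ⁻ 62 ∷ ⁻ 56 ∷ ⁻ 50 ∷ ⁻ 67 ∷ + 71 ∷ []) ∷ [])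
      (+ 49 ∷ + 192 ∷ + 87 ∷ + 7 ∷ ⁻ 17 ∷ + 227 ∷ []) (+ 0 ∷ ⁻ 961 ∷ ⁻ 459 ∷ ⁻ 133 ∷ ⁻ 176 ∷ ⁻ 1000 ∷ [])
      (⁻ 529 ∷ + 409 ∷ + 1397 ∷ ⁻ 1851 ∷ ⁻ 808 ∷ ⁻ 404 ∷ []) (⁻ 1983) (⁻ 471 ∷ ⁻ 1272 ∷ ⁻ 559 ∷ + 519 ∷ ⁻ 12 ∷ ⁻ 471 ∷ []) (⁻ 1980) ∷
    []

  certs46 : List Certificate
  certs46 =
    mk 12 ((+ 8 ∷ + 12 ∷ + 0 ∷ + 16 ∷ + 0 ∷ + 0 ∷ []) ∷ (+ 12 ∷ + 18 ∷ ⁻ 1 ∷ + 24 ∷ + 0 ∷ + 0 ∷ []) ∷ (+ 0 ∷ ⁻ 1 ∷ + 0 ∷ ⁻ 1 ∷ ⁻ 1 ∷ + 7 ∷ []) ∷ (+ 16 ∷ + 24 ∷ ⁻ 1 ∷ + 70 ∷ ⁻ 1 ∷ ⁻ 1 ∷ []) ∷ (+ 0 ∷ + 0 ∷ ⁻ 1 ∷ ⁻ 1 ∷ + 84 ∷ ⁻ 1 ∷ []) ∷ (+ 0 ∷ + 0 ∷ + 7 ∷ ⁻ 1 ∷ ⁻ 1 ∷ ⁻ 1 ∷ []) ∷ [])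
      (⁻ 2 ∷ ⁻ 3 ∷ + 14 ∷ ⁻ 3 ∷ + 6 ∷ + 7 ∷ []) (+ 0 ∷ + 0 ∷ ⁻ 20 ∷ + 0 ∷ + 0 ∷ + 0 ∷ [])
      (⁻ 48 ∷ + 141 ∷ + 93 ∷ ⁻ 80 ∷ ⁻ 88 ∷ ⁻ 5 ∷ []) (⁻ 53) (⁻ 14 ∷ ⁻ 22 ∷ + 13 ∷ ⁻ 56 ∷ ⁻ 90 ∷ ⁻ 7 ∷ []) (⁻ 69) ∷
    mk 11 ((+ 4 ∷ + 5 ∷ + 8 ∷ + 9 ∷ + 4 ∷ + 3 ∷ []) ∷ (+ 5 ∷ + 6 ∷ + 9 ∷ + 10 ∷ + 3 ∷ + 1 ∷ []) ∷ (+ 8 ∷ + 9 ∷ + 12 ∷ + 13 ∷ + 17 ∷ + 1 ∷ []) ∷ (+ 9 ∷ + 10 ∷ + 13 ∷ + 14 ∷ + 3 ∷ + 0 ∷ []) ∷ (+ 4 ∷ + 3 ∷ + 17 ∷ + 3 ∷ + 16 ∷ + 0 ∷ []) ∷ (+ 3 ∷ + 1 ∷ + 1 ∷ + 0 ∷ + 0 ∷ + 0 ∷ []) ∷ [])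
      (⁻ 1 ∷ ⁻ 1 ∷ ⁻ 1 ∷ ⁻ 1 ∷ + 1 ∷ + 2 ∷ []) (+ 0 ∷ + 0 ∷ ⁻ 2 ∷ ⁻ 2 ∷ + 0 ∷ + 0 ∷ [])
      (⁻ 2 ∷ + 29 ∷ ⁻ 16 ∷ ⁻ 17 ∷ ⁻ 17 ∷ ⁻ 2 ∷ []) (⁻ 84) (⁻ 6 ∷ ⁻ 8 ∷ ⁻ 13 ∷ ⁻ 16 ∷ ⁻ 18 ∷ ⁻ 2 ∷ []) (⁻ 108) ∷
    mk 11 ((+ 24 ∷ + 36 ∷ + 57 ∷ + 50 ∷ + 56 ∷ ⁻ 2 ∷ []) ∷ (+ 36 ∷ + 54 ∷ + 79 ∷ + 75 ∷ + 84 ∷ ⁻ 3 ∷ []) ∷ (+ 57 ∷ + 79 ∷ + 107 ∷ + 103 ∷ + 237 ∷ ⁻ 4 ∷ []) ∷ (+ 50 ∷ + 75 ∷ + 103 ∷ + 257 ∷ + 110 ∷ ⁻ 4 ∷ []) ∷ (+ 56 ∷ + 84 ∷ + 237 ∷ + 110 ∷ + 120 ∷ ⁻ 4 ∷ []) ∷ (⁻ 2 ∷ ⁻ 3 ∷ ⁻ 4 ∷ ⁻ 4 ∷ ⁻ 4 ∷ ⁻ 3 ∷ []) ∷ [])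
      (⁻ 6 ∷ ⁻ 9 ∷ ⁻ 10 ∷ ⁻ 10 ∷ ⁻ 10 ∷ + 22 ∷ []) (+ 0 ∷ + 0 ∷ ⁻ 13 ∷ + 0 ∷ + 0 ∷ + 0 ∷ [])
      (⁻ 164 ∷ + 517 ∷ ⁻ 154 ∷ ⁻ 292 ∷ ⁻ 136 ∷ ⁻ 17 ∷ []) (⁻ 147) (⁻ 36 ∷ ⁻ 73 ∷ ⁻ 121 ∷ ⁻ 176 ∷ ⁻ 140 ∷ ⁻ 25 ∷ []) (⁻ 161) ∷
    mk 11 ((+ 49 ∷ + 76 ∷ ⁻ 27 ∷ ⁻ 17 ∷ + 97 ∷ ⁻ 17 ∷ []) ∷ (+ 76 ∷ + 120 ∷ ⁻ 20 ∷ ⁻ 16 ∷ + 156 ∷ ⁻ 13 ∷ []) ∷ (⁻ 27 ∷ ⁻ 20 ∷ ⁻ 9 ∷ ⁻ 17 ∷ ⁻ 19 ∷ + 73 ∷ []) ∷ (⁻ 17 ∷ ⁻ 16 ∷ ⁻ 17 ∷ ⁻ 14 ∷ ⁻ 25 ∷ + 120 ∷ []) ∷ (+ 97 ∷ + 156 ∷ ⁻ 19 ∷ ⁻ 25 ∷ + 144 ∷ ⁻ 25 ∷ []) ∷ (⁻ 17 ∷ ⁻ 13 ∷ + 73 ∷ + 120 ∷ ⁻ 25 ∷ + 74 ∷ []) ∷ [])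
      (⁻ 12 ∷ ⁻ 20 ∷ + 238 ∷ + 239 ∷ ⁻ 12 ∷ + 51 ∷ []) (+ 0 ∷ + 0 ∷ ⁻ 400 ∷ ⁻ 400 ∷ + 0 ∷ + 0 ∷ [])
      (⁻ 849 ∷ ⁻ 516 ∷ ⁻ 258 ∷ ⁻ 186 ∷ ⁻ 233 ∷ ⁻ 188 ∷ []) (⁻ 804) (⁻ 81 ∷ ⁻ 234 ∷ + 260 ∷ + 351 ∷ ⁻ 258 ∷ ⁻ 234 ∷ []) (⁻ 784) ∷
    mk 11 ((+ 228 ∷ + 521 ∷ + 688 ∷ + 617 ∷ + 754 ∷ ⁻ 165 ∷ []) ∷ (+ 521 ∷ + 1050 ∷ + 1390 ∷ + 1373 ∷ + 1668 ∷ + 379 ∷ []) ∷ (+ 688 ∷ + 1390 ∷ + 1840 ∷ + 1814 ∷ + 2204 ∷ + 482 ∷ []) ∷ (+ 617 ∷ + 1373 ∷ + 1814 ∷ + 19053 ∷ + 7317 ∷ ⁻ 248 ∷ []) ∷ (+ 754 ∷ + 1668 ∷ + 2204 ∷ + 7317 ∷ + 2476 ∷ ⁻ 250 ∷ []) ∷ (⁻ 165 ∷ + 379 ∷ + 482 ∷ ⁻ 248 ∷ ⁻ 250 ∷ ⁻ 190 ∷ []) ∷ [])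
      (⁻ 57 ∷ ⁻ 175 ∷ ⁻ 230 ∷ ⁻ 166 ∷ ⁻ 206 ∷ + 282 ∷ []) (+ 0 ∷ + 0 ∷ + 0 ∷ + 0 ∷ + 0 ∷ + 0 ∷ [])
      (⁻ 8228 ∷ + 26992 ∷ + 19586 ∷ ⁻ 21053 ∷ ⁻ 3365 ∷ ⁻ 953 ∷ []) (⁻ 8016) (+ 4017 ∷ ⁻ 2193 ∷ ⁻ 2640 ∷ ⁻ 9541 ∷ ⁻ 3619 ∷ ⁻ 1410 ∷ []) (⁻ 8087) ∷
    mk 10 ((+ 216 ∷ + 332 ∷ + 442 ∷ + 556 ∷ ⁻ 44 ∷ ⁻ 46 ∷ []) ∷ (+ 332 ∷ + 511 ∷ + 681 ∷ + 854 ∷ ⁻ 41 ∷ ⁻ 41 ∷ []) ∷ (+ 442 ∷ + 681 ∷ + 1524 ∷ + 1139 ∷ + 4629 ∷ ⁻ 56 ∷ []) ∷ (+ 556 ∷ + 854 ∷ + 1139 ∷ + 1430 ∷ ⁻ 62 ∷ ⁻ 59 ∷ []) ∷ (⁻ 44 ∷ ⁻ 41 ∷ + 4629 ∷ ⁻ 62 ∷ + 3222 ∷ ⁻ 62 ∷ []) ∷ (⁻ 46 ∷ ⁻ 41 ∷ ⁻ 56 ∷ ⁻ 59 ∷ ⁻ 62 ∷ ⁻ 48 ∷ []) ∷ [])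
      (⁻ 54 ∷ ⁻ 85 ∷ ⁻ 113 ∷ ⁻ 143 ∷ + 184 ∷ + 212 ∷ []) (+ 0 ∷ + 0 ∷ + 0 ∷ + 0 ∷ + 0 ∷ + 0 ∷ [])
      (⁻ 2216 ∷ + 8110 ∷ ⁻ 2191 ∷ + 656 ∷ ⁻ 3444 ∷ ⁻ 238 ∷ []) (⁻ 1971) (⁻ 182 ∷ ⁻ 844 ∷ ⁻ 1774 ∷ ⁻ 1680 ∷ ⁻ 3508 ∷ + 172 ∷ []) (⁻ 2063) ∷
    mk 10 ((+ 12 ∷ + 17 ∷ + 22 ∷ + 27 ∷ + 20 ∷ + 3 ∷ []) ∷ (+ 17 ∷ + 24 ∷ + 31 ∷ + 38 ∷ + 27 ∷ + 1 ∷ []) ∷ (+ 22 ∷ + 31 ∷ + 40 ∷ + 50 ∷ + 34 ∷ ⁻ 1 ∷ []) ∷ (+ 27 ∷ + 38 ∷ + 50 ∷ + 63 ∷ + 41 ∷ ⁻ 3 ∷ []) ∷ (+ 20 ∷ + 27 ∷ + 34 ∷ + 41 ∷ + 12 ∷ ⁻ 3 ∷ []) ∷ (+ 3 ∷ + 1 ∷ ⁻ 1 ∷ ⁻ 3 ∷ ⁻ 3 ∷ + 4 ∷ []) ∷ [])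
      (⁻ 3 ∷ ⁻ 4 ∷ ⁻ 5 ∷ ⁻ 6 ∷ ⁻ 1 ∷ + 9 ∷ []) (+ 0 ∷ + 0 ∷ + 0 ∷ + 0 ∷ + 0 ∷ + 0 ∷ [])
      (+ 3 ∷ ⁻ 29 ∷ ⁻ 70 ∷ ⁻ 85 ∷ ⁻ 22 ∷ ⁻ 17 ∷ []) (⁻ 156) (⁻ 34 ∷ ⁻ 39 ∷ ⁻ 50 ∷ ⁻ 67 ∷ ⁻ 25 ∷ ⁻ 22 ∷ []) (⁻ 214) ∷
    mk 10 ((+ 197 ∷ + 333 ∷ + 449 ∷ + 563 ∷ + 690 ∷ ⁻ 200 ∷ []) ∷ (+ 333 ∷ + 558 ∷ + 750 ∷ + 942 ∷ + 1149 ∷ ⁻ 165 ∷ []) ∷ (+ 449 ∷ + 750 ∷ + 1010 ∷ + 1266 ∷ + 1547 ∷ ⁻ 204 ∷ []) ∷ (+ 563 ∷ + 942 ∷ + 1266 ∷ + 1590 ∷ + 1939 ∷ ⁻ 247 ∷ []) ∷ (+ 690 ∷ + 1149 ∷ + 1547 ∷ + 1939 ∷ + 2370 ∷ ⁻ 250 ∷ []) ∷ (⁻ 200 ∷ ⁻ 165 ∷ ⁻ 204 ∷ ⁻ 247 ∷ ⁻ 250 ∷ + 739 ∷ []) ∷ [])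
      (⁻ 49 ∷ ⁻ 93 ∷ ⁻ 126 ∷ ⁻ 159 ∷ ⁻ 197 ∷ + 272 ∷ []) (+ 0 ∷ + 0 ∷ + 0 ∷ + 0 ∷ + 0 ∷ + 0 ∷ [])
      (⁻ 8197 ∷ ⁻ 3123 ∷ + 3051 ∷ + 244 ∷ ⁻ 3259 ∷ ⁻ 1882 ∷ []) (⁻ 8008) (+ 279 ∷ ⁻ 1334 ∷ ⁻ 2010 ∷ ⁻ 2590 ∷ ⁻ 3513 ∷ ⁻ 1392 ∷ []) (⁻ 8021) ∷
    mk 9 ((+ 444 ∷ + 111 ∷ + 277 ∷ + 57 ∷ ⁻ 28 ∷ ⁻ 25 ∷ []) ∷ (+ 111 ∷ ⁻ 63 ∷ + 105 ∷ + 37 ∷ + 47 ∷ + 36 ∷ []) ∷ (+ 277 ∷ + 105 ∷ + 129 ∷ + 17 ∷ ⁻ 18 ∷ ⁻ 22 ∷ []) ∷ (+ 57 ∷ + 37 ∷ + 17 ∷ + 130 ∷ + 171 ∷ ⁻ 25 ∷ []) ∷ (⁻ 28 ∷ + 47 ∷ ⁻ 18 ∷ + 171 ∷ + 246 ∷ ⁻ 24 ∷ []) ∷ (⁻ 25 ∷ + 36 ∷ ⁻ 22 ∷ ⁻ 25 ∷ ⁻ 24 ∷ + 58 ∷ []) ∷ [])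
      (+ 89 ∷ + 11 ∷ + 22 ∷ + 13 ∷ ⁻ 4 ∷ + 87 ∷ []) (⁻ 400 ∷ + 0 ∷ + 0 ∷ ⁻ 128 ∷ ⁻ 98 ∷ ⁻ 372 ∷ [])
      (⁻ 1244 ∷ ⁻ 337 ∷ + 928 ∷ + 894 ∷ ⁻ 335 ∷ ⁻ 172 ∷ []) (⁻ 805) (⁻ 711 ∷ + 134 ∷ ⁻ 289 ∷ ⁻ 230 ∷ ⁻ 360 ∷ ⁻ 218 ∷ []) (⁻ 795) ∷
    mk 9 ((+ 3070 ∷ + 567 ∷ ⁻ 27 ∷ ⁻ 667 ∷ ⁻ 285 ∷ ⁻ 266 ∷ []) ∷ (+ 567 ∷ ⁻ 667 ∷ ⁻ 443 ∷ ⁻ 453 ∷ + 507 ∷ + 300 ∷ []) ∷ (⁻ 27 ∷ ⁻ 443 ∷ + 146 ∷ + 314 ∷ + 1402 ∷ + 516 ∷ []) ∷ (⁻ 667 ∷ ⁻ 453 ∷ + 314 ∷ + 9931 ∷ + 5182 ∷ ⁻ 250 ∷ []) ∷ (⁻ 285 ∷ + 507 ∷ + 1402 ∷ + 5182 ∷ + 2417 ∷ ⁻ 250 ∷ []) ∷ (⁻ 266 ∷ + 300 ∷ + 516 ∷ ⁻ 250 ∷ ⁻ 250 ∷ + 629 ∷ []) ∷ [])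
      (+ 799 ∷ + 165 ∷ ⁻ 18 ∷ ⁻ 13 ∷ + 42 ∷ + 903 ∷ []) (⁻ 3133 ∷ ⁻ 161 ∷ + 0 ∷ ⁻ 169 ∷ ⁻ 1460 ∷ ⁻ 4000 ∷ [])
      (⁻ 11070 ∷ ⁻ 3333 ∷ + 2564 ∷ ⁻ 11931 ∷ ⁻ 3306 ∷ ⁻ 1772 ∷ []) (⁻ 8013) (⁻ 5737 ∷ + 791 ∷ ⁻ 1746 ∷ ⁻ 2418 ∷ + 302 ∷ ⁻ 2229 ∷ []) (⁻ 8001) ∷
    mk 9 ((+ 444 ∷ + 321 ∷ + 50 ∷ ⁻ 33 ∷ ⁻ 27 ∷ ⁻ 24 ∷ []) ∷ (+ 321 ∷ ⁻ 67 ∷ ⁻ 67 ∷ ⁻ 50 ∷ ⁻ 26 ∷ ⁻ 25 ∷ []) ∷ (+ 50 ∷ ⁻ 67 ∷ + 24 ∷ + 39 ∷ + 135 ∷ + 42 ∷ []) ∷ (⁻ 33 ∷ ⁻ 50 ∷ + 39 ∷ + 605 ∷ + 160 ∷ ⁻ 25 ∷ []) ∷ (⁻ 27 ∷ ⁻ 26 ∷ + 135 ∷ + 160 ∷ + 256 ∷ ⁻ 25 ∷ []) ∷ (⁻ 24 ∷ ⁻ 25 ∷ + 42 ∷ ⁻ 25 ∷ ⁻ 25 ∷ + 49 ∷ []) ∷ [])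
      (+ 89 ∷ + 23 ∷ ⁻ 3 ∷ ⁻ 6 ∷ ⁻ 5 ∷ + 89 ∷ []) (⁻ 400 ∷ + 0 ∷ + 0 ∷ + 0 ∷ ⁻ 97 ∷ ⁻ 377 ∷ [])
      (⁻ 1244 ∷ + 691 ∷ + 732 ∷ + 813 ∷ ⁻ 345 ∷ ⁻ 163 ∷ []) (⁻ 807) (⁻ 711 ∷ + 910 ∷ ⁻ 184 ∷ ⁻ 705 ∷ ⁻ 370 ∷ ⁻ 185 ∷ []) (⁻ 823) ∷
    mk 9 ((+ 440 ∷ + 141 ∷ + 226 ∷ ⁻ 67 ∷ ⁻ 29 ∷ ⁻ 2 ∷ []) ∷ (+ 141 ∷ ⁻ 67 ∷ + 60 ∷ ⁻ 50 ∷ ⁻ 27 ∷ ⁻ 25 ∷ []) ∷ (+ 226 ∷ + 60 ∷ + 128 ∷ ⁻ 33 ∷ + 24 ∷ ⁻ 20 ∷ []) ∷ (⁻ 67 ∷ ⁻ 50 ∷ ⁻ 33 ∷ + 1583 ∷ + 18 ∷ ⁻ 25 ∷ []) ∷ (⁻ 29 ∷ ⁻ 27 ∷ + 24 ∷ + 18 ∷ + 112 ∷ + 14 ∷ []) ∷ (⁻ 2 ∷ ⁻ 25 ∷ ⁻ 20 ∷ ⁻ 25 ∷ + 14 ∷ ⁻ 19 ∷ []) ∷ [])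
      (+ 90 ∷ + 27 ∷ + 61 ∷ + 9 ∷ + 14 ∷ + 64 ∷ []) (⁻ 400 ∷ + 0 ∷ ⁻ 308 ∷ + 0 ∷ ⁻ 138 ∷ ⁻ 355 ∷ [])
      (⁻ 259 ∷ + 2534 ∷ + 575 ∷ ⁻ 1783 ∷ + 746 ∷ ⁻ 95 ∷ []) (⁻ 801) (⁻ 707 ∷ + 939 ∷ ⁻ 288 ∷ ⁻ 736 ∷ ⁻ 226 ∷ ⁻ 141 ∷ []) (⁻ 794) ∷
    mk 9 ((⁻ 48 ∷ ⁻ 42 ∷ + 29 ∷ + 341 ∷ ⁻ 12 ∷ ⁻ 10 ∷ []) ∷ (⁻ 42 ∷ + 141 ∷ + 58 ∷ ⁻ 25 ∷ + 32 ∷ ⁻ 10 ∷ []) ∷ (+ 29 ∷ + 58 ∷ + 127 ∷ ⁻ 8 ∷ + 89 ∷ ⁻ 10 ∷ []) ∷ (+ 341 ∷ ⁻ 25 ∷ ⁻ 8 ∷ ⁻ 7 ∷ ⁻ 12 ∷ ⁻ 12 ∷ []) ∷ (⁻ 12 ∷ + 32 ∷ + 89 ∷ ⁻ 12 ∷ + 40 ∷ ⁻ 12 ∷ []) ∷ (⁻ 10 ∷ ⁻ 10 ∷ ⁻ 10 ∷ ⁻ 12 ∷ ⁻ 12 ∷ ⁻ 10 ∷ []) ∷ [])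
      (+ 12 ∷ + 3 ∷ + 7 ∷ + 70 ∷ + 10 ∷ + 63 ∷ []) (+ 0 ∷ + 0 ∷ ⁻ 91 ∷ ⁻ 200 ∷ ⁻ 80 ∷ ⁻ 200 ∷ [])
      (+ 1137 ∷ + 418 ∷ + 95 ∷ + 638 ∷ ⁻ 84 ∷ ⁻ 47 ∷ []) (⁻ 426) (⁻ 85 ∷ + 1743 ∷ ⁻ 207 ∷ + 174 ∷ + 1033 ∷ ⁻ 70 ∷ []) (⁻ 415) ∷
    mk 9 ((+ 932 ∷ ⁻ 364 ∷ + 741 ∷ + 441 ∷ ⁻ 286 ∷ + 168 ∷ []) ∷ (⁻ 364 ∷ + 5461 ∷ + 176 ∷ + 318 ∷ + 122 ∷ ⁻ 248 ∷ []) ∷ (+ 741 ∷ + 176 ∷ + 1231 ∷ + 1420 ∷ + 1365 ∷ ⁻ 222 ∷ []) ∷ (+ 441 ∷ + 318 ∷ + 1420 ∷ + 1930 ∷ + 2283 ∷ ⁻ 248 ∷ []) ∷ (⁻ 286 ∷ + 122 ∷ + 1365 ∷ + 2283 ∷ + 3138 ∷ ⁻ 250 ∷ []) ∷ (+ 168 ∷ ⁻ 248 ∷ ⁻ 222 ∷ ⁻ 248 ∷ ⁻ 250 ∷ + 711 ∷ []) ∷ [])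
      (+ 464 ∷ + 183 ∷ + 294 ∷ + 134 ∷ ⁻ 116 ∷ + 989 ∷ []) (⁻ 1394 ∷ + 0 ∷ ⁻ 1790 ∷ ⁻ 1635 ∷ ⁻ 872 ∷ ⁻ 4000 ∷ [])
      (⁻ 8932 ∷ ⁻ 9461 ∷ + 1186 ∷ ⁻ 1989 ∷ ⁻ 4027 ∷ ⁻ 1854 ∷ []) (⁻ 7992) (⁻ 3599 ∷ + 886 ∷ ⁻ 2831 ∷ ⁻ 2930 ∷ ⁻ 440 ∷ ⁻ 2311 ∷ []) (⁻ 7995) ∷
    mk 9 ((+ 346 ∷ + 81 ∷ + 240 ∷ ⁻ 27 ∷ ⁻ 28 ∷ ⁻ 25 ∷ []) ∷ (+ 81 ∷ ⁻ 67 ∷ ⁻ 50 ∷ ⁻ 27 ∷ + 35 ∷ ⁻ 25 ∷ []) ∷ (+ 240 ∷ ⁻ 50 ∷ ⁻ 40 ∷ ⁻ 33 ∷ ⁻ 20 ∷ ⁻ 22 ∷ []) ∷ (⁻ 27 ∷ ⁻ 27 ∷ ⁻ 33 ∷ + 140 ∷ + 244 ∷ ⁻ 23 ∷ []) ∷ (⁻ 28 ∷ + 35 ∷ ⁻ 20 ∷ + 244 ∷ + 360 ∷ ⁻ 24 ∷ []) ∷ (⁻ 25 ∷ ⁻ 25 ∷ ⁻ 22 ∷ ⁻ 23 ∷ ⁻ 24 ∷ + 64 ∷ []) ∷ [])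
      (+ 76 ∷ + 18 ∷ + 27 ∷ ⁻ 14 ∷ ⁻ 19 ∷ + 101 ∷ []) (⁻ 325 ∷ ⁻ 20 ∷ + 0 ∷ + 0 ∷ ⁻ 65 ∷ ⁻ 384 ∷ [])
      (⁻ 1146 ∷ + 340 ∷ + 999 ∷ + 419 ∷ ⁻ 449 ∷ ⁻ 178 ∷ []) (⁻ 811) (⁻ 613 ∷ + 927 ∷ + 585 ∷ ⁻ 240 ∷ ⁻ 474 ∷ ⁻ 151 ∷ []) (⁻ 820) ∷
    mk 9 ((+ 443 ∷ + 125 ∷ + 162 ∷ + 57 ∷ ⁻ 29 ∷ ⁻ 27 ∷ []) ∷ (+ 125 ∷ ⁻ 66 ∷ + 29 ∷ + 7 ∷ + 1 ∷ ⁻ 24 ∷ []) ∷ (+ 162 ∷ + 29 ∷ + 110 ∷ + 101 ∷ + 103 ∷ ⁻ 19 ∷ []) ∷ (+ 57 ∷ + 7 ∷ + 101 ∷ + 132 ∷ + 171 ∷ ⁻ 23 ∷ []) ∷ (⁻ 29 ∷ + 1 ∷ + 103 ∷ + 171 ∷ + 246 ∷ ⁻ 25 ∷ []) ∷ (⁻ 27 ∷ ⁻ 24 ∷ ⁻ 19 ∷ ⁻ 23 ∷ ⁻ 25 ∷ + 58 ∷ []) ∷ [])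
      (+ 75 ∷ + 11 ∷ + 18 ∷ ⁻ 2 ∷ ⁻ 18 ∷ + 73 ∷ []) (⁻ 371 ∷ + 0 ∷ ⁻ 127 ∷ ⁻ 56 ∷ ⁻ 12 ∷ ⁻ 272 ∷ [])
      (⁻ 1243 ∷ + 495 ∷ + 932 ∷ + 892 ∷ ⁻ 335 ∷ ⁻ 172 ∷ []) (⁻ 788) (⁻ 710 ∷ + 728 ∷ ⁻ 270 ∷ ⁻ 232 ∷ ⁻ 360 ∷ ⁻ 218 ∷ []) (⁻ 781) ∷
    mk 9 ((+ 3070 ∷ + 2117 ∷ ⁻ 27 ∷ + 754 ∷ ⁻ 285 ∷ ⁻ 266 ∷ []) ∷ (+ 2117 ∷ + 1593 ∷ + 267 ∷ + 972 ∷ + 377 ∷ ⁻ 250 ∷ []) ∷ (⁻ 27 ∷ + 267 ∷ + 146 ∷ + 1166 ∷ + 1402 ∷ + 516 ∷ []) ∷ (+ 754 ∷ + 972 ∷ + 1166 ∷ + 1612 ∷ + 1786 ∷ ⁻ 249 ∷ []) ∷ (⁻ 285 ∷ + 377 ∷ + 1402 ∷ + 1786 ∷ + 2417 ∷ ⁻ 250 ∷ []) ∷ (⁻ 266 ∷ ⁻ 250 ∷ + 516 ∷ ⁻ 249 ∷ ⁻ 250 ∷ + 629 ∷ []) ∷ [])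
      (+ 799 ∷ + 585 ∷ ⁻ 18 ∷ + 270 ∷ + 42 ∷ + 903 ∷ []) (⁻ 3133 ∷ ⁻ 2550 ∷ + 0 ∷ ⁻ 2156 ∷ ⁻ 1460 ∷ ⁻ 4000 ∷ [])
      (⁻ 11070 ∷ ⁻ 998 ∷ + 2564 ∷ + 7141 ∷ ⁻ 3306 ∷ ⁻ 1772 ∷ []) (⁻ 8007) (⁻ 5737 ∷ ⁻ 3593 ∷ ⁻ 1746 ∷ ⁻ 2612 ∷ + 302 ∷ ⁻ 2229 ∷ []) (⁻ 7998) ∷
    mk 9 ((⁻ 8 ∷ + 36 ∷ + 15 ∷ + 2 ∷ + 2 ∷ + 26 ∷ []) ∷ (+ 36 ∷ + 61 ∷ + 40 ∷ + 25 ∷ + 16 ∷ ⁻ 6 ∷ []) ∷ (+ 15 ∷ + 40 ∷ + 39 ∷ + 42 ∷ + 43 ∷ ⁻ 6 ∷ []) ∷ (+ 2 ∷ + 25 ∷ + 42 ∷ + 230 ∷ + 72 ∷ ⁻ 6 ∷ []) ∷ (+ 2 ∷ + 16 ∷ + 43 ∷ + 72 ∷ + 84 ∷ ⁻ 6 ∷ []) ∷ (+ 26 ∷ ⁻ 6 ∷ ⁻ 6 ∷ ⁻ 6 ∷ ⁻ 6 ∷ ⁻ 1 ∷ []) ∷ [])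
      (+ 2 ∷ + 12 ∷ + 2 ∷ ⁻ 6 ∷ ⁻ 7 ∷ + 30 ∷ []) (+ 0 ∷ ⁻ 66 ∷ ⁻ 27 ∷ + 0 ∷ + 0 ∷ ⁻ 100 ∷ [])
      (⁻ 102 ∷ + 163 ∷ + 199 ∷ ⁻ 280 ∷ ⁻ 83 ∷ ⁻ 28 ∷ []) (⁻ 206) (⁻ 59 ∷ ⁻ 111 ∷ ⁻ 79 ∷ ⁻ 255 ∷ ⁻ 113 ∷ ⁻ 39 ∷ []) (⁻ 204) ∷
    mk 9 ((+ 392 ∷ + 81 ∷ + 261 ∷ ⁻ 17 ∷ ⁻ 28 ∷ ⁻ 27 ∷ []) ∷ (+ 81 ∷ ⁻ 14 ∷ + 119 ∷ ⁻ 32 ∷ + 30 ∷ ⁻ 24 ∷ []) ∷ (+ 261 ∷ + 119 ∷ + 272 ∷ + 147 ∷ + 184 ∷ ⁻ 22 ∷ []) ∷ (⁻ 17 ∷ ⁻ 32 ∷ + 147 ∷ + 144 ∷ + 246 ∷ ⁻ 24 ∷ []) ∷ (⁻ 28 ∷ + 30 ∷ + 184 ∷ + 246 ∷ + 360 ∷ ⁻ 25 ∷ []) ∷ (⁻ 27 ∷ ⁻ 24 ∷ ⁻ 22 ∷ ⁻ 24 ∷ ⁻ 25 ∷ + 65 ∷ []) ∷ [])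
      (+ 83 ∷ + 16 ∷ + 48 ∷ ⁻ 12 ∷ ⁻ 18 ∷ + 104 ∷ []) (⁻ 362 ∷ + 0 ∷ ⁻ 327 ∷ ⁻ 12 ∷ ⁻ 72 ∷ ⁻ 400 ∷ [])
      (⁻ 1192 ∷ + 227 ∷ + 192 ∷ + 372 ∷ ⁻ 449 ∷ ⁻ 179 ∷ []) (⁻ 787) (⁻ 659 ∷ + 1052 ∷ ⁻ 432 ∷ ⁻ 244 ∷ ⁻ 474 ∷ ⁻ 225 ∷ []) (⁻ 799) ∷
    mk 9 ((⁻ 8 ∷ + 0 ∷ ⁻ 2 ∷ + 0 ∷ ⁻ 2 ∷ ⁻ 3 ∷ []) ∷ (+ 0 ∷ ⁻ 8 ∷ + 1 ∷ ⁻ 5 ∷ ⁻ 3 ∷ ⁻ 3 ∷ []) ∷ (⁻ 2 ∷ + 1 ∷ + 24 ∷ + 35 ∷ + 24 ∷ ⁻ 2 ∷ []) ∷ (+ 0 ∷ ⁻ 5 ∷ + 35 ∷ + 50 ∷ + 34 ∷ ⁻ 3 ∷ []) ∷ (⁻ 2 ∷ ⁻ 3 ∷ + 24 ∷ + 34 ∷ + 4 ∷ ⁻ 2 ∷ []) ∷ (⁻ 3 ∷ ⁻ 3 ∷ ⁻ 2 ∷ ⁻ 3 ∷ ⁻ 2 ∷ ⁻ 2 ∷ []) ∷ [])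
      (+ 2 ∷ + 4 ∷ ⁻ 3 ∷ ⁻ 5 ∷ + 2 ∷ + 17 ∷ []) (+ 0 ∷ + 0 ∷ + 0 ∷ + 0 ∷ ⁻ 14 ∷ ⁻ 45 ∷ [])
      (⁻ 82 ∷ + 450 ∷ + 41 ∷ + 114 ∷ + 315 ∷ ⁻ 11 ∷ []) (⁻ 92) (+ 144 ∷ + 119 ∷ ⁻ 42 ∷ ⁻ 61 ∷ ⁻ 17 ∷ ⁻ 16 ∷ []) (⁻ 94) ∷
    mk 9 ((+ 2393 ∷ ⁻ 9 ∷ + 1134 ∷ + 734 ∷ ⁻ 285 ∷ ⁻ 266 ∷ []) ∷ (⁻ 9 ∷ + 3718 ∷ + 68 ∷ + 280 ∷ + 1 ∷ ⁻ 250 ∷ []) ∷ (+ 1134 ∷ + 68 ∷ + 1133 ∷ + 1250 ∷ + 1006 ∷ ⁻ 222 ∷ []) ∷ (+ 734 ∷ + 280 ∷ + 1250 ∷ + 1572 ∷ + 1662 ∷ ⁻ 246 ∷ []) ∷ (⁻ 285 ∷ + 1 ∷ + 1006 ∷ + 1662 ∷ + 2214 ∷ ⁻ 244 ∷ []) ∷ (⁻ 266 ∷ ⁻ 250 ∷ ⁻ 222 ∷ ⁻ 246 ∷ ⁻ 244 ∷ + 837 ∷ []) ∷ [])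
      (+ 742 ∷ + 232 ∷ + 428 ∷ + 326 ∷ + 95 ∷ + 876 ∷ []) (⁻ 2680 ∷ + 0 ∷ ⁻ 2277 ∷ ⁻ 2416 ∷ ⁻ 1677 ∷ ⁻ 4000 ∷ [])
      (⁻ 10393 ∷ ⁻ 7622 ∷ + 2660 ∷ + 3971 ∷ ⁻ 3103 ∷ ⁻ 1980 ∷ []) (⁻ 8007) (⁻ 5060 ∷ + 3109 ∷ ⁻ 2733 ∷ ⁻ 2572 ∷ + 1492 ∷ ⁻ 2437 ∷ []) (⁻ 8013) ∷
    mk 9 ((⁻ 504 ∷ ⁻ 1166 ∷ ⁻ 491 ∷ ⁻ 447 ∷ ⁻ 285 ∷ ⁻ 136 ∷ []) ∷ (⁻ 1166 ∷ + 3409 ∷ ⁻ 615 ∷ ⁻ 307 ∷ + 101 ∷ ⁻ 250 ∷ []) ∷ (⁻ 491 ∷ ⁻ 615 ∷ + 122 ∷ + 456 ∷ + 872 ∷ ⁻ 219 ∷ []) ∷ (⁻ 447 ∷ ⁻ 307 ∷ + 456 ∷ + 930 ∷ + 1468 ∷ ⁻ 248 ∷ []) ∷ (⁻ 285 ∷ + 101 ∷ + 872 ∷ + 1468 ∷ + 2110 ∷ ⁻ 249 ∷ []) ∷ (⁻ 136 ∷ ⁻ 250 ∷ ⁻ 219 ∷ ⁻ 248 ∷ ⁻ 249 ∷ + 851 ∷ []) ∷ [])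
      (+ 434 ∷ + 240 ∷ + 284 ∷ + 214 ∷ + 162 ∷ + 857 ∷ []) (⁻ 616 ∷ + 0 ∷ ⁻ 1197 ∷ ⁻ 1535 ∷ ⁻ 2027 ∷ ⁻ 4000 ∷ [])
      (⁻ 7496 ∷ ⁻ 7409 ∷ + 5217 ∷ + 6369 ∷ ⁻ 2999 ∷ ⁻ 1994 ∷ []) (⁻ 8005) (⁻ 2163 ∷ ⁻ 1454 ∷ ⁻ 1722 ∷ ⁻ 1930 ∷ ⁻ 3253 ∷ + 3543 ∷ []) (⁻ 8029) ∷
    []

  certs47 : List Certificate
  certs47 =
    mk 11 ((+ 21 ∷ + 31 ∷ + 44 ∷ ⁻ 3 ∷ + 42 ∷ ⁻ 2 ∷ []) ∷ (+ 31 ∷ + 48 ∷ + 65 ∷ ⁻ 2 ∷ + 66 ∷ ⁻ 1 ∷ []) ∷ (+ 44 ∷ + 65 ∷ + 86 ∷ ⁻ 3 ∷ + 87 ∷ ⁻ 3 ∷ []) ∷ (⁻ 3 ∷ ⁻ 2 ∷ ⁻ 3 ∷ ⁻ 2 ∷ ⁻ 4 ∷ + 47 ∷ []) ∷ (+ 42 ∷ + 66 ∷ + 87 ∷ ⁻ 4 ∷ + 72 ∷ ⁻ 4 ∷ []) ∷ (⁻ 2 ∷ ⁻ 1 ∷ ⁻ 3 ∷ + 47 ∷ ⁻ 4 ∷ ⁻ 3 ∷ []) ∷ [])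
      (⁻ 5 ∷ ⁻ 8 ∷ ⁻ 10 ∷ + 15 ∷ ⁻ 6 ∷ + 19 ∷ []) (+ 0 ∷ + 0 ∷ ⁻ 3 ∷ + 0 ∷ + 0 ∷ + 0 ∷ [])
      (⁻ 161 ∷ + 162 ∷ + 473 ∷ ⁻ 33 ∷ ⁻ 90 ∷ ⁻ 17 ∷ []) (⁻ 159) (⁻ 43 ∷ ⁻ 68 ∷ ⁻ 100 ∷ + 42 ∷ + 78 ∷ ⁻ 25 ∷ []) (⁻ 140) ∷
    mk 10 ((+ 32 ∷ + 54 ∷ + 221 ∷ + 82 ∷ + 98 ∷ ⁻ 8 ∷ []) ∷ (+ 54 ∷ + 90 ∷ ⁻ 19 ∷ + 138 ∷ + 165 ∷ + 9 ∷ []) ∷ (+ 221 ∷ ⁻ 19 ∷ ⁻ 10 ∷ ⁻ 10 ∷ ⁻ 10 ∷ ⁻ 11 ∷ []) ∷ (+ 82 ∷ + 138 ∷ ⁻ 10 ∷ + 212 ∷ + 807 ∷ ⁻ 10 ∷ []) ∷ (+ 98 ∷ + 165 ∷ ⁻ 10 ∷ + 807 ∷ + 304 ∷ ⁻ 12 ∷ []) ∷ (⁻ 8 ∷ + 9 ∷ ⁻ 11 ∷ ⁻ 10 ∷ ⁻ 12 ∷ ⁻ 10 ∷ []) ∷ [])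
      (⁻ 8 ∷ ⁻ 15 ∷ + 93 ∷ ⁻ 21 ∷ ⁻ 25 ∷ + 32 ∷ []) (+ 0 ∷ + 0 ∷ ⁻ 200 ∷ + 0 ∷ + 0 ∷ + 0 ∷ [])
      (⁻ 432 ∷ + 330 ∷ + 1464 ∷ ⁻ 312 ∷ ⁻ 354 ∷ ⁻ 47 ∷ []) (⁻ 411) (+ 81 ∷ ⁻ 170 ∷ + 383 ∷ + 4 ∷ + 12 ∷ ⁻ 70 ∷ []) (⁻ 420) ∷
    mk 10 ((⁻ 4 ∷ ⁻ 5 ∷ ⁻ 4 ∷ ⁻ 7 ∷ ⁻ 8 ∷ ⁻ 9 ∷ []) ∷ (⁻ 5 ∷ + 940 ∷ ⁻ 4 ∷ ⁻ 8 ∷ ⁻ 9 ∷ ⁻ 10 ∷ []) ∷ (⁻ 4 ∷ ⁻ 4 ∷ + 0 ∷ ⁻ 4 ∷ ⁻ 4 ∷ ⁻ 4 ∷ []) ∷ (⁻ 7 ∷ ⁻ 8 ∷ ⁻ 4 ∷ + 911 ∷ + 1002 ∷ ⁻ 10 ∷ []) ∷ (⁻ 8 ∷ ⁻ 9 ∷ ⁻ 4 ∷ + 1002 ∷ + 326 ∷ ⁻ 12 ∷ []) ∷ (⁻ 9 ∷ ⁻ 10 ∷ ⁻ 4 ∷ ⁻ 10 ∷ ⁻ 12 ∷ ⁻ 10 ∷ []) ∷ [])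
      (+ 1 ∷ + 1 ∷ + 0 ∷ + 1 ∷ + 1 ∷ + 1 ∷ []) (+ 0 ∷ + 0 ∷ + 0 ∷ + 0 ∷ + 0 ∷ + 0 ∷ [])
      (⁻ 396 ∷ ⁻ 1140 ∷ + 1814 ∷ ⁻ 1011 ∷ ⁻ 376 ∷ ⁻ 47 ∷ []) (⁻ 381) (+ 75 ∷ ⁻ 900 ∷ ⁻ 57 ∷ ⁻ 931 ∷ ⁻ 346 ∷ ⁻ 70 ∷ []) (+ 890) ∷
    mk 10 ((+ 8 ∷ + 13 ∷ + 17 ∷ + 23 ∷ + 0 ∷ ⁻ 2 ∷ []) ∷ (+ 13 ∷ + 19 ∷ + 26 ∷ + 33 ∷ + 11 ∷ ⁻ 2 ∷ []) ∷ (+ 17 ∷ + 26 ∷ + 34 ∷ + 43 ∷ + 1 ∷ ⁻ 2 ∷ []) ∷ (+ 23 ∷ + 33 ∷ + 43 ∷ + 51 ∷ ⁻ 2 ∷ ⁻ 2 ∷ []) ∷ (+ 0 ∷ + 11 ∷ + 1 ∷ ⁻ 2 ∷ ⁻ 1 ∷ + 19 ∷ []) ∷ (⁻ 2 ∷ ⁻ 2 ∷ ⁻ 2 ∷ ⁻ 2 ∷ + 19 ∷ ⁻ 1 ∷ []) ∷ [])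
      (⁻ 2 ∷ ⁻ 3 ∷ ⁻ 4 ∷ ⁻ 4 ∷ + 6 ∷ + 8 ∷ []) (+ 0 ∷ + 0 ∷ + 0 ∷ ⁻ 4 ∷ + 0 ∷ + 0 ∷ [])
      (⁻ 68 ∷ + 73 ∷ + 217 ∷ ⁻ 66 ∷ ⁻ 7 ∷ ⁻ 8 ∷ []) (⁻ 55) (⁻ 9 ∷ ⁻ 24 ∷ ⁻ 36 ∷ ⁻ 58 ∷ ⁻ 8 ∷ ⁻ 11 ∷ []) (⁻ 46) ∷
    mk 9 ((⁻ 132 ∷ ⁻ 105 ∷ ⁻ 80 ∷ ⁻ 66 ∷ ⁻ 31 ∷ ⁻ 24 ∷ []) ∷ (⁻ 105 ∷ ⁻ 64 ∷ ⁻ 27 ∷ + 2 ∷ + 48 ∷ ⁻ 17 ∷ []) ∷ (⁻ 80 ∷ ⁻ 27 ∷ + 20 ∷ + 62 ∷ + 117 ∷ ⁻ 22 ∷ []) ∷ (⁻ 66 ∷ + 2 ∷ + 62 ∷ + 125 ∷ + 188 ∷ ⁻ 20 ∷ []) ∷ (⁻ 31 ∷ + 48 ∷ + 117 ∷ + 188 ∷ + 678 ∷ ⁻ 23 ∷ []) ∷ (⁻ 24 ∷ ⁻ 17 ∷ ⁻ 22 ∷ ⁻ 20 ∷ ⁻ 23 ∷ ⁻ 19 ∷ []) ∷ [])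
      (+ 33 ∷ + 26 ∷ + 21 ∷ + 13 ∷ + 9 ∷ + 88 ∷ []) (+ 0 ∷ ⁻ 46 ∷ ⁻ 94 ∷ ⁻ 125 ∷ ⁻ 185 ∷ ⁻ 383 ∷ [])
      (⁻ 668 ∷ + 1611 ∷ + 4067 ∷ + 3515 ∷ ⁻ 778 ∷ ⁻ 95 ∷ []) (⁻ 864) (+ 53 ∷ ⁻ 136 ∷ ⁻ 180 ∷ ⁻ 225 ∷ ⁻ 792 ∷ + 735 ∷ []) (⁻ 921) ∷
    mk 9 ((⁻ 332 ∷ ⁻ 393 ∷ ⁻ 238 ∷ ⁻ 167 ∷ ⁻ 81 ∷ ⁻ 65 ∷ []) ∷ (⁻ 393 ∷ + 4700 ∷ ⁻ 205 ∷ ⁻ 125 ∷ + 33 ∷ ⁻ 50 ∷ []) ∷ (⁻ 238 ∷ ⁻ 205 ∷ ⁻ 52 ∷ ⁻ 100 ∷ + 171 ∷ ⁻ 62 ∷ []) ∷ (⁻ 167 ∷ ⁻ 125 ∷ ⁻ 100 ∷ ⁻ 36 ∷ + 181 ∷ + 588 ∷ []) ∷ (⁻ 81 ∷ + 33 ∷ + 171 ∷ + 181 ∷ + 434 ∷ ⁻ 61 ∷ []) ∷ (⁻ 65 ∷ ⁻ 50 ∷ ⁻ 62 ∷ + 588 ∷ ⁻ 61 ∷ ⁻ 48 ∷ []) ∷ [])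
      (+ 99 ∷ + 64 ∷ + 76 ∷ + 17 ∷ + 66 ∷ + 202 ∷ []) (⁻ 32 ∷ + 0 ∷ ⁻ 278 ∷ + 0 ∷ ⁻ 613 ∷ ⁻ 1000 ∷ [])
      (⁻ 1668 ∷ ⁻ 5700 ∷ + 10340 ∷ ⁻ 464 ∷ + 1849 ∷ ⁻ 238 ∷ []) (⁻ 1982) (⁻ 335 ∷ ⁻ 4132 ∷ ⁻ 348 ∷ ⁻ 214 ∷ ⁻ 720 ∷ + 2121 ∷ []) (⁻ 2036) ∷
    mk 9 ((⁻ 8 ∷ ⁻ 2 ∷ + 51 ∷ + 10 ∷ ⁻ 6 ∷ ⁻ 2 ∷ []) ∷ (⁻ 2 ∷ + 329 ∷ + 64 ∷ + 106 ∷ ⁻ 6 ∷ ⁻ 3 ∷ []) ∷ (+ 51 ∷ + 64 ∷ + 107 ∷ + 91 ∷ ⁻ 4 ∷ + 0 ∷ []) ∷ (+ 10 ∷ + 106 ∷ + 91 ∷ + 100 ∷ ⁻ 4 ∷ ⁻ 4 ∷ []) ∷ (⁻ 6 ∷ ⁻ 6 ∷ ⁻ 4 ∷ ⁻ 4 ∷ ⁻ 2 ∷ + 69 ∷ []) ∷ (⁻ 2 ∷ ⁻ 3 ∷ + 0 ∷ ⁻ 4 ∷ + 69 ∷ ⁻ 3 ∷ []) ∷ [])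
      (+ 2 ∷ ⁻ 2 ∷ + 3 ∷ ⁻ 10 ∷ + 13 ∷ + 29 ∷ []) (+ 0 ∷ + 0 ∷ ⁻ 65 ∷ + 0 ∷ + 0 ∷ ⁻ 70 ∷ [])
      (+ 464 ∷ ⁻ 399 ∷ ⁻ 177 ∷ ⁻ 135 ∷ ⁻ 16 ∷ ⁻ 17 ∷ []) (⁻ 142) (⁻ 39 ∷ + 83 ∷ ⁻ 135 ∷ ⁻ 118 ∷ + 33 ∷ ⁻ 25 ∷ []) (⁻ 169) ∷
    mk 9 ((⁻ 52 ∷ ⁻ 19 ∷ ⁻ 16 ∷ ⁻ 32 ∷ + 49 ∷ ⁻ 13 ∷ []) ∷ (⁻ 19 ∷ + 60 ∷ + 94 ∷ + 96 ∷ + 216 ∷ + 87 ∷ []) ∷ (⁻ 16 ∷ + 94 ∷ + 144 ∷ + 149 ∷ + 293 ∷ + 82 ∷ []) ∷ (⁻ 32 ∷ + 96 ∷ + 149 ∷ + 144 ∷ + 299 ∷ ⁻ 7 ∷ []) ∷ (+ 49 ∷ + 216 ∷ + 293 ∷ + 299 ∷ + 486 ∷ + 106 ∷ []) ∷ (⁻ 13 ∷ + 87 ∷ + 82 ∷ ⁻ 7 ∷ + 106 ∷ ⁻ 10 ∷ []) ∷ [])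
      (+ 13 ∷ ⁻ 10 ∷ ⁻ 18 ∷ ⁻ 13 ∷ ⁻ 29 ∷ + 61 ∷ []) (+ 0 ∷ + 0 ∷ + 0 ∷ ⁻ 7 ∷ ⁻ 69 ∷ ⁻ 200 ∷ [])
      (⁻ 348 ∷ ⁻ 260 ∷ + 534 ∷ ⁻ 244 ∷ ⁻ 536 ∷ ⁻ 47 ∷ []) (⁻ 393) (⁻ 81 ∷ + 440 ∷ ⁻ 224 ∷ + 263 ∷ + 295 ∷ ⁻ 70 ∷ []) (⁻ 410) ∷
    mk 9 ((+ 412 ∷ + 101 ∷ + 42 ∷ + 30 ∷ ⁻ 32 ∷ ⁻ 27 ∷ []) ∷ (+ 101 ∷ ⁻ 65 ∷ ⁻ 39 ∷ + 28 ∷ + 55 ∷ ⁻ 1 ∷ []) ∷ (+ 42 ∷ ⁻ 39 ∷ + 10 ∷ + 99 ∷ + 154 ∷ ⁻ 25 ∷ []) ∷ (+ 30 ∷ + 28 ∷ + 99 ∷ + 206 ∷ + 288 ∷ ⁻ 20 ∷ []) ∷ (⁻ 32 ∷ + 55 ∷ + 154 ∷ + 288 ∷ + 404 ∷ ⁻ 25 ∷ []) ∷ (⁻ 27 ∷ ⁻ 1 ∷ ⁻ 25 ∷ ⁻ 20 ∷ ⁻ 25 ∷ + 65 ∷ []) ∷ [])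
      (+ 83 ∷ + 11 ∷ ⁻ 1 ∷ ⁻ 10 ∷ ⁻ 27 ∷ + 109 ∷ []) (⁻ 372 ∷ + 0 ∷ + 0 ∷ ⁻ 53 ∷ ⁻ 40 ∷ ⁻ 400 ∷ [])
      (⁻ 1212 ∷ ⁻ 335 ∷ + 310 ∷ + 535 ∷ ⁻ 504 ∷ ⁻ 179 ∷ []) (⁻ 808) (⁻ 679 ∷ + 349 ∷ + 335 ∷ ⁻ 306 ∷ ⁻ 518 ∷ ⁻ 225 ∷ []) (⁻ 796) ∷
    mk 9 ((⁻ 4 ∷ ⁻ 3 ∷ ⁻ 2 ∷ ⁻ 1 ∷ + 0 ∷ ⁻ 1 ∷ []) ∷ (⁻ 3 ∷ + 0 ∷ + 3 ∷ + 6 ∷ + 9 ∷ ⁻ 1 ∷ []) ∷ (⁻ 2 ∷ + 3 ∷ + 8 ∷ + 13 ∷ + 18 ∷ ⁻ 1 ∷ []) ∷ (⁻ 1 ∷ + 6 ∷ + 13 ∷ + 33 ∷ + 104 ∷ ⁻ 1 ∷ []) ∷ (+ 0 ∷ + 9 ∷ + 18 ∷ + 104 ∷ + 36 ∷ ⁻ 1 ∷ []) ∷ (⁻ 1 ∷ ⁻ 1 ∷ ⁻ 1 ∷ ⁻ 1 ∷ ⁻ 1 ∷ ⁻ 1 ∷ []) ∷ [])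
      (+ 1 ∷ + 0 ∷ ⁻ 1 ∷ ⁻ 2 ∷ ⁻ 3 ∷ + 7 ∷ []) (+ 0 ∷ + 0 ∷ + 0 ∷ + 0 ∷ + 0 ∷ ⁻ 20 ∷ [])
      (⁻ 36 ∷ + 75 ∷ + 194 ∷ ⁻ 43 ∷ ⁻ 41 ∷ ⁻ 5 ∷ []) (⁻ 38) (+ 1 ∷ ⁻ 10 ∷ ⁻ 16 ∷ ⁻ 38 ∷ ⁻ 30 ∷ ⁻ 7 ∷ []) (+ 140) ∷
    mk 9 ((⁻ 133 ∷ ⁻ 185 ∷ + 70 ∷ + 25 ∷ + 3 ∷ ⁻ 27 ∷ []) ∷ (⁻ 185 ∷ + 1880 ∷ + 11 ∷ ⁻ 10 ∷ ⁻ 13 ∷ ⁻ 20 ∷ []) ∷ (+ 70 ∷ + 11 ∷ + 136 ∷ + 77 ∷ + 30 ∷ ⁻ 17 ∷ []) ∷ (+ 25 ∷ ⁻ 10 ∷ + 77 ∷ + 38 ∷ + 7 ∷ ⁻ 20 ∷ []) ∷ (+ 3 ∷ ⁻ 13 ∷ + 30 ∷ + 7 ∷ ⁻ 13 ∷ ⁻ 25 ∷ []) ∷ (⁻ 27 ∷ ⁻ 20 ∷ ⁻ 17 ∷ ⁻ 20 ∷ ⁻ 25 ∷ ⁻ 19 ∷ []) ∷ [])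
      (+ 49 ∷ + 35 ∷ + 83 ∷ + 73 ∷ + 68 ∷ + 59 ∷ []) (⁻ 31 ∷ + 0 ∷ ⁻ 400 ∷ ⁻ 384 ∷ ⁻ 400 ∷ ⁻ 400 ∷ [])
      (⁻ 667 ∷ ⁻ 2280 ∷ + 3536 ∷ + 2400 ∷ + 1221 ∷ ⁻ 95 ∷ []) (⁻ 794) (+ 1441 ∷ ⁻ 556 ∷ ⁻ 296 ∷ ⁻ 138 ∷ ⁻ 101 ∷ ⁻ 141 ∷ []) (⁻ 778) ∷
    mk 9 ((⁻ 76 ∷ ⁻ 89 ∷ ⁻ 68 ∷ ⁻ 33 ∷ ⁻ 31 ∷ + 61 ∷ []) ∷ (⁻ 89 ∷ + 1880 ∷ ⁻ 52 ∷ ⁻ 11 ∷ + 10 ∷ ⁻ 20 ∷ []) ∷ (⁻ 68 ∷ ⁻ 52 ∷ + 32 ∷ + 96 ∷ + 151 ∷ + 16 ∷ []) ∷ (⁻ 33 ∷ ⁻ 11 ∷ + 96 ∷ + 166 ∷ + 239 ∷ ⁻ 18 ∷ []) ∷ (⁻ 31 ∷ + 10 ∷ + 151 ∷ + 239 ∷ + 342 ∷ ⁻ 25 ∷ []) ∷ (+ 61 ∷ ⁻ 20 ∷ + 16 ∷ ⁻ 18 ∷ ⁻ 25 ∷ ⁻ 19 ∷ []) ∷ [])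
      (+ 19 ∷ + 16 ∷ ⁻ 4 ∷ ⁻ 7 ∷ ⁻ 22 ∷ + 103 ∷ []) (+ 0 ∷ + 0 ∷ + 0 ∷ ⁻ 48 ∷ ⁻ 39 ∷ ⁻ 400 ∷ [])
      (⁻ 724 ∷ ⁻ 2280 ∷ + 2305 ∷ + 1905 ∷ ⁻ 54 ∷ ⁻ 95 ∷ []) (⁻ 804) (⁻ 191 ∷ ⁻ 1414 ∷ ⁻ 192 ∷ ⁻ 266 ∷ ⁻ 456 ∷ + 271 ∷ []) (⁻ 868) ∷
    mk 9 ((⁻ 132 ∷ ⁻ 93 ∷ ⁻ 88 ∷ ⁻ 38 ∷ ⁻ 31 ∷ ⁻ 24 ∷ []) ∷ (⁻ 93 ∷ ⁻ 64 ∷ ⁻ 58 ∷ ⁻ 25 ∷ ⁻ 12 ∷ ⁻ 20 ∷ []) ∷ (⁻ 88 ∷ ⁻ 58 ∷ ⁻ 40 ∷ ⁻ 14 ∷ + 17 ∷ + 5 ∷ []) ∷ (⁻ 38 ∷ ⁻ 25 ∷ ⁻ 14 ∷ ⁻ 14 ∷ + 15 ∷ ⁻ 20 ∷ []) ∷ (⁻ 31 ∷ ⁻ 12 ∷ + 17 ∷ + 15 ∷ + 70 ∷ + 37 ∷ []) ∷ (⁻ 24 ∷ ⁻ 20 ∷ + 5 ∷ ⁻ 20 ∷ + 37 ∷ ⁻ 16 ∷ []) ∷ [])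
      (+ 33 ∷ + 38 ∷ + 32 ∷ + 45 ∷ + 33 ∷ + 43 ∷ []) (+ 0 ∷ ⁻ 82 ∷ ⁻ 108 ∷ ⁻ 217 ∷ ⁻ 233 ∷ ⁻ 293 ∷ [])
      (⁻ 668 ∷ + 1608 ∷ + 3733 ∷ + 2606 ∷ + 449 ∷ ⁻ 98 ∷ []) (⁻ 930) (⁻ 135 ∷ ⁻ 136 ∷ ⁻ 120 ∷ + 165 ∷ ⁻ 184 ∷ + 725 ∷ []) (⁻ 801) ∷
    mk 9 ((⁻ 12 ∷ ⁻ 11 ∷ + 32 ∷ ⁻ 9 ∷ ⁻ 6 ∷ + 29 ∷ []) ∷ (⁻ 11 ∷ + 26 ∷ + 30 ∷ + 82 ∷ + 12 ∷ + 18 ∷ []) ∷ (+ 32 ∷ + 30 ∷ + 48 ∷ + 26 ∷ + 28 ∷ ⁻ 6 ∷ []) ∷ (⁻ 9 ∷ + 82 ∷ + 26 ∷ + 70 ∷ + 241 ∷ ⁻ 4 ∷ []) ∷ (⁻ 6 ∷ + 12 ∷ + 28 ∷ + 241 ∷ + 87 ∷ ⁻ 6 ∷ []) ∷ (+ 29 ∷ + 18 ∷ ⁻ 6 ∷ ⁻ 4 ∷ ⁻ 6 ∷ ⁻ 5 ∷ []) ∷ [])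
      (+ 3 ∷ + 1 ∷ + 10 ∷ ⁻ 3 ∷ ⁻ 6 ∷ + 25 ∷ []) (+ 0 ∷ + 0 ∷ ⁻ 64 ∷ + 0 ∷ + 0 ∷ ⁻ 100 ∷ [])
      (⁻ 21 ∷ + 43 ∷ + 244 ∷ ⁻ 120 ∷ ⁻ 112 ∷ ⁻ 24 ∷ []) (⁻ 218) (⁻ 55 ∷ ⁻ 76 ∷ ⁻ 88 ∷ ⁻ 71 ∷ + 12 ∷ ⁻ 35 ∷ []) (⁻ 266) ∷
    mk 9 ((⁻ 1332 ∷ + 884 ∷ ⁻ 998 ∷ + 185 ∷ ⁻ 332 ∷ ⁻ 121 ∷ []) ∷ (+ 884 ∷ ⁻ 667 ∷ + 912 ∷ + 894 ∷ ⁻ 333 ∷ ⁻ 200 ∷ []) ∷ (⁻ 998 ∷ + 912 ∷ ⁻ 76 ∷ + 996 ∷ + 1036 ∷ ⁻ 176 ∷ []) ∷ (+ 185 ∷ + 894 ∷ + 996 ∷ + 1810 ∷ + 1926 ∷ ⁻ 200 ∷ []) ∷ (⁻ 332 ∷ ⁻ 333 ∷ + 1036 ∷ + 1926 ∷ + 2455 ∷ ⁻ 250 ∷ []) ∷ (⁻ 121 ∷ ⁻ 200 ∷ ⁻ 176 ∷ ⁻ 200 ∷ ⁻ 250 ∷ + 814 ∷ []) ∷ [])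
      (+ 333 ∷ + 315 ∷ + 186 ∷ + 315 ∷ + 110 ∷ + 895 ∷ []) (+ 0 ∷ + 0 ∷ ⁻ 706 ∷ ⁻ 2480 ∷ ⁻ 1886 ∷ ⁻ 4000 ∷ [])
      (⁻ 6668 ∷ ⁻ 1077 ∷ ⁻ 3924 ∷ ⁻ 536 ∷ ⁻ 1981 ∷ ⁻ 1957 ∷ []) (⁻ 8010) (⁻ 1335 ∷ ⁻ 1333 ∷ ⁻ 1504 ∷ ⁻ 2810 ∷ ⁻ 3598 ∷ + 2593 ∷ []) (⁻ 7999) ∷
    []

  certs48 : List Certificate
  certs48 =
    mk 11 ((+ 0 ∷ + 0 ∷ + 0 ∷ + 0 ∷ + 0 ∷ + 0 ∷ []) ∷ (+ 0 ∷ + 0 ∷ + 0 ∷ + 0 ∷ + 0 ∷ + 0 ∷ []) ∷ (+ 0 ∷ + 0 ∷ + 1 ∷ + 1 ∷ + 0 ∷ + 0 ∷ []) ∷ (+ 0 ∷ + 0 ∷ + 1 ∷ + 1 ∷ + 1 ∷ + 13 ∷ []) ∷ (+ 0 ∷ + 0 ∷ + 0 ∷ + 1 ∷ + 0 ∷ + 7 ∷ []) ∷ (+ 0 ∷ + 0 ∷ + 0 ∷ + 13 ∷ + 7 ∷ + 0 ∷ []) ∷ [])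
      (+ 0 ∷ + 0 ∷ + 0 ∷ + 0 ∷ + 0 ∷ + 0 ∷ []) (+ 0 ∷ + 0 ∷ + 0 ∷ + 0 ∷ + 0 ∷ + 0 ∷ [])
      (⁻ 40 ∷ ⁻ 40 ∷ + 166 ∷ ⁻ 14 ∷ ⁻ 6 ∷ ⁻ 6 ∷ []) (⁻ 80) (+ 10 ∷ + 11 ∷ ⁻ 5 ∷ ⁻ 5 ∷ + 13 ∷ + 11 ∷ []) (⁻ 44) ∷
    mk 10 ((+ 0 ∷ + 0 ∷ + 0 ∷ + 0 ∷ + 0 ∷ + 0 ∷ []) ∷ (+ 0 ∷ + 0 ∷ + 52 ∷ + 0 ∷ + 0 ∷ + 0 ∷ []) ∷ (+ 0 ∷ + 52 ∷ + 0 ∷ + 0 ∷ + 0 ∷ + 0 ∷ []) ∷ (+ 0 ∷ + 0 ∷ + 0 ∷ + 1 ∷ + 0 ∷ + 0 ∷ []) ∷ (+ 0 ∷ + 0 ∷ + 0 ∷ + 0 ∷ + 0 ∷ + 7 ∷ []) ∷ (+ 0 ∷ + 0 ∷ + 0 ∷ + 0 ∷ + 7 ∷ + 0 ∷ []) ∷ [])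
      (+ 0 ∷ + 0 ∷ + 0 ∷ + 0 ∷ + 0 ∷ + 0 ∷ []) (+ 0 ∷ + 0 ∷ + 0 ∷ + 0 ∷ + 0 ∷ + 0 ∷ [])
      (⁻ 20 ∷ ⁻ 20 ∷ ⁻ 10 ∷ + 84 ∷ ⁻ 3 ∷ ⁻ 3 ∷ []) (⁻ 43) (+ 7 ∷ + 6 ∷ + 6 ∷ ⁻ 3 ∷ + 6 ∷ + 6 ∷ []) (⁻ 34) ∷
    mk 9 ((⁻ 23 ∷ ⁻ 9 ∷ ⁻ 23 ∷ + 4 ∷ + 12 ∷ ⁻ 4 ∷ []) ∷ (⁻ 9 ∷ + 2 ∷ + 372 ∷ + 9 ∷ + 14 ∷ ⁻ 3 ∷ []) ∷ (⁻ 23 ∷ + 372 ∷ + 160 ∷ ⁻ 1 ∷ + 6 ∷ ⁻ 4 ∷ []) ∷ (+ 4 ∷ + 9 ∷ ⁻ 1 ∷ + 8 ∷ + 9 ∷ ⁻ 4 ∷ []) ∷ (+ 12 ∷ + 14 ∷ + 6 ∷ + 9 ∷ + 8 ∷ ⁻ 3 ∷ []) ∷ (⁻ 4 ∷ ⁻ 3 ∷ ⁻ 4 ∷ ⁻ 4 ∷ ⁻ 3 ∷ ⁻ 3 ∷ []) ∷ [])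
      (+ 6 ∷ + 8 ∷ + 5 ∷ + 10 ∷ + 11 ∷ + 8 ∷ []) (+ 0 ∷ ⁻ 25 ∷ ⁻ 10 ∷ ⁻ 54 ∷ ⁻ 70 ∷ ⁻ 52 ∷ [])
      (⁻ 117 ∷ ⁻ 142 ∷ ⁻ 230 ∷ + 663 ∷ + 291 ∷ ⁻ 17 ∷ []) (⁻ 161) (⁻ 24 ∷ ⁻ 49 ∷ ⁻ 104 ∷ ⁻ 28 ∷ ⁻ 28 ∷ + 113 ∷ []) (⁻ 147) ∷
    mk 9 ((+ 140 ∷ ⁻ 77 ∷ ⁻ 133 ∷ + 60 ∷ ⁻ 40 ∷ ⁻ 22 ∷ []) ∷ (⁻ 77 ∷ + 3 ∷ + 2127 ∷ ⁻ 27 ∷ + 140 ∷ ⁻ 27 ∷ []) ∷ (⁻ 133 ∷ + 2127 ∷ + 1920 ∷ ⁻ 44 ∷ ⁻ 22 ∷ ⁻ 20 ∷ []) ∷ (+ 60 ∷ ⁻ 27 ∷ ⁻ 44 ∷ + 50 ∷ ⁻ 7 ∷ + 5 ∷ []) ∷ (⁻ 40 ∷ + 140 ∷ ⁻ 22 ∷ ⁻ 7 ∷ + 2056 ∷ ⁻ 25 ∷ []) ∷ (⁻ 22 ∷ ⁻ 27 ∷ ⁻ 20 ∷ + 5 ∷ ⁻ 25 ∷ ⁻ 19 ∷ []) ∷ [])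
      (+ 75 ∷ + 36 ∷ + 27 ∷ + 64 ∷ + 53 ∷ + 59 ∷ []) (⁻ 220 ∷ + 0 ∷ + 0 ∷ ⁻ 343 ∷ ⁻ 296 ∷ ⁻ 400 ∷ [])
      (⁻ 940 ∷ ⁻ 803 ∷ ⁻ 2320 ∷ + 3271 ∷ ⁻ 2170 ∷ ⁻ 95 ∷ []) (⁻ 800) (+ 571 ∷ + 1121 ∷ ⁻ 685 ∷ ⁻ 164 ∷ ⁻ 1885 ∷ ⁻ 114 ∷ []) (⁻ 800) ∷
    mk 9 ((+ 266 ∷ + 122 ∷ + 74 ∷ + 138 ∷ ⁻ 39 ∷ ⁻ 21 ∷ []) ∷ (+ 122 ∷ ⁻ 133 ∷ ⁻ 100 ∷ ⁻ 67 ∷ ⁻ 29 ∷ ⁻ 27 ∷ []) ∷ (+ 74 ∷ ⁻ 100 ∷ ⁻ 40 ∷ ⁻ 44 ∷ ⁻ 22 ∷ ⁻ 20 ∷ []) ∷ (+ 138 ∷ ⁻ 67 ∷ ⁻ 44 ∷ + 98 ∷ ⁻ 15 ∷ + 32 ∷ []) ∷ (⁻ 39 ∷ ⁻ 29 ∷ ⁻ 22 ∷ ⁻ 15 ∷ + 966 ∷ ⁻ 25 ∷ []) ∷ (⁻ 21 ∷ ⁻ 27 ∷ ⁻ 20 ∷ + 32 ∷ ⁻ 25 ∷ + 54 ∷ []) ∷ [])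
      (+ 39 ∷ + 33 ∷ + 24 ∷ + 25 ∷ + 8 ∷ + 3 ∷ []) (⁻ 211 ∷ + 0 ∷ + 0 ∷ ⁻ 172 ∷ + 0 ∷ ⁻ 47 ∷ [])
      (⁻ 1066 ∷ + 845 ∷ + 510 ∷ ⁻ 365 ∷ ⁻ 1080 ∷ ⁻ 168 ∷ []) (⁻ 803) (⁻ 533 ∷ + 1337 ∷ + 687 ∷ ⁻ 212 ∷ ⁻ 1080 ∷ ⁻ 187 ∷ []) (⁻ 803) ∷
    mk 9 ((+ 226 ∷ + 531 ∷ ⁻ 331 ∷ + 265 ∷ + 161 ∷ + 41 ∷ []) ∷ (+ 531 ∷ + 669 ∷ ⁻ 250 ∷ + 283 ∷ + 120 ∷ ⁻ 67 ∷ []) ∷ (⁻ 331 ∷ ⁻ 250 ∷ + 3686 ∷ ⁻ 90 ∷ ⁻ 52 ∷ ⁻ 46 ∷ []) ∷ (+ 265 ∷ + 283 ∷ ⁻ 90 ∷ + 100 ∷ + 40 ∷ ⁻ 60 ∷ []) ∷ (+ 161 ∷ + 120 ∷ ⁻ 52 ∷ + 40 ∷ + 32 ∷ ⁻ 24 ∷ []) ∷ (+ 41 ∷ ⁻ 67 ∷ ⁻ 46 ∷ ⁻ 60 ∷ ⁻ 24 ∷ ⁻ 44 ∷ []) ∷ [])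
      (+ 156 ∷ + 90 ∷ + 66 ∷ + 190 ∷ + 164 ∷ + 146 ∷ []) (⁻ 425 ∷ + 0 ∷ + 0 ∷ ⁻ 1000 ∷ ⁻ 1000 ∷ ⁻ 1000 ∷ [])
      (+ 1382 ∷ + 8464 ∷ ⁻ 4686 ∷ + 4091 ∷ + 1489 ∷ ⁻ 242 ∷ []) (⁻ 2194) (⁻ 893 ∷ ⁻ 1336 ∷ ⁻ 1008 ∷ ⁻ 386 ∷ ⁻ 318 ∷ + 496 ∷ []) (⁻ 2036) ∷
    mk 9 ((⁻ 332 ∷ ⁻ 465 ∷ ⁻ 168 ∷ + 65 ∷ ⁻ 42 ∷ ⁻ 53 ∷ []) ∷ (⁻ 465 ∷ ⁻ 333 ∷ ⁻ 250 ∷ ⁻ 45 ∷ ⁻ 71 ∷ ⁻ 67 ∷ []) ∷ (⁻ 168 ∷ ⁻ 250 ∷ ⁻ 100 ∷ ⁻ 111 ∷ + 37 ∷ ⁻ 46 ∷ []) ∷ (+ 65 ∷ ⁻ 45 ∷ ⁻ 111 ∷ + 372 ∷ + 48 ∷ ⁻ 67 ∷ []) ∷ (⁻ 42 ∷ ⁻ 71 ∷ + 37 ∷ + 48 ∷ + 131 ∷ + 54 ∷ []) ∷ (⁻ 53 ∷ ⁻ 67 ∷ ⁻ 46 ∷ ⁻ 67 ∷ + 54 ∷ ⁻ 44 ∷ []) ∷ [])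
      (+ 119 ∷ + 90 ∷ + 66 ∷ + 185 ∷ + 134 ∷ + 146 ∷ []) (⁻ 72 ∷ + 0 ∷ + 0 ∷ ⁻ 958 ∷ ⁻ 868 ∷ ⁻ 1000 ∷ [])
      (+ 1376 ∷ ⁻ 1667 ∷ + 10233 ∷ + 6168 ∷ + 1561 ∷ ⁻ 242 ∷ []) (⁻ 2076) (⁻ 335 ∷ + 1130 ∷ + 399 ∷ ⁻ 658 ∷ ⁻ 417 ∷ + 1615 ∷ []) (⁻ 2032) ∷
    []

  certs49 : List Certificate
  certs49 =
    mk 10 ((+ 0 ∷ + 6 ∷ + 0 ∷ + 3 ∷ + 2 ∷ + 0 ∷ []) ∷ (+ 6 ∷ + 2 ∷ + 0 ∷ + 0 ∷ + 0 ∷ + 0 ∷ []) ∷ (+ 0 ∷ + 0 ∷ + 19 ∷ + 0 ∷ + 2 ∷ + 0 ∷ []) ∷ (+ 3 ∷ + 0 ∷ + 0 ∷ + 0 ∷ + 0 ∷ + 0 ∷ []) ∷ (+ 2 ∷ + 0 ∷ + 2 ∷ + 0 ∷ + 5 ∷ + 2 ∷ []) ∷ (+ 0 ∷ + 0 ∷ + 0 ∷ + 0 ∷ + 2 ∷ + 0 ∷ []) ∷ [])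
      (+ 0 ∷ + 1 ∷ + 0 ∷ + 1 ∷ + 0 ∷ + 0 ∷ []) (+ 0 ∷ ⁻ 4 ∷ + 0 ∷ ⁻ 4 ∷ ⁻ 2 ∷ + 0 ∷ [])
      (⁻ 8 ∷ + 19 ∷ ⁻ 23 ∷ + 10 ∷ ⁻ 6 ∷ ⁻ 1 ∷ []) (⁻ 16) (⁻ 2 ∷ + 8 ∷ ⁻ 19 ∷ + 3 ∷ ⁻ 6 ∷ ⁻ 1 ∷ []) (⁻ 19) ∷
    mk 10 ((+ 0 ∷ + 0 ∷ + 3 ∷ + 1 ∷ + 0 ∷ + 0 ∷ []) ∷ (+ 0 ∷ + 0 ∷ + 0 ∷ + 0 ∷ + 0 ∷ + 0 ∷ []) ∷ (+ 3 ∷ + 0 ∷ + 0 ∷ + 0 ∷ + 0 ∷ + 0 ∷ []) ∷ (+ 1 ∷ + 0 ∷ + 0 ∷ + 0 ∷ + 0 ∷ + 3 ∷ []) ∷ (+ 0 ∷ + 0 ∷ + 0 ∷ + 0 ∷ + 0 ∷ + 3 ∷ []) ∷ (+ 0 ∷ + 0 ∷ + 0 ∷ + 3 ∷ + 3 ∷ + 0 ∷ []) ∷ [])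
      (+ 0 ∷ + 0 ∷ + 0 ∷ + 0 ∷ + 0 ∷ + 0 ∷ []) (+ 0 ∷ + 0 ∷ + 0 ∷ + 0 ∷ + 0 ∷ + 0 ∷ [])
      (⁻ 8 ∷ ⁻ 8 ∷ + 15 ∷ ⁻ 3 ∷ ⁻ 1 ∷ ⁻ 1 ∷ []) (⁻ 23) (⁻ 2 ∷ + 34 ∷ + 4 ∷ + 2 ∷ + 3 ∷ ⁻ 1 ∷ []) (⁻ 20) ∷
    mk 9 ((⁻ 20 ∷ ⁻ 15 ∷ ⁻ 14 ∷ ⁻ 11 ∷ ⁻ 5 ∷ ⁻ 4 ∷ []) ∷ (⁻ 15 ∷ ⁻ 11 ∷ ⁻ 11 ∷ + 233 ∷ ⁻ 1 ∷ ⁻ 3 ∷ []) ∷ (⁻ 14 ∷ ⁻ 11 ∷ + 219 ∷ ⁻ 6 ∷ + 5 ∷ ⁻ 2 ∷ []) ∷ (⁻ 11 ∷ + 233 ∷ ⁻ 6 ∷ + 69 ∷ + 6 ∷ ⁻ 2 ∷ []) ∷ (⁻ 5 ∷ ⁻ 1 ∷ + 5 ∷ + 6 ∷ + 26 ∷ + 14 ∷ []) ∷ (⁻ 4 ∷ ⁻ 3 ∷ ⁻ 2 ∷ ⁻ 2 ∷ + 14 ∷ ⁻ 2 ∷ []) ∷ [])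
      (+ 5 ∷ + 6 ∷ + 5 ∷ + 6 ∷ + 3 ∷ + 7 ∷ []) (+ 0 ∷ ⁻ 11 ∷ ⁻ 16 ∷ ⁻ 26 ∷ ⁻ 31 ∷ ⁻ 45 ∷ [])
      (⁻ 70 ∷ ⁻ 79 ∷ ⁻ 264 ∷ ⁻ 99 ∷ + 203 ∷ ⁻ 11 ∷ []) (⁻ 94) (⁻ 25 ∷ + 572 ∷ + 175 ∷ + 139 ∷ ⁻ 39 ∷ ⁻ 13 ∷ []) (⁻ 89) ∷
    []

  certs50 : List Certificate
  certs50 =
    mk 9 ((⁻ 4 ∷ ⁻ 4 ∷ + 18 ∷ + 15 ∷ ⁻ 1 ∷ ⁻ 1 ∷ []) ∷ (⁻ 4 ∷ + 48 ∷ + 6 ∷ + 2 ∷ ⁻ 1 ∷ ⁻ 1 ∷ []) ∷ (+ 18 ∷ + 6 ∷ + 0 ∷ + 1 ∷ ⁻ 1 ∷ + 0 ∷ []) ∷ (+ 15 ∷ + 2 ∷ + 1 ∷ ⁻ 1 ∷ + 0 ∷ + 0 ∷ []) ∷ (⁻ 1 ∷ ⁻ 1 ∷ ⁻ 1 ∷ + 0 ∷ + 3 ∷ + 2 ∷ []) ∷ (⁻ 1 ∷ ⁻ 1 ∷ + 0 ∷ + 0 ∷ + 2 ∷ + 2 ∷ []) ∷ [])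
      (+ 1 ∷ + 1 ∷ + 2 ∷ + 2 ∷ + 1 ∷ + 1 ∷ []) (+ 0 ∷ + 0 ∷ ⁻ 8 ∷ ⁻ 8 ∷ ⁻ 7 ∷ ⁻ 8 ∷ [])
      (+ 63 ∷ + 12 ∷ + 55 ∷ + 44 ∷ ⁻ 6 ∷ ⁻ 4 ∷ []) (⁻ 139) (⁻ 4 ∷ ⁻ 53 ∷ + 12 ∷ + 7 ∷ + 20 ∷ ⁻ 5 ∷ []) (⁻ 35) ∷
    mk 9 ((⁻ 8 ∷ + 14 ∷ ⁻ 9 ∷ + 49 ∷ ⁻ 1 ∷ + 0 ∷ []) ∷ (+ 14 ∷ ⁻ 7 ∷ ⁻ 7 ∷ ⁻ 2 ∷ ⁻ 2 ∷ ⁻ 1 ∷ []) ∷ (⁻ 9 ∷ ⁻ 7 ∷ ⁻ 3 ∷ ⁻ 3 ∷ ⁻ 1 ∷ ⁻ 1 ∷ []) ∷ (+ 49 ∷ ⁻ 2 ∷ ⁻ 3 ∷ + 0 ∷ ⁻ 1 ∷ ⁻ 1 ∷ []) ∷ (⁻ 1 ∷ ⁻ 2 ∷ ⁻ 1 ∷ ⁻ 1 ∷ + 96 ∷ ⁻ 1 ∷ []) ∷ (+ 0 ∷ ⁻ 1 ∷ ⁻ 1 ∷ ⁻ 1 ∷ ⁻ 1 ∷ ⁻ 1 ∷ []) ∷ [])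
      (+ 2 ∷ + 2 ∷ + 2 ∷ + 4 ∷ + 3 ∷ + 3 ∷ []) (+ 0 ∷ + 0 ∷ ⁻ 3 ∷ ⁻ 20 ∷ ⁻ 17 ∷ ⁻ 20 ∷ [])
      (+ 155 ∷ + 157 ∷ ⁻ 37 ∷ + 187 ∷ ⁻ 104 ∷ ⁻ 4 ∷ []) (⁻ 33) (⁻ 12 ∷ + 72 ∷ + 258 ∷ + 24 ∷ ⁻ 101 ∷ ⁻ 6 ∷ []) (⁻ 41) ∷
    []

  entries45 : List Entry
  entries45 =
    entry (22 ∷ 3 ∷ 7 ∷ 2 ∷ 15 ∷ 32 ∷ []) 1 (mk 9 ((⁻ 1960 ∷ + 2241 ∷ ⁻ 3750 ∷ ⁻ 1875 ∷ ⁻ 1250 ∷ ⁻ 1000 ∷ []) ∷ (+ 2241 ∷ + 5382 ∷ + 1047 ∷ + 1659 ∷ + 1876 ∷ ⁻ 935 ∷ []) ∷ (⁻ 3750 ∷ + 1047 ∷ + 1087 ∷ + 3152 ∷ + 5678 ∷ + 2525 ∷ []) ∷ (⁻ 1875 ∷ + 1659 ∷ + 3152 ∷ + 3752 ∷ + 5667 ∷ ⁻ 750 ∷ []) ∷ (⁻ 1250 ∷ + 1876 ∷ + 5678 ∷ + 5667 ∷ + 7826 ∷ ⁻ 999 ∷ []) ∷ (⁻ 1000 ∷ ⁻ 935 ∷ + 2525 ∷ ⁻ 750 ∷ ⁻ 999 ∷ + 3885 ∷ []) ∷ [])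
      (+ 1722 ∷ + 2252 ∷ + 65 ∷ + 798 ∷ + 676 ∷ + 3206 ∷ []) (⁻ 2463 ∷ ⁻ 9447 ∷ ⁻ 803 ∷ ⁻ 5866 ∷ ⁻ 7969 ∷ ⁻ 15000 ∷ [])
      (⁻ 28040 ∷ + 1336 ∷ ⁻ 7399 ∷ + 9188 ∷ ⁻ 11576 ∷ ⁻ 8885 ∷ []) (⁻ 30012) (⁻ 8040 ∷ ⁻ 12882 ∷ ⁻ 6087 ∷ + 16837 ∷ + 16090 ∷ ⁻ 9885 ∷ []) (⁻ 29994)) (+ 6256) (+ 25024) ∷
    []

  entries46 : List Entry
  entries46 =
    entry (22 ∷ 0 ∷ 10 ∷ 2 ∷ 9 ∷ 38 ∷ []) 2 (mk 9 ((⁻ 667 ∷ ⁻ 64 ∷ + 556 ∷ + 490 ∷ ⁻ 143 ∷ ⁻ 133 ∷ []) ∷ (⁻ 64 ∷ ⁻ 333 ∷ ⁻ 332 ∷ ⁻ 250 ∷ ⁻ 133 ∷ ⁻ 125 ∷ []) ∷ (+ 556 ∷ ⁻ 332 ∷ + 898 ∷ + 710 ∷ + 237 ∷ ⁻ 110 ∷ []) ∷ (+ 490 ∷ ⁻ 250 ∷ + 710 ∷ + 620 ∷ + 386 ∷ + 20 ∷ []) ∷ (⁻ 143 ∷ ⁻ 133 ∷ + 237 ∷ + 386 ∷ + 532 ∷ + 288 ∷ []) ∷ (⁻ 133 ∷ ⁻ 125 ∷ ⁻ 110 ∷ + 20 ∷ + 288 ∷ ⁻ 92 ∷ []) ∷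 [])
      (+ 167 ∷ + 292 ∷ + 387 ∷ + 338 ∷ + 148 ∷ + 216 ∷ []) (+ 0 ∷ + 0 ∷ ⁻ 1997 ∷ ⁻ 2000 ∷ ⁻ 1154 ∷ ⁻ 1466 ∷ [])
      (⁻ 3333 ∷ + 20078 ∷ + 12060 ∷ + 5528 ∷ ⁻ 976 ∷ ⁻ 479 ∷ []) (⁻ 4140) (+ 1604 ∷ + 7677 ∷ ⁻ 1698 ∷ ⁻ 1120 ∷ ⁻ 1103 ∷ ⁻ 708 ∷ []) (⁻ 4073)) (+ 2498) (+ 4996) ∷
    entry (22 ∷ 1 ∷ 7 ∷ 5 ∷ 8 ∷ 38 ∷ []) 2 (mk 9 ((+ 152 ∷ + 520 ∷ ⁻ 84 ∷ + 75 ∷ ⁻ 71 ∷ ⁻ 66 ∷ []) ∷ (+ 520 ∷ + 808 ∷ + 357 ∷ + 438 ∷ + 314 ∷ ⁻ 62 ∷ []) ∷ (⁻ 84 ∷ + 357 ∷ + 290 ∷ + 526 ∷ + 657 ∷ + 130 ∷ []) ∷ (+ 75 ∷ + 438 ∷ + 526 ∷ + 688 ∷ + 843 ∷ ⁻ 62 ∷ []) ∷ (⁻ 71 ∷ + 314 ∷ + 657 ∷ + 843 ∷ + 1123 ∷ ⁻ 62 ∷ []) ∷ (⁻ 66 ∷ ⁻ 62 ∷ + 130 ∷ ⁻ 62 ∷ ⁻ 62 ∷ ⁻ 48 ∷ []) ∷ [])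
      (+ 116 ∷ + 156 ∷ ⁻ 36 ∷ + 1 ∷ ⁻ 61 ∷ + 281 ∷ []) (⁻ 308 ∷ ⁻ 872 ∷ + 0 ∷ ⁻ 349 ∷ ⁻ 195 ∷ ⁻ 1000 ∷ [])
      (⁻ 2152 ∷ + 7961 ∷ + 6060 ∷ + 3197 ∷ ⁻ 1345 ∷ ⁻ 238 ∷ []) (⁻ 1986) (⁻ 819 ∷ ⁻ 1308 ∷ ⁻ 690 ∷ ⁻ 938 ∷ ⁻ 1275 ∷ ⁻ 352 ∷ []) (⁻ 1997)) (+ 1694) (+ 3388) ∷
    entry (22 ∷ 2 ∷ 5 ∷ 5 ∷ 10 ∷ 37 ∷ []) 2 (mk 9 ((+ 214 ∷ ⁻ 60 ∷ + 235 ∷ + 89 ∷ ⁻ 71 ∷ ⁻ 67 ∷ []) ∷ (⁻ 60 ∷ ⁻ 167 ∷ + 183 ∷ + 178 ∷ + 162 ∷ ⁻ 62 ∷ []) ∷ (+ 235 ∷ + 183 ∷ + 476 ∷ + 496 ∷ + 511 ∷ ⁻ 56 ∷ []) ∷ (+ 89 ∷ + 178 ∷ + 496 ∷ + 629 ∷ + 761 ∷ ⁻ 62 ∷ []) ∷ (⁻ 71 ∷ + 162 ∷ + 511 ∷ + 761 ∷ + 1013 ∷ ⁻ 62 ∷ []) ∷ (⁻ 67 ∷ ⁻ 62 ∷ ⁻ 56 ∷ ⁻ 62 ∷ ⁻ 62 ∷ + 50 ∷ []) ∷ [])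
      (+ 112 ∷ + 28 ∷ + 57 ∷ + 1 ∷ ⁻ 59 ∷ + 254 ∷ []) (⁻ 330 ∷ + 0 ∷ ⁻ 466 ∷ ⁻ 319 ∷ ⁻ 150 ∷ ⁻ 893 ∷ [])
      (⁻ 2214 ∷ + 5976 ∷ + 4814 ∷ + 1814 ∷ ⁻ 1235 ∷ ⁻ 336 ∷ []) (⁻ 1974) (⁻ 881 ∷ + 2284 ∷ ⁻ 876 ∷ ⁻ 879 ∷ ⁻ 862 ∷ ⁻ 450 ∷ []) (⁻ 1987)) (+ 1210) (+ 2420) ∷
    entry (23 ∷ 0 ∷ 4 ∷ 10 ∷ 6 ∷ 38 ∷ []) 0 (mk 9 ((⁻ 20 ∷ + 93 ∷ + 38 ∷ ⁻ 5 ∷ ⁻ 5 ∷ ⁻ 3 ∷ []) ∷ (+ 93 ∷ ⁻ 12 ∷ ⁻ 12 ∷ ⁻ 9 ∷ ⁻ 5 ∷ ⁻ 4 ∷ []) ∷ (+ 38 ∷ ⁻ 12 ∷ + 94 ∷ + 63 ∷ + 68 ∷ + 22 ∷ []) ∷ (⁻ 5 ∷ ⁻ 9 ∷ + 63 ∷ + 44 ∷ + 58 ∷ ⁻ 4 ∷ []) ∷ (⁻ 5 ∷ ⁻ 5 ∷ + 68 ∷ + 58 ∷ + 78 ∷ ⁻ 4 ∷ []) ∷ (⁻ 3 ∷ ⁻ 4 ∷ + 22 ∷ ⁻ 4 ∷ ⁻ 4 ∷ ⁻ 3 ∷ []) ∷ [])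
      (+ 5 ∷ + 16 ∷ + 6 ∷ + 0 ∷ ⁻ 3 ∷ + 19 ∷ []) (+ 0 ∷ + 0 ∷ ⁻ 70 ∷ ⁻ 20 ∷ ⁻ 19 ∷ ⁻ 70 ∷ [])
      (⁻ 120 ∷ + 512 ∷ + 62 ∷ + 251 ∷ ⁻ 94 ∷ ⁻ 17 ∷ []) (⁻ 150) (⁻ 27 ∷ + 160 ∷ ⁻ 122 ∷ ⁻ 62 ∷ ⁻ 26 ∷ ⁻ 25 ∷ []) (⁻ 152)) (⁻ 24) (+ 536) ∷
    entry (23 ∷ 0 ∷ 5 ∷ 7 ∷ 9 ∷ 37 ∷ []) 0 (mk 9 ((⁻ 32 ∷ + 60 ∷ + 34 ∷ + 28 ∷ + 24 ∷ ⁻ 5 ∷ []) ∷ (+ 60 ∷ ⁻ 17 ∷ ⁻ 15 ∷ ⁻ 12 ∷ ⁻ 7 ∷ ⁻ 6 ∷ []) ∷ (+ 34 ∷ ⁻ 15 ∷ + 64 ∷ + 51 ∷ + 42 ∷ + 10 ∷ []) ∷ (+ 28 ∷ ⁻ 12 ∷ + 51 ∷ + 41 ∷ + 34 ∷ + 8 ∷ []) ∷ (+ 24 ∷ ⁻ 7 ∷ + 42 ∷ + 34 ∷ + 32 ∷ + 9 ∷ []) ∷ (⁻ 5 ∷ ⁻ 6 ∷ + 10 ∷ + 8 ∷ + 9 ∷ ⁻ 5 ∷ []) ∷ [])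
      (+ 8 ∷ + 16 ∷ + 17 ∷ + 16 ∷ + 14 ∷ + 11 ∷ []) (+ 0 ∷ + 0 ∷ ⁻ 100 ∷ ⁻ 100 ∷ ⁻ 100 ∷ ⁻ 73 ∷ [])
      (⁻ 168 ∷ + 877 ∷ + 382 ∷ + 168 ∷ ⁻ 54 ∷ ⁻ 24 ∷ []) (⁻ 213) (⁻ 35 ∷ + 243 ∷ ⁻ 104 ∷ ⁻ 66 ∷ ⁻ 36 ∷ ⁻ 35 ∷ []) (⁻ 231)) (⁻ 34) (+ 566) ∷
    entry (23 ∷ 0 ∷ 6 ∷ 4 ∷ 12 ∷ 36 ∷ []) 0 (mk 9 ((⁻ 32 ∷ + 89 ∷ ⁻ 23 ∷ + 32 ∷ + 18 ∷ ⁻ 5 ∷ []) ∷ (+ 89 ∷ ⁻ 17 ∷ ⁻ 17 ∷ ⁻ 12 ∷ ⁻ 7 ∷ ⁻ 6 ∷ []) ∷ (⁻ 23 ∷ ⁻ 17 ∷ + 34 ∷ + 65 ∷ + 75 ∷ + 38 ∷ []) ∷ (+ 32 ∷ ⁻ 12 ∷ + 65 ∷ + 63 ∷ + 59 ∷ ⁻ 6 ∷ []) ∷ (+ 18 ∷ ⁻ 7 ∷ + 75 ∷ + 59 ∷ + 68 ∷ ⁻ 6 ∷ []) ∷ (⁻ 5 ∷ ⁻ 6 ∷ + 38 ∷ ⁻ 6 ∷ ⁻ 6 ∷ ⁻ 5 ∷ []) ∷ [])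
      (+ 8 ∷ + 14 ∷ ⁻ 4 ∷ + 14 ∷ + 8 ∷ + 21 ∷ []) (+ 0 ∷ + 0 ∷ ⁻ 1 ∷ ⁻ 100 ∷ ⁻ 82 ∷ ⁻ 93 ∷ [])
      (⁻ 168 ∷ + 820 ∷ + 299 ∷ + 383 ∷ ⁻ 90 ∷ ⁻ 24 ∷ []) (⁻ 214) (⁻ 35 ∷ + 231 ∷ ⁻ 74 ∷ ⁻ 88 ∷ ⁻ 97 ∷ ⁻ 35 ∷ []) (⁻ 107)) (⁻ 34) (+ 724) ∷
    entry (23 ∷ 1 ∷ 3 ∷ 7 ∷ 11 ∷ 36 ∷ []) 0 (mk 9 ((⁻ 32 ∷ ⁻ 14 ∷ ⁻ 22 ∷ + 30 ∷ ⁻ 6 ∷ ⁻ 4 ∷ []) ∷ (⁻ 14 ∷ + 30 ∷ + 35 ∷ + 80 ∷ + 66 ∷ + 69 ∷ []) ∷ (⁻ 22 ∷ + 35 ∷ + 286 ∷ + 65 ∷ + 60 ∷ + 51 ∷ []) ∷ (+ 30 ∷ + 80 ∷ + 65 ∷ + 53 ∷ + 37 ∷ ⁻ 5 ∷ []) ∷ (⁻ 6 ∷ + 66 ∷ + 60 ∷ + 37 ∷ + 40 ∷ ⁻ 6 ∷ []) ∷ (⁻ 4 ∷ + 69 ∷ + 51 ∷ ⁻ 5 ∷ ⁻ 6 ∷ ⁻ 5 ∷ []) ∷ [])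
      (+ 8 ∷ ⁻ 5 ∷ ⁻ 5 ∷ + 15 ∷ + 6 ∷ + 18 ∷ []) (+ 0 ∷ + 0 ∷ + 0 ∷ ⁻ 100 ∷ ⁻ 54 ∷ ⁻ 88 ∷ [])
      (⁻ 168 ∷ ⁻ 34 ∷ ⁻ 201 ∷ + 294 ∷ + 98 ∷ ⁻ 24 ∷ []) (⁻ 228) (⁻ 35 ∷ ⁻ 80 ∷ ⁻ 326 ∷ ⁻ 78 ∷ ⁻ 69 ∷ ⁻ 35 ∷ []) (⁻ 250)) (⁻ 34) (+ 1140) ∷
    entry (23 ∷ 2 ∷ 1 ∷ 7 ∷ 13 ∷ 35 ∷ []) 0 (mk 9 ((⁻ 32 ∷ ⁻ 14 ∷ + 40 ∷ + 30 ∷ ⁻ 6 ∷ ⁻ 4 ∷ []) ∷ (⁻ 14 ∷ + 30 ∷ + 78 ∷ + 80 ∷ + 66 ∷ + 69 ∷ []) ∷ (+ 40 ∷ + 78 ∷ + 336 ∷ + 70 ∷ + 46 ∷ + 18 ∷ []) ∷ (+ 30 ∷ + 80 ∷ + 70 ∷ + 53 ∷ + 37 ∷ ⁻ 5 ∷ []) ∷ (⁻ 6 ∷ + 66 ∷ + 46 ∷ + 37 ∷ + 40 ∷ ⁻ 6 ∷ []) ∷ (⁻ 4 ∷ + 69 ∷ + 18 ∷ ⁻ 5 ∷ ⁻ 6 ∷ ⁻ 5 ∷ []) ∷ [])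
      (+ 8 ∷ ⁻ 5 ∷ + 14 ∷ + 15 ∷ + 6 ∷ + 18 ∷ []) (+ 0 ∷ + 0 ∷ ⁻ 100 ∷ ⁻ 100 ∷ ⁻ 54 ∷ ⁻ 88 ∷ [])
      (⁻ 168 ∷ ⁻ 130 ∷ + 17 ∷ + 318 ∷ + 38 ∷ ⁻ 24 ∷ []) (⁻ 136) (⁻ 35 ∷ ⁻ 80 ∷ ⁻ 376 ∷ ⁻ 78 ∷ ⁻ 69 ∷ ⁻ 35 ∷ []) (⁻ 250)) (⁻ 34) (+ 1140) ∷
    []

  entries47 : List Entry
  entries47 =
    entry (23 ∷ 0 ∷ 2 ∷ 8 ∷ 7 ∷ 41 ∷ []) 1 (mk 9 ((⁻ 32 ∷ + 113 ∷ ⁻ 24 ∷ ⁻ 9 ∷ ⁻ 6 ∷ ⁻ 6 ∷ []) ∷ (+ 113 ∷ ⁻ 17 ∷ ⁻ 25 ∷ ⁻ 12 ∷ ⁻ 8 ∷ ⁻ 5 ∷ []) ∷ (⁻ 24 ∷ ⁻ 25 ∷ + 122 ∷ + 26 ∷ + 48 ∷ + 53 ∷ []) ∷ (⁻ 9 ∷ ⁻ 12 ∷ + 26 ∷ ⁻ 4 ∷ + 8 ∷ ⁻ 5 ∷ []) ∷ (⁻ 6 ∷ ⁻ 8 ∷ + 48 ∷ + 8 ∷ + 28 ∷ + 13 ∷ []) ∷ (⁻ 6 ∷ ⁻ 5 ∷ + 53 ∷ ⁻ 5 ∷ + 13 ∷ ⁻ 5 ∷ []) ∷ [])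
      (+ 12 ∷ + 10 ∷ + 1 ∷ + 15 ∷ + 11 ∷ + 15 ∷ []) (⁻ 8 ∷ + 0 ∷ ⁻ 18 ∷ ⁻ 73 ∷ ⁻ 80 ∷ ⁻ 100 ∷ [])
      (⁻ 168 ∷ + 547 ∷ + 85 ∷ + 652 ∷ + 54 ∷ ⁻ 24 ∷ []) (⁻ 198) (⁻ 35 ∷ + 241 ∷ ⁻ 162 ∷ + 332 ∷ ⁻ 57 ∷ ⁻ 35 ∷ []) (⁻ 192)) (+ 0) (+ 1050) ∷
    entry (23 ∷ 0 ∷ 3 ∷ 5 ∷ 10 ∷ 40 ∷ []) 1 (mk 9 ((⁻ 32 ∷ + 125 ∷ ⁻ 23 ∷ + 28 ∷ ⁻ 5 ∷ ⁻ 5 ∷ []) ∷ (+ 125 ∷ ⁻ 17 ∷ ⁻ 25 ∷ ⁻ 12 ∷ ⁻ 8 ∷ ⁻ 5 ∷ []) ∷ (⁻ 23 ∷ ⁻ 25 ∷ + 30 ∷ + 54 ∷ + 50 ∷ + 53 ∷ []) ∷ (+ 28 ∷ ⁻ 12 ∷ + 54 ∷ + 42 ∷ + 26 ∷ + 9 ∷ []) ∷ (⁻ 5 ∷ ⁻ 8 ∷ + 50 ∷ + 26 ∷ + 30 ∷ + 15 ∷ []) ∷ (⁻ 5 ∷ ⁻ 5 ∷ + 53 ∷ + 9 ∷ + 15 ∷ ⁻ 5 ∷ []) ∷ [])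
      (+ 8 ∷ + 13 ∷ ⁻ 3 ∷ + 16 ∷ + 7 ∷ + 11 ∷ []) (+ 0 ∷ + 0 ∷ ⁻ 3 ∷ ⁻ 100 ∷ ⁻ 57 ∷ ⁻ 73 ∷ [])
      (⁻ 168 ∷ + 352 ∷ + 189 ∷ + 330 ∷ + 48 ∷ ⁻ 24 ∷ []) (⁻ 232) (⁻ 35 ∷ + 229 ∷ ⁻ 70 ∷ ⁻ 67 ∷ ⁻ 59 ∷ ⁻ 25 ∷ []) (⁻ 194)) (⁻ 28) (+ 1028) ∷
    entry (22 ∷ 0 ∷ 6 ∷ 6 ∷ 4 ∷ 43 ∷ []) 3 (mk 9 ((⁻ 32 ∷ + 152 ∷ ⁻ 25 ∷ ⁻ 17 ∷ ⁻ 8 ∷ ⁻ 7 ∷ []) ∷ (+ 152 ∷ ⁻ 17 ∷ ⁻ 25 ∷ ⁻ 12 ∷ ⁻ 6 ∷ ⁻ 5 ∷ []) ∷ (⁻ 25 ∷ ⁻ 25 ∷ + 6 ∷ + 26 ∷ + 43 ∷ ⁻ 6 ∷ []) ∷ (⁻ 17 ∷ ⁻ 12 ∷ + 26 ∷ + 52 ∷ + 379 ∷ + 0 ∷ []) ∷ (⁻ 8 ∷ ⁻ 6 ∷ + 43 ∷ + 379 ∷ + 96 ∷ ⁻ 6 ∷ []) ∷ (⁻ 7 ∷ ⁻ 5 ∷ ⁻ 6 ∷ + 0 ∷ ⁻ 6 ∷ ⁻ 5 ∷ []) ∷ [])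
      (+ 8 ∷ + 8 ∷ + 2 ∷ ⁻ 1 ∷ ⁻ 2 ∷ + 26 ∷ []) (+ 0 ∷ + 0 ∷ ⁻ 11 ∷ ⁻ 21 ∷ ⁻ 36 ∷ ⁻ 100 ∷ [])
      (⁻ 50 ∷ + 631 ∷ + 907 ∷ ⁻ 102 ∷ ⁻ 5 ∷ ⁻ 24 ∷ []) (⁻ 179) (⁻ 35 ∷ + 241 ∷ + 258 ∷ + 148 ∷ ⁻ 125 ∷ ⁻ 35 ∷ []) (⁻ 178)) (+ 0) (+ 614) ∷
    []

  -- Here e = 47 - 2 · 22 = 3 equals the degree of the single degree-3 vertex, so the strict
  -- inequality behind `generic-filter` fails and that vertex has to be starred.
  starred : Entry
  starred = entry (22 ∷ 1 ∷ 4 ∷ 6 ∷ 6 ∷ 42 ∷ []) 3 (mk 9 ((⁻ 67 ∷ + 71 ∷ + 63 ∷ ⁻ 7 ∷ + 40 ∷ ⁻ 13 ∷ []) ∷ (+ 71 ∷ + 166 ∷ + 139 ∷ + 68 ∷ + 76 ∷ + 8 ∷ []) ∷ (+ 63 ∷ + 139 ∷ + 120 ∷ + 75 ∷ + 70 ∷ + 14 ∷ []) ∷ (⁻ 7 ∷ + 68 ∷ + 75 ∷ + 76 ∷ + 77 ∷ + 51 ∷ []) ∷ (+ 40 ∷ + 76 ∷ + 70 ∷ + 77 ∷ + 43 ∷ + 9 ∷ []) ∷ (⁻ 13 ∷ + 8 ∷ + 14 ∷ + 51 ∷ + 9 ∷ ⁻ 10 ∷ []) ∷ [])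
      (+ 17 ∷ + 39 ∷ + 35 ∷ + 13 ∷ + 30 ∷ + 22 ∷ []) (+ 0 ∷ ⁻ 200 ∷ ⁻ 200 ∷ ⁻ 102 ∷ ⁻ 200 ∷ ⁻ 147 ∷ [])
      (+ 471 ∷ + 179 ∷ + 568 ∷ ⁻ 176 ∷ ⁻ 93 ∷ ⁻ 47 ∷ []) (⁻ 396) (⁻ 66 ∷ ⁻ 266 ∷ ⁻ 200 ∷ ⁻ 126 ∷ + 139 ∷ ⁻ 70 ∷ []) (⁻ 398)) (+ 0) (+ 840)

  -- Here e = 47 - 2 · 21 = 5, again too many free lines for `generic-filter`; the two degree-3
  -- vertices yield a direct contradiction instead.
  two-threes-distribution : Vec ℕ 6
  two-threes-distribution = 21 ∷ 2 ∷ 6 ∷ 4 ∷ 5 ∷ 43 ∷ []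

  open Entry

  -- Only in this block may `compositions` compute. It is opaque elsewhere, so that checking the
  -- soundness proofs never starts an enumeration.
  opaque
    unfolding compositions

    check39 : check 39 certs39 [] ≡ true
    check39 = refl

    check40 : check 40 certs40 [] ≡ true
    check40 = refl

    check41 : check 41 certs41 [] ≡ true
    check41 = refl

    check42 : check 42 certs42 [] ≡ true
    check42 = refl

    check43 : check 43 certs43 [] ≡ true
    check43 = refl

    check44 : check 44 certs44 [] ≡ true
    check44 = refl

    check45 : check 45 certs45 (List.map distribution entries45) ≡ true
    check45 = refl

    check46 : check 46 certs46 (List.map distribution entries46) ≡ true
    check46 = refl

    check47 : check 47 certs47 (distribution starred ∷ two-threes-distribution ∷ List.map distribution entries47) ≡ true
    check47 = refl

    check48 : check 48 certs48 [] ≡ true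
    check48 = refl

    check49 : check 49 certs49 [] ≡ true
    check49 = refl

    check50 : check 50 certs50 [] ≡ true
    check50 = refl

    check51 : check 51 [] [] ≡ true
    check51 = refl

    filter45 : every (entryCheck 45) entries45 ≡ true
    filter45 = refl

    filter46 : every (entryCheck 46) entries46 ≡ true
    filter46 = refl

    filter47 : every (entryCheck 47) entries47 ≡ true
    filter47 = refl

    filter-starred : filterCheck true 47 3 (distribution starred) (certificate starred) (θ₁ starred) (θ₂ starred) ≡ true
    filter-starred = refl

    no-two-three : compositions 6 2 55 9 noTwoThree ≡ true
    no-two-three = refl

    pencils : compositions 6 2 55 9 pencil ≡ true
    pencils = refl

    few-sevens : compositions 6 2 47 9 fewSevens ≡ true
    few-sevens = refl

  -- Splitting on m turns it into a numeral, so that the tables apply and the exactness hypotheses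
  -- become `refl`. Only m = 47 has exceptions outside the generic filter.
  refute : ∀ {n m} {X : LinearSpace 9 n m} (Z : Critical X) → Analysis.Sevens Z → ∀ k → m ≡ 39 ℕ.+ k → ⊥
  refute Z s 0 refl = Analysis.plan-sound Z certs39 [] check39 refl s refl refl
  refute Z s 1 refl = Analysis.plan-sound Z certs40 [] check40 refl s refl refl
  refute Z s 2 refl = Analysis.plan-sound Z certs41 [] check41 refl s refl refl
  refute Z s 3 refl = Analysis.plan-sound Z certs42 [] check42 refl s refl refl
  refute Z s 4 refl = Analysis.plan-sound Z certs43 [] check43 refl s refl refl
  refute Z s 5 refl = Analysis.plan-sound Z certs44 [] check44 refl s refl refl
  refute Z s 6 refl = Analysis.plan-sound Z certs45 entries45 check45 filter45 s refl refl
  refute Z s 7 refl = Analysis.plan-sound Z certs46 entries46 check46 filter46 s refl refl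
  refute Z s 8 refl = finish (Analysis.search-sound Z certs47 (distribution starred ∷ two-threes-distribution ∷ List.map distribution entries47) check47 s refl refl)
    where
    45≤47 : + 45 ≤ + 47
    45≤47 = +≤+ (≤ᵇ-sound refl)
    at : ∀ {x} → x ∈ distribution starred ∷ two-threes-distribution ∷ List.map distribution entries47 → (Analysis.allVec Z) ≡ x → ⊥
    at (here refl) e = Analysis.starred-sound Z starred e (Analysis.order Z e refl) 45≤47 refl refl no-two-three filter-starred
    at (there (here refl)) e = Analysis.two-threes-sound Z two-threes-distribution e (Analysis.order Z e refl) 45≤47 refl refl refl no-two-three pencils few-sevens
    at (there (there x∈)) e = Analysis.entries-sound Z entries47 filter47 x∈ e
    finish : (∃ λ x → x ∈ distribution starred ∷ two-threes-distribution ∷ List.map distribution entries47 × sameVec (Analysis.allVec Z) x ≡ true) → ⊥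
    finish (x , x∈ , same) = at x∈ (sameVec-sound (Analysis.allVec Z) x same)
  refute Z s 9 refl = Analysis.plan-sound Z certs48 [] check48 refl s refl refl
  refute Z s 10 refl = Analysis.plan-sound Z certs49 [] check49 refl s refl refl
  refute Z s 11 refl = Analysis.plan-sound Z certs50 [] check50 refl s refl refl
  refute Z s 12 refl = Analysis.plan-sound Z [] [] check51 refl s refl refl
  refute Z s (suc (suc (suc (suc (suc (suc (suc (suc (suc (suc (suc (suc (suc k))))))))))))) e = Analysis.m<52 Z k e

-- Small covers, and the averaging argument.

module Covers where
  open Sums
  open LinearSpaces
  open import Defs
  open import Data.Bool.Base using (Bool; true; false; _∧_; _∨_; not) renaming (T to Holds)
  import Data.Bool.Properties as Boolₚ
  open import Data.Nat.Base as ℕ using (ℕ; zero; suc)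
  import Data.Nat.Properties as ℕₚ
  open import Data.Integer.Base as ℤ using (ℤ; +_; -[1+_]; _+_; _*_; _-_; -_; _≤_; 0ℤ; 1ℤ; +≤+)
  import Data.Integer.Properties as ℤₚ
  open import Data.Integer.Tactic.RingSolver using (solve-∀)
  open import Data.Fin.Base using (Fin; zero; suc)
  open import Data.Fin.Properties using (_≟_; all?; ¬∀⟶∃¬)
  open import Data.Fin.Subset using (_∈_) renaming (∣_∣ to card)
  open import Data.Vec.Base using (lookup; tabulate)
  open import Data.Vec.Properties using (lookup⇒[]=; []=⇒lookup; lookup∘tabulate)
  open import Data.Product.Base using (∃; _×_; _,_; proj₁; proj₂)
  open import Data.Sum.Base using (_⊎_; inj₁; inj₂)
  open import Data.Empty using (⊥; ⊥-elim)
  open import Relation.Nullary using (¬_; Dec; yes; no; does)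
  open import Relation.Binary.PropositionalEquality
  open import Algebra.Properties.Semiring.Sum ℤₚ.+-*-semiring using (sum; sum-cong-≗; ∑-comm)

  split : ∀ x y → x ≤ y ⊎ y + 1ℤ ≤ x
  split x y with x ℤₚ.≤? y
  ... | yes p = inj₁ p
  ... | no q = inj₂ (subst (_≤ x) (ℤₚ.+-comm 1ℤ y) (ℤₚ.i<j⇒suc[i]≤j (ℤₚ.≰⇒> q)))

  square≥0 : ∀ z → 0ℤ ≤ z * z
  square≥0 (+ n) = 0≤* {+ n} {+ n} (+≤+ ℕ.z≤n) (+≤+ ℕ.z≤n)
  square≥0 -[1+ n ] = +≤+ ℕ.z≤n

  card-tabulate : ∀ {n} (b : Fin n → Bool) → + card (tabulate b) ≡ sum (λ v → 𝟙 (b v))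
  card-tabulate {zero} b = refl
  card-tabulate {suc n} b with b zero
  ... | true = trans (ℤₚ.pos-+ 1 (card (tabulate (λ v → b (suc v))))) (cong (_+_ 1ℤ) (card-tabulate (λ v → b (suc v))))
  ... | false = trans (card-tabulate (λ v → b (suc v))) (sym (ℤₚ.+-identityˡ _))

  -- Twice the averaged sum of (d - 3)(D - d) + (D - 2)[d = 2], after n is replaced by its lower
  -- bound R² and the number of degree-2 vertices by its upper bound M / 2; the doubling avoids the
  -- fraction.
  excess : ℤ → ℤ → ℤ → ℤ
  excess D R M = (+ 2 * ((D + + 3) * (R * M)) - + 6 * (D * (R * R)) + (D - + 2) * M) - + 2 * (M * ((M + R) - 1ℤ))

  excess≥0 : ∀ D M R n T S → + 2 ≤ D → R * R ≤ n → + 2 * T ≤ M → 0ℤ ≤ S →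
    S ≡ ((D + + 3) * (R * M) + (D - + 2) * T) - (M * ((M + R) - 1ℤ) + n * (+ 3 * D)) → 0ℤ ≤ excess D R M
  excess≥0 D M R n T S 2≤D p q s refl = subst (0ℤ ≤_) (ring D M R n T)
      (0≤+ (0≤+ (0≤* {+ 2} (+≤+ ℕ.z≤n) s) (0≤* {+ 6 * D} (0≤* {+ 6} (+≤+ ℕ.z≤n) (ℤₚ.≤-trans (+≤+ ℕ.z≤n) 2≤D)) (diff p))) (0≤* (diff 2≤D) (diff q)))
    where
    ring : ∀ D M R n T → (+ 2 * (((D + + 3) * (R * M) + (D - + 2) * T) - (M * ((M + R) - 1ℤ) + n * (+ 3 * D))) + (+ 6 * D) * (n - R * R)) + (D - + 2) * (M - + 2 * T) ≡
      (+ 2 * ((D + + 3) * (R * M)) - + 6 * (D * (R * R)) + (D - + 2) * M) - + 2 * (M * ((M + R) - 1ℤ))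
    ring = solve-∀

  -- The number of sides is written r = k + 2, so `suc k` is the size r - 1 of a forbidden cover and
  -- k is the degree bound r - 2.
  record Uncovered {k n lines : ℕ} (X : LinearSpace (2 ℕ.+ k) n lines) : Set where
    open LinearSpace X
    field
      meeting     : ∀ ℓ ℓ′ → ∃ λ x → inc x ℓ ≡ true × inc x ℓ′ ≡ true
      point-on    : ∀ ℓ s → ∃ λ x → inc x ℓ ≡ true × side x ≡ s
      through     : ∀ v → ∃ λ ℓ → inc v ℓ ≡ true
      some-vertex : ∃ λ (v : Fin n) → v ≡ v
      no-cover    : (b : Fin n → Bool) → (∀ ℓ → ∃ λ x → b x ≡ true × inc x ℓ ≡ true) → sum (λ v → 𝟙 (b v)) ≤ + suc k → ⊥

  module HypergraphSpace {k n : ℕ} (H : Hypergraph n) (lin : Linear H) (int : Intersecting H)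
    (side′ : Fin n → Fin (2 ℕ.+ k)) (part : IsPartition (2 ℕ.+ k) H side′) (pos : PositiveDegrees H)
    (large : ¬ CoveringNumber≤ H (suc k)) where

    private
      on : Fin n → Fin (m H) → Bool
      on v ℓ = lookup (line H ℓ) v

      ∈⇒ : ∀ {v ℓ} → v ∈ line H ℓ → on v ℓ ≡ true
      ∈⇒ = []=⇒lookup

      ⇒∈ : ∀ {v ℓ} → on v ℓ ≡ true → v ∈ line H ℓ
      ⇒∈ {v} {ℓ} = lookup⇒[]= v (line H ℓ)

      same-point : ∀ {ℓ ℓ′ x y} → ℓ ≢ ℓ′ → on x ℓ ≡ true → on x ℓ′ ≡ true → on y ℓ ≡ true → on y ℓ′ ≡ true → x ≡ y
      same-point {ℓ} {ℓ′} {x} {y} ne p q r s = lin ℓ ℓ′ (λ e → ne (injective H e)) x y (⇒∈ p) (⇒∈ q) (⇒∈ r) (⇒∈ s)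

      same-side : ∀ {ℓ v w} → on v ℓ ≡ true → on w ℓ ≡ true → side′ v ≡ side′ w → v ≡ w
      same-side {ℓ} {v} {w} p q e = let x , _ , u = part ℓ (side′ w) in trans (u v (⇒∈ p) e) (sym (u w (⇒∈ q) refl))

    meeting : ∀ ℓ ℓ′ → ∃ λ x → on x ℓ ≡ true × on x ℓ′ ≡ true
    meeting ℓ ℓ′ = let x , p , q = int ℓ ℓ′ in x , ∈⇒ p , ∈⇒ q

    point-on : ∀ ℓ s → ∃ λ x → on x ℓ ≡ true × side′ x ≡ s
    point-on ℓ s = let x , (p , q) , _ = part ℓ s in x , ∈⇒ p , q

    X : LinearSpace (2 ℕ.+ k) n (m H)
    X = record
      { inc = on
      ; side = side′
      ; one-per-side = λ ℓ s → let x , (p , q) , u = part ℓ s in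
          trans (sum-cong-≗ λ v → sym (𝟙-∧ (on v ℓ) (does (s ≟ side′ v))))
            (Σ-unique x (λ v → on v ℓ ∧ does (s ≟ side′ v)) (∧-intro (∈⇒ p) (does-refl (sym q)))
              (λ y e → u y (⇒∈ (∧-left e)) (sym (does-≡ (∧-right {on y ℓ} e)))))
      ; meet-once = λ ℓ ℓ′ ne → let x , p , q = meeting ℓ ℓ′ in
          trans (sum-cong-≗ λ v → sym (𝟙-∧ (on v ℓ) (on v ℓ′)))
            (Σ-unique x (λ v → on v ℓ ∧ on v ℓ′) (∧-intro p q)
              (λ y e → same-point ne (∧-left e) (∧-right {on y ℓ} e) p q))
      ; join-once = λ v w ne → subst (_≤ 1ℤ) (sum-cong-≗ λ ℓ → 𝟙-∧ (on v ℓ) (on w ℓ))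
          (Σ-atMostOne (λ ℓ → on v ℓ ∧ on w ℓ) (λ ℓ ℓ′ e e′ → unique-line v w ne ℓ ℓ′ e e′ (ℓ ≟ ℓ′)))
      ; apart = λ v w ne e → Σ-0 λ ℓ → trans (sym (𝟙-∧ (on v ℓ) (on w ℓ))) (disjoint v w ne e ℓ (on v ℓ ∧ on w ℓ) refl)
      }
      where
      unique-line : ∀ v w → v ≢ w → ∀ ℓ ℓ′ → on v ℓ ∧ on w ℓ ≡ true → on v ℓ′ ∧ on w ℓ′ ≡ true → Dec (ℓ ≡ ℓ′) → ℓ ≡ ℓ′
      unique-line v w ne ℓ ℓ′ e e′ (yes q) = q
      unique-line v w ne ℓ ℓ′ e e′ (no q) =
        ⊥-elim (ne (same-point q (∧-left e) (∧-left e′) (∧-right {on v ℓ} e) (∧-right {on v ℓ′} e′)))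
      disjoint : ∀ v w → v ≢ w → side′ v ≡ side′ w → ∀ ℓ b → on v ℓ ∧ on w ℓ ≡ b → 𝟙 b ≡ 0ℤ
      disjoint v w ne e ℓ true q = ⊥-elim (ne (same-side (∧-left q) (∧-right {on v ℓ} q) e))
      disjoint v w ne e ℓ false q = refl

    no-cover : (b : Fin n → Bool) → (∀ ℓ → ∃ λ x → b x ≡ true × on x ℓ ≡ true) → sum (λ v → 𝟙 (b v)) ≤ + suc k → ⊥
    no-cover b cov le = large (tabulate b ,
      (λ ℓ → let x , p , q = cov ℓ in x , lookup⇒[]= x (tabulate b) (trans (lookup∘tabulate b x) p) , ⇒∈ q) ,
      ℤₚ.drop‿+≤+ (subst (_≤ + suc k) (sym (card-tabulate b)) le))

    through : ∀ v → ∃ λ ℓ → on v ℓ ≡ true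
    through v = let ℓ , p = pos v in ℓ , ∈⇒ p

    some-vertex : ∃ λ (v : Fin n) → v ≡ v
    -- The predicate is false for every line, so `all?` merely decides whether there is a line at
    -- all; without one the empty set would be a cover.
    some-vertex with all? {n = m H} (λ ℓ → Boolₚ.T? false)
    ... | yes none = ⊥-elim (no-cover (λ _ → false) (λ ℓ → ⊥-elim (none ℓ)) (ℤₚ.≤-trans (ℤₚ.≤-reflexive (Σ-0 {n} {λ _ → 0ℤ} (λ _ → refl))) (+≤+ ℕ.z≤n)))
    ... | no q = let ℓ , _ = ¬∀⟶∃¬ (m H) (λ _ → Holds false) (λ ℓ → Boolₚ.T? false) q ; x , _ = nonempty H ℓ in x , refl

    uncovered : Uncovered X
    uncovered = record { meeting = meeting ; point-on = point-on ; through = through ; some-vertex = some-vertex ; no-cover = no-cover }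

  module Uncoverable {k n lines : ℕ} {X : LinearSpace (2 ℕ.+ k) n lines} (U : Uncovered X) where
    open Counting X public
    open Uncovered U

    two-lines : ∀ {v ℓ ℓ′} → ℓ ≢ ℓ′ → inc v ℓ ≡ true → inc v ℓ′ ≡ true → + 2 ≤ deg v
    two-lines {v} ne p q = ℤₚ.≤-trans (ℤₚ.≤-reflexive (sym (cong₂ (λ b d → 𝟙 b + 𝟙 d) p q)))
      (two-terms (a v) (λ ℓ → 𝟙-nonneg (inc v ℓ)) ne)

    three-lines : ∀ {v ℓ ℓ′ ℓ″} → ℓ ≢ ℓ′ → ℓ ≢ ℓ″ → ℓ′ ≢ ℓ″ → inc v ℓ ≡ true → inc v ℓ′ ≡ true → inc v ℓ″ ≡ true → + 3 ≤ deg v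
    three-lines {v} ne ne′ ne″ p q r = ℤₚ.≤-trans (ℤₚ.≤-reflexive (sym (cong₂ _+_ (cong₂ (λ b d → 𝟙 b + 𝟙 d) p q) (cong 𝟙 r))))
      (three-terms (a v) (λ ℓ → 𝟙-nonneg (inc v ℓ)) ne ne′ ne″)

    -- If ℓ were the only line through v, the other r - 1 vertices of ℓ would form a cover.
    2≤deg : ∀ v → + 2 ≤ deg v
    2≤deg v = go (split (deg v) 1ℤ) (through v)
      where
      go : deg v ≤ 1ℤ ⊎ + 2 ≤ deg v → (∃ λ ℓ → inc v ℓ ≡ true) → + 2 ≤ deg v
      go (inj₂ p) _ = p
      go (inj₁ p) (ℓ , vℓ) = ⊥-elim (no-cover b cov (ℤₚ.≤-reflexive size))
        where
        b : Fin n → Bool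
        b x = inc x ℓ ∧ not (does (v ≟ x))
        eq : ∀ p d → p * (1ℤ - d) ≡ p - d * p
        eq = solve-∀
        size : sum (λ x → 𝟙 (b x)) ≡ + suc k
        size = trans (sum-cong-≗ λ x → trans (𝟙-∧ (inc x ℓ) (not (does (v ≟ x)))) (trans (cong (a x ℓ *_) (𝟙-not (does (v ≟ x)))) (eq (a x ℓ) (δ v x))))
          (trans (Σ-- (λ x → a x ℓ) (λ x → δ v x * a x ℓ)) (cong₂ _-_ (line-size ℓ) (trans (Σ-δ v (λ x → a x ℓ)) (cong 𝟙 vℓ))))
        cov : ∀ ℓ′ → ∃ λ x → b x ≡ true × inc x ℓ′ ≡ true
        cov ℓ′ = at (meeting ℓ′ ℓ)
          where
          at : (∃ λ x → inc x ℓ′ ≡ true × inc x ℓ ≡ true) → ∃ λ x → b x ≡ true × inc x ℓ′ ≡ true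
          at (x , q , r) = case₁ (does (v ≟ x)) refl
            where
            case₂ : Dec (ℓ′ ≡ ℓ) → inc v ℓ′ ≡ true → ∃ λ x → b x ≡ true × inc x ℓ′ ≡ true
            case₂ (no ne) s = ⊥-elim (not≤ p (two-lines ne s vℓ))
            -- ℓ itself no longer has v available, but it keeps k + 1 ≥ 1 vertices of the cover.
            case₂ (yes refl) s = let y , t = Σ-pos⇒∃ b (subst (1ℤ ≤_) (sym size) (+≤+ (ℕ.s≤s ℕ.z≤n))) in y , t , ∧-left t
            case₁ : ∀ d → does (v ≟ x) ≡ d → ∃ λ x → b x ≡ true × inc x ℓ′ ≡ true
            case₁ false d = x , ∧-intro r (cong not d) , q
            case₁ true d = case₂ (ℓ′ ≟ ℓ) (subst (λ z → inc z ℓ′ ≡ true) (sym (does-≡ d)) q)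

    -- Every line has a vertex on side s, so the side is itself a cover and cannot have fewer than r
    -- vertices.
    r≤size : ∀ s → + (2 ℕ.+ k) ≤ sideSize s
    r≤size s = go (split (sideSize s) (+ suc k))
      where
      go : sideSize s ≤ + suc k ⊎ + suc k + 1ℤ ≤ sideSize s → + (2 ℕ.+ k) ≤ sideSize s
      go (inj₂ p) = subst (_≤ sideSize s) (cong +_ (ℕₚ.+-comm (suc k) 1)) p
      go (inj₁ p) = ⊥-elim (no-cover (λ v → does (s ≟ side v)) (λ ℓ → let x , q , e = point-on ℓ s in x , does-refl (sym e) , q) p)

    avoiding : ∀ v → ∃ λ ℓ → inc v ℓ ≡ false
    avoiding v with all? (λ ℓ → inc v ℓ Boolₚ.≟ true)
    ... | yes every = ⊥-elim (no-cover (λ x → does (v ≟ x)) (λ ℓ → v , does-refl {x = v} refl , every ℓ)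
      (ℤₚ.≤-trans (ℤₚ.≤-reflexive (trans (sum-cong-≗ λ x → sym (ℤₚ.*-identityʳ (δ v x))) (Σ-δ v (λ _ → 1ℤ)))) (+≤+ (ℕ.s≤s ℕ.z≤n))))
    ... | no q = let ℓ , r = ¬∀⟶∃¬ lines (λ ℓ → inc v ℓ ≡ true) (λ ℓ → inc v ℓ Boolₚ.≟ true) q in ℓ , Boolₚ.¬-not r

    other-side : ∀ (s : Fin (2 ℕ.+ k)) → ∃ λ s′ → s′ ≢ s
    other-side zero = suc zero , λ ()
    other-side (suc s) = zero , λ ()

    -- If deg v = r - 1, every line meets a given other side in a vertex joined to v, and there are only deg v of those.
    deg≤k : ∀ v → deg v ≤ + k
    deg≤k v = go (split (deg v) (+ k)) (avoiding v) (other-side (side v))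
      where
      go : deg v ≤ + k ⊎ + k + 1ℤ ≤ deg v → (∃ λ ℓ → inc v ℓ ≡ false) → (∃ λ s → s ≢ side v) → deg v ≤ + k
      go (inj₁ p) _ _ = p
      go (inj₂ p) (ℓ , vℓ) (s , ne) = ⊥-elim (no-cover b cov (ℤₚ.≤-trans size deg≤))
        where
        eq : ∀ d → 1ℤ * (+ suc k - d) ≡ + suc k - d
        eq d = ℤₚ.*-identityˡ (+ suc k - d)
        -- On a line avoiding v the number of far vertices is k + 1 - deg v, which cannot be
        -- negative. So deg v is exactly k + 1 here.
        deg≤ : deg v ≤ + suc k
        deg≤ = ℤₚ.0≤i-j⇒j≤i (subst (0ℤ ≤_) (trans (φ-line v ℓ) (trans (cong (λ b → (1ℤ - 𝟙 b) * (+ suc k - deg v)) vℓ) (eq (deg v))))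
          (Σ-nonneg λ w → 0≤* (𝟙-nonneg (inc w ℓ)) (φ-nonneg v w)))
        ≤deg : + suc k ≤ deg v
        ≤deg = subst (_≤ deg v) (cong +_ (ℕₚ.+-comm k 1)) p
        b : Fin n → Bool
        b w = does (s ≟ side w) ∧ (1ℤ ℤ.≤ᵇ c v w)
        ind≤ : ∀ z → 0ℤ ≤ z → 𝟙 (1ℤ ℤ.≤ᵇ z) ≤ z
        ind≤ (+ zero) _ = ℤₚ.≤-refl
        ind≤ (+ suc z) _ = +≤+ (ℕ.s≤s ℕ.z≤n)
        size : sum (λ w → 𝟙 (b w)) ≤ deg v
        size = subst (sum (λ w → 𝟙 (b w)) ≤_) (c-side v s) (Σ-mono λ w → subst₂ _≤_ (sym (𝟙-∧ (does (s ≟ side w)) (1ℤ ℤ.≤ᵇ c v w))) (ℤₚ.*-comm (σ s w) (c v w))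
          (*-mono-left {σ s w} (𝟙-nonneg (does (s ≟ side w))) (ind≤ (c v w) (c-nonneg v w))))
        joined : ∀ {ℓ w} → inc w ℓ ≡ true → side w ≡ s → 1ℤ ≤ c v w
        joined {ℓ} {w} wℓ e = ≤-by _ (eq₁ (c v w)) (diff bound)
          where
          eq₁ : ∀ c → c - 1ℤ ≡ 0ℤ - (1ℤ * (1ℤ - c))
          eq₁ = solve-∀
          eq₂ : ∀ p d s → 0ℤ - (1ℤ - p) * (s - d) ≡ (1ℤ - p) * (d - s)
          eq₂ = solve-∀
          bound : 1ℤ * (1ℤ - c v w) ≤ 0ℤ
          bound = ℤₚ.≤-trans (ℤₚ.≤-reflexive (sym (cong₂ (λ b f → 𝟙 b * f) wℓ (φ-other v w (λ q → ne (trans (sym e) (sym q)))))))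
            (ℤₚ.≤-trans (term≤Σ (λ w → a w ℓ * φ v w) (λ w → 0≤* (𝟙-nonneg (inc w ℓ)) (φ-nonneg v w)) w)
              (ℤₚ.≤-trans (ℤₚ.≤-reflexive (φ-line v ℓ)) (≤-by _ (eq₂ (a v ℓ) (deg v) (+ suc k)) (0≤* (diff (𝟙≤1 (inc v ℓ))) (diff ≤deg)))))
        ≤ᵇ-of : ∀ z → 1ℤ ≤ z → (1ℤ ℤ.≤ᵇ z) ≡ true
        ≤ᵇ-of (+ suc z) _ = refl
        ≤ᵇ-of (+ zero) (+≤+ ())
        cov : ∀ ℓ → ∃ λ x → b x ≡ true × inc x ℓ ≡ true
        cov ℓ = let w , q , e = point-on ℓ s in w , ∧-intro (does-refl (sym e)) (≤ᵇ-of (c v w) (joined {ℓ} {w} q e)) , q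

    other-line : ∀ {v} ℓ → + 2 ≤ deg v → ∃ λ ℓ′ → ℓ′ ≢ ℓ × inc v ℓ′ ≡ true
    other-line {v} ℓ p = let x , y , ne , q , r = Σ-pos⇒2 (inc v) p in go x y ne q r (x ≟ ℓ)
      where
      go : ∀ x y → x ≢ y → inc v x ≡ true → inc v y ≡ true → Dec (x ≡ ℓ) → ∃ λ ℓ′ → ℓ′ ≢ ℓ × inc v ℓ′ ≡ true
      go x y ne q r (no s) = x , s , q
      go x y ne q r (yes refl) = y , (λ e → ne (sym e)) , r

    one-of : ∀ {v ℓ ℓ′ A} → deg v ≡ + 2 → A ≢ ℓ → inc v ℓ ≡ true → inc v A ≡ true → inc v ℓ′ ≡ true → ℓ′ ≡ ℓ ⊎ ℓ′ ≡ A
    one-of {v} {ℓ} {ℓ′} {A} d ne p q r = go (ℓ′ ≟ ℓ) (ℓ′ ≟ A)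
      where
      go : Dec (ℓ′ ≡ ℓ) → Dec (ℓ′ ≡ A) → ℓ′ ≡ ℓ ⊎ ℓ′ ≡ A
      go (yes e) _ = inj₁ e
      go (no _) (yes e) = inj₂ e
      go (no e) (no f) = ⊥-elim (not≤ {+ 3} {+ 2} (ℤₚ.≤-trans (three-lines (λ g → e (sym g)) (λ g → ne (sym g)) f p r q) (ℤₚ.≤-reflexive d)) ℤₚ.≤-refl)

    module _ (1≤k : 1 ℕ.≤ k) where

      -- Let A and B be the second lines through v and w. Removing v and w from ℓ and adding a
      -- common vertex q of A and B would give a cover of size r - 1: a line meeting ℓ only in v or
      -- w is A or B.
      at-most-one-two : ∀ {ℓ v w} → inc v ℓ ≡ true → inc w ℓ ≡ true → deg v ≡ + 2 → deg w ≡ + 2 → v ≡ w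
      at-most-one-two {ℓ} {v} {w} vℓ wℓ dv dw = go (v ≟ w) (other-line ℓ (2≤deg v)) (other-line ℓ (2≤deg w))
        where
        go : Dec (v ≡ w) → (∃ λ A → A ≢ ℓ × inc v A ≡ true) → (∃ λ B → B ≢ ℓ × inc w B ≡ true) → v ≡ w
        go (yes e) _ _ = e
        go (no v≢w) (A , A≢ , vA) (B , B≢ , wB) = ⊥-elim (no-cover b cov size≤)
          where
          q : Fin n
          q = proj₁ (meeting A B)
          qA : inc q A ≡ true
          qA = proj₁ (proj₂ (meeting A B))
          qB : inc q B ≡ true
          qB = proj₂ (proj₂ (meeting A B))
          b₀ b : Fin n → Bool
          b₀ x = inc x ℓ ∧ (not (does (v ≟ x)) ∧ not (does (w ≟ x)))
          b x = b₀ x ∨ does (q ≟ x)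
          eq : ∀ p d e → p * ((1ℤ - d) * (1ℤ - e)) ≡ ((p - d * p) - e * p) + d * (e * p)
          eq = solve-∀
          size : sum (λ x → 𝟙 (b₀ x)) ≡ + k
          size = trans (sum-cong-≗ λ x → trans (𝟙-∧ (inc x ℓ) (not (does (v ≟ x)) ∧ not (does (w ≟ x)))) (trans (cong (a x ℓ *_) (trans (𝟙-∧ (not (does (v ≟ x))) (not (does (w ≟ x))))
              (cong₂ _*_ (𝟙-not (does (v ≟ x))) (𝟙-not (does (w ≟ x)))))) (eq (a x ℓ) (δ v x) (δ w x))))
            (trans (Σ-+ (λ x → (a x ℓ - δ v x * a x ℓ) - δ w x * a x ℓ) (λ x → δ v x * (δ w x * a x ℓ)))
            (trans (cong₂ _+_ (trans (Σ-- (λ x → a x ℓ - δ v x * a x ℓ) (λ x → δ w x * a x ℓ)) (cong₂ _-_ (trans (Σ-- (λ x → a x ℓ) (λ x → δ v x * a x ℓ))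
                (cong₂ _-_ (line-size ℓ) (trans (Σ-δ v (λ x → a x ℓ)) (cong 𝟙 vℓ)))) (trans (Σ-δ w (λ x → a x ℓ)) (cong 𝟙 wℓ))))
              (trans (Σ-δ v (λ x → δ w x * a x ℓ)) (cong (_* a v ℓ) (δ-≢ (λ e → v≢w (sym e)))))) (ℤₚ.+-identityʳ (+ k))))
          ∨≤ : ∀ c d → 𝟙 (c ∨ d) ≤ 𝟙 c + 𝟙 d
          ∨≤ true d = ≤-by _ (eq₀ (𝟙 d)) (𝟙-nonneg d)
            where
            eq₀ : ∀ d → (1ℤ + d) - 1ℤ ≡ d
            eq₀ = solve-∀
          ∨≤ false d = ℤₚ.≤-reflexive (sym (ℤₚ.+-identityˡ (𝟙 d)))
          size≤ : sum (λ x → 𝟙 (b x)) ≤ + suc k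
          size≤ = ℤₚ.≤-trans (Σ-mono λ x → ∨≤ (b₀ x) (does (q ≟ x))) (ℤₚ.≤-reflexive (trans (Σ-+ (λ x → 𝟙 (b₀ x)) (δ q))
            (trans (cong₂ _+_ size (trans (sum-cong-≗ λ x → sym (ℤₚ.*-identityʳ (δ q x))) (Σ-δ q (λ _ → 1ℤ)))) (cong +_ (ℕₚ.+-comm k 1)))))
          in-b₀ : ∀ {x} → b₀ x ≡ true → b x ≡ true
          in-b₀ e = cong (_∨ _) e
          or-right : ∀ c {d} → d ≡ true → c ∨ d ≡ true
          or-right true _ = refl
          or-right false e = e
          q∈ : b q ≡ true
          q∈ = or-right (b₀ q) (does-refl {x = q} refl)
          -- ℓ itself has to be covered as well, and 1 ≤ k leaves it a third vertex.
          third : ∃ λ x → b₀ x ≡ true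
          third = Σ-pos⇒∃ b₀ (subst (1ℤ ≤_) (sym size) (+≤+ 1≤k))
          on-ℓ : ∃ λ x → b x ≡ true × inc x ℓ ≡ true
          on-ℓ = let y , t = third in y , in-b₀ t , ∧-left t
          cov : ∀ ℓ′ → ∃ λ x → b x ≡ true × inc x ℓ′ ≡ true
          cov ℓ′ = at (meeting ℓ′ ℓ)
            where
            via : ∀ {C} → inc q C ≡ true → ℓ′ ≡ ℓ ⊎ ℓ′ ≡ C → ∃ λ x → b x ≡ true × inc x ℓ′ ≡ true
            via _ (inj₁ refl) = on-ℓ
            via i (inj₂ refl) = q , q∈ , i
            at : (∃ λ x → inc x ℓ′ ≡ true × inc x ℓ ≡ true) → ∃ λ x → b x ≡ true × inc x ℓ′ ≡ true
            at (x , xℓ′ , xℓ) = cases (does (v ≟ x)) (does (w ≟ x)) refl refl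
              where
              cases : ∀ d e → does (v ≟ x) ≡ d → does (w ≟ x) ≡ e → ∃ λ x → b x ≡ true × inc x ℓ′ ≡ true
              cases false false d e = x , in-b₀ (∧-intro xℓ (∧-intro (cong not d) (cong not e))) , xℓ′
              cases true _ d _ = via qA (one-of dv A≢ vℓ vA (subst (λ z → inc z ℓ′ ≡ true) (sym (does-≡ d)) xℓ′))
              cases false true _ e = via qB (one-of dw B≢ wℓ wB (subst (λ z → inc z ℓ′ ≡ true) (sym (does-≡ e)) xℓ′))

      Σsize : sum sideSize ≡ + n
      Σsize = trans (sum-cong-≗ λ s → sum-cong-≗ λ v → sym (ℤₚ.*-identityʳ (σ s v)))
        (trans (sym (split-sides (λ _ → 1ℤ))) (trans (Σ-const n 1ℤ) (ℤₚ.*-identityʳ _)))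

      r²≤n : R * R ≤ + n
      r²≤n = subst₂ _≤_ (Σ-const (2 ℕ.+ k) R) Σsize (Σ-mono r≤size)

      twoB : Fin n → Bool
      twoB v = does (deg v ℤₚ.≟ + 2)

      twoB⇒ : ∀ {v} → twoB v ≡ true → deg v ≡ + 2
      twoB⇒ {v} e with deg v ℤₚ.≟ + 2
      ... | yes p = p

      two-count : + 2 * sum (λ v → 𝟙 (twoB v)) ≤ M
      two-count = subst₂ _≤_ (trans (sym (double-count (λ v → 𝟙 (twoB v)))) (trans (sum-cong-≗ λ v → at v (twoB v) refl) (Σ-*ˡ (+ 2) (λ v → 𝟙 (twoB v)))))
          (trans (Σ-const lines 1ℤ) (ℤₚ.*-identityʳ M)) (Σ-mono each)
        where
        at : ∀ v b → twoB v ≡ b → deg v * 𝟙 b ≡ + 2 * 𝟙 b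
        at v true e = cong (_* 1ℤ) (twoB⇒ {v} e)
        at v false e = ℤₚ.*-zeroʳ (deg v)
        each : ∀ ℓ → sum (λ v → a v ℓ * 𝟙 (twoB v)) ≤ 1ℤ
        each ℓ = subst (_≤ 1ℤ) (sum-cong-≗ λ v → 𝟙-∧ (inc v ℓ) (twoB v)) (Σ-atMostOne (λ v → inc v ℓ ∧ twoB v)
          (λ v w p q → at-most-one-two (∧-left p) (∧-left q) (twoB⇒ {v} (∧-right {inc v ℓ} p)) (twoB⇒ {w} (∧-right {inc w ℓ} q))))

      -- Sums (d - 3)(D - d) ≥ -(D - 2)[d = 2] over all vertices.
      moment-bound : ∀ D → + 2 ≤ D → (∀ v → deg v ≤ D) → 0ℤ ≤ excess D R M
      moment-bound D 2≤D le = excess≥0 D M R (+ n) Tw (sum S) 2≤D r²≤n two-count (Σ-nonneg nonneg) total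
        where
        Tw : ℤ
        Tw = sum (λ v → 𝟙 (twoB v))
        S : Fin n → ℤ
        S v = (deg v - + 3) * (D - deg v) + (D - + 2) * 𝟙 (twoB v)
        eq : ∀ d D t → (d - + 3) * (D - d) + (D - + 2) * t ≡ ((D + + 3) * d + (D - + 2) * t) - (d * d + + 3 * D)
        eq = solve-∀
        total : sum S ≡ ((D + + 3) * (R * M) + (D - + 2) * Tw) - (M * ((M + R) - 1ℤ) + + n * (+ 3 * D))
        total = trans (sum-cong-≗ λ v → eq (deg v) D (𝟙 (twoB v))) (trans (Σ-- (λ v → (D + + 3) * deg v + (D - + 2) * 𝟙 (twoB v)) (λ v → deg v * deg v + + 3 * D))
          (cong₂ _-_ (trans (Σ-+ (λ v → (D + + 3) * deg v) (λ v → (D - + 2) * 𝟙 (twoB v))) (cong₂ _+_ (trans (Σ-*ˡ (D + + 3) deg) (cong ((D + + 3) *_) Σdeg)) (Σ-*ˡ (D - + 2) (λ v → 𝟙 (twoB v)))))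
            (trans (Σ-+ (λ v → deg v * deg v) (λ _ → + 3 * D)) (cong₂ _+_ Σdeg² (Σ-const n (+ 3 * D))))))
        nonneg : ∀ v → 0ℤ ≤ S v
        nonneg v = go (split (deg v) (+ 2))
          where
          eq₁ : ∀ D → (+ 2 - + 3) * (D - + 2) + (D - + 2) * 1ℤ ≡ 0ℤ
          eq₁ = solve-∀
          isTwo : deg v ≡ + 2 → twoB v ≡ true
          isTwo e with deg v ℤₚ.≟ + 2
          ... | yes _ = refl
          ... | no q = ⊥-elim (q e)
          go : deg v ≤ + 2 ⊎ + 3 ≤ deg v → 0ℤ ≤ S v
          go (inj₂ p) = 0≤+ (0≤* (diff p) (diff (le v))) (0≤* (diff 2≤D) (𝟙-nonneg (twoB v)))
          go (inj₁ p) = ℤₚ.≤-reflexive (sym (trans (cong₂ (λ d b → (d - + 3) * (D - d) + (D - + 2) * 𝟙 b) (ℤₚ.≤-antisym p (2≤deg v)) (isTwo (ℤₚ.≤-antisym p (2≤deg v)))) (eq₁ D)))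

      -- b and c come from completing the square.
      no-solution : ∀ D → + 2 ≤ D → (∀ v → deg v ≤ D) → ∀ b c →
        + 8 * excess D R M + (+ 4 * M - b) * (+ 4 * M - b) ≡ -[1+ c ] → ⊥
      no-solution D 2≤D le b c e with subst (0ℤ ≤_) e (0≤+ (0≤* {+ 8} (+≤+ ℕ.z≤n) (moment-bound D 2≤D le)) (square≥0 (+ 4 * M - b)))
      ... | ()

    small-case : k ℕ.≤ 6 → ⊥
    small-case k≤ = go k≤ refl
      where
      v : Fin n
      v = proj₁ some-vertex
      -- For r ≤ 3 the bounds 2 ≤ deg v ≤ r - 2 already contradict each other.
      tiny : k ℕ.≤ 1 → ⊥
      tiny p = not≤ (deg≤k v) (ℤₚ.≤-trans (+≤+ (subst (ℕ._≤ 2) (ℕₚ.+-comm 1 k) (ℕ.s≤s p))) (2≤deg v))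
      go : k ℕ.≤ 6 → ∀ {k′} → k ≡ k′ → ⊥
      go _ {0} refl = tiny ℕ.z≤n
      go _ {1} refl = tiny (ℕ.s≤s ℕ.z≤n)
      go _ {2} refl = no-solution (ℕ.s≤s ℕ.z≤n) (+ 2) (ℤₚ.≤-refl) deg≤k (+ 34) 379 (eq M)
        where
        eq : ∀ M → + 8 * ((+ 2 * ((+ 2 + + 3) * (+ 4 * M)) - + 6 * (+ 2 * (+ 4 * + 4)) + (+ 2 - + 2) * M) - + 2 * (M * ((M + + 4) - 1ℤ))) + (+ 4 * M - + 34) * (+ 4 * M - + 34) ≡ -[1+ 379 ]
        eq = solve-∀
      go _ {3} refl = no-solution (ℕ.s≤s ℕ.z≤n) (+ 3) (+≤+ (ℕ.s≤s (ℕ.s≤s ℕ.z≤n))) deg≤k (+ 53) 790 (eq M)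
        where
        eq : ∀ M → + 8 * ((+ 2 * ((+ 3 + + 3) * (+ 5 * M)) - + 6 * (+ 3 * (+ 5 * + 5)) + (+ 3 - + 2) * M) - + 2 * (M * ((M + + 5) - 1ℤ))) + (+ 4 * M - + 53) * (+ 4 * M - + 53) ≡ -[1+ 790 ]
        eq = solve-∀
      go _ {4} refl = no-solution (ℕ.s≤s ℕ.z≤n) (+ 4) (+≤+ (ℕ.s≤s (ℕ.s≤s ℕ.z≤n))) deg≤k (+ 76) 1135 (eq M)
        where
        eq : ∀ M → + 8 * ((+ 2 * ((+ 4 + + 3) * (+ 6 * M)) - + 6 * (+ 4 * (+ 6 * + 6)) + (+ 4 - + 2) * M) - + 2 * (M * ((M + + 6) - 1ℤ))) + (+ 4 * M - + 76) * (+ 4 * M - + 76) ≡ -[1+ 1135 ]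
        eq = solve-∀
      go _ {5} refl = no-solution (ℕ.s≤s ℕ.z≤n) (+ 5) (+≤+ (ℕ.s≤s (ℕ.s≤s ℕ.z≤n))) deg≤k (+ 103) 1150 (eq M)
        where
        eq : ∀ M → + 8 * ((+ 2 * ((+ 5 + + 3) * (+ 7 * M)) - + 6 * (+ 5 * (+ 7 * + 7)) + (+ 5 - + 2) * M) - + 2 * (M * ((M + + 7) - 1ℤ))) + (+ 4 * M - + 103) * (+ 4 * M - + 103) ≡ -[1+ 1150 ]
        eq = solve-∀
      go _ {6} refl = no-solution (ℕ.s≤s ℕ.z≤n) (+ 6) (+≤+ (ℕ.s≤s (ℕ.s≤s ℕ.z≤n))) deg≤k (+ 134) 475 (eq M)
        where
        eq : ∀ M → + 8 * ((+ 2 * ((+ 6 + + 3) * (+ 8 * M)) - + 6 * (+ 6 * (+ 8 * + 8)) + (+ 6 - + 2) * M) - + 2 * (M * ((M + + 8) - 1ℤ))) + (+ 4 * M - + 134) * (+ 4 * M - + 134) ≡ -[1+ 475 ]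
        eq = solve-∀
      go (ℕ.s≤s (ℕ.s≤s (ℕ.s≤s (ℕ.s≤s (ℕ.s≤s (ℕ.s≤s ())))))) {suc (suc (suc (suc (suc (suc (suc k))))))} refl

-- Nine sides, and assembly of all cases.

open Sums
open LinearSpaces
open NineSides
open Checkers
open DegreeDistributions
open Tables
open Covers
open import Defs
open import Data.Nat using (ℕ; _≤_; _∸_)
open import Data.Nat.Base as ℕ using (zero; suc; z≤n; s≤s)
open import Data.Bool.Base using (_∧_)
import Data.Nat.Properties as ℕₚ
open import Data.Integer.Base as ℤ using (ℤ; +_; -[1+_]; _+_; _*_; _-_; 0ℤ; 1ℤ; +≤+)
import Data.Integer.Properties as ℤₚ
open import Data.Integer.Tactic.RingSolver using (solve-∀)
open import Data.Fin.Base using (Fin; zero; suc)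
open import Data.Fin.Properties using (_≟_; all?; any?)
open import Data.Fin.Subset.Properties using (anySubset?; _∈?_)
open import Data.Product.Base using (∃; _,_; proj₁; proj₂)
open import Data.Sum.Base using (_⊎_; inj₁; inj₂)
open import Data.Empty using (⊥; ⊥-elim)
open import Relation.Nullary using (¬_; Dec; does)
open import Relation.Nullary.Decidable using (_×-dec_; decidable-stable)
open import Relation.Binary.PropositionalEquality
open import Algebra.Properties.Semiring.Sum ℤₚ.+-*-semiring using (sum; sum-cong-≗)

-- The degrees lie between 2 and 7. A vertex of degree 7 leads to the tables; without one, averaging
-- works as in the smaller cases.
nine-case : ∀ {n lines} {X : LinearSpace 9 n lines} → Uncovered X → ⊥
nine-case {n} {lines} {X} U = go (Analysis.#deg Z five) refl
  where
  open Uncoverable U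
  degree-class : ∀ d → + 2 ℤ.≤ d → d ℤ.≤ + 7 → ∃ λ i → d ≡ D i
  degree-class (+ 0) (+≤+ ()) _
  degree-class (+ 1) (+≤+ (s≤s ())) _
  degree-class (+ 2) _ _ = zero , refl
  degree-class (+ 3) _ _ = suc zero , refl
  degree-class (+ 4) _ _ = suc (suc zero) , refl
  degree-class (+ 5) _ _ = suc (suc (suc zero)) , refl
  degree-class (+ 6) _ _ = suc (suc (suc (suc zero))) , refl
  degree-class (+ 7) _ _ = five , refl
  degree-class (+ suc (suc (suc (suc (suc (suc (suc (suc d)))))))) _ (+≤+ (s≤s (s≤s (s≤s (s≤s (s≤s (s≤s (s≤s ()))))))))
  class : ∀ v → ∃ λ i → deg v ≡ D i
  class v = degree-class (deg v) (2≤deg v) (deg≤k v)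
  kind : Fin n → Fin 6
  kind v = proj₁ (class v)
  degree-two : ∀ {v} → zero ≡ kind v → deg v ≡ + 2
  degree-two {v} e = trans (proj₂ (class v)) (cong D (sym e))
  Z : Critical X
  Z = record
    { κ = kind
    ; deg≡ = λ v → proj₂ (class v)
    ; one-two = λ ℓ → subst (ℤ._≤ 1ℤ) (sum-cong-≗ λ v → 𝟙-∧ (inc v ℓ) (does (zero ≟ kind v)))
        (Σ-atMostOne (λ v → inc v ℓ ∧ does (zero ≟ kind v)) λ v w p q → at-most-one-two (s≤s z≤n) {ℓ} {v} {w} (∧-left p) (∧-left q)
          (degree-two {v} (does-≡ (∧-right {inc v ℓ} p))) (degree-two {w} (does-≡ (∧-right {inc w ℓ} q))))
    ; size≥9 = r≤size
    }
  eq : ∀ M → + 8 * ((+ 2 * ((+ 6 + + 3) * (+ 9 * M)) - + 6 * (+ 6 * (+ 9 * + 9)) + (+ 6 - + 2) * M) - + 2 * (M * ((M + + 9) - 1ℤ))) + (+ 4 * M - + 150) * (+ 4 * M - + 150) ≡ -[1+ 827 ]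
  eq = solve-∀
  go : ∀ k → Analysis.#deg Z five ≡ k → ⊥
  go (suc k) e = refute Z seven (lines ∸ 39) (sym (ℕₚ.m+[n∸m]≡n (Analysis.39≤m Z seven)))
    where
    seven : Analysis.Sevens Z
    seven = subst (1 ≤_) (sym e) (s≤s z≤n)
  -- Without degree 7 the bound D improves from r - 2 = 7 to 6, which makes the discriminant
  -- negative.
  go zero e = no-solution (s≤s z≤n) (+ 6) (+≤+ (s≤s (s≤s z≤n))) (λ v → subst (ℤ._≤ + 6) (sym (proj₂ (class v))) (low v (kind v) refl)) (+ 150) 827 (eq M)
    where
    none : Analysis.N Z five ≡ 0ℤ
    none = trans (sym (Analysis.#deg≡ Z five)) (cong +_ e)
    low : ∀ v i → kind v ≡ i → D i ℤ.≤ + 6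
    low v zero _ = ≤ᵇℤ-sound {D zero} {+ 6} refl
    low v (suc zero) _ = ≤ᵇℤ-sound {+ 3} {+ 6} refl
    low v (suc (suc zero)) _ = ≤ᵇℤ-sound {+ 4} {+ 6} refl
    low v (suc (suc (suc zero))) _ = ≤ᵇℤ-sound {+ 5} {+ 6} refl
    low v (suc (suc (suc (suc zero)))) _ = ≤ᵇℤ-sound {+ 6} {+ 6} refl
    low v (suc (suc (suc (suc (suc zero))))) q = ⊥-elim (not≤ {1ℤ} {0ℤ} (ℤₚ.≤-trans (ℤₚ.≤-reflexive (sym (trans (ℤₚ.*-identityˡ (δ five (kind v))) (cong 𝟙 (does-refl (sym q))))))
      (ℤₚ.≤-trans (term≤Σ (λ v → 1ℤ * δ five (kind v)) (λ v → 0≤* {1ℤ} (+≤+ z≤n) (𝟙-nonneg (does (five ≟ kind v)))) v) (ℤₚ.≤-reflexive none))) ℤₚ.≤-refl)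

-- The argument only refutes the absence of a small cover; since the vertex set is finite,
-- decidability turns that into an actual cover.
coverable? : ∀ {n} (H : Hypergraph n) k → Dec (CoveringNumber≤ H k)
coverable? H k = anySubset? λ C → all? (λ i → any? λ x → (x ∈? C) ×-dec (x ∈? line H i)) ×-dec (_ ℕₚ.≤? k)

theorem2p9 : ∀ (r : ℕ) → 2 ≤ r → r ≤ 9 → ∀ (n : ℕ) (H : Hypergraph n) →
    Linear H → Intersecting H → Partite r H → PositiveDegrees H →
    CoveringNumber≤ H (r ∸ 1)
theorem2p9 (suc (suc k)) (s≤s (s≤s z≤n)) (s≤s (s≤s k≤7)) n H lin int (side , part) pos =
  decidable-stable (coverable? H (suc k)) (by-size (ℕₚ.m≤n⇒m<n∨m≡n k≤7))
  where
  by-size : k ℕ.< 7 ⊎ k ≡ 7 → ¬ ¬ CoveringNumber≤ H (suc k)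
  by-size (inj₁ (s≤s k≤6)) large = Uncoverable.small-case (HypergraphSpace.uncovered H lin int side part pos large) k≤6
  by-size (inj₂ refl) large = nine-case (HypergraphSpace.uncovered H lin int side part pos large)
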